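{- Let $\mathsf{R}$ be a principal ideal domain. The PROP morphism $\mathcal{S}:\mathbb{IH}^{\mathsf{Cp}}_{\mathsf{R}}\to\mathsf{Cospan}(\mathsf{Mat}\,\mathsf{R})$ defined in the context is an isomorphism of PROPs.
   Context: A PROP is a strict symmetric monoidal category whose objects are the natural numbers and whose monoidal product $\oplus$ on objects is addition. Morphisms of PROPs are identity-on-objects strict symmetric monoidal functors. Composition is written in diagrammatic order $f;g$. The PROP presented by generators $\Sigma$ and equations $E$ has as arrows the terms built from $\Sigma$, $\mathrm{id}_1$ and the symmetry $\sigma:=\sigma_{1,1}$ using $;$ and $\oplus$, modulo the laws of symmetric monoidal categories and the smallest congruence containing $E$. The PROP $\mathbb{HA}_{\mathsf{R}}$ has generators $\Delta_\bullet:1\to2$, $\varepsilon_\bullet:1\to0$, $\mu_\circ:2\to1$, $\eta_\circ:0\to1$ and $s_k:1\to1$ for each $k\in\mathsf{R}$, and equations (for all $k,k_1,k_2\in\mathsf{R}$): (A1) $(\eta_\circ\oplus\mathrm{id}_1);\mu_\circ=\mathrm{id}_1$; (A2) $\sigma;\mu_\circ=\mu_\circ$; (A3) $(\mu_\circ\oplus\mathrm{id}_1);\mu_\circ=(\mathrm{id}_1\oplus\mu_\circ);\mu_\circ$; (A4) $\Delta_\bullet;(\varepsilon_\bullet\oplus\mathrm{id}_1)=\mathrm{id}_1$; (A5) $\Delta_\bullet;\sigma=\Delta_\bullet$; (A6) $\Delta_\bullet;(\Delta_\bullet\oplus\mathrm{id}_1)=\Delta_\bullet;(\mathrm{id}_1\oplus\Delta_\bullet)$;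 (A7) $\mu_\circ;\varepsilon_\bullet=\varepsilon_\bullet\oplus\varepsilon_\bullet$; (A8) $\mu_\circ;\Delta_\bullet=(\Delta_\bullet\oplus\Delta_\bullet);(\mathrm{id}_1\oplus\sigma\oplus\mathrm{id}_1);(\mu_\circ\oplus\mu_\circ)$; (A9) $\eta_\circ;\Delta_\bullet=\eta_\circ\oplus\eta_\circ$; (A10) $\eta_\circ;\varepsilon_\bullet=\mathrm{id}_0$; (A11) $s_1=\mathrm{id}_1$; (A12) $s_{k_1};s_{k_2}=s_{k_1k_2}$; (A13) $\mu_\circ;s_k=(s_k\oplus s_k);\mu_\circ$; (A14) $\eta_\circ;s_k=\eta_\circ$; (A15) $s_k;\Delta_\bullet=\Delta_\bullet;(s_k\oplus s_k)$; (A16) $s_k;\varepsilon_\bullet=\varepsilon_\bullet$; (A17) $s_0=\varepsilon_\bullet;\eta_\circ$; (A18) $\Delta_\bullet;(s_{k_1}\oplus s_{k_2});\mu_\circ=s_{k_1+k_2}$. The opposite PROP $\mathbb{HA}_{\mathsf{R}}^{op}$ is presented by generators $\mu_\bullet:2\to1$, $\eta_\bullet:0\to1$, $\Delta_\circ:1\to2$, $\varepsilon_\circ:1\to0$, $\bar s_k:1\to1$ ($k\in\mathsf{R}$), the opposites of $\Delta_\bullet,\varepsilon_\bullet,\mu_\circ,\eta_\circ,s_k$ respectively, and the reversed equations (A1)$^{op}$–(A18)$^{op}$. The coproduct $\mathbb{HA}_{\mathsf{R}}+\mathbb{HA}_{\mathsf{R}}^{op}$ is presented by the disjoint union of the generators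 and of the equations. $\mathbb{IH}^{\mathsf{Cp}}_{\mathsf{R}}$ is the quotient of $\mathbb{HA}_{\mathsf{R}}+\mathbb{HA}_{\mathsf{R}}^{op}$ by the following equations, for $k$ any element and $l$ any non-zero element of $\mathsf{R}$: (B1) $\bar s_l;s_l=\mathrm{id}_1$; (B2) $\eta_\bullet;\varepsilon_\bullet=\mathrm{id}_0$; (B3) $(\Delta_\bullet\oplus\mathrm{id}_1);(\mathrm{id}_1\oplus\mu_\bullet)=\mu_\bullet;\Delta_\bullet=(\mathrm{id}_1\oplus\Delta_\bullet);(\mu_\bullet\oplus\mathrm{id}_1)$; (B4) $(\Delta_\circ\oplus\mathrm{id}_1);(\mathrm{id}_1\oplus\mu_\circ)=\mu_\circ;\Delta_\circ=(\mathrm{id}_1\oplus\Delta_\circ);(\mu_\circ\oplus\mathrm{id}_1)$; (B5) $\eta_\bullet;\Delta_\bullet=\eta_\circ;\Delta_\circ;(\mathrm{id}_1\oplus s_{ -1})$; (B6) $\mu_\bullet;\varepsilon_\bullet=(\mathrm{id}_1\oplus s_{ -1});\mu_\circ;\varepsilon_\circ$; (B7) $(\bar s_k\oplus\mathrm{id}_1);\mu_\circ=(\mathrm{id}_1\oplus s_k);\mu_\circ;\bar s_k$; (B8) $\Delta_\circ;(s_k\oplus\mathrm{id}_1)=s_k;\Delta_\circ;(\mathrm{id}_1\oplus\bar s_k)$. $\mathsf{Mat}\,\mathsf{R}$ is the PROP whose arrows $n\to m$ are $m\times n$ matrices over $\mathsf{R}$, with $A;B$ the matrix product $BA$, $A\oplus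 B$ block-diagonal, and permutation matrices as symmetries; since $\mathsf{R}$ is a PID it has pullbacks, and (by transposition) pushouts. $\mathsf{Cospan}(\mathsf{Mat}\,\mathsf{R})$ is the PROP whose arrows $n\to m$ are isomorphism classes of cospans $n\rightarrow z\leftarrow m$ in $\mathsf{Mat}\,\mathsf{R}$, composed by pushout, with $\oplus$ inherited from $\mathsf{Mat}\,\mathsf{R}$. The PROP morphism $\mathcal{M}:\mathbb{HA}_{\mathsf{R}}\to\mathsf{Mat}\,\mathsf{R}$ is given by: $\eta_\circ\mapsto$ the unique matrix $0\to1$; $\varepsilon_\bullet\mapsto$ the unique matrix $1\to0$; $\mu_\circ\mapsto(1\ 1)$; $\Delta_\bullet\mapsto\binom{1}{1}$; $s_k\mapsto(k)$. The morphism $\mathcal{S}$ is defined inductively (it respects the equations of $\mathbb{IH}^{\mathsf{Cp}}_{\mathsf{R}}$, so it is well defined): a generator $c:n\to m$ of $\mathbb{HA}_{\mathsf{R}}$ is sent to the cospan $n\xrightarrow{\mathcal{M}(c)}m\xleftarrow{\mathrm{id}}m$; a generator $c:n\to m$ of $\mathbb{HA}_{\mathsf{R}}^{op}$, being the opposite of a generator $c':m\to n$ of $\mathbb{HA}_{\mathsf{R}}$, is sent to the cospan $n\xrightarrow{\mathrm{id}}n\xleftarrow{\mathcal{M}(c')}m$; and $\mathcal{S}(c_1;c_2)=\mathcal{S}(c_1);\mathcal{S}(c_2)$, $\mathcal{S}(c_1\oplus c_2)=\mathcal{S}(c_1)\oplus\mathcal{S}(c_2)$. -}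

module Defs where

open import Algebra.Bundles using (CommutativeRing)
import Algebra.Properties.AbelianGroup as AbelianGroupProperties
import Algebra.Properties.Ring as RingProperties
import Algebra.Properties.Semiring.Divisibility as SemiringDivisibility
import Algebra.Properties.Semiring.Sum as SemiringSum
open import Data.Bool.Base using (if_then_else_)
open import Data.Fin.Base using (Fin; zero; suc; _↑ˡ_; _↑ʳ_; splitAt; join)
open import Data.Fin.Properties using (join-splitAt) renaming (_≟_ to _≟ᶠ_)
open import Data.Nat.Base using (ℕ; zero; suc) renaming (_+_ to _+ℕ_)
open import Data.Nat.Properties using () renaming (+-assoc to +ℕ-assoc; +-identityʳ to +ℕ-identityʳ)
open import Data.Product.Base using (Σ; ∃; _×_; _,_; proj₁; proj₂)
open import Data.Sum.Base using (_⊎_; inj₁; inj₂)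
open import Data.Vec.Functional using (Vector; _∷_; _++_; head; tail; replicate)
open import Data.Vec.Functional.Properties using (lookup-++ˡ; lookup-++ʳ)
open import Function.Bundles using (_⇔_; Equivalence)
open import Level using (_⊔_; Lift; lift; lower) renaming (suc to lsuc)
open import Relation.Binary.Core using (Rel)
open import Relation.Binary.PropositionalEquality using (_≡_; refl; sym; subst; subst₂)
open import Relation.Binary.Structures using (IsEquivalence)
open import Relation.Nullary using (¬_; Dec; yes; no; does; contradiction)
open import Relation.Unary using (Pred)

-- The homs are setoids.  ⊕ on objects is _+_, which is strictly associative
-- and unital only up to propositional equality, so the strict monoidal laws
-- transport arrows along those equalities with `cast`.

cast : ∀ {a} {Hom : ℕ → ℕ → Set a} {n n′ m m′} →
       n ≡ n′ → m ≡ m′ → Hom n m → Hom n′ m′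
cast {Hom = Hom} = subst₂ Hom

record RawPROP a ℓ : Set (lsuc (a ⊔ ℓ)) where
  infix  4 _≈_
  infixl 6 _⨾_
  infixr 7 _⊕_
  field
    Hom : ℕ → ℕ → Set a
    _≈_ : ∀ {n m} → Rel (Hom n m) ℓ
    id  : ∀ n → Hom n n
    _⨾_ : ∀ {n m k} → Hom n m → Hom m k → Hom n k
    _⊕_ : ∀ {n m n′ m′} → Hom n m → Hom n′ m′ → Hom (n +ℕ n′) (m +ℕ m′)
    σ   : ∀ n m → Hom (n +ℕ m) (m +ℕ n)

record IsPROP {a ℓ} (P : RawPROP a ℓ) : Set (a ⊔ ℓ) where
  open RawPROP P
  field
    isEquivalence : ∀ {n m} → IsEquivalence (_≈_ {n} {m})
    ⨾-cong : ∀ {n m k} {f f′ : Hom n m} {g g′ : Hom m k} →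
             f ≈ f′ → g ≈ g′ → f ⨾ g ≈ f′ ⨾ g′
    ⊕-cong : ∀ {n m n′ m′} {f f′ : Hom n m} {g g′ : Hom n′ m′} →
             f ≈ f′ → g ≈ g′ → f ⊕ g ≈ f′ ⊕ g′

    ⨾-assoc : ∀ {n m k l} (f : Hom n m) (g : Hom m k) (h : Hom k l) →
              (f ⨾ g) ⨾ h ≈ f ⨾ (g ⨾ h)
    ⨾-identityˡ : ∀ {n m} (f : Hom n m) → id n ⨾ f ≈ f
    ⨾-identityʳ : ∀ {n m} (f : Hom n m) → f ⨾ id m ≈ f

    ⊕-id : ∀ n m → id n ⊕ id m ≈ id (n +ℕ m)
    interchange : ∀ {n m k n′ m′ k′} (f : Hom n m) (g : Hom m k)
                  (f′ : Hom n′ m′) (g′ : Hom m′ k′) →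
                  (f ⨾ g) ⊕ (f′ ⨾ g′) ≈ (f ⊕ f′) ⨾ (g ⊕ g′)

    ⊕-assoc : ∀ {n m n′ m′ n″ m″}
              (f : Hom n m) (g : Hom n′ m′) (h : Hom n″ m″) →
              cast {Hom = Hom} (+ℕ-assoc n n′ n″) (+ℕ-assoc m m′ m″) ((f ⊕ g) ⊕ h)
                ≈ f ⊕ (g ⊕ h)
    ⊕-identityˡ : ∀ {n m} (f : Hom n m) → id 0 ⊕ f ≈ f
    ⊕-identityʳ : ∀ {n m} (f : Hom n m) →
                  cast {Hom = Hom} (+ℕ-identityʳ n) (+ℕ-identityʳ m) (f ⊕ id 0) ≈ f

    σ-natural : ∀ {n m n′ m′} (f : Hom n m) (g : Hom n′ m′) →
                (f ⊕ g) ⨾ σ m m′ ≈ σ n n′ ⨾ (g ⊕ f)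
    σ-involutive : ∀ n m → σ n m ⨾ σ m n ≈ id (n +ℕ m)
    σ-hexagon : ∀ n m k →
                cast {Hom = Hom} (+ℕ-assoc n m k) (sym (+ℕ-assoc k n m)) (σ (n +ℕ m) k)
                  ≈ (id n ⊕ σ m k) ⨾ cast {Hom = Hom} (+ℕ-assoc n k m) refl (σ n k ⊕ id m)

module _ {a₁ ℓ₁ a₂ ℓ₂} (P : RawPROP a₁ ℓ₁) (Q : RawPROP a₂ ℓ₂) where
  private
    module P = RawPROP P
    module Q = RawPROP Q

  record IsPROPMorphism (F : ∀ {n m} → P.Hom n m → Q.Hom n m) :
                        Set (a₁ ⊔ ℓ₁ ⊔ ℓ₂) where
    field
      cong   : ∀ {n m} {f g : P.Hom n m} → f P.≈ g → F f Q.≈ F g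
      id-homo : ∀ n → F (P.id n) Q.≈ Q.id n
      ⨾-homo : ∀ {n m k} (f : P.Hom n m) (g : P.Hom m k) →
               F (f P.⨾ g) Q.≈ F f Q.⨾ F g
      ⊕-homo : ∀ {n m n′ m′} (f : P.Hom n m) (g : P.Hom n′ m′) →
               F (f P.⊕ g) Q.≈ F f Q.⊕ F g
      σ-homo : ∀ n m → F (P.σ n m) Q.≈ Q.σ n m

-- That both sides satisfy the PROP laws is part of being an isomorphism of
-- PROPs.

record IsPROPIsomorphism {a₁ ℓ₁ a₂ ℓ₂} (P : RawPROP a₁ ℓ₁) (Q : RawPROP a₂ ℓ₂)
    (F : ∀ {n m} → RawPROP.Hom P n m → RawPROP.Hom Q n m) :
    Set (a₁ ⊔ ℓ₁ ⊔ a₂ ⊔ ℓ₂) where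
  private
    module P = RawPROP P
    module Q = RawPROP Q
  field
    source-isPROP      : IsPROP P
    target-isPROP      : IsPROP Q
    isMorphism         : IsPROPMorphism P Q F
    inverse            : ∀ {n m} → Q.Hom n m → P.Hom n m
    inverse-isMorphism : IsPROPMorphism Q P inverse
    inverseˡ           : ∀ {n m} (f : P.Hom n m) → inverse (F f) P.≈ f
    inverseʳ           : ∀ {n m} (g : Q.Hom n m) → F (inverse g) Q.≈ g

Signature : ∀ a → Set (lsuc a)
Signature a = ℕ → ℕ → Set a

module _ {a} (Gen : Signature a) where

  infixl 6 _⨾_
  infixr 7 _⊕_

  data Term : ℕ → ℕ → Set a where
    gen : ∀ {n m} → Gen n m → Term n m
    id₀ : Term 0 0
    id₁ : Term 1 1
    σ₁₁ : Term 2 2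
    _⨾_ : ∀ {n m k} → Term n m → Term m k → Term n k
    _⊕_ : ∀ {n m n′ m′} → Term n m → Term n′ m′ → Term (n +ℕ n′) (m +ℕ m′)

  Equations : ∀ ℓ → Set (a ⊔ lsuc ℓ)
  Equations ℓ = ∀ {n m} → Rel (Term n m) ℓ

module _ {a} {Gen : Signature a} where

  idᵗ : ∀ n → Term Gen n n
  idᵗ zero    = id₀
  idᵗ (suc n) = id₁ ⊕ idᵗ n

  σ₁ᵗ : ∀ m → Term Gen (1 +ℕ m) (m +ℕ 1)
  σ₁ᵗ zero    = id₁
  σ₁ᵗ (suc m) = (σ₁₁ ⊕ idᵗ m) ⨾ (id₁ ⊕ σ₁ᵗ m)

  σᵗ : ∀ n m → Term Gen (n +ℕ m) (m +ℕ n)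
  σᵗ zero    m = cast {Hom = Term Gen} refl (sym (+ℕ-identityʳ m)) (idᵗ m)
  σᵗ (suc n) m = (id₁ ⊕ σᵗ n m) ⨾
                 cast {Hom = Term Gen} refl (+ℕ-assoc m 1 n) (σ₁ᵗ m ⊕ idᵗ n)

module _ {a ℓ} {Gen : Signature a} (E : Equations Gen ℓ) where

  infix 4 _≃_

  private
    Tm = Term Gen

  -- The smallest congruence containing E and the laws of (strict) symmetric
  -- monoidal categories.
  data _≃_ : ∀ {n m} → Rel (Term Gen n m) (a ⊔ ℓ) where
    axiom : ∀ {n m} {f g : Tm n m} → E f g → f ≃ g

    ≃-refl  : ∀ {n m} {f : Tm n m} → f ≃ f
    ≃-sym   : ∀ {n m} {f g : Tm n m} → f ≃ g → g ≃ f
    ≃-trans : ∀ {n m} {f g h : Tm n m} → f ≃ g → g ≃ h → f ≃ h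
    ⨾-cong  : ∀ {n m k} {f f′ : Tm n m} {g g′ : Tm m k} →
              f ≃ f′ → g ≃ g′ → f ⨾ g ≃ f′ ⨾ g′
    ⊕-cong  : ∀ {n m n′ m′} {f f′ : Tm n m} {g g′ : Tm n′ m′} →
              f ≃ f′ → g ≃ g′ → f ⊕ g ≃ f′ ⊕ g′

    ⨾-assoc : ∀ {n m k l} (f : Tm n m) (g : Tm m k) (h : Tm k l) →
              (f ⨾ g) ⨾ h ≃ f ⨾ (g ⨾ h)
    ⨾-identityˡ : ∀ {n m} (f : Tm n m) → idᵗ n ⨾ f ≃ f
    ⨾-identityʳ : ∀ {n m} (f : Tm n m) → f ⨾ idᵗ m ≃ f

    ⊕-id : ∀ n m → idᵗ n ⊕ idᵗ m ≃ idᵗ (n +ℕ m)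
    interchange : ∀ {n m k n′ m′ k′} (f : Tm n m) (g : Tm m k)
                  (f′ : Tm n′ m′) (g′ : Tm m′ k′) →
                  (f ⨾ g) ⊕ (f′ ⨾ g′) ≃ (f ⊕ f′) ⨾ (g ⊕ g′)

    ⊕-assoc : ∀ {n m n′ m′ n″ m″} (f : Tm n m) (g : Tm n′ m′) (h : Tm n″ m″) →
              cast {Hom = Tm} (+ℕ-assoc n n′ n″) (+ℕ-assoc m m′ m″) ((f ⊕ g) ⊕ h)
                ≃ f ⊕ (g ⊕ h)
    ⊕-identityˡ : ∀ {n m} (f : Tm n m) → id₀ ⊕ f ≃ f
    ⊕-identityʳ : ∀ {n m} (f : Tm n m) →
                  cast {Hom = Tm} (+ℕ-identityʳ n) (+ℕ-identityʳ m) (f ⊕ id₀) ≃ f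

    σ-natural : ∀ {n m n′ m′} (f : Tm n m) (g : Tm n′ m′) →
                (f ⊕ g) ⨾ σᵗ m m′ ≃ σᵗ n n′ ⨾ (g ⊕ f)
    σ-involutive : ∀ n m → σᵗ n m ⨾ σᵗ m n ≃ idᵗ (n +ℕ m)
    σ-hexagon : ∀ n m k →
                cast {Hom = Tm} (+ℕ-assoc n m k) (sym (+ℕ-assoc k n m)) (σᵗ (n +ℕ m) k)
                  ≃ (idᵗ n ⊕ σᵗ m k) ⨾ cast {Hom = Tm} (+ℕ-assoc n k m) refl (σᵗ n k ⊕ idᵗ m)

  Presented : RawPROP a (a ⊔ ℓ)
  Presented = record
    { Hom = Term Gen
    ; _≈_ = _≃_
    ; id  = idᵗ
    ; _⨾_ = _⨾_
    ; _⊕_ = _⊕_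
    ; σ   = σᵗ
    }

record IsIdeal {c ℓ p} (R : CommutativeRing c ℓ)
               (I : Pred (CommutativeRing.Carrier R) p) : Set (c ⊔ ℓ ⊔ p) where
  open CommutativeRing R
  field
    resp     : ∀ {x y} → x ≈ y → I x → I y
    0#-mem   : I 0#
    +-closed : ∀ {x y} → I x → I y → I (x + y)
    *-closed : ∀ k {x} → I x → I (k * x)

-- All ideals given by arbitrary predicates on the carrier are principal, as in
-- classical algebra.  Undecidable predicates are included, so an instance also
-- decides every type in Set (c ⊔ ℓ); see ≈0? below.
record IsPID {c ℓ} (R : CommutativeRing c ℓ) : Set (lsuc (c ⊔ ℓ)) where
  open CommutativeRing R
  open SemiringDivisibility semiring using (_∣_)
  field
    1≉0            : ¬ 1# ≈ 0#
    noZeroDivisors : ∀ {x y} → x * y ≈ 0# → x ≈ 0# ⊎ y ≈ 0#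
    principal      : (I : Pred Carrier (c ⊔ ℓ)) → IsIdeal R I →
                     ∃ λ g → ∀ x → I x ⇔ g ∣ x

record PrincipalIdealDomain c ℓ : Set (lsuc (c ⊔ ℓ)) where
  field
    commutativeRing : CommutativeRing c ℓ
    isPID           : IsPID commutativeRing

module HopfAlgebras {c ℓ} (R : CommutativeRing c ℓ) where
  open CommutativeRing R using (Carrier; _≈_; 0#; 1#; _+_; _*_)

  data HAGen : Signature c where
    Δ : HAGen 1 2
    ε : HAGen 1 0
    μ : HAGen 2 1
    η : HAGen 0 1
    s : Carrier → HAGen 1 1

  Δ• : Term HAGen 1 2
  Δ• = gen Δ
  ε• : Term HAGen 1 0
  ε• = gen ε
  μ∘ : Term HAGen 2 1
  μ∘ = gen μ
  η∘ : Term HAGen 0 1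
  η∘ = gen η
  s⟨_⟩ : Carrier → Term HAGen 1 1
  s⟨ k ⟩ = gen (s k)

  data HAEq : Equations HAGen (c ⊔ ℓ) where
    -- Scalars are elements of a setoid: s_k depends on k only up to ≈.
    s-cong : ∀ {k k′} → k ≈ k′ → HAEq s⟨ k ⟩ s⟨ k′ ⟩

    a1  : HAEq ((η∘ ⊕ id₁) ⨾ μ∘) id₁
    a2  : HAEq (σ₁₁ ⨾ μ∘) μ∘
    a3  : HAEq ((μ∘ ⊕ id₁) ⨾ μ∘) ((id₁ ⊕ μ∘) ⨾ μ∘)
    a4  : HAEq (Δ• ⨾ (ε• ⊕ id₁)) id₁
    a5  : HAEq (Δ• ⨾ σ₁₁) Δ•
    a6  : HAEq (Δ• ⨾ (Δ• ⊕ id₁)) (Δ• ⨾ (id₁ ⊕ Δ•))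
    a7  : HAEq (μ∘ ⨾ ε•) (ε• ⊕ ε•)
    a8  : HAEq (μ∘ ⨾ Δ•) ((Δ• ⊕ Δ•) ⨾ (id₁ ⊕ σ₁₁ ⊕ id₁) ⨾ (μ∘ ⊕ μ∘))
    a9  : HAEq (η∘ ⨾ Δ•) (η∘ ⊕ η∘)
    a10 : HAEq (η∘ ⨾ ε•) id₀
    a11 : HAEq s⟨ 1# ⟩ id₁
    a12 : ∀ k₁ k₂ → HAEq (s⟨ k₁ ⟩ ⨾ s⟨ k₂ ⟩) s⟨ k₁ * k₂ ⟩
    a13 : ∀ k → HAEq (μ∘ ⨾ s⟨ k ⟩) ((s⟨ k ⟩ ⊕ s⟨ k ⟩) ⨾ μ∘)
    a14 : ∀ k → HAEq (η∘ ⨾ s⟨ k ⟩) η∘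
    a15 : ∀ k → HAEq (s⟨ k ⟩ ⨾ Δ•) (Δ• ⨾ (s⟨ k ⟩ ⊕ s⟨ k ⟩))
    a16 : ∀ k → HAEq (s⟨ k ⟩ ⨾ ε•) ε•
    a17 : HAEq s⟨ 0# ⟩ (ε• ⨾ η∘)
    a18 : ∀ k₁ k₂ → HAEq (Δ• ⨾ (s⟨ k₁ ⟩ ⊕ s⟨ k₂ ⟩) ⨾ μ∘) s⟨ k₁ + k₂ ⟩

  HA : RawPROP c (c ⊔ ℓ)
  HA = Presented HAEq

module InteractingHopfAlgebras {c ℓ} (R : CommutativeRing c ℓ) where
  open CommutativeRing R using (Carrier; _≈_; 0#; 1#; -_)
  open HopfAlgebras R using (HAGen; Δ; ε; μ; η; s; HAEq)

  -- `bwd g` is the opposite of the generator g.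
  data IHGen : Signature c where
    fwd : ∀ {n m} → HAGen n m → IHGen n m
    bwd : ∀ {n m} → HAGen m n → IHGen n m

  ⟦_⟧ : ∀ {n m} → Term HAGen n m → Term IHGen n m
  ⟦ gen g ⟧ = gen (fwd g)
  ⟦ id₀ ⟧   = id₀
  ⟦ id₁ ⟧   = id₁
  ⟦ σ₁₁ ⟧   = σ₁₁
  ⟦ f ⨾ g ⟧ = ⟦ f ⟧ ⨾ ⟦ g ⟧
  ⟦ f ⊕ g ⟧ = ⟦ f ⟧ ⊕ ⟦ g ⟧

  ⟦_⟧ᵒᵖ : ∀ {n m} → Term HAGen n m → Term IHGen m n
  ⟦ gen g ⟧ᵒᵖ = gen (bwd g)
  ⟦ id₀ ⟧ᵒᵖ   = id₀
  ⟦ id₁ ⟧ᵒᵖ   = id₁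
  ⟦ σ₁₁ ⟧ᵒᵖ   = σ₁₁
  ⟦ f ⨾ g ⟧ᵒᵖ = ⟦ g ⟧ᵒᵖ ⨾ ⟦ f ⟧ᵒᵖ
  ⟦ f ⊕ g ⟧ᵒᵖ = ⟦ f ⟧ᵒᵖ ⊕ ⟦ g ⟧ᵒᵖ

  Δ• : Term IHGen 1 2
  Δ• = gen (fwd Δ)
  ε• : Term IHGen 1 0
  ε• = gen (fwd ε)
  μ∘ : Term IHGen 2 1
  μ∘ = gen (fwd μ)
  η∘ : Term IHGen 0 1
  η∘ = gen (fwd η)
  s⟨_⟩ : Carrier → Term IHGen 1 1
  s⟨ k ⟩ = gen (fwd (s k))

  μ• : Term IHGen 2 1
  μ• = gen (bwd Δ)
  η• : Term IHGen 0 1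
  η• = gen (bwd ε)
  Δ∘ : Term IHGen 1 2
  Δ∘ = gen (bwd μ)
  ε∘ : Term IHGen 1 0
  ε∘ = gen (bwd η)
  s̄⟨_⟩ : Carrier → Term IHGen 1 1
  s̄⟨ k ⟩ = gen (bwd (s k))

  -- `ha` and `haᵒᵖ` alone present the coproduct of HA and its opposite.
  data IHEq : Equations IHGen (c ⊔ ℓ) where
    ha   : ∀ {n m} {f g : Term HAGen n m} → HAEq f g → IHEq ⟦ f ⟧ ⟦ g ⟧
    haᵒᵖ : ∀ {n m} {f g : Term HAGen n m} → HAEq f g → IHEq ⟦ f ⟧ᵒᵖ ⟦ g ⟧ᵒᵖ

    b1  : ∀ l → ¬ l ≈ 0# → IHEq (s̄⟨ l ⟩ ⨾ s⟨ l ⟩) id₁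
    b2  : IHEq (η• ⨾ ε•) id₀
    b3ˡ : IHEq ((Δ• ⊕ id₁) ⨾ (id₁ ⊕ μ•)) (μ• ⨾ Δ•)
    b3ʳ : IHEq (μ• ⨾ Δ•) ((id₁ ⊕ Δ•) ⨾ (μ• ⊕ id₁))
    b4ˡ : IHEq ((Δ∘ ⊕ id₁) ⨾ (id₁ ⊕ μ∘)) (μ∘ ⨾ Δ∘)
    b4ʳ : IHEq (μ∘ ⨾ Δ∘) ((id₁ ⊕ Δ∘) ⨾ (μ∘ ⊕ id₁))
    b5  : IHEq (η• ⨾ Δ•) (η∘ ⨾ Δ∘ ⨾ (id₁ ⊕ s⟨ - 1# ⟩))
    b6  : IHEq (μ• ⨾ ε•) ((id₁ ⊕ s⟨ - 1# ⟩) ⨾ μ∘ ⨾ ε∘)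
    b7  : ∀ k → IHEq ((s̄⟨ k ⟩ ⊕ id₁) ⨾ μ∘) ((id₁ ⊕ s⟨ k ⟩) ⨾ μ∘ ⨾ s̄⟨ k ⟩)
    b8  : ∀ k → IHEq (Δ∘ ⨾ (s⟨ k ⟩ ⊕ id₁)) (s⟨ k ⟩ ⨾ Δ∘ ⨾ (id₁ ⊕ s̄⟨ k ⟩))

  IHᶜᵖ : RawPROP c (c ⊔ ℓ)
  IHᶜᵖ = Presented IHEq

module Matrices {c ℓ} (R : CommutativeRing c ℓ) where
  open CommutativeRing R using (Carrier; _≈_; 0#; 1#; _+_; _*_; semiring)
  open SemiringSum semiring using (sum)

  infix  4 _≋_
  infixl 6 _⨾ᴹ_
  infixr 7 _⊕ᴹ_

  -- Arrows n → m: m rows and n columns.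
  Mat : ℕ → ℕ → Set c
  Mat n m = Vector (Vector Carrier n) m

  _≋_ : ∀ {n m} → Rel (Mat n m) ℓ
  A ≋ B = ∀ i j → A i j ≈ B i j

  idᴹ : ∀ n → Mat n n
  idᴹ n i j = if does (i ≟ᶠ j) then 1# else 0#

  _⨾ᴹ_ : ∀ {n m k} → Mat n m → Mat m k → Mat n k
  (A ⨾ᴹ B) i j = sum (λ l → B i l * A l j)

  _⊕ᴹ_ : ∀ {n m n′ m′} → Mat n m → Mat n′ m′ → Mat (n +ℕ n′) (m +ℕ m′)
  _⊕ᴹ_ {n} {n′ = n′} A B =
    (λ i → A i ++ replicate n′ 0#) ++ (λ i → replicate n 0# ++ B i)

  -- (x , y) ↦ (y , x) for x of length n and y of length m.
  σᴹ : ∀ n m → Mat (n +ℕ m) (m +ℕ n)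
  σᴹ n m = (λ i → replicate n 0# ++ idᴹ m i) ++ (λ i → idᴹ n i ++ replicate m 0#)

  MatPROP : RawPROP c ℓ
  MatPROP = record
    { Hom = Mat ; _≈_ = _≋_ ; id = idᴹ ; _⨾_ = _⨾ᴹ_ ; _⊕_ = _⊕ᴹ_ ; σ = σᴹ }

  record Pushout {k n m} (f : Mat k n) (g : Mat k m) : Set (c ⊔ ℓ) where
    field
      apex      : ℕ
      ι₁        : Mat n apex
      ι₂        : Mat m apex
      commutes  : f ⨾ᴹ ι₁ ≋ g ⨾ᴹ ι₂
      universal : ∀ {q} (h₁ : Mat n q) (h₂ : Mat m q) → f ⨾ᴹ h₁ ≋ g ⨾ᴹ h₂ → Mat apex q
      factor₁   : ∀ {q} {h₁ : Mat n q} {h₂ : Mat m q} (e : f ⨾ᴹ h₁ ≋ g ⨾ᴹ h₂) →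
                  ι₁ ⨾ᴹ universal h₁ h₂ e ≋ h₁
      factor₂   : ∀ {q} {h₁ : Mat n q} {h₂ : Mat m q} (e : f ⨾ᴹ h₁ ≋ g ⨾ᴹ h₂) →
                  ι₂ ⨾ᴹ universal h₁ h₂ e ≋ h₂
      unique    : ∀ {q} (u v : Mat apex q) →
                  ι₁ ⨾ᴹ u ≋ ι₁ ⨾ᴹ v → ι₂ ⨾ᴹ u ≋ ι₂ ⨾ᴹ v → u ≋ v

module PIDPushouts {c ℓ} (R : PrincipalIdealDomain c ℓ) where
  open PrincipalIdealDomain R using (commutativeRing; isPID)
  open CommutativeRing commutativeRing
    hiding (zero) renaming (refl to ≈-refl; sym to ≈-sym; trans to ≈-trans)
  open IsPID isPID
  open SemiringSum semiring
    using (sum; sum-cong-≋; sum-replicate-zero; ∑-distrib-+; *-distribˡ-sum)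
  open SemiringDivisibility semiring using (_∣_; _,_)
  open RingProperties ring using (-‿distribˡ-*)
  open AbelianGroupProperties +-abelianGroup using () renaming (∙-cancelˡ to +-cancelˡ)
  open Matrices commutativeRing
  open import Relation.Binary.Reasoning.Setoid setoid
  open import Algebra.Properties.Group +-group using (x∙y⁻¹≈ε⇒x≈y)

  -- The ideal { x | x ≈ 0 or a ≈ 0 } is principal; its generator tells which
  -- of the two cases holds.
  ≈0? : ∀ a → Dec (a ≈ 0#)
  ≈0? a with principal I record
      { resp     = λ { x≈y (lift (inj₁ x≈0)) → lift (inj₁ (≈-trans (≈-sym x≈y) x≈0))
                     ; x≈y (lift (inj₂ a≈0)) → lift (inj₂ a≈0) }
      ; 0#-mem   = lift (inj₁ ≈-refl)
      ; +-closed = λ { (lift (inj₁ p)) (lift (inj₁ q)) →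
                         lift (inj₁ (≈-trans (+-cong p q) (+-identityˡ 0#)))
                     ; (lift (inj₂ a≈0)) _ → lift (inj₂ a≈0)
                     ; _ (lift (inj₂ a≈0)) → lift (inj₂ a≈0) }
      ; *-closed = λ { k (lift (inj₁ p)) →
                         lift (inj₁ (≈-trans (*-congˡ p) (zeroʳ k)))
                     ; k (lift (inj₂ a≈0)) → lift (inj₂ a≈0) }
      }
    where
    I : Pred Carrier (c ⊔ ℓ)
    I x = Lift (c ⊔ ℓ) (x ≈ 0# ⊎ a ≈ 0#)
  ... | g , spec with Equivalence.from (spec g) (1# , *-identityˡ g)
  ...   | lift (inj₂ a≈0) = yes a≈0
  ...   | lift (inj₁ g≈0) = no λ a≈0 →
    let k , kg≈1 = Equivalence.to (spec 1#) (lift (inj₂ a≈0))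
    in 1≉0 (≈-trans (≈-sym kg≈1) (≈-trans (*-congˡ g≈0) (zeroʳ k)))

  infix 4 _≈ᵛ_
  _≈ᵛ_ : ∀ {n} → Rel (Vector Carrier n) ℓ
  v ≈ᵛ w = ∀ i → v i ≈ w i

  record IsSubmodule {n} (N : Pred (Vector Carrier n) (c ⊔ ℓ)) : Set (c ⊔ ℓ) where
    field
      resp     : ∀ {v w} → v ≈ᵛ w → N v → N w
      0-mem    : N (λ _ → 0#)
      +-closed : ∀ {v w} → N v → N w → N (λ i → v i + w i)
      *-closed : ∀ k {v} → N v → N (λ i → k * v i)

  combination : ∀ {n p} → Vector Carrier p → Vector (Vector Carrier n) p → Vector Carrier n
  combination k b i = sum (λ t → k t * b t i)

  record Basis {n} (N : Pred (Vector Carrier n) (c ⊔ ℓ)) : Set (c ⊔ ℓ) where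
    field
      rank         : ℕ
      basis        : Vector (Vector Carrier n) rank
      basis-mem    : ∀ t → N (basis t)
      coords       : ∀ {v} → N v → Vector Carrier rank
      coords-spec  : ∀ {v} (v∈N : N v) → combination (coords v∈N) basis ≈ᵛ v
      independent  : ∀ k k′ → combination k basis ≈ᵛ combination k′ basis → k ≈ᵛ k′

  cancelʳ-nonZero : ∀ {x y z} → ¬ z ≈ 0# → x * z ≈ y * z → x ≈ y
  cancelʳ-nonZero {x} {y} {z} z≉0 e with noZeroDivisors {x + - y} {z} (begin
      (x + - y) * z      ≈⟨ distribʳ z x (- y) ⟩
      x * z + - y * z    ≈⟨ +-cong e (≈-sym (-‿distribˡ-* y z)) ⟩
      y * z + - (y * z)  ≈⟨ -‿inverseʳ (y * z) ⟩
      0#                 ∎)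
  ... | inj₁ d≈0 = x∙y⁻¹≈ε⇒x≈y x y d≈0
  ... | inj₂ z≈0 = contradiction z≈0 z≉0

  -- Submodules of free modules are free: split off the ideal of leading
  -- coefficients.
  submodule-free : ∀ n (N : Pred (Vector Carrier n) (c ⊔ ℓ)) → IsSubmodule N → Basis N
  submodule-free zero N N-sub = record
    { rank        = 0
    ; basis       = λ ()
    ; basis-mem   = λ ()
    ; coords      = λ _ ()
    ; coords-spec = λ _ ()
    ; independent = λ _ _ _ ()
    }
  submodule-free (suc n) N N-sub = result
    where
    module N = IsSubmodule N-sub

    ∷-resp : ∀ {x y v w} → x ≈ y → v ≈ᵛ w → N (x ∷ v) → N (y ∷ w)
    ∷-resp p q = N.resp λ { zero → p ; (suc i) → q i }

    ∷-+ : ∀ {x y v w} → N (x ∷ v) → N (y ∷ w) → N ((x + y) ∷ (λ i → v i + w i))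
    ∷-+ p q = N.resp (λ { zero → ≈-refl ; (suc i) → ≈-refl }) (N.+-closed p q)

    ∷-* : ∀ k {x v} → N (x ∷ v) → N ((k * x) ∷ (λ i → k * v i))
    ∷-* k p = N.resp (λ { zero → ≈-refl ; (suc i) → ≈-refl }) (N.*-closed k p)

    ∷-η : ∀ {v} → N v → N (head v ∷ tail v)
    ∷-η = N.resp λ { zero → ≈-refl ; (suc i) → ≈-refl }

    N₀ : Pred (Vector Carrier n) (c ⊔ ℓ)
    N₀ v = N (0# ∷ v)

    N₀-sub : IsSubmodule N₀
    N₀-sub = record
      { resp     = ∷-resp ≈-refl
      ; 0-mem    = N.resp (λ { zero → ≈-refl ; (suc i) → ≈-refl }) N.0-mem
      ; +-closed = λ p q → ∷-resp (+-identityˡ 0#) (λ _ → ≈-refl) (∷-+ p q)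
      ; *-closed = λ k p → ∷-resp (zeroʳ k) (λ _ → ≈-refl) (∷-* k p)
      }

    open Basis (submodule-free n N₀ N₀-sub)

    I : Pred Carrier (c ⊔ ℓ)
    I x = Σ (Vector Carrier n) λ v → N (x ∷ v)

    I-principal : ∃ λ g → ∀ x → I x ⇔ g ∣ x
    I-principal = principal I record
      { resp     = λ x≈y (v , p) → v , ∷-resp x≈y (λ _ → ≈-refl) p
      ; 0#-mem   = (λ _ → 0#) , ∷-η N.0-mem
      ; +-closed = λ (_ , p) (_ , q) → _ , ∷-+ p q
      ; *-closed = λ k (_ , p) → _ , ∷-* k p
      }

    g : Carrier
    g = proj₁ I-principal

    head-coeff : ∀ {v} → N v → g ∣ head v
    head-coeff v∈N = Equivalence.to (proj₂ I-principal _) (_ , ∷-η v∈N)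

    g-mem : I g
    g-mem = Equivalence.from (proj₂ I-principal g) (1# , *-identityˡ g)

    w : Vector Carrier n
    w = proj₁ g-mem

    comb-head : ∀ {p} (k : Vector Carrier p) → sum (λ t → k t * 0#) ≈ 0#
    comb-head {p} k = ≈-trans (sum-cong-≋ (λ t → zeroʳ (k t))) (sum-replicate-zero p)

    result : Basis N
    result with ≈0? g
    ... | yes g≈0 = record
      { rank        = rank
      ; basis       = λ t → 0# ∷ basis t
      ; basis-mem   = basis-mem
      ; coords      = λ v∈N → coords (v∈N₀ v∈N)
      ; coords-spec = λ { v∈N zero    → ≈-trans (comb-head (coords (v∈N₀ v∈N))) (≈-sym (head≈0 v∈N))
                        ; v∈N (suc i) → coords-spec (v∈N₀ v∈N) i }
      ; independent = λ k k′ e → independent k k′ (λ i → e (suc i))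
      }
      where
      head≈0 : ∀ {v} → N v → head v ≈ 0#
      head≈0 v∈N = let q , qg≈x = head-coeff v∈N in
        ≈-trans (≈-sym qg≈x) (≈-trans (*-congˡ g≈0) (zeroʳ q))

      v∈N₀ : ∀ {v} → N v → N₀ (tail v)
      v∈N₀ v∈N = ∷-resp (head≈0 v∈N) (λ _ → ≈-refl) (∷-η v∈N)
    ... | no g≉0 = record
      { rank        = suc rank
      ; basis       = basis′
      ; basis-mem   = λ { zero → proj₂ g-mem ; (suc t) → basis-mem t }
      ; coords      = λ v∈N → q v∈N ∷ coords (rest v∈N)
      ; coords-spec = λ { v∈N zero    → ≈-trans (headline _ _) (qg≈head v∈N)
                        ; {v} v∈N (suc i) → begin
                            q v∈N * w i + combination (coords (rest v∈N)) basis i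
                              ≈⟨ +-congˡ (coords-spec (rest v∈N) i) ⟩
                            q v∈N * w i + (v (suc i) + - q v∈N * w i)
                              ≈⟨ +-congˡ (+-comm _ _) ⟩
                            q v∈N * w i + (- q v∈N * w i + v (suc i))
                              ≈⟨ +-assoc _ _ _ ⟨
                            (q v∈N * w i + - q v∈N * w i) + v (suc i)
                              ≈⟨ +-congʳ (cancel (q v∈N) (w i)) ⟩
                            0# + v (suc i)
                              ≈⟨ +-identityˡ _ ⟩
                            v (suc i) ∎ }
      ; independent = λ k k′ e →
          let k₀≈k′₀ = cancelʳ-nonZero g≉0
                (≈-trans (≈-sym (headline _ _)) (≈-trans (e zero) (headline _ _)))
          in λ { zero    → k₀≈k′₀
               ; (suc t) → independent (tail k) (tail k′) (λ i →
                   +-cancelˡ (head k * w i) _ _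
                     (≈-trans (e (suc i)) (+-congʳ (*-congʳ (≈-sym k₀≈k′₀))))) t }
      }
      where
      basis′ : Vector (Vector Carrier (suc n)) (suc rank)
      basis′ zero    = g ∷ w
      basis′ (suc t) = 0# ∷ basis t

      headline : ∀ x (k : Vector Carrier rank) → x * g + sum (λ t → k t * 0#) ≈ x * g
      headline x k = ≈-trans (+-congˡ (comb-head k)) (+-identityʳ (x * g))

      cancel : ∀ x y → x * y + - x * y ≈ 0#
      cancel x y = ≈-trans (+-congˡ (≈-sym (-‿distribˡ-* x y))) (-‿inverseʳ (x * y))

      q : ∀ {v} → N v → Carrier
      q v∈N = let k , _ = head-coeff v∈N in k

      qg≈head : ∀ {v} (v∈N : N v) → q v∈N * g ≈ head v
      qg≈head v∈N = let _ , e = head-coeff v∈N in e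

      rest : ∀ {v} (v∈N : N v) → N₀ (λ i → v (suc i) + - q v∈N * w i)
      rest {v} v∈N = ∷-resp
        (begin
          v zero + - q v∈N * g       ≈⟨ +-congʳ (qg≈head v∈N) ⟨
          q v∈N * g + - q v∈N * g    ≈⟨ cancel (q v∈N) g ⟩
          0#                         ∎)
        (λ _ → ≈-refl)
        (∷-+ (∷-η v∈N) (∷-* (- q v∈N) (proj₂ g-mem)))

  -- The rows of [ι₁ ι₂] form a basis of the module of row vectors (x , y)
  -- with x f = y g.
  pushout : ∀ {k n m} (f : Mat k n) (g : Mat k m) → Pushout f g
  pushout {k} {n} {m} f g = record
    { apex      = rank
    ; ι₁        = λ t → left (basis t)
    ; ι₂        = λ t → right (basis t)
    ; commutes  = λ t → lower (basis-mem t)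
    ; universal = λ h₁ h₂ e i → coords {h₁ i ++ h₂ i} (row h₁ h₂ e i)
    ; factor₁   = λ {_} {h₁} {h₂} e i j →
        ≈-trans (coords-spec {h₁ i ++ h₂ i} (row h₁ h₂ e i) (j ↑ˡ m))
                (reflexive (lookup-++ˡ (h₁ i) (h₂ i) j))
    ; factor₂   = λ {_} {h₁} {h₂} e i j →
        ≈-trans (coords-spec {h₁ i ++ h₂ i} (row h₁ h₂ e i) (n ↑ʳ j))
                (reflexive (lookup-++ʳ (h₁ i) (h₂ i) j))
    ; unique    = λ u v e₁ e₂ i → independent (u i) (v i) (split-≈ (e₁ i) (e₂ i))
    }
    where
    left : Vector Carrier (n +ℕ m) → Vector Carrier n
    left v l = v (l ↑ˡ m)

    right : Vector Carrier (n +ℕ m) → Vector Carrier m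
    right v l = v (n ↑ʳ l)

    _·_ : ∀ {p} → Vector Carrier p → Mat k p → Vector Carrier k
    (x · A) j = sum (λ l → x l * A l j)

    ·-congʳ : ∀ {p} {x y : Vector Carrier p} (A : Mat k p) → x ≈ᵛ y → x · A ≈ᵛ y · A
    ·-congʳ A e j = sum-cong-≋ (λ l → *-congʳ (e l))

    ·-+ : ∀ {p} (x y : Vector Carrier p) (A : Mat k p) →
          (λ l → x l + y l) · A ≈ᵛ λ j → (x · A) j + (y · A) j
    ·-+ x y A j = ≈-trans (sum-cong-≋ (λ l → distribʳ (A l j) (x l) (y l)))
                          (∑-distrib-+ (λ l → x l * A l j) (λ l → y l * A l j))

    ·-* : ∀ {p} a (x : Vector Carrier p) (A : Mat k p) →
          (λ l → a * x l) · A ≈ᵛ λ j → a * (x · A) j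
    ·-* a x A j = ≈-trans (sum-cong-≋ (λ l → *-assoc a (x l) (A l j)))
                          (≈-sym (*-distribˡ-sum a (λ l → x l * A l j)))

    ·-0 : ∀ {p} (A : Mat k p) → (λ _ → 0#) · A ≈ᵛ λ _ → 0#
    ·-0 {p} A j = ≈-trans (sum-cong-≋ (λ l → zeroˡ (A l j))) (sum-replicate-zero p)

    N : Pred (Vector Carrier (n +ℕ m)) (c ⊔ ℓ)
    N v = Lift (c ⊔ ℓ) (left v · f ≈ᵛ right v · g)

    N-sub : IsSubmodule N
    N-sub = record
      { resp     = λ e (lift p) → lift λ j → begin
          _ ≈⟨ ·-congʳ f (λ l → e (l ↑ˡ m)) j ⟨
          _ ≈⟨ p j ⟩
          _ ≈⟨ ·-congʳ g (λ l → e (n ↑ʳ l)) j ⟩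
          _ ∎
      ; 0-mem    = lift λ j → ≈-trans (·-0 f j) (≈-sym (·-0 g j))
      ; +-closed = λ {v} {w} (lift p) (lift q) → lift λ j → begin
          _ ≈⟨ ·-+ (left v) (left w) f j ⟩
          _ ≈⟨ +-cong (p j) (q j) ⟩
          _ ≈⟨ ·-+ (right v) (right w) g j ⟨
          _ ∎
      ; *-closed = λ a {v} (lift p) → lift λ j → begin
          _ ≈⟨ ·-* a (left v) f j ⟩
          _ ≈⟨ *-congˡ (p j) ⟩
          _ ≈⟨ ·-* a (right v) g j ⟨
          _ ∎
      }

    open Basis (submodule-free (n +ℕ m) N N-sub)

    row : ∀ {q} (h₁ : Mat n q) (h₂ : Mat m q) → f ⨾ᴹ h₁ ≋ g ⨾ᴹ h₂ → 
          ∀ i → N (h₁ i ++ h₂ i)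
    row h₁ h₂ e i = lift λ j → begin
      _ ≈⟨ ·-congʳ f (λ l → reflexive (lookup-++ˡ (h₁ i) (h₂ i) l)) j ⟩
      _ ≈⟨ e i j ⟩
      _ ≈⟨ ·-congʳ g (λ l → reflexive (lookup-++ʳ (h₁ i) (h₂ i) l)) j ⟨
      _ ∎

    split-≈ : ∀ {v w} → left v ≈ᵛ left w → right v ≈ᵛ right w → v ≈ᵛ w
    split-≈ {v} {w} p q i = subst (λ i → v i ≈ w i) (join-splitAt n m i) (go (splitAt n i))
      where
      go : (x : Fin n ⊎ Fin m) → v (join n m x) ≈ w (join n m x)
      go (inj₁ l) = p l
      go (inj₂ l) = q l

module Cospans {c ℓ} (R : PrincipalIdealDomain c ℓ) where
  open PrincipalIdealDomain R using (commutativeRing)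
  open Matrices commutativeRing
  open PIDPushouts R using (pushout)

  record Cospan (n m : ℕ) : Set c where
    constructor cospan
    field
      {apex} : ℕ
      left   : Mat n apex
      right  : Mat m apex

  open Cospan

  infix 4 _≅_
  record _≅_ {n m} (C D : Cospan n m) : Set (c ⊔ ℓ) where
    field
      to        : Mat (apex C) (apex D)
      from      : Mat (apex D) (apex C)
      to-from   : to ⨾ᴹ from ≋ idᴹ (apex C)
      from-to   : from ⨾ᴹ to ≋ idᴹ (apex D)
      left-to   : left C ⨾ᴹ to ≋ left D
      right-to  : right C ⨾ᴹ to ≋ right D

  idᶜ : ∀ n → Cospan n n
  idᶜ n = cospan (idᴹ n) (idᴹ n)

  _⨾ᶜ_ : ∀ {n m k} → Cospan n m → Cospan m k → Cospan n k
  C ⨾ᶜ D = cospan (left C ⨾ᴹ P.ι₁) (right D ⨾ᴹ P.ι₂)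
    where module P = Pushout (pushout (right C) (left D))

  _⊕ᶜ_ : ∀ {n m n′ m′} → Cospan n m → Cospan n′ m′ → Cospan (n +ℕ n′) (m +ℕ m′)
  C ⊕ᶜ D = cospan (left C ⊕ᴹ left D) (right C ⊕ᴹ right D)

  σᶜ : ∀ n m → Cospan (n +ℕ m) (m +ℕ n)
  σᶜ n m = cospan (σᴹ n m) (idᴹ (m +ℕ n))

  CospanMat : RawPROP c (c ⊔ ℓ)
  CospanMat = record
    { Hom = Cospan ; _≈_ = _≅_ ; id = idᶜ ; _⨾_ = _⨾ᶜ_ ; _⊕_ = _⊕ᶜ_ ; σ = σᶜ }

module Interpretation {c ℓ} (R : PrincipalIdealDomain c ℓ) where
  open PrincipalIdealDomain R using (commutativeRing)
  open CommutativeRing commutativeRing using (1#)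
  open HopfAlgebras commutativeRing using (HAGen; Δ; ε; μ; η; s)
  open InteractingHopfAlgebras commutativeRing using (IHGen; fwd; bwd; IHᶜᵖ) public
  open Matrices commutativeRing using (Mat; idᴹ)
  open Cospans R using (Cospan; cospan; idᶜ; _⨾ᶜ_; _⊕ᶜ_; σᶜ; CospanMat) public

  𝓜 : ∀ {n m} → HAGen n m → Mat n m
  𝓜 Δ     = λ _ _ → 1#
  𝓜 ε     = λ ()
  𝓜 μ     = λ _ _ → 1#
  𝓜 η     = λ _ ()
  𝓜 (s k) = λ _ _ → k

  𝓢 : ∀ {n m} → Term IHGen n m → Cospan n m
  𝓢 (gen (fwd {n} {m} g)) = cospan (𝓜 g) (idᴹ m)
  𝓢 (gen (bwd {n} {m} g)) = cospan (idᴹ n) (𝓜 g)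
  𝓢 id₀     = idᶜ 0
  𝓢 id₁     = idᶜ 1
  𝓢 σ₁₁     = σᶜ 1 1
  𝓢 (f ⨾ g) = 𝓢 f ⨾ᶜ 𝓢 g
  𝓢 (f ⊕ g) = 𝓢 f ⊕ᶜ 𝓢 g

{-# OPTIONS --safe #-}
module Submission where

-- A term of HA_R is determined by its matrix, because it can be rewritten to a
-- normal form that adds up the columns one by one; hence every matrix A has
-- well-defined images F A and G A in IH^Cp_R, G A being the converse of F A.
-- The inverse of 𝓢 sends the cospan (A , B) to F A ⨾ G B, and the only point
-- is that it preserves composition: G f ⨾ F g ≈ F l ⨾ G r for the pushout
-- (l , r) of (f , g).
--
-- The basic tool is the absorption law (C † ⊕ id) ⨾ add ≈ (id ⊕ C) ⨾ add ⨾ C †,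
-- which holds for the image C of any term of HA_R since it holds for generators.
-- Fraction-free Gaussian elimination, whose scalars are inverted by (B1), shows
-- that G U ≈ F (U⁻¹) for an invertible matrix U. Therefore the exchange law can
-- be tested after a change of basis, which settles the cokernel of one column
-- and, inductively, of any matrix. The pushout of f and g is the cokernel of
-- (- g , f), and bending its wires gives the law for general spans.

open import Algebra.Bundles using (CommutativeRing)
import Algebra.Properties.CommutativeMonoid.Sum as CommutativeMonoidSum
import Algebra.Properties.Semiring.Divisibility as SemiringDivisibility
import Algebra.Properties.Semiring.Sum as SemiringSum
open import Data.Fin.Base using (Fin; _↑ʳ_; _↑ˡ_; splitAt; suc; zero)
open import Data.Fin.Properties using (all?; splitAt⁻¹-↑ʳ; splitAt⁻¹-↑ˡ; ¬∀⟶∃¬)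
open import Data.Nat.Base using (suc; zero; ℕ) renaming (_+_ to _+ℕ_)
open import Data.Nat.Properties using () renaming (+-assoc to +ℕ-assoc; +-identityʳ to +ℕ-identityʳ)
open import Data.Product.Base using (_,_; proj₁; proj₂; Σ; ∃)
open import Data.Sum.Base using (inj₁; inj₂)
open import Data.Vec.Functional using (Vector; []; _++_; _∷_; replicate; tail)
open import Data.Vec.Functional.Properties using (lookup-++ʳ; lookup-++ˡ)
open import Function.Base using (_∘_)
open import Function.Bundles using (Equivalence)
open import Level using (_⊔_)
open import Relation.Binary.Bundles using (Setoid)
open import Relation.Binary.PropositionalEquality using (_≡_; cong; cong₂; refl; subst; subst₂; sym; trans)
import Relation.Binary.Reasoning.Setoid as SetoidReasoning
open import Relation.Binary.Structures using (IsEquivalence)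
open import Relation.Nullary using (contradiction; no; yes; ¬_)
open import Defs
  using (RawPROP; IsPROP; IsPROPMorphism; IsPROPIsomorphism; cast; Signature; Equations; Presented; Term;
         gen; id₀; id₁; σ₁₁; idᵗ; σᵗ; σ₁ᵗ; _≃_; axiom; IsIdeal; IsPID; PrincipalIdealDomain;
         module HopfAlgebras; module InteractingHopfAlgebras; module Matrices; module PIDPushouts;
         module Cospans; module Interpretation)

-- (B1) cancels a non-zero scalar in one order only: `s̄⟨ l ⟩ ⨾ s⟨ l ⟩` is the identity, whereas
-- `s⟨ l ⟩ ⨾ s̄⟨ l ⟩` denotes the cospan `(l , l)`, which is isomorphic to the identity just when l
-- is a unit. So the invariant carried through elimination is the one-sided `f † ⨾ f ≈ id`, which
-- for a matrix expresses that it is an epimorphism. Elimination avoids division and gcd steps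
-- because over a PID that is not Euclidean elementary operations need not generate all invertible
-- matrices, while scaling by a non-zero pivot respects the one-sided invariant. As a guide, the
-- cospan `(A , B)` relates x to y when `A x = B y`; then `G A` is `F A` read backwards, and
-- absorption says that `z + y = w` with `C z = x` amounts to `C w = x + C y`. Pushouts of matrices
-- are taken among free modules, where torsion disappears: a column `d q` with d non-zero has the
-- same cokernel as q. The diagrammatic counterpart is `η• ⨾ s⟨ d ⟩ ≈ η•`, again a consequence of
-- (B1).

-- (w , x , y , z) ↦ (w , y , x , z)
module Shuffle {a ℓ} (P : RawPROP a ℓ) where
  open RawPROP P

  regroup : ∀ a b c d → a +ℕ ((b +ℕ c) +ℕ d) ≡ (a +ℕ b) +ℕ (c +ℕ d)
  regroup a b c d = trans (cong (a +ℕ_) (+ℕ-assoc b c d)) (sym (+ℕ-assoc a b (c +ℕ d)))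

  shuffle : ∀ a b c d → Hom ((a +ℕ b) +ℕ (c +ℕ d)) ((a +ℕ c) +ℕ (b +ℕ d))
  shuffle a b c d = cast {Hom = Hom} (regroup a b c d) (regroup a c b d) (id a ⊕ (σ b c ⊕ id d))

-- Equational reasoning in a PROP, up to the strictness casts

module PROPReasoning {a ℓ} {P : RawPROP a ℓ} (isPROP : IsPROP P) where
  open RawPROP P
  open IsPROP isPROP public

  hom-setoid : ℕ → ℕ → Setoid a ℓ
  hom-setoid n m = record { isEquivalence = isEquivalence {n} {m} }

  ≈-refl : ∀ {n m} {f : Hom n m} → f ≈ f
  ≈-refl = IsEquivalence.refl isEquivalence
  ≈-sym : ∀ {n m} {f g : Hom n m} → f ≈ g → g ≈ f
  ≈-sym = IsEquivalence.sym isEquivalence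
  ≈-trans : ∀ {n m} {f g h : Hom n m} → f ≈ g → g ≈ h → f ≈ h
  ≈-trans = IsEquivalence.trans isEquivalence

  module ≈-Reasoning {n m} = SetoidReasoning (hom-setoid n m)
  open ≈-Reasoning

  infixl 6 _⟩⨾⟨_
  infixr 7 _⟩⊕⟨_
  infixl 6 refl⟩⨾⟨_ _⟩⨾⟨refl
  infixr 7 refl⟩⊕⟨_ _⟩⊕⟨refl

  _⟩⨾⟨_ : ∀ {n m k} {f f′ : Hom n m} {g g′ : Hom m k} →
          f ≈ f′ → g ≈ g′ → f ⨾ g ≈ f′ ⨾ g′
  _⟩⨾⟨_ = ⨾-cong

  refl⟩⨾⟨_ : ∀ {n m k} {f : Hom n m} {g g′ : Hom m k} → g ≈ g′ → f ⨾ g ≈ f ⨾ g′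
  refl⟩⨾⟨ p = ⨾-cong ≈-refl p

  _⟩⨾⟨refl : ∀ {n m k} {f f′ : Hom n m} {g : Hom m k} → f ≈ f′ → f ⨾ g ≈ f′ ⨾ g
  p ⟩⨾⟨refl = ⨾-cong p ≈-refl

  _⟩⊕⟨_ : ∀ {n m n′ m′} {f f′ : Hom n m} {g g′ : Hom n′ m′} →
          f ≈ f′ → g ≈ g′ → f ⊕ g ≈ f′ ⊕ g′
  _⟩⊕⟨_ = ⊕-cong

  refl⟩⊕⟨_ : ∀ {n m n′ m′} {f : Hom n m} {g g′ : Hom n′ m′} → g ≈ g′ → f ⊕ g ≈ f ⊕ g′
  refl⟩⊕⟨ p = ⊕-cong ≈-refl p

  _⟩⊕⟨refl : ∀ {n m n′ m′} {f f′ : Hom n m} {g : Hom n′ m′} → f ≈ f′ → f ⊕ g ≈ f′ ⊕ g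
  p ⟩⊕⟨refl = ⊕-cong p ≈-refl

  assoc²ˡ : ∀ {n m k l} {f : Hom n m} {g : Hom m k} {h : Hom k l} {gh : Hom m l} →
            g ⨾ h ≈ gh → (f ⨾ g) ⨾ h ≈ f ⨾ gh
  assoc²ˡ p = ≈-trans (⨾-assoc _ _ _) (refl⟩⨾⟨ p)

  assoc²ʳ : ∀ {n m k l} {f : Hom n m} {g : Hom m k} {h : Hom k l} {fg : Hom n k} →
            f ⨾ g ≈ fg → f ⨾ (g ⨾ h) ≈ fg ⨾ h
  assoc²ʳ p = ≈-trans (≈-sym (⨾-assoc _ _ _)) (p ⟩⨾⟨refl)

  rewriteʳ : ∀ {n m m′ k l} {f : Hom n m} {g : Hom m k} {h : Hom k l}
             {g′ : Hom m m′} {h′ : Hom m′ l} →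
             g ⨾ h ≈ g′ ⨾ h′ → (f ⨾ g) ⨾ h ≈ (f ⨾ g′) ⨾ h′
  rewriteʳ p = ≈-trans (assoc²ˡ p) (≈-sym (⨾-assoc _ _ _))

  cancelʳ : ∀ {n m k} {f : Hom n m} {g : Hom m k} {h : Hom k m} →
            g ⨾ h ≈ id m → (f ⨾ g) ⨾ h ≈ f
  cancelʳ p = ≈-trans (assoc²ˡ p) (⨾-identityʳ _)

  ⊕-assoc-id : ∀ {p q n m} {f : Hom n m} →
               f ⊕ (id p ⊕ id q) ≈ f ⊕ id (p +ℕ q)
  ⊕-assoc-id = refl⟩⊕⟨ ⊕-id _ _

  merge : ∀ {n m k n′ m′ k′} {f : Hom n m} {g : Hom m k} {f′ : Hom n′ m′} {g′ : Hom m′ k′} →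
          (f ⊕ f′) ⨾ (g ⊕ g′) ≈ (f ⨾ g) ⊕ (f′ ⨾ g′)
  merge = ≈-sym (interchange _ _ _ _)

  id-⊕-⨾ : ∀ {p n m k} {f : Hom n m} {g : Hom m k} →
           id p ⊕ (f ⨾ g) ≈ (id p ⊕ f) ⨾ (id p ⊕ g)
  id-⊕-⨾ = ≈-trans (≈-sym (⨾-identityˡ _) ⟩⊕⟨refl) (interchange _ _ _ _)

  ⨾-⊕-id : ∀ {p n m k} {f : Hom n m} {g : Hom m k} →
           (f ⨾ g) ⊕ id p ≈ (f ⊕ id p) ⨾ (g ⊕ id p)
  ⨾-⊕-id = ≈-trans (refl⟩⊕⟨ ≈-sym (⨾-identityˡ _)) (interchange _ _ _ _)

  slideˡʳ : ∀ {n m n′ m′} {f : Hom n m} {g : Hom n′ m′} →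
            (f ⊕ id n′) ⨾ (id m ⊕ g) ≈ f ⊕ g
  slideˡʳ = ≈-trans merge (⨾-identityʳ _ ⟩⊕⟨ ⨾-identityˡ _)

  slideʳˡ : ∀ {n m n′ m′} {f : Hom n m} {g : Hom n′ m′} →
            (id n ⊕ g) ⨾ (f ⊕ id m′) ≈ f ⊕ g
  slideʳˡ = ≈-trans merge (⨾-identityˡ _ ⟩⊕⟨ ⨾-identityʳ _)

  exchange : ∀ {n m n′ m′} {f : Hom n m} {g : Hom n′ m′} →
             (f ⊕ id n′) ⨾ (id m ⊕ g) ≈ (id n ⊕ g) ⨾ (f ⊕ id m′)
  exchange = ≈-trans slideˡʳ (≈-sym slideʳˡ)

  -- Heterogeneous, so that casts along equations of (co)domains can be ignored.
  infix 4 _≈ʰ_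
  data _≈ʰ_ {n m} (f : Hom n m) : ∀ {n′ m′} → Hom n′ m′ → Set (a ⊔ ℓ) where
    het : {g : Hom n m} → f ≈ g → f ≈ʰ g

  unhet : ∀ {n m} {f g : Hom n m} → f ≈ʰ g → f ≈ g
  unhet (het p) = p

  symʰ : ∀ {n m n′ m′} {f : Hom n m} {g : Hom n′ m′} → f ≈ʰ g → g ≈ʰ f
  symʰ (het p) = het (≈-sym p)

  transʰ : ∀ {n m n′ m′ n″ m″} {f : Hom n m} {g : Hom n′ m′} {h : Hom n″ m″} →
           f ≈ʰ g → g ≈ʰ h → f ≈ʰ h
  transʰ (het p) (het q) = het (≈-trans p q)

  ⨾-congʰ : ∀ {n m k n′ m′ k′} {f : Hom n m} {g : Hom m k} {f′ : Hom n′ m′} {g′ : Hom m′ k′} →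
            f ≈ʰ f′ → g ≈ʰ g′ → f ⨾ g ≈ʰ f′ ⨾ g′
  ⨾-congʰ (het p) (het q) = het (⨾-cong p q)

  ⊕-congʰ : ∀ {n m k l n′ m′ k′ l′} {f : Hom n m} {g : Hom k l}
            {f′ : Hom n′ m′} {g′ : Hom k′ l′} →
            f ≈ʰ f′ → g ≈ʰ g′ → f ⊕ g ≈ʰ f′ ⊕ g′
  ⊕-congʰ (het p) (het q) = het (⊕-cong p q)

  cast-het : ∀ {n m n′ m′} (p : n ≡ n′) (q : m ≡ m′) {f : Hom n m} →
             cast {Hom = Hom} p q f ≈ʰ f
  cast-het refl refl = het ≈-refl

  ⊕-assocʰ : ∀ {n m n′ m′ n″ m″} (f : Hom n m) (g : Hom n′ m′) (h : Hom n″ m″) →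
             (f ⊕ g) ⊕ h ≈ʰ f ⊕ (g ⊕ h)
  ⊕-assocʰ f g h = transʰ (symʰ (cast-het _ _)) (het (⊕-assoc f g h))

  ⊕-identityʳʰ : ∀ {n m} (f : Hom n m) → f ⊕ id 0 ≈ʰ f
  ⊕-identityʳʰ f = transʰ (symʰ (cast-het _ _)) (het (⊕-identityʳ f))

  id-het : ∀ {n m} → n ≡ m → id n ≈ʰ id m
  id-het refl = het ≈-refl

  open Shuffle P public

  ⊕-regroup : ∀ {a b c d a′ b′ c′ d′} (f : Hom a a′) (g : Hom b b′) (h : Hom c c′) (k : Hom d d′) →
              (f ⊕ g) ⊕ (h ⊕ k) ≈ʰ f ⊕ ((g ⊕ h) ⊕ k)
  ⊕-regroup f g h k = transʰ (⊕-assocʰ f g (h ⊕ k)) (⊕-congʰ (het ≈-refl) (symʰ (⊕-assocʰ g h k)))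

  shuffle-natural : ∀ {a b c d a′ b′ c′ d′} (f : Hom a a′) (g : Hom b b′) (h : Hom c c′) (k : Hom d d′) →
    ((f ⊕ g) ⊕ (h ⊕ k)) ⨾ shuffle a′ b′ c′ d′ ≈ shuffle a b c d ⨾ ((f ⊕ h) ⊕ (g ⊕ k))
  shuffle-natural {a} {b} {c} {d} {a′} {b′} {c′} {d′} f g h k = unhet
    (transʰ (⨾-congʰ (⊕-regroup f g h k) (cast-het (regroup a′ b′ c′ d′) (regroup a′ c′ b′ d′)))
    (transʰ (het (begin
        (f ⊕ ((g ⊕ h) ⊕ k)) ⨾ (id a′ ⊕ (σ b′ c′ ⊕ id d′))
          ≈⟨ ≈-trans merge (≈-trans (⨾-identityʳ f) (≈-sym (⨾-identityˡ f)) ⟩⊕⟨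
               ≈-trans merge (σ-natural g h ⟩⊕⟨ ≈-trans (⨾-identityʳ k) (≈-sym (⨾-identityˡ k)))) ⟩
        (id a ⨾ f) ⊕ ((σ b c ⨾ (h ⊕ g)) ⊕ (id d ⨾ k))
          ≈⟨ ≈-trans (refl⟩⊕⟨ interchange _ _ _ _) (interchange _ _ _ _) ⟩
        (id a ⊕ (σ b c ⊕ id d)) ⨾ (f ⊕ ((h ⊕ g) ⊕ k)) ∎))
    (symʰ (⨾-congʰ (cast-het (regroup a b c d) (regroup a c b d)) (⊕-regroup f h g k)))))

-- Presented PROPs

presented-isPROP : ∀ {a ℓ} {Gen : Signature a} (E : Equations Gen ℓ) → IsPROP (Presented E)
presented-isPROP E = record
  { isEquivalence = record { refl = Defs.≃-refl ; sym = Defs.≃-sym ; trans = Defs.≃-trans }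
  ; ⨾-cong = Defs.⨾-cong ; ⊕-cong = Defs.⊕-cong
  ; ⨾-assoc = Defs.⨾-assoc ; ⨾-identityˡ = Defs.⨾-identityˡ ; ⨾-identityʳ = Defs.⨾-identityʳ
  ; ⊕-id = Defs.⊕-id ; interchange = Defs.interchange
  ; ⊕-assoc = Defs.⊕-assoc ; ⊕-identityˡ = Defs.⊕-identityˡ ; ⊕-identityʳ = Defs.⊕-identityʳ
  ; σ-natural = Defs.σ-natural ; σ-involutive = Defs.σ-involutive ; σ-hexagon = Defs.σ-hexagon
  }

module PresentedStructure {a ℓ} {Gen : Signature a} (E : Equations Gen ℓ) where
  open RawPROP (Presented E)
  open PROPReasoning (presented-isPROP E)
  open ≈-Reasoning

  -- `idᵗ 1` unfolds to `id₁ ⊕ id₀`, so the constant and the identity of the PROP agree only through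
  -- the right unit law, whose casts reduce away at numerals.
  id₁≈id : Term.id₁ ≈ id 1
  id₁≈id = ≈-sym (⊕-identityʳ Term.id₁)

  σ≈σ₁₁ : σ 1 1 ≈ Term.σ₁₁
  σ≈σ₁₁ = begin
    (Term.id₁ ⊕ id 1) ⨾ (((Term.σ₁₁ ⊕ id 0) ⨾ (Term.id₁ ⊕ Term.id₁)) ⊕ id 0)
      ≈⟨ ⨾-identityˡ _ ⟩
    ((Term.σ₁₁ ⊕ id 0) ⨾ (Term.id₁ ⊕ Term.id₁)) ⊕ id 0
      ≈⟨ ⊕-identityʳ _ ⟩
    (Term.σ₁₁ ⊕ id 0) ⨾ (Term.id₁ ⊕ Term.id₁)
      ≈⟨ ⊕-identityʳ Term.σ₁₁ ⟩⨾⟨ (refl⟩⊕⟨ id₁≈id) ⟩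
    Term.σ₁₁ ⨾ id 2
      ≈⟨ ⨾-identityʳ _ ⟩
    Term.σ₁₁ ∎

-- Local laws of HA: adding multiples of one wire to others

module HopfLocal {c ℓ} (R : CommutativeRing c ℓ) where
  open CommutativeRing R using (Carrier; 0#; _+_; _*_)
  open HopfAlgebras R
  open RawPROP HA using (_≈_; id; _⨾_; _⊕_; σ)
  open PROPReasoning (presented-isPROP HAEq)
  open PresentedStructure HAEq public
  open ≈-Reasoning

  σ² : σ₁₁ ⨾ σ₁₁ ≈ id 2
  σ² = ≈-trans (≈-sym σ≈σ₁₁ ⟩⨾⟨ ≈-sym σ≈σ₁₁) (σ-involutive 1 1)

  σ₂₁ : σ 2 1 ≈ (id 1 ⊕ σ₁₁) ⨾ (σ₁₁ ⊕ id 1)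
  σ₂₁ = ≈-trans (σ-hexagon 1 1 1) ((refl⟩⊕⟨ σ≈σ₁₁) ⟩⨾⟨ (σ≈σ₁₁ ⟩⊕⟨refl))

  σ⊕id² : ∀ {p} → (σ₁₁ ⊕ id p) ⨾ (σ₁₁ ⊕ id p) ≈ id (2 +ℕ p)
  σ⊕id² = ≈-trans merge (≈-trans (σ² ⟩⊕⟨ ⨾-identityˡ _) (⊕-id _ _))

  id⊕σ² : ∀ {p} → (id p ⊕ σ₁₁) ⨾ (id p ⊕ σ₁₁) ≈ id (p +ℕ 2)
  id⊕σ² = ≈-trans merge (≈-trans (⨾-identityˡ _ ⟩⊕⟨ σ²) (⊕-id _ _))

  -- The hexagon law splits only the first argument of the symmetry; splitting the second is
  -- obtained by inverting `σ₂₁`.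
  σ₁₂ : σ 1 2 ≈ (σ₁₁ ⊕ id 1) ⨾ (id 1 ⊕ σ₁₁)
  σ₁₂ = begin
    σ 1 2
      ≈⟨ ⨾-identityʳ _ ⟨
    σ 1 2 ⨾ id 3
      ≈⟨ refl⟩⨾⟨ inv ⟨
    σ 1 2 ⨾ (σ 2 1 ⨾ ((σ₁₁ ⊕ id 1) ⨾ (id 1 ⊕ σ₁₁)))
      ≈⟨ assoc²ʳ (σ-involutive 1 2) ⟩
    id 3 ⨾ ((σ₁₁ ⊕ id 1) ⨾ (id 1 ⊕ σ₁₁))
      ≈⟨ ⨾-identityˡ _ ⟩
    (σ₁₁ ⊕ id 1) ⨾ (id 1 ⊕ σ₁₁) ∎
    where
    inv : σ 2 1 ⨾ ((σ₁₁ ⊕ id 1) ⨾ (id 1 ⊕ σ₁₁)) ≈ id 3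
    inv = begin
      σ 2 1 ⨾ ((σ₁₁ ⊕ id 1) ⨾ (id 1 ⊕ σ₁₁))
        ≈⟨ σ₂₁ ⟩⨾⟨refl ⟩
      ((id 1 ⊕ σ₁₁) ⨾ (σ₁₁ ⊕ id 1)) ⨾ ((σ₁₁ ⊕ id 1) ⨾ (id 1 ⊕ σ₁₁))
        ≈⟨ assoc²ˡ (assoc²ʳ σ⊕id²) ⟩
      (id 1 ⊕ σ₁₁) ⨾ (id 3 ⨾ (id 1 ⊕ σ₁₁))
        ≈⟨ refl⟩⨾⟨ ⨾-identityˡ _ ⟩
      (id 1 ⊕ σ₁₁) ⨾ (id 1 ⊕ σ₁₁)
        ≈⟨ id⊕σ² ⟩
      id 3 ∎


  σ₁₀ : σ 1 0 ≈ id 1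
  σ₁₀ = ≈-trans (≈-sym (⨾-identityʳ _)) (σ-involutive 1 0)

  σ-nat : ∀ {f : Term HAGen 1 1} → (id 1 ⊕ f) ⨾ σ₁₁ ≈ σ₁₁ ⨾ (f ⊕ id 1)
  σ-nat {f} = begin
    (id 1 ⊕ f) ⨾ σ₁₁   ≈⟨ refl⟩⨾⟨ σ≈σ₁₁ ⟨
    (id 1 ⊕ f) ⨾ σ 1 1 ≈⟨ σ-natural _ _ ⟩
    σ 1 1 ⨾ (f ⊕ id 1) ≈⟨ σ≈σ₁₁ ⟩⨾⟨refl ⟩
    σ₁₁ ⨾ (f ⊕ id 1)   ∎

  σ-nat₁₂ : ∀ {f : Term HAGen 1 2} → σ₁₁ ⨾ (f ⊕ id 1) ≈ (id 1 ⊕ f) ⨾ (σ₁₁ ⊕ id 1) ⨾ (id 1 ⊕ σ₁₁)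
  σ-nat₁₂ {f} = begin
    σ₁₁ ⨾ (f ⊕ id 1)   ≈⟨ σ≈σ₁₁ ⟩⨾⟨refl ⟨
    σ 1 1 ⨾ (f ⊕ id 1) ≈⟨ σ-natural _ _ ⟨
    (id 1 ⊕ f) ⨾ σ 1 2 ≈⟨ refl⟩⨾⟨ σ₁₂ ⟩
    (id 1 ⊕ f) ⨾ ((σ₁₁ ⊕ id 1) ⨾ (id 1 ⊕ σ₁₁)) ≈⟨ ⨾-assoc _ _ _ ⟨
    (id 1 ⊕ f) ⨾ (σ₁₁ ⊕ id 1) ⨾ (id 1 ⊕ σ₁₁) ∎

  σ-nat₁₂′ : ∀ {f : Term HAGen 1 2} → σ₁₁ ⨾ (id 1 ⊕ f) ≈ (f ⊕ id 1) ⨾ (id 1 ⊕ σ₁₁) ⨾ (σ₁₁ ⊕ id 1)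
  σ-nat₁₂′ {f} = begin
    σ₁₁ ⨾ (id 1 ⊕ f)   ≈⟨ σ≈σ₁₁ ⟩⨾⟨refl ⟨
    σ 1 1 ⨾ (id 1 ⊕ f) ≈⟨ σ-natural _ _ ⟨
    (f ⊕ id 1) ⨾ σ 2 1 ≈⟨ refl⟩⨾⟨ σ₂₁ ⟩
    (f ⊕ id 1) ⨾ ((id 1 ⊕ σ₁₁) ⨾ (σ₁₁ ⊕ id 1)) ≈⟨ ⨾-assoc _ _ _ ⟨
    (f ⊕ id 1) ⨾ (id 1 ⊕ σ₁₁) ⨾ (σ₁₁ ⊕ id 1) ∎

  σ-nat₂₁ : ∀ {f : Term HAGen 2 1} → (id 1 ⊕ f) ⨾ σ₁₁ ≈ (σ₁₁ ⊕ id 1) ⨾ (id 1 ⊕ σ₁₁) ⨾ (f ⊕ id 1)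
  σ-nat₂₁ {f} = begin
    (id 1 ⊕ f) ⨾ σ₁₁   ≈⟨ refl⟩⨾⟨ σ≈σ₁₁ ⟨
    (id 1 ⊕ f) ⨾ σ 1 1 ≈⟨ σ-natural _ _ ⟩
    σ 1 2 ⨾ (f ⊕ id 1) ≈⟨ σ₁₂ ⟩⨾⟨refl ⟩
    (σ₁₁ ⊕ id 1) ⨾ (id 1 ⊕ σ₁₁) ⨾ (f ⊕ id 1) ∎

  σ-ε : σ₁₁ ⨾ (ε• ⊕ id 1) ≈ id 1 ⊕ ε•
  σ-ε = begin
    σ₁₁ ⨾ (ε• ⊕ id 1)   ≈⟨ σ≈σ₁₁ ⟩⨾⟨refl ⟨
    σ 1 1 ⨾ (ε• ⊕ id 1) ≈⟨ σ-natural _ _ ⟨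
    (id 1 ⊕ ε•) ⨾ σ 1 0 ≈⟨ refl⟩⨾⟨ σ₁₀ ⟩
    (id 1 ⊕ ε•) ⨾ id 1  ≈⟨ ⨾-identityʳ _ ⟩
    id 1 ⊕ ε•           ∎

  η-σ : (id 1 ⊕ η∘) ⨾ σ₁₁ ≈ η∘ ⊕ id 1
  η-σ = begin
    (id 1 ⊕ η∘) ⨾ σ₁₁   ≈⟨ refl⟩⨾⟨ σ≈σ₁₁ ⟨
    (id 1 ⊕ η∘) ⨾ σ 1 1 ≈⟨ σ-natural _ _ ⟩
    σ 1 0 ⨾ (η∘ ⊕ id 1) ≈⟨ σ₁₀ ⟩⨾⟨refl ⟩
    id 1 ⨾ (η∘ ⊕ id 1)  ≈⟨ ⨾-identityˡ _ ⟩
    η∘ ⊕ id 1           ∎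

  -- Naturality of `σ 1 2` with respect to `σ₁₁` itself.
  yang-baxter : (σ₁₁ ⊕ id 1) ⨾ (id 1 ⊕ σ₁₁) ⨾ (σ₁₁ ⊕ id 1) ≈
                (id 1 ⊕ σ₁₁) ⨾ (σ₁₁ ⊕ id 1) ⨾ (id 1 ⊕ σ₁₁)
  yang-baxter = begin
    (σ₁₁ ⊕ id 1) ⨾ (id 1 ⊕ σ₁₁) ⨾ (σ₁₁ ⊕ id 1)
      ≈⟨ σ₁₂ ⟩⨾⟨refl ⟨
    σ 1 2 ⨾ (σ₁₁ ⊕ id 1)
      ≈⟨ σ-natural _ _ ⟨
    (id 1 ⊕ σ₁₁) ⨾ σ 1 2
      ≈⟨ refl⟩⨾⟨ σ₁₂ ⟩
    (id 1 ⊕ σ₁₁) ⨾ ((σ₁₁ ⊕ id 1) ⨾ (id 1 ⊕ σ₁₁))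
      ≈⟨ ⨾-assoc _ _ _ ⟨
    (id 1 ⊕ σ₁₁) ⨾ (σ₁₁ ⊕ id 1) ⨾ (id 1 ⊕ σ₁₁) ∎

  Δ-coassoc : Δ• ⨾ (Δ• ⊕ id 1) ≈ Δ• ⨾ (id 1 ⊕ Δ•)
  Δ-coassoc = begin
    Δ• ⨾ (Δ• ⊕ id 1) ≈⟨ refl⟩⨾⟨ (refl⟩⊕⟨ id₁≈id) ⟨
    Δ• ⨾ (Δ• ⊕ id₁)  ≈⟨ axiom a6 ⟩
    Δ• ⨾ (id₁ ⊕ Δ•)  ≈⟨ refl⟩⨾⟨ (id₁≈id ⟩⊕⟨refl) ⟩
    Δ• ⨾ (id 1 ⊕ Δ•) ∎

  Δ-counitˡ : Δ• ⨾ (ε• ⊕ id 1) ≈ id 1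
  Δ-counitˡ = ≈-trans (refl⟩⨾⟨ (refl⟩⊕⟨ ≈-sym id₁≈id)) (≈-trans (axiom a4) id₁≈id)

  Δ-counitʳ : Δ• ⨾ (id 1 ⊕ ε•) ≈ id 1
  Δ-counitʳ = begin
    Δ• ⨾ (id 1 ⊕ ε•)         ≈⟨ refl⟩⨾⟨ σ-ε ⟨
    Δ• ⨾ (σ₁₁ ⨾ (ε• ⊕ id 1)) ≈⟨ assoc²ʳ (axiom a5) ⟩
    Δ• ⨾ (ε• ⊕ id 1)         ≈⟨ Δ-counitˡ ⟩
    id 1                     ∎

  μ-assoc : (μ∘ ⊕ id 1) ⨾ μ∘ ≈ (id 1 ⊕ μ∘) ⨾ μ∘
  μ-assoc = begin
    (μ∘ ⊕ id 1) ⨾ μ∘ ≈⟨ (refl⟩⊕⟨ id₁≈id) ⟩⨾⟨refl ⟨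
    (μ∘ ⊕ id₁) ⨾ μ∘  ≈⟨ axiom a3 ⟩
    (id₁ ⊕ μ∘) ⨾ μ∘  ≈⟨ (id₁≈id ⟩⊕⟨refl) ⟩⨾⟨refl ⟩
    (id 1 ⊕ μ∘) ⨾ μ∘ ∎

  μ-unitˡ : (η∘ ⊕ id 1) ⨾ μ∘ ≈ id 1
  μ-unitˡ = ≈-trans ((refl⟩⊕⟨ ≈-sym id₁≈id) ⟩⨾⟨refl) (≈-trans (axiom a1) id₁≈id)

  μ-unitʳ : (id 1 ⊕ η∘) ⨾ μ∘ ≈ id 1
  μ-unitʳ = begin
    (id 1 ⊕ η∘) ⨾ μ∘         ≈⟨ refl⟩⨾⟨ axiom a2 ⟨
    (id 1 ⊕ η∘) ⨾ (σ₁₁ ⨾ μ∘) ≈⟨ assoc²ʳ η-σ ⟩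
    (η∘ ⊕ id 1) ⨾ μ∘         ≈⟨ μ-unitˡ ⟩
    id 1                     ∎

  mid : Term HAGen 4 4
  mid = id 1 ⊕ (σ₁₁ ⊕ id 1)

  μ-Δ : μ∘ ⨾ Δ• ≈ (Δ• ⊕ Δ•) ⨾ mid ⨾ (μ∘ ⊕ μ∘)
  μ-Δ = ≈-trans (axiom a8) ((refl⟩⨾⟨ (id₁≈id ⟩⊕⟨ (refl⟩⊕⟨ id₁≈id))) ⟩⨾⟨refl)

  mid-nat : ∀ {f g h k : Term HAGen 1 1} →
            mid ⨾ ((f ⊕ g) ⊕ (h ⊕ k)) ≈ ((f ⊕ h) ⊕ (g ⊕ k)) ⨾ mid
  mid-nat {f} {g} {h} {k} = begin
    mid ⨾ ((f ⊕ g) ⊕ (h ⊕ k))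
      ≈⟨ refl⟩⨾⟨ ≈-trans (⊕-assoc f g (h ⊕ k)) (refl⟩⊕⟨ ≈-sym (⊕-assoc g h k)) ⟩
    mid ⨾ (f ⊕ ((g ⊕ h) ⊕ k))
      ≈⟨ ≈-trans merge (⨾-identityˡ _ ⟩⊕⟨ ≈-trans merge (≈-refl ⟩⊕⟨ ⨾-identityˡ _)) ⟩
    f ⊕ ((σ₁₁ ⨾ (g ⊕ h)) ⊕ k)
      ≈⟨ refl⟩⊕⟨ (swap ⟩⊕⟨refl) ⟩
    f ⊕ (((h ⊕ g) ⨾ σ₁₁) ⊕ k)
      ≈⟨ ≈-trans merge (⨾-identityʳ _ ⟩⊕⟨ ≈-trans merge (≈-refl ⟩⊕⟨ ⨾-identityʳ _)) ⟨
    (f ⊕ ((h ⊕ g) ⊕ k)) ⨾ mid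
      ≈⟨ ≈-trans (⊕-assoc f h (g ⊕ k)) (refl⟩⊕⟨ ≈-sym (⊕-assoc h g k)) ⟩⨾⟨refl ⟨
    ((f ⊕ h) ⊕ (g ⊕ k)) ⨾ mid ∎
    where
    swap : σ₁₁ ⨾ (g ⊕ h) ≈ (h ⊕ g) ⨾ σ₁₁
    swap = begin
      σ₁₁ ⨾ (g ⊕ h)   ≈⟨ σ≈σ₁₁ ⟩⨾⟨refl ⟨
      σ 1 1 ⨾ (g ⊕ h) ≈⟨ σ-natural _ _ ⟨
      (h ⊕ g) ⨾ σ 1 1 ≈⟨ refl⟩⨾⟨ σ≈σ₁₁ ⟩
      (h ⊕ g) ⨾ σ₁₁   ∎

  scaleAdd : Carrier → Term HAGen 2 1
  scaleAdd a = (s⟨ a ⟩ ⊕ id 1) ⨾ μ∘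

  -- `(x , y) ↦ (x , y + a x)`
  control : Carrier → Term HAGen 2 2
  control a = (Δ• ⊕ id 1) ⨾ (id 1 ⊕ scaleAdd a)

  -- (x , y) ↦ (y + a x , x)
  pass : Carrier → Term HAGen 2 2
  pass a = control a ⨾ σ₁₁

  -- `(x , y , z) ↦ (x , y , z + a x)`
  farControl : Carrier → Term HAGen 3 3
  farControl a = (Δ• ⊕ id 2) ⨾ (id 1 ⊕ ((σ₁₁ ⊕ id 1) ⨾ (id 1 ⊕ scaleAdd a)))

  -- (x , y , z) ↦ (y + a x , z + b x)
  scaleAdd₂ : Carrier → Carrier → Term HAGen 3 2
  scaleAdd₂ a b = (Δ• ⊕ id 2) ⨾ mid ⨾ (scaleAdd a ⊕ scaleAdd b)

  control-σ : ∀ a → (σ₁₁ ⊕ id 1) ⨾ (id 1 ⊕ control a) ≈ farControl a ⨾ (σ₁₁ ⊕ id 1)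
  control-σ a = begin
    (σ₁₁ ⊕ id 1) ⨾ (id 1 ⊕ control a)
      ≈⟨ refl⟩⨾⟨ id-⊕-⨾ ⟩
    (σ₁₁ ⊕ id 1) ⨾ ((id 1 ⊕ (Δ• ⊕ id 1)) ⨾ (id 1 ⊕ (id 1 ⊕ scaleAdd a)))
      ≈⟨ assoc²ʳ (begin
           (σ₁₁ ⊕ id 1) ⨾ (id 1 ⊕ (Δ• ⊕ id 1))
             ≈⟨ refl⟩⨾⟨ ⊕-assoc _ _ _ ⟨
           (σ₁₁ ⊕ id 1) ⨾ ((id 1 ⊕ Δ•) ⊕ id 1)
             ≈⟨ ⨾-⊕-id ⟨
           (σ₁₁ ⨾ (id 1 ⊕ Δ•)) ⊕ id 1
             ≈⟨ σ-nat₁₂′ ⟩⊕⟨refl ⟩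
           ((Δ• ⊕ id 1) ⨾ (id 1 ⊕ σ₁₁) ⨾ (σ₁₁ ⊕ id 1)) ⊕ id 1
             ≈⟨ ≈-trans ⨾-⊕-id (⨾-⊕-id ⟩⨾⟨refl) ⟩
           ((Δ• ⊕ id 1) ⊕ id 1) ⨾ ((id 1 ⊕ σ₁₁) ⊕ id 1) ⨾ ((σ₁₁ ⊕ id 1) ⊕ id 1)
             ≈⟨ (≈-trans (⊕-assoc _ _ _) ⊕-assoc-id) ⟩⨾⟨ ⊕-assoc _ _ _ ⟩⨾⟨ ≈-trans (⊕-assoc _ _ _) ⊕-assoc-id ⟩
           (Δ• ⊕ id 2) ⨾ mid ⨾ (σ₁₁ ⊕ id 2) ∎) ⟩
    (Δ• ⊕ id 2) ⨾ mid ⨾ (σ₁₁ ⊕ id 2) ⨾ (id 1 ⊕ (id 1 ⊕ scaleAdd a))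
      ≈⟨ refl⟩⨾⟨ ≈-trans (≈-sym (⊕-assoc _ _ _)) (⊕-id 1 1 ⟩⊕⟨refl) ⟩
    (Δ• ⊕ id 2) ⨾ mid ⨾ (σ₁₁ ⊕ id 2) ⨾ (id 2 ⊕ scaleAdd a)
      ≈⟨ rewriteʳ exchange ⟩
    (Δ• ⊕ id 2) ⨾ mid ⨾ (id 2 ⊕ scaleAdd a) ⨾ (σ₁₁ ⊕ id 1)
      ≈⟨ assoc²ˡ (begin
           mid ⨾ (id 2 ⊕ scaleAdd a)
             ≈⟨ refl⟩⨾⟨ ≈-trans (≈-sym (⊕-id 1 1) ⟩⊕⟨refl) (⊕-assoc _ _ _) ⟩
           mid ⨾ (id 1 ⊕ (id 1 ⊕ scaleAdd a))
             ≈⟨ id-⊕-⨾ ⟨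
           id 1 ⊕ ((σ₁₁ ⊕ id 1) ⨾ (id 1 ⊕ scaleAdd a)) ∎) ⟩⨾⟨refl ⟩
    farControl a ⨾ (σ₁₁ ⊕ id 1) ∎

  -- Coassociativity draws both copies of x from one duplication, and cocommutativity lets their
  -- order be ignored.
  control-farControl : ∀ a b →
    (control a ⊕ id 1) ⨾ farControl b ≈ (Δ• ⊕ id 2) ⨾ (id 1 ⊕ scaleAdd₂ a b)
  control-farControl a b = begin
    (control a ⊕ id 1) ⨾ farControl b
      ≈⟨ ≈-trans ⨾-⊕-id (≈-trans (⊕-assoc _ _ _) ⊕-assoc-id ⟩⨾⟨ ⊕-assoc _ _ _) ⟩⨾⟨refl ⟩
    (Δ• ⊕ id 2) ⨾ (id 1 ⊕ (scaleAdd a ⊕ id 1)) ⨾ farControl b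
      ≈⟨ ≈-sym (⨾-assoc _ _ _) ⟩
    (Δ• ⊕ id 2) ⨾ (id 1 ⊕ (scaleAdd a ⊕ id 1)) ⨾ (Δ• ⊕ id 2) ⨾ (id 1 ⊕ β)
      ≈⟨ rewriteʳ (≈-sym exchange) ⟩⨾⟨refl ⟩
    (Δ• ⊕ id 2) ⨾ (Δ• ⊕ id 3) ⨾ (id 2 ⊕ (scaleAdd a ⊕ id 1)) ⨾ (id 1 ⊕ β)
      ≈⟨ (begin
           (Δ• ⊕ id 2) ⨾ (Δ• ⊕ id 3)
             ≈⟨ refl⟩⨾⟨ ≈-trans (⊕-assoc _ _ _) ⊕-assoc-id ⟨
           (Δ• ⊕ id 2) ⨾ ((Δ• ⊕ id 1) ⊕ id 2)
             ≈⟨ ⨾-⊕-id ⟨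
           (Δ• ⨾ (Δ• ⊕ id 1)) ⊕ id 2
             ≈⟨ Δ-coassoc ⟩⊕⟨refl ⟩
           (Δ• ⨾ (id 1 ⊕ Δ•)) ⊕ id 2
             ≈⟨ ⨾-⊕-id ⟩
           (Δ• ⊕ id 2) ⨾ ((id 1 ⊕ Δ•) ⊕ id 2)
             ≈⟨ refl⟩⨾⟨ ⊕-assoc _ _ _ ⟩
           (Δ• ⊕ id 2) ⨾ (id 1 ⊕ (Δ• ⊕ id 2)) ∎)
         ⟩⨾⟨ ≈-trans (≈-sym (⊕-id 1 1) ⟩⊕⟨refl) (⊕-assoc _ _ _) ⟩⨾⟨refl ⟩
    (Δ• ⊕ id 2) ⨾ (id 1 ⊕ (Δ• ⊕ id 2)) ⨾ (id 1 ⊕ (id 1 ⊕ (scaleAdd a ⊕ id 1))) ⨾ (id 1 ⊕ β)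
      ≈⟨ ≈-trans (assoc²ˡ (≈-sym id-⊕-⨾)) (≈-trans (⨾-assoc _ _ _) (refl⟩⨾⟨ ≈-sym id-⊕-⨾)) ⟩
    (Δ• ⊕ id 2) ⨾ (id 1 ⊕ ((Δ• ⊕ id 2) ⨾ ((id 1 ⊕ (scaleAdd a ⊕ id 1)) ⨾ β)))
      ≈⟨ refl⟩⨾⟨ (refl⟩⊕⟨ inner) ⟩
    (Δ• ⊕ id 2) ⨾ (id 1 ⊕ scaleAdd₂ a b) ∎
    where
    β = (σ₁₁ ⊕ id 1) ⨾ (id 1 ⊕ scaleAdd b)
    inner : (Δ• ⊕ id 2) ⨾ ((id 1 ⊕ (scaleAdd a ⊕ id 1)) ⨾ β) ≈ scaleAdd₂ a b
    inner = begin
      (Δ• ⊕ id 2) ⨾ ((id 1 ⊕ (scaleAdd a ⊕ id 1)) ⨾ β)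
        ≈⟨ refl⟩⨾⟨ assoc²ʳ (begin
             (id 1 ⊕ (scaleAdd a ⊕ id 1)) ⨾ (σ₁₁ ⊕ id 1)
               ≈⟨ ⊕-assoc _ _ _ ⟩⨾⟨refl ⟨
             ((id 1 ⊕ scaleAdd a) ⊕ id 1) ⨾ (σ₁₁ ⊕ id 1)
               ≈⟨ ⨾-⊕-id ⟨
             ((id 1 ⊕ scaleAdd a) ⨾ σ₁₁) ⊕ id 1
               ≈⟨ σ-nat₂₁ ⟩⊕⟨refl ⟩
             ((σ₁₁ ⊕ id 1) ⨾ (id 1 ⊕ σ₁₁) ⨾ (scaleAdd a ⊕ id 1)) ⊕ id 1
               ≈⟨ ≈-trans ⨾-⊕-id (⨾-⊕-id ⟩⨾⟨refl) ⟩
             ((σ₁₁ ⊕ id 1) ⊕ id 1) ⨾ ((id 1 ⊕ σ₁₁) ⊕ id 1) ⨾ ((scaleAdd a ⊕ id 1) ⊕ id 1)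
               ≈⟨ ≈-trans (⊕-assoc _ _ _) ⊕-assoc-id ⟩⨾⟨ ⊕-assoc _ _ _ ⟩⨾⟨ ≈-trans (⊕-assoc _ _ _) ⊕-assoc-id ⟩
             (σ₁₁ ⊕ id 2) ⨾ mid ⨾ (scaleAdd a ⊕ id 2) ∎) ⟩
      (Δ• ⊕ id 2) ⨾ ((σ₁₁ ⊕ id 2) ⨾ mid ⨾ (scaleAdd a ⊕ id 2) ⨾ (id 1 ⊕ scaleAdd b))
        ≈⟨ refl⟩⨾⟨ ≈-trans (assoc²ˡ slideˡʳ) (⨾-assoc _ _ _) ⟩
      (Δ• ⊕ id 2) ⨾ ((σ₁₁ ⊕ id 2) ⨾ (mid ⨾ (scaleAdd a ⊕ scaleAdd b)))
        ≈⟨ assoc²ʳ (≈-trans (≈-sym ⨾-⊕-id) (axiom a5 ⟩⊕⟨refl)) ⟩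
      (Δ• ⊕ id 2) ⨾ (mid ⨾ (scaleAdd a ⊕ scaleAdd b))
        ≈⟨ ⨾-assoc _ _ _ ⟨
      scaleAdd₂ a b ∎

  -- Normal form of two consecutive passes: x is duplicated, added to both wires by `scaleAdd₂`,
  -- then moved behind them. Through it the laws of `pass` for Δ, σ and μ become identities of
  -- `scaleAdd₂`.
  pass-pass : ∀ a b → (pass a ⊕ id 1) ⨾ (id 1 ⊕ pass b) ≈
    (Δ• ⊕ id 2) ⨾ (id 1 ⊕ scaleAdd₂ a b) ⨾ (σ₁₁ ⊕ id 1) ⨾ (id 1 ⊕ σ₁₁)
  pass-pass a b = begin
    (pass a ⊕ id 1) ⨾ (id 1 ⊕ pass b)
      ≈⟨ ⨾-⊕-id ⟩⨾⟨ id-⊕-⨾ ⟩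
    ((control a ⊕ id 1) ⨾ (σ₁₁ ⊕ id 1)) ⨾ ((id 1 ⊕ control b) ⨾ (id 1 ⊕ σ₁₁))
      ≈⟨ ⨾-assoc _ _ _ ⟨
    (control a ⊕ id 1) ⨾ (σ₁₁ ⊕ id 1) ⨾ (id 1 ⊕ control b) ⨾ (id 1 ⊕ σ₁₁)
      ≈⟨ rewriteʳ (control-σ b) ⟩⨾⟨refl ⟩
    (control a ⊕ id 1) ⨾ farControl b ⨾ (σ₁₁ ⊕ id 1) ⨾ (id 1 ⊕ σ₁₁)
      ≈⟨ control-farControl a b ⟩⨾⟨refl ⟩⨾⟨refl ⟩
    (Δ• ⊕ id 2) ⨾ (id 1 ⊕ scaleAdd₂ a b) ⨾ (σ₁₁ ⊕ id 1) ⨾ (id 1 ⊕ σ₁₁) ∎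

  scaleAdd-ε : ∀ a → scaleAdd a ⨾ ε• ≈ ε• ⊕ ε•
  scaleAdd-ε a = begin
    (s⟨ a ⟩ ⊕ id 1) ⨾ μ∘ ⨾ ε•       ≈⟨ assoc²ˡ (axiom a7) ⟩
    (s⟨ a ⟩ ⊕ id 1) ⨾ (ε• ⊕ ε•)      ≈⟨ merge ⟩
    (s⟨ a ⟩ ⨾ ε•) ⊕ (id 1 ⨾ ε•)      ≈⟨ axiom (a16 a) ⟩⊕⟨ ⨾-identityˡ _ ⟩
    ε• ⊕ ε•                           ∎

  scaleAdd-Δ : ∀ a → scaleAdd a ⨾ Δ• ≈ (id 1 ⊕ Δ•) ⨾ scaleAdd₂ a a
  scaleAdd-Δ a = begin
    (s⟨ a ⟩ ⊕ id 1) ⨾ μ∘ ⨾ Δ•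
      ≈⟨ assoc²ˡ (≈-trans μ-Δ (⨾-assoc _ _ _)) ⟩
    (s⟨ a ⟩ ⊕ id 1) ⨾ ((Δ• ⊕ Δ•) ⨾ (mid ⨾ (μ∘ ⊕ μ∘)))
      ≈⟨ assoc²ʳ (begin
           (s⟨ a ⟩ ⊕ id 1) ⨾ (Δ• ⊕ Δ•)
             ≈⟨ ≈-trans merge (axiom (a15 a) ⟩⊕⟨ ≈-trans (⨾-identityˡ _) (≈-sym (⨾-identityʳ _))) ⟩
           (Δ• ⨾ (s⟨ a ⟩ ⊕ s⟨ a ⟩)) ⊕ (Δ• ⨾ id 2)
             ≈⟨ interchange _ _ _ _ ⟩
           (Δ• ⊕ Δ•) ⨾ ((s⟨ a ⟩ ⊕ s⟨ a ⟩) ⊕ id 2)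
             ≈⟨ refl⟩⨾⟨ (refl⟩⊕⟨ ⊕-id 1 1) ⟨
           (Δ• ⊕ Δ•) ⨾ ((s⟨ a ⟩ ⊕ s⟨ a ⟩) ⊕ (id 1 ⊕ id 1)) ∎) ⟩
    (Δ• ⊕ Δ•) ⨾ ((s⟨ a ⟩ ⊕ s⟨ a ⟩) ⊕ (id 1 ⊕ id 1)) ⨾ (mid ⨾ (μ∘ ⊕ μ∘))
      ≈⟨ ≈-trans (assoc²ˡ (assoc²ʳ (≈-sym mid-nat))) (refl⟩⨾⟨ assoc²ˡ merge) ⟩
    (Δ• ⊕ Δ•) ⨾ (mid ⨾ (scaleAdd a ⊕ scaleAdd a))
      ≈⟨ ≈-sym slideʳˡ ⟩⨾⟨refl ⟩
    (id 1 ⊕ Δ•) ⨾ (Δ• ⊕ id 2) ⨾ (mid ⨾ (scaleAdd a ⊕ scaleAdd a))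
      ≈⟨ assoc²ˡ (≈-sym (⨾-assoc _ _ _)) ⟩
    (id 1 ⊕ Δ•) ⨾ scaleAdd₂ a a ∎

  σ₂₂ : σ 2 2 ≈ mid ⨾ (σ₁₁ ⊕ σ₁₁) ⨾ mid
  σ₂₂ = begin
    σ 2 2
      ≈⟨ σ-hexagon 1 1 2 ⟩
    (id 1 ⊕ σ 1 2) ⨾ (σ 1 2 ⊕ id 1)
      ≈⟨ (refl⟩⊕⟨ σ₁₂) ⟩⨾⟨ (σ₁₂ ⟩⊕⟨refl) ⟩
    (id 1 ⊕ ((σ₁₁ ⊕ id 1) ⨾ (id 1 ⊕ σ₁₁))) ⨾ (((σ₁₁ ⊕ id 1) ⨾ (id 1 ⊕ σ₁₁)) ⊕ id 1)
      ≈⟨ id-⊕-⨾ ⟩⨾⟨ ⨾-⊕-id ⟩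
    (mid ⨾ (id 1 ⊕ (id 1 ⊕ σ₁₁))) ⨾ (((σ₁₁ ⊕ id 1) ⊕ id 1) ⨾ ((id 1 ⊕ σ₁₁) ⊕ id 1))
      ≈⟨ (refl⟩⨾⟨ ≈-trans (≈-sym (⊕-assoc _ _ _)) (⊕-id 1 1 ⟩⊕⟨refl))
         ⟩⨾⟨ (≈-trans (⊕-assoc _ _ _) ⊕-assoc-id ⟩⨾⟨ ⊕-assoc _ _ _) ⟩
    (mid ⨾ (id 2 ⊕ σ₁₁)) ⨾ ((σ₁₁ ⊕ id 2) ⨾ mid)
      ≈⟨ ⨾-assoc _ _ _ ⟨
    mid ⨾ (id 2 ⊕ σ₁₁) ⨾ (σ₁₁ ⊕ id 2) ⨾ mid
      ≈⟨ assoc²ˡ slideʳˡ ⟩⨾⟨refl ⟩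
    mid ⨾ (σ₁₁ ⊕ σ₁₁) ⨾ mid ∎

  mid² : mid ⨾ mid ≈ id 4
  mid² = ≈-trans (≈-sym id-⊕-⨾) (≈-trans (refl⟩⊕⟨ σ⊕id²) (⊕-id 1 3))

  scaleAdd₂-σ : ∀ a b → scaleAdd₂ a b ⨾ σ₁₁ ≈ (id 1 ⊕ σ₁₁) ⨾ scaleAdd₂ b a
  scaleAdd₂-σ a b = begin
    (Δ• ⊕ id 2) ⨾ mid ⨾ (scaleAdd a ⊕ scaleAdd b) ⨾ σ₁₁
      ≈⟨ refl⟩⨾⟨ ≈-sym σ≈σ₁₁ ⟩
    (Δ• ⊕ id 2) ⨾ mid ⨾ (scaleAdd a ⊕ scaleAdd b) ⨾ σ 1 1
      ≈⟨ assoc²ˡ (≈-trans (σ-natural _ _) (≈-trans (σ₂₂ ⟩⨾⟨refl) (⨾-assoc _ _ _))) ⟩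
    (Δ• ⊕ id 2) ⨾ mid ⨾ (mid ⨾ (σ₁₁ ⊕ σ₁₁) ⨾ (mid ⨾ (scaleAdd b ⊕ scaleAdd a)))
      ≈⟨ ≈-trans (refl⟩⨾⟨ ⨾-assoc _ _ _) (≈-trans (assoc²ʳ (cancelʳ mid²)) (≈-sym (⨾-assoc _ _ _))) ⟩
    (Δ• ⊕ id 2) ⨾ (σ₁₁ ⊕ σ₁₁) ⨾ (mid ⨾ (scaleAdd b ⊕ scaleAdd a))
      ≈⟨ ≈-trans merge (≈-trans (axiom a5 ⟩⊕⟨ ⨾-identityˡ _) (≈-sym slideʳˡ)) ⟩⨾⟨refl ⟩
    (id 1 ⊕ σ₁₁) ⨾ (Δ• ⊕ id 2) ⨾ (mid ⨾ (scaleAdd b ⊕ scaleAdd a))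
      ≈⟨ assoc²ˡ (≈-sym (⨾-assoc _ _ _)) ⟩
    (id 1 ⊕ σ₁₁) ⨾ scaleAdd₂ b a ∎

  -- After reassociation the two middle inputs meet in a single addition, and commutativity absorbs
  -- their exchange.
  mid-μ : mid ⨾ ((μ∘ ⊕ μ∘) ⨾ μ∘) ≈ (μ∘ ⊕ μ∘) ⨾ μ∘
  mid-μ = begin
    mid ⨾ ((μ∘ ⊕ μ∘) ⨾ μ∘)
      ≈⟨ refl⟩⨾⟨ nest ⟩
    mid ⨾ ((id 1 ⊕ ((id 1 ⊕ μ∘) ⨾ μ∘)) ⨾ μ∘)
      ≈⟨ assoc²ʳ (≈-sym id-⊕-⨾) ⟩
    (id 1 ⊕ ((σ₁₁ ⊕ id 1) ⨾ ((id 1 ⊕ μ∘) ⨾ μ∘))) ⨾ μ∘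
      ≈⟨ (refl⟩⊕⟨ (begin
           (σ₁₁ ⊕ id 1) ⨾ ((id 1 ⊕ μ∘) ⨾ μ∘) ≈⟨ refl⟩⨾⟨ μ-assoc ⟨
           (σ₁₁ ⊕ id 1) ⨾ ((μ∘ ⊕ id 1) ⨾ μ∘) ≈⟨ assoc²ʳ (≈-trans (≈-sym ⨾-⊕-id) (axiom a2 ⟩⊕⟨refl)) ⟩
           (μ∘ ⊕ id 1) ⨾ μ∘                  ≈⟨ μ-assoc ⟩
           (id 1 ⊕ μ∘) ⨾ μ∘                  ∎)) ⟩⨾⟨refl ⟩
    (id 1 ⊕ ((id 1 ⊕ μ∘) ⨾ μ∘)) ⨾ μ∘
      ≈⟨ nest ⟨
    (μ∘ ⊕ μ∘) ⨾ μ∘ ∎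
    where
    nest : (μ∘ ⊕ μ∘) ⨾ μ∘ ≈ (id 1 ⊕ ((id 1 ⊕ μ∘) ⨾ μ∘)) ⨾ μ∘
    nest = begin
      (μ∘ ⊕ μ∘) ⨾ μ∘                           ≈⟨ slideʳˡ ⟩⨾⟨refl ⟨
      (id 2 ⊕ μ∘) ⨾ (μ∘ ⊕ id 1) ⨾ μ∘           ≈⟨ rewriteʳ μ-assoc ⟩
      (id 2 ⊕ μ∘) ⨾ (id 1 ⊕ μ∘) ⨾ μ∘
        ≈⟨ ≈-trans (≈-sym (⊕-id 1 1) ⟩⊕⟨refl) (⊕-assoc _ _ _) ⟩⨾⟨refl ⟩⨾⟨refl ⟩
      (id 1 ⊕ (id 1 ⊕ μ∘)) ⨾ (id 1 ⊕ μ∘) ⨾ μ∘  ≈⟨ id-⊕-⨾ ⟩⨾⟨refl ⟨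
      (id 1 ⊕ ((id 1 ⊕ μ∘) ⨾ μ∘)) ⨾ μ∘         ∎

  -- The two copies of x, scaled by a and by b, are brought together first; (A18) then fuses them.
  scaleAdd₂-μ : ∀ a b → scaleAdd₂ a b ⨾ μ∘ ≈ (id 1 ⊕ μ∘) ⨾ scaleAdd (a + b)
  scaleAdd₂-μ a b = begin
    (Δ• ⊕ id 2) ⨾ mid ⨾ (scaleAdd a ⊕ scaleAdd b) ⨾ μ∘
      ≈⟨ (refl⟩⨾⟨ interchange _ _ _ _) ⟩⨾⟨refl ⟩
    (Δ• ⊕ id 2) ⨾ mid ⨾ (((s⟨ a ⟩ ⊕ id 1) ⊕ (s⟨ b ⟩ ⊕ id 1)) ⨾ (μ∘ ⊕ μ∘)) ⨾ μ∘
      ≈⟨ ≈-trans (≈-sym (⨾-assoc _ _ _) ⟩⨾⟨refl) (rewriteʳ mid-nat ⟩⨾⟨refl ⟩⨾⟨refl) ⟩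
    (Δ• ⊕ id 2) ⨾ ((s⟨ a ⟩ ⊕ s⟨ b ⟩) ⊕ (id 1 ⊕ id 1)) ⨾ mid ⨾ (μ∘ ⊕ μ∘) ⨾ μ∘
      ≈⟨ ≈-trans (⨾-assoc _ _ _) (assoc²ˡ mid-μ) ⟩
    (Δ• ⊕ id 2) ⨾ ((s⟨ a ⟩ ⊕ s⟨ b ⟩) ⊕ (id 1 ⊕ id 1)) ⨾ ((μ∘ ⊕ μ∘) ⨾ μ∘)
      ≈⟨ ≈-trans (refl⟩⨾⟨ (refl⟩⊕⟨ ⊕-id 1 1)) (≈-sym ⨾-⊕-id) ⟩⨾⟨refl ⟩
    ((Δ• ⨾ (s⟨ a ⟩ ⊕ s⟨ b ⟩)) ⊕ id 2) ⨾ ((μ∘ ⊕ μ∘) ⨾ μ∘)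
      ≈⟨ assoc²ʳ (≈-trans merge (axiom (a18 a b) ⟩⊕⟨ ⨾-identityˡ _)) ⟩
    (s⟨ a + b ⟩ ⊕ μ∘) ⨾ μ∘
      ≈⟨ slideʳˡ ⟩⨾⟨refl ⟨
    (id 1 ⊕ μ∘) ⨾ (s⟨ a + b ⟩ ⊕ id 1) ⨾ μ∘
      ≈⟨ ⨾-assoc _ _ _ ⟩
    (id 1 ⊕ μ∘) ⨾ scaleAdd (a + b) ∎

  scaleAdd-s : ∀ a k → scaleAdd a ⨾ s⟨ k ⟩ ≈ (id 1 ⊕ s⟨ k ⟩) ⨾ scaleAdd (a * k)
  scaleAdd-s a k = begin
    (s⟨ a ⟩ ⊕ id 1) ⨾ μ∘ ⨾ s⟨ k ⟩
      ≈⟨ rewriteʳ (axiom (a13 k)) ⟩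
    (s⟨ a ⟩ ⊕ id 1) ⨾ (s⟨ k ⟩ ⊕ s⟨ k ⟩) ⨾ μ∘
      ≈⟨ ≈-trans merge (axiom (a12 a k) ⟩⊕⟨ ⨾-identityˡ _) ⟩⨾⟨refl ⟩
    (s⟨ a * k ⟩ ⊕ s⟨ k ⟩) ⨾ μ∘
      ≈⟨ slideʳˡ ⟩⨾⟨refl ⟨
    (id 1 ⊕ s⟨ k ⟩) ⨾ (s⟨ a * k ⟩ ⊕ id 1) ⨾ μ∘
      ≈⟨ ⨾-assoc _ _ _ ⟩
    (id 1 ⊕ s⟨ k ⟩) ⨾ scaleAdd (a * k) ∎

  η-scaleAdd : ∀ a → (id 1 ⊕ η∘) ⨾ scaleAdd a ≈ s⟨ a ⟩
  η-scaleAdd a = begin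
    (id 1 ⊕ η∘) ⨾ ((s⟨ a ⟩ ⊕ id 1) ⨾ μ∘)
      ≈⟨ assoc²ʳ (≈-sym exchange) ⟩
    (s⟨ a ⟩ ⊕ id 0) ⨾ (id 1 ⊕ η∘) ⨾ μ∘
      ≈⟨ assoc²ˡ μ-unitʳ ⟩
    (s⟨ a ⟩ ⊕ id 0) ⨾ id 1
      ≈⟨ ≈-trans (⨾-identityʳ _) (⊕-identityʳ _) ⟩
    s⟨ a ⟩ ∎

  scaleAdd-0 : scaleAdd 0# ≈ ε• ⊕ id 1
  scaleAdd-0 = begin
    (s⟨ 0# ⟩ ⊕ id 1) ⨾ μ∘               ≈⟨ ≈-trans (axiom a17 ⟩⊕⟨refl) ⨾-⊕-id ⟩⨾⟨refl ⟩
    (ε• ⊕ id 1) ⨾ (η∘ ⊕ id 1) ⨾ μ∘      ≈⟨ assoc²ˡ μ-unitˡ ⟩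
    (ε• ⊕ id 1) ⨾ id 1                   ≈⟨ ⨾-identityʳ _ ⟩
    ε• ⊕ id 1                            ∎

  pass-ε : ∀ a → pass a ⨾ (ε• ⊕ id 1) ≈ id 1 ⊕ ε•
  pass-ε a = begin
    control a ⨾ σ₁₁ ⨾ (ε• ⊕ id 1)
      ≈⟨ assoc²ˡ σ-ε ⟩
    (Δ• ⊕ id 1) ⨾ (id 1 ⊕ scaleAdd a) ⨾ (id 1 ⊕ ε•)
      ≈⟨ assoc²ˡ (≈-trans (≈-sym id-⊕-⨾) (≈-trans (refl⟩⊕⟨ scaleAdd-ε a) (≈-sym (⊕-assoc _ _ _)))) ⟩
    (Δ• ⊕ id 1) ⨾ ((id 1 ⊕ ε•) ⊕ ε•)
      ≈⟨ ≈-trans merge (Δ-counitʳ ⟩⊕⟨ ⨾-identityˡ _) ⟩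
    id 1 ⊕ ε• ∎

  pass-εʳ : ∀ a → pass a ⨾ (id 1 ⊕ ε•) ≈ scaleAdd a
  pass-εʳ a = begin
    control a ⨾ σ₁₁ ⨾ (id 1 ⊕ ε•)
      ≈⟨ refl⟩⨾⟨ σ-ε ⟨
    control a ⨾ σ₁₁ ⨾ (σ₁₁ ⨾ (ε• ⊕ id 1))
      ≈⟨ assoc²ʳ (cancelʳ σ²) ⟩
    (Δ• ⊕ id 1) ⨾ (id 1 ⊕ scaleAdd a) ⨾ (ε• ⊕ id 1)
      ≈⟨ rewriteʳ (≈-sym exchange) ⟩
    (Δ• ⊕ id 1) ⨾ (ε• ⊕ id 2) ⨾ (id 0 ⊕ scaleAdd a)
      ≈⟨ (≈-trans (refl⟩⨾⟨ ≈-trans (≈-sym ⊕-assoc-id) (≈-sym (⊕-assoc _ _ _)))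
           (≈-trans (≈-sym ⨾-⊕-id) (≈-trans (Δ-counitˡ ⟩⊕⟨refl) (⊕-id 1 1)))) ⟩⨾⟨ ⊕-identityˡ _ ⟩
    id 2 ⨾ scaleAdd a
      ≈⟨ ⨾-identityˡ _ ⟩
    scaleAdd a ∎

  pass-Δ : ∀ a → pass a ⨾ (Δ• ⊕ id 1) ≈ (id 1 ⊕ Δ•) ⨾ ((pass a ⊕ id 1) ⨾ (id 1 ⊕ pass a))
  pass-Δ a = begin
    control a ⨾ σ₁₁ ⨾ (Δ• ⊕ id 1)
      ≈⟨ assoc²ˡ (≈-trans σ-nat₁₂ (⨾-assoc _ _ _)) ⟩
    (Δ• ⊕ id 1) ⨾ (id 1 ⊕ scaleAdd a) ⨾ ((id 1 ⊕ Δ•) ⨾ ((σ₁₁ ⊕ id 1) ⨾ (id 1 ⊕ σ₁₁)))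
      ≈⟨ assoc²ʳ (assoc²ˡ (≈-trans (≈-sym id-⊕-⨾) (≈-trans (refl⟩⊕⟨ scaleAdd-Δ a) id-⊕-⨾))) ⟩
    (Δ• ⊕ id 1) ⨾ ((id 1 ⊕ (id 1 ⊕ Δ•)) ⨾ (id 1 ⊕ scaleAdd₂ a a)) ⨾ ((σ₁₁ ⊕ id 1) ⨾ (id 1 ⊕ σ₁₁))
      ≈⟨ assoc²ʳ (begin
           (Δ• ⊕ id 1) ⨾ (id 1 ⊕ (id 1 ⊕ Δ•))
             ≈⟨ refl⟩⨾⟨ ≈-trans (≈-sym (⊕-assoc _ _ _)) (⊕-id 1 1 ⟩⊕⟨refl) ⟩
           (Δ• ⊕ id 1) ⨾ (id 2 ⊕ Δ•)
             ≈⟨ exchange ⟩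
           (id 1 ⊕ Δ•) ⨾ (Δ• ⊕ id 2) ∎) ⟩⨾⟨refl ⟩
    (id 1 ⊕ Δ•) ⨾ (Δ• ⊕ id 2) ⨾ (id 1 ⊕ scaleAdd₂ a a) ⨾ ((σ₁₁ ⊕ id 1) ⨾ (id 1 ⊕ σ₁₁))
      ≈⟨ ≈-trans (⨾-assoc _ _ _ ⟩⨾⟨refl) (assoc²ˡ (≈-sym (⨾-assoc _ _ _))) ⟩
    (id 1 ⊕ Δ•) ⨾ ((Δ• ⊕ id 2) ⨾ (id 1 ⊕ scaleAdd₂ a a) ⨾ (σ₁₁ ⊕ id 1) ⨾ (id 1 ⊕ σ₁₁))
      ≈⟨ refl⟩⨾⟨ pass-pass a a ⟨
    (id 1 ⊕ Δ•) ⨾ ((pass a ⊕ id 1) ⨾ (id 1 ⊕ pass a)) ∎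

  pass-σ : ∀ a b → ((pass a ⊕ id 1) ⨾ (id 1 ⊕ pass b)) ⨾ (σ₁₁ ⊕ id 1) ≈
                   (id 1 ⊕ σ₁₁) ⨾ ((pass b ⊕ id 1) ⨾ (id 1 ⊕ pass a))
  pass-σ a b = begin
    ((pass a ⊕ id 1) ⨾ (id 1 ⊕ pass b)) ⨾ (σ₁₁ ⊕ id 1)
      ≈⟨ pass-pass a b ⟩⨾⟨refl ⟩
    (Δ• ⊕ id 2) ⨾ (id 1 ⊕ scaleAdd₂ a b) ⨾ (σ₁₁ ⊕ id 1) ⨾ (id 1 ⊕ σ₁₁) ⨾ (σ₁₁ ⊕ id 1)
      ≈⟨ ≈-trans (⨾-assoc _ _ _ ⟩⨾⟨refl) (assoc²ˡ (≈-trans yang-baxter (⨾-assoc _ _ _))) ⟩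
    (Δ• ⊕ id 2) ⨾ (id 1 ⊕ scaleAdd₂ a b) ⨾ ((id 1 ⊕ σ₁₁) ⨾ ((σ₁₁ ⊕ id 1) ⨾ (id 1 ⊕ σ₁₁)))
      ≈⟨ assoc²ʳ (assoc²ˡ (≈-trans (≈-sym id-⊕-⨾) (≈-trans (refl⟩⊕⟨ scaleAdd₂-σ a b) id-⊕-⨾))) ⟩
    (Δ• ⊕ id 2) ⨾ ((id 1 ⊕ (id 1 ⊕ σ₁₁)) ⨾ (id 1 ⊕ scaleAdd₂ b a)) ⨾ ((σ₁₁ ⊕ id 1) ⨾ (id 1 ⊕ σ₁₁))
      ≈⟨ assoc²ʳ (begin
           (Δ• ⊕ id 2) ⨾ (id 1 ⊕ (id 1 ⊕ σ₁₁))
             ≈⟨ refl⟩⨾⟨ ≈-trans (≈-sym (⊕-assoc _ _ _)) (⊕-id 1 1 ⟩⊕⟨refl) ⟩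
           (Δ• ⊕ id 2) ⨾ (id 2 ⊕ σ₁₁)
             ≈⟨ exchange ⟩
           (id 1 ⊕ σ₁₁) ⨾ (Δ• ⊕ id 2) ∎) ⟩⨾⟨refl ⟩
    (id 1 ⊕ σ₁₁) ⨾ (Δ• ⊕ id 2) ⨾ (id 1 ⊕ scaleAdd₂ b a) ⨾ ((σ₁₁ ⊕ id 1) ⨾ (id 1 ⊕ σ₁₁))
      ≈⟨ ≈-trans (⨾-assoc _ _ _ ⟩⨾⟨refl) (assoc²ˡ (≈-sym (⨾-assoc _ _ _))) ⟩
    (id 1 ⊕ σ₁₁) ⨾ ((Δ• ⊕ id 2) ⨾ (id 1 ⊕ scaleAdd₂ b a) ⨾ (σ₁₁ ⊕ id 1) ⨾ (id 1 ⊕ σ₁₁))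
      ≈⟨ refl⟩⨾⟨ pass-pass b a ⟨
    (id 1 ⊕ σ₁₁) ⨾ ((pass b ⊕ id 1) ⨾ (id 1 ⊕ pass a)) ∎

  pass-μ : ∀ a b → ((pass a ⊕ id 1) ⨾ (id 1 ⊕ pass b)) ⨾ (μ∘ ⊕ id 1) ≈ (id 1 ⊕ μ∘) ⨾ pass (a + b)
  pass-μ a b = begin
    ((pass a ⊕ id 1) ⨾ (id 1 ⊕ pass b)) ⨾ (μ∘ ⊕ id 1)
      ≈⟨ pass-pass a b ⟩⨾⟨refl ⟩
    (Δ• ⊕ id 2) ⨾ (id 1 ⊕ scaleAdd₂ a b) ⨾ (σ₁₁ ⊕ id 1) ⨾ (id 1 ⊕ σ₁₁) ⨾ (μ∘ ⊕ id 1)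
      ≈⟨ ≈-trans (⨾-assoc _ _ _ ⟩⨾⟨refl) (assoc²ˡ (≈-sym σ-nat₂₁)) ⟩
    (Δ• ⊕ id 2) ⨾ (id 1 ⊕ scaleAdd₂ a b) ⨾ ((id 1 ⊕ μ∘) ⨾ σ₁₁)
      ≈⟨ assoc²ʳ (assoc²ˡ (≈-trans (≈-sym id-⊕-⨾) (≈-trans (refl⟩⊕⟨ scaleAdd₂-μ a b) id-⊕-⨾))) ⟩
    (Δ• ⊕ id 2) ⨾ ((id 1 ⊕ (id 1 ⊕ μ∘)) ⨾ (id 1 ⊕ scaleAdd (a + b))) ⨾ σ₁₁
      ≈⟨ assoc²ʳ (begin
           (Δ• ⊕ id 2) ⨾ (id 1 ⊕ (id 1 ⊕ μ∘))
             ≈⟨ refl⟩⨾⟨ ≈-trans (≈-sym (⊕-assoc _ _ _)) (⊕-id 1 1 ⟩⊕⟨refl) ⟩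
           (Δ• ⊕ id 2) ⨾ (id 2 ⊕ μ∘)
             ≈⟨ exchange ⟩
           (id 1 ⊕ μ∘) ⨾ (Δ• ⊕ id 1) ∎) ⟩⨾⟨refl ⟩
    (id 1 ⊕ μ∘) ⨾ (Δ• ⊕ id 1) ⨾ (id 1 ⊕ scaleAdd (a + b)) ⨾ σ₁₁
      ≈⟨ ≈-trans (⨾-assoc _ _ _ ⟩⨾⟨refl) (⨾-assoc _ _ _) ⟩
    (id 1 ⊕ μ∘) ⨾ pass (a + b) ∎

  pass-s : ∀ a k → pass a ⨾ (s⟨ k ⟩ ⊕ id 1) ≈ (id 1 ⊕ s⟨ k ⟩) ⨾ pass (a * k)
  pass-s a k = begin
    control a ⨾ σ₁₁ ⨾ (s⟨ k ⟩ ⊕ id 1)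
      ≈⟨ rewriteʳ (≈-sym σ-nat) ⟩
    (Δ• ⊕ id 1) ⨾ (id 1 ⊕ scaleAdd a) ⨾ (id 1 ⊕ s⟨ k ⟩) ⨾ σ₁₁
      ≈⟨ assoc²ˡ (≈-trans (≈-sym id-⊕-⨾) (≈-trans (refl⟩⊕⟨ scaleAdd-s a k) id-⊕-⨾)) ⟩⨾⟨refl ⟩
    (Δ• ⊕ id 1) ⨾ ((id 1 ⊕ (id 1 ⊕ s⟨ k ⟩)) ⨾ (id 1 ⊕ scaleAdd (a * k))) ⨾ σ₁₁
      ≈⟨ assoc²ʳ (begin
           (Δ• ⊕ id 1) ⨾ (id 1 ⊕ (id 1 ⊕ s⟨ k ⟩))
             ≈⟨ refl⟩⨾⟨ ≈-trans (≈-sym (⊕-assoc _ _ _)) (⊕-id 1 1 ⟩⊕⟨refl) ⟩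
           (Δ• ⊕ id 1) ⨾ (id 2 ⊕ s⟨ k ⟩)
             ≈⟨ exchange ⟩
           (id 1 ⊕ s⟨ k ⟩) ⨾ (Δ• ⊕ id 1) ∎) ⟩⨾⟨refl ⟩
    (id 1 ⊕ s⟨ k ⟩) ⨾ (Δ• ⊕ id 1) ⨾ (id 1 ⊕ scaleAdd (a * k)) ⨾ σ₁₁
      ≈⟨ ≈-trans (⨾-assoc _ _ _ ⟩⨾⟨refl) (⨾-assoc _ _ _) ⟩
    (id 1 ⊕ s⟨ k ⟩) ⨾ pass (a * k) ∎

  -- The coefficient is `0#` because a wire created by `η∘` carries the coordinate `act η∘ v`, which
  -- is zero.
  pass-η : (id 1 ⊕ η∘) ⨾ pass 0# ≈ η∘ ⊕ id 1
  pass-η = begin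
    (id 1 ⊕ η∘) ⨾ ((Δ• ⊕ id 1) ⨾ (id 1 ⊕ scaleAdd 0#) ⨾ σ₁₁)
      ≈⟨ refl⟩⨾⟨ ⨾-assoc _ _ _ ⟩
    (id 1 ⊕ η∘) ⨾ ((Δ• ⊕ id 1) ⨾ ((id 1 ⊕ scaleAdd 0#) ⨾ σ₁₁))
      ≈⟨ assoc²ʳ (≈-trans (≈-sym exchange) (⊕-identityʳ _ ⟩⨾⟨ ≈-trans (≈-sym (⊕-id 1 1) ⟩⊕⟨refl) (⊕-assoc _ _ _))) ⟩
    Δ• ⨾ (id 1 ⊕ (id 1 ⊕ η∘)) ⨾ ((id 1 ⊕ scaleAdd 0#) ⨾ σ₁₁)
      ≈⟨ ≈-trans (⨾-assoc _ _ _) (refl⟩⨾⟨ assoc²ʳ (≈-trans (≈-sym id-⊕-⨾) (≈-trans (refl⟩⊕⟨ ≈-trans (η-scaleAdd 0#) (axiom a17)) id-⊕-⨾))) ⟩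
    Δ• ⨾ ((id 1 ⊕ ε•) ⨾ (id 1 ⊕ η∘) ⨾ σ₁₁)
      ≈⟨ refl⟩⨾⟨ ⨾-assoc _ _ _ ⟩
    Δ• ⨾ ((id 1 ⊕ ε•) ⨾ ((id 1 ⊕ η∘) ⨾ σ₁₁))
      ≈⟨ ≈-trans (assoc²ʳ Δ-counitʳ) (⨾-identityˡ _) ⟩
    (id 1 ⊕ η∘) ⨾ σ₁₁
      ≈⟨ η-σ ⟩
    η∘ ⊕ id 1 ∎

-- Linear maps denoted by terms, and completeness of HA

module Action {c ℓ} (R : CommutativeRing c ℓ) where
  open CommutativeRing R using (Carrier; 0#; 1#; _+_; _*_; reflexive)
    renaming (_≈_ to _≈ᴿ_; refl to reflᴿ; sym to symᴿ)
  open HopfAlgebras R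

  infix 4 _≈ᵛ_
  _≈ᵛ_ : ∀ {n} → Vector Carrier n → Vector Carrier n → Set ℓ
  v ≈ᵛ w = ∀ i → v i ≈ᴿ w i

  takeᵛ : ∀ {n m} → Vector Carrier (n +ℕ m) → Vector Carrier n
  takeᵛ {m = m} v i = v (i ↑ˡ m)

  dropᵛ : ∀ {n m} → Vector Carrier (n +ℕ m) → Vector Carrier m
  dropᵛ {n} v i = v (n ↑ʳ i)

  -- Semantics on vectors rather than matrices: on a concrete term it unfolds by computation, so an
  -- equation between small diagrams becomes one ring identity per coordinate.
  act : ∀ {n m} → Term HAGen n m → Vector Carrier n → Vector Carrier m
  act (gen Δ)      x = λ _ → x zero
  act (gen ε)      x = λ ()
  act (gen μ)      x = λ _ → x zero + x (suc zero)
  act (gen η)      x = λ _ → 0#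
  act (gen (s k))  x = λ _ → k * x zero
  act id₀          x = x
  act id₁          x = x
  act σ₁₁          x = λ { zero → x (suc zero) ; (suc zero) → x zero }
  act (f Term.⨾ g) x = act g (act f x)
  act (f Term.⊕ g) x = act f (takeᵛ x) ++ act g (dropᵛ x)

  ++-cong : ∀ {n m} {v v′ : Vector Carrier n} {w w′ : Vector Carrier m} →
            v ≈ᵛ v′ → w ≈ᵛ w′ → v ++ w ≈ᵛ v′ ++ w′
  ++-cong {n} p q i with splitAt n i
  ... | inj₁ j = p j
  ... | inj₂ j = q j

  ++-tail : ∀ {n m} (v : Vector Carrier (suc n)) (w : Vector Carrier m) →
            ∀ i → (v ++ w) (suc i) ≡ ((v ∘ suc) ++ w) i
  ++-tail {n} v w i with splitAt n i
  ... | inj₁ j = refl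
  ... | inj₂ j = refl

  act-id : ∀ n x → act (idᵗ n) x ≈ᵛ x
  act-id (suc n) x zero    = reflᴿ
  act-id (suc n) x (suc i) = act-id n (dropᵛ {1} x) i

module HopfCompleteness {c ℓ} (R : CommutativeRing c ℓ) where
  open CommutativeRing R using (Carrier; 0#; 1#; _+_; _*_; reflexive)
    renaming (_≈_ to _≈ᴿ_; refl to reflᴿ; sym to symᴿ; *-comm to *-commᴿ)
  open HopfAlgebras R
  open RawPROP HA using (_≈_; id; _⨾_; _⊕_; σ)
  open PROPReasoning (presented-isPROP HAEq)
  open ≈-Reasoning
  open HopfLocal R
  open Action R
  open Matrices R using (Mat; _≋_; idᴹ)

  pass-cong : ∀ {a b} → a ≈ᴿ b → pass a ≈ pass b
  pass-cong p = (refl⟩⨾⟨ (refl⟩⊕⟨ ((axiom (s-cong p) ⟩⊕⟨refl) ⟩⨾⟨refl))) ⟩⨾⟨refl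

  -- (x , y) ↦ y + x v
  accumulate : ∀ {m} → Vector Carrier m → Term HAGen (1 +ℕ m) m
  accumulate {zero}  v = ε•
  accumulate {suc m} v = (pass (v zero) ⊕ id m) ⨾ (id 1 ⊕ accumulate (tail v))

  accumulate-cong : ∀ {m} {v w : Vector Carrier m} → v ≈ᵛ w → accumulate v ≈ accumulate w
  accumulate-cong {zero}  p = ≈-refl
  accumulate-cong {suc m} p =
    (pass-cong (p zero) ⟩⊕⟨refl) ⟩⨾⟨ (refl⟩⊕⟨ accumulate-cong (p ∘ suc))

  -- Linearity of `h` in the direction `x`, expressed by diagrams: `h (w + t x) = h w + t y`.
  Intertwines : ∀ {n m} → Term HAGen n m → Vector Carrier n → Vector Carrier m → Set _
  Intertwines h x y = accumulate x ⨾ h ≈ (id 1 ⊕ h) ⨾ accumulate y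

  intertwines-id-⊕ : ∀ {q n m} {h : Term HAGen n m} {x y} (u : Vector Carrier q) →
                     Intertwines h x y → Intertwines (id q ⊕ h) (u ++ x) (u ++ y)
  intertwines-id-⊕ {zero} {h = h} {x} {y} u p = begin
    accumulate x ⨾ (id 0 ⊕ h)          ≈⟨ refl⟩⨾⟨ ⊕-identityˡ h ⟩
    accumulate x ⨾ h                   ≈⟨ p ⟩
    (id 1 ⊕ h) ⨾ accumulate y          ≈⟨ (refl⟩⊕⟨ ⊕-identityˡ h) ⟩⨾⟨refl ⟨
    (id 1 ⊕ (id 0 ⊕ h)) ⨾ accumulate y ∎
  intertwines-id-⊕ {suc q} {n} {m} {h} {x} {y} u p = begin
    accumulate (u ++ x) ⨾ ((id₁ ⊕ id q) ⊕ h)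
      ≈⟨ (refl⟩⨾⟨ (refl⟩⊕⟨ accumulate-cong (λ i → reflexive (++-tail u x i)))) ⟩⨾⟨
         ≈-trans (⊕-assoc id₁ (id q) h) (id₁≈id ⟩⊕⟨refl) ⟩
    (pass (u zero) ⊕ id _) ⨾ (id 1 ⊕ accumulate (tail u ++ x)) ⨾ (id 1 ⊕ (id q ⊕ h))
      ≈⟨ assoc²ˡ (≈-trans (≈-sym id-⊕-⨾) (≈-trans (refl⟩⊕⟨ intertwines-id-⊕ (tail u) p) id-⊕-⨾)) ⟩
    (pass (u zero) ⊕ id _) ⨾ ((id 1 ⊕ (id 1 ⊕ (id q ⊕ h))) ⨾ (id 1 ⊕ accumulate (tail u ++ y)))
      ≈⟨ assoc²ʳ (begin
           (pass (u zero) ⊕ id _) ⨾ (id 1 ⊕ (id 1 ⊕ (id q ⊕ h)))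
             ≈⟨ refl⟩⨾⟨ ≈-trans (≈-sym (⊕-assoc _ _ _)) (⊕-id 1 1 ⟩⊕⟨refl) ⟩
           (pass (u zero) ⊕ id _) ⨾ (id 2 ⊕ (id q ⊕ h))
             ≈⟨ exchange ⟩
           (id 2 ⊕ (id q ⊕ h)) ⨾ (pass (u zero) ⊕ id _)
             ≈⟨ ≈-trans (≈-sym (⊕-id 1 1) ⟩⊕⟨refl) (⊕-assoc _ _ _) ⟩⨾⟨refl ⟩
           (id 1 ⊕ (id 1 ⊕ (id q ⊕ h))) ⨾ (pass (u zero) ⊕ id _) ∎) ⟩
    (id 1 ⊕ (id 1 ⊕ (id q ⊕ h))) ⨾ (pass (u zero) ⊕ id _) ⨾ (id 1 ⊕ accumulate (tail u ++ y))
      ≈⟨ ⨾-assoc _ _ _ ⟩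
    (id 1 ⊕ (id 1 ⊕ (id q ⊕ h))) ⨾ ((pass (u zero) ⊕ id _) ⨾ (id 1 ⊕ accumulate (tail u ++ y)))
      ≈⟨ (refl⟩⊕⟨ ≈-trans (⊕-assoc id₁ (id q) h) (id₁≈id ⟩⊕⟨refl)) ⟩⨾⟨
         (refl⟩⨾⟨ (refl⟩⊕⟨ accumulate-cong (λ i → reflexive (++-tail u y i)))) ⟨
    (id 1 ⊕ ((id₁ ⊕ id q) ⊕ h)) ⨾ accumulate (u ++ y) ∎

  accumulate-++-assoc : ∀ {n m p} (v : Vector Carrier (n +ℕ m)) (w : Vector Carrier p) →
    accumulate (v ++ w) ≈ʰ accumulate (takeᵛ {n} v ++ (dropᵛ {n} v ++ w))
  accumulate-++-assoc {zero} v w = het ≈-refl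
  accumulate-++-assoc {suc n} {m} {p} v w =
    transʰ (het (refl⟩⨾⟨ (refl⟩⊕⟨ accumulate-cong (λ i → reflexive (++-tail v w i)))))
    (transʰ (⨾-congʰ (⊕-congʰ (het ≈-refl) (id-het (+ℕ-assoc n m p)))
                     (⊕-congʰ (het ≈-refl) (accumulate-++-assoc {n} (tail v) w)))
            (het (refl⟩⨾⟨ (refl⟩⊕⟨ accumulate-cong (λ i → symᴿ (reflexive (++-tail (takeᵛ {suc n} v) (dropᵛ {suc n} v ++ w) i)))))))

  accumulate₂ : ∀ {p} (x : Vector Carrier (2 +ℕ p)) → accumulate x ≈
    (((pass (x zero) ⊕ id 1) ⨾ (id 1 ⊕ pass (x (suc zero)))) ⊕ id p) ⨾
    (id 2 ⊕ accumulate (tail (tail x)))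
  accumulate₂ {p} x = begin
    (pass a ⊕ id (1 +ℕ p)) ⨾ (id 1 ⊕ ((pass b ⊕ id p) ⨾ (id 1 ⊕ z)))
      ≈⟨ refl⟩⨾⟨ id-⊕-⨾ ⟩
    (pass a ⊕ id (1 +ℕ p)) ⨾ ((id 1 ⊕ (pass b ⊕ id p)) ⨾ (id 1 ⊕ (id 1 ⊕ z)))
      ≈⟨ ⨾-assoc _ _ _ ⟨
    (pass a ⊕ id (1 +ℕ p)) ⨾ (id 1 ⊕ (pass b ⊕ id p)) ⨾ (id 1 ⊕ (id 1 ⊕ z))
      ≈⟨ ≈-trans (⊕-assoc _ _ _) ⊕-assoc-id ⟩⨾⟨ ⊕-assoc _ _ _ ⟩⨾⟨
         ≈-trans (≈-sym (⊕-id 1 1) ⟩⊕⟨refl) (⊕-assoc _ _ _) ⟨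
    ((pass a ⊕ id 1) ⊕ id p) ⨾ ((id 1 ⊕ pass b) ⊕ id p) ⨾ (id 2 ⊕ z)
      ≈⟨ ⨾-⊕-id ⟩⨾⟨refl ⟨
    (((pass a ⊕ id 1) ⨾ (id 1 ⊕ pass b)) ⊕ id p) ⨾ (id 2 ⊕ z) ∎
    where
    a = x zero
    b = x (suc zero)
    z = accumulate (tail (tail x))


  -- The spectator wires `w` make the property stable under `⊕`; without them (p = 0) it is the
  -- naturality of `accumulate`.
  record Carries {n m} (t : Term HAGen n m) : Set (c ⊔ ℓ) where
    constructor carries
    field carry : ∀ {p} v (w : Vector Carrier p) → Intertwines (t ⊕ id p) (v ++ w) (act t v ++ w)
  open Carries

  carries-Δ : Carries Δ•
  carries-Δ .carry {p} v w = begin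
    (pass a ⊕ id p) ⨾ (id 1 ⊕ z) ⨾ (Δ• ⊕ id p)
      ≈⟨ assoc²ˡ (≈-sym exchange) ⟩
    (pass a ⊕ id p) ⨾ ((Δ• ⊕ id (1 +ℕ p)) ⨾ (id 2 ⊕ z))
      ≈⟨ assoc²ʳ (begin
           (pass a ⊕ id p) ⨾ (Δ• ⊕ id (1 +ℕ p))
             ≈⟨ refl⟩⨾⟨ ≈-trans (⊕-assoc _ _ _) ⊕-assoc-id ⟨
           (pass a ⊕ id p) ⨾ ((Δ• ⊕ id 1) ⊕ id p)
             ≈⟨ ≈-trans (≈-sym ⨾-⊕-id) (≈-trans (pass-Δ a ⟩⊕⟨refl) ⨾-⊕-id) ⟩
           ((id 1 ⊕ Δ•) ⊕ id p) ⨾ (((pass a ⊕ id 1) ⨾ (id 1 ⊕ pass a)) ⊕ id p) ∎) ⟩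
    ((id 1 ⊕ Δ•) ⊕ id p) ⨾ (((pass a ⊕ id 1) ⨾ (id 1 ⊕ pass a)) ⊕ id p) ⨾ (id 2 ⊕ z)
      ≈⟨ ⨾-assoc _ _ _ ⟩
    ((id 1 ⊕ Δ•) ⊕ id p) ⨾ ((((pass a ⊕ id 1) ⨾ (id 1 ⊕ pass a)) ⊕ id p) ⨾ (id 2 ⊕ z))
      ≈⟨ ⊕-assoc _ _ _ ⟩⨾⟨ ≈-sym (accumulate₂ (act Δ• v ++ w)) ⟩
    (id 1 ⊕ (Δ• ⊕ id p)) ⨾ accumulate (act Δ• v ++ w) ∎
    where
    a = v zero
    z = accumulate w

  carries-ε : Carries ε•
  carries-ε .carry {p} v w = begin
    (pass a ⊕ id p) ⨾ (id 1 ⊕ z) ⨾ (ε• ⊕ id p)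
      ≈⟨ assoc²ˡ (≈-sym exchange) ⟩
    (pass a ⊕ id p) ⨾ ((ε• ⊕ id (1 +ℕ p)) ⨾ (id 0 ⊕ z))
      ≈⟨ assoc²ʳ (begin
           (pass a ⊕ id p) ⨾ (ε• ⊕ id (1 +ℕ p))
             ≈⟨ refl⟩⨾⟨ ≈-trans (⊕-assoc _ _ _) ⊕-assoc-id ⟨
           (pass a ⊕ id p) ⨾ ((ε• ⊕ id 1) ⊕ id p)
             ≈⟨ ≈-trans (≈-sym ⨾-⊕-id) (pass-ε a ⟩⊕⟨refl) ⟩
           (id 1 ⊕ ε•) ⊕ id p ∎) ⟩
    ((id 1 ⊕ ε•) ⊕ id p) ⨾ (id 0 ⊕ z)
      ≈⟨ ⊕-assoc _ _ _ ⟩⨾⟨ ≈-trans (⊕-identityˡ _) (accumulate-cong (λ _ → reflᴿ)) ⟩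
    (id 1 ⊕ (ε• ⊕ id p)) ⨾ accumulate (act ε• v ++ w) ∎
    where
    a = v zero
    z = accumulate w

  carries-s : ∀ k → Carries s⟨ k ⟩
  carries-s k .carry {p} v w = begin
    (pass a ⊕ id p) ⨾ (id 1 ⊕ z) ⨾ (s⟨ k ⟩ ⊕ id p)
      ≈⟨ assoc²ˡ (≈-sym exchange) ⟩
    (pass a ⊕ id p) ⨾ ((s⟨ k ⟩ ⊕ id (1 +ℕ p)) ⨾ (id 1 ⊕ z))
      ≈⟨ assoc²ʳ (begin
           (pass a ⊕ id p) ⨾ (s⟨ k ⟩ ⊕ id (1 +ℕ p))
             ≈⟨ refl⟩⨾⟨ ≈-trans (⊕-assoc _ _ _) ⊕-assoc-id ⟨
           (pass a ⊕ id p) ⨾ ((s⟨ k ⟩ ⊕ id 1) ⊕ id p)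
             ≈⟨ ≈-trans (≈-sym ⨾-⊕-id) (≈-trans (pass-s a k ⟩⊕⟨refl) ⨾-⊕-id) ⟩
           ((id 1 ⊕ s⟨ k ⟩) ⊕ id p) ⨾ (pass (a * k) ⊕ id p) ∎) ⟩
    ((id 1 ⊕ s⟨ k ⟩) ⊕ id p) ⨾ (pass (a * k) ⊕ id p) ⨾ (id 1 ⊕ z)
      ≈⟨ ⨾-assoc _ _ _ ⟩
    ((id 1 ⊕ s⟨ k ⟩) ⊕ id p) ⨾ ((pass (a * k) ⊕ id p) ⨾ (id 1 ⊕ z))
      ≈⟨ ⊕-assoc _ _ _ ⟩⨾⟨ ((pass-cong (*-commᴿ a k) ⟩⊕⟨refl) ⟩⨾⟨refl) ⟩
    (id 1 ⊕ (s⟨ k ⟩ ⊕ id p)) ⨾ accumulate (act s⟨ k ⟩ v ++ w) ∎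
    where
    a = v zero
    z = accumulate w

  carries-μ : Carries μ∘
  carries-μ .carry {p} v w = begin
    accumulate (v ++ w) ⨾ (μ∘ ⊕ id p)
      ≈⟨ accumulate₂ (v ++ w) ⟩⨾⟨refl ⟩
    (((pass a ⊕ id 1) ⨾ (id 1 ⊕ pass b)) ⊕ id p) ⨾ (id 2 ⊕ z) ⨾ (μ∘ ⊕ id p)
      ≈⟨ assoc²ˡ (≈-sym exchange) ⟩
    (((pass a ⊕ id 1) ⨾ (id 1 ⊕ pass b)) ⊕ id p) ⨾ ((μ∘ ⊕ id (1 +ℕ p)) ⨾ (id 1 ⊕ z))
      ≈⟨ assoc²ʳ (begin
           (((pass a ⊕ id 1) ⨾ (id 1 ⊕ pass b)) ⊕ id p) ⨾ (μ∘ ⊕ id (1 +ℕ p))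
             ≈⟨ refl⟩⨾⟨ ≈-trans (⊕-assoc _ _ _) ⊕-assoc-id ⟨
           (((pass a ⊕ id 1) ⨾ (id 1 ⊕ pass b)) ⊕ id p) ⨾ ((μ∘ ⊕ id 1) ⊕ id p)
             ≈⟨ ≈-trans (≈-sym ⨾-⊕-id) (≈-trans (pass-μ a b ⟩⊕⟨refl) ⨾-⊕-id) ⟩
           ((id 1 ⊕ μ∘) ⊕ id p) ⨾ (pass (a + b) ⊕ id p) ∎) ⟩
    ((id 1 ⊕ μ∘) ⊕ id p) ⨾ (pass (a + b) ⊕ id p) ⨾ (id 1 ⊕ z)
      ≈⟨ ⨾-assoc _ _ _ ⟩
    ((id 1 ⊕ μ∘) ⊕ id p) ⨾ ((pass (a + b) ⊕ id p) ⨾ (id 1 ⊕ z))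
      ≈⟨ ⊕-assoc _ _ _ ⟩⨾⟨refl ⟩
    (id 1 ⊕ (μ∘ ⊕ id p)) ⨾ accumulate (act μ∘ v ++ w) ∎
    where
    a = v zero
    b = v (suc zero)
    z = accumulate w

  carries-σ : Carries σ₁₁
  carries-σ .carry {p} v w = begin
    accumulate (v ++ w) ⨾ (σ₁₁ ⊕ id p)
      ≈⟨ accumulate₂ (v ++ w) ⟩⨾⟨refl ⟩
    (((pass a ⊕ id 1) ⨾ (id 1 ⊕ pass b)) ⊕ id p) ⨾ (id 2 ⊕ z) ⨾ (σ₁₁ ⊕ id p)
      ≈⟨ assoc²ˡ (≈-sym exchange) ⟩
    (((pass a ⊕ id 1) ⨾ (id 1 ⊕ pass b)) ⊕ id p) ⨾ ((σ₁₁ ⊕ id (1 +ℕ p)) ⨾ (id 2 ⊕ z))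
      ≈⟨ assoc²ʳ (begin
           (((pass a ⊕ id 1) ⨾ (id 1 ⊕ pass b)) ⊕ id p) ⨾ (σ₁₁ ⊕ id (1 +ℕ p))
             ≈⟨ refl⟩⨾⟨ ≈-trans (⊕-assoc _ _ _) ⊕-assoc-id ⟨
           (((pass a ⊕ id 1) ⨾ (id 1 ⊕ pass b)) ⊕ id p) ⨾ ((σ₁₁ ⊕ id 1) ⊕ id p)
             ≈⟨ ≈-trans (≈-sym ⨾-⊕-id) (≈-trans (pass-σ a b ⟩⊕⟨refl) ⨾-⊕-id) ⟩
           ((id 1 ⊕ σ₁₁) ⊕ id p) ⨾ (((pass b ⊕ id 1) ⨾ (id 1 ⊕ pass a)) ⊕ id p) ∎) ⟩
    ((id 1 ⊕ σ₁₁) ⊕ id p) ⨾ (((pass b ⊕ id 1) ⨾ (id 1 ⊕ pass a)) ⊕ id p) ⨾ (id 2 ⊕ z)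
      ≈⟨ ⨾-assoc _ _ _ ⟩
    ((id 1 ⊕ σ₁₁) ⊕ id p) ⨾ ((((pass b ⊕ id 1) ⨾ (id 1 ⊕ pass a)) ⊕ id p) ⨾ (id 2 ⊕ z))
      ≈⟨ ⊕-assoc _ _ _ ⟩⨾⟨ ≈-sym (accumulate₂ (act σ₁₁ v ++ w)) ⟩
    (id 1 ⊕ (σ₁₁ ⊕ id p)) ⨾ accumulate (act σ₁₁ v ++ w) ∎
    where
    a = v zero
    b = v (suc zero)
    z = accumulate w

  carries-η : Carries η∘
  carries-η .carry {p} v w = begin
    accumulate (v ++ w) ⨾ (η∘ ⊕ id p)
      ≈⟨ accumulate-cong (λ _ → reflᴿ) ⟩⨾⟨refl ⟩
    z ⨾ (η∘ ⊕ id p)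
      ≈⟨ ⊕-identityˡ z ⟩⨾⟨refl ⟨
    (id 0 ⊕ z) ⨾ (η∘ ⊕ id p)
      ≈⟨ exchange ⟨
    (η∘ ⊕ id (1 +ℕ p)) ⨾ (id 1 ⊕ z)
      ≈⟨ (begin
           η∘ ⊕ id (1 +ℕ p)
             ≈⟨ ≈-trans (⊕-assoc _ _ _) ⊕-assoc-id ⟨
           (η∘ ⊕ id 1) ⊕ id p
             ≈⟨ ≈-trans (≈-sym pass-η ⟩⊕⟨refl) ⨾-⊕-id ⟩
           ((id 1 ⊕ η∘) ⊕ id p) ⨾ (pass 0# ⊕ id p) ∎) ⟩⨾⟨refl ⟩
    ((id 1 ⊕ η∘) ⊕ id p) ⨾ (pass 0# ⊕ id p) ⨾ (id 1 ⊕ z)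
      ≈⟨ ⨾-assoc _ _ _ ⟩
    ((id 1 ⊕ η∘) ⊕ id p) ⨾ ((pass 0# ⊕ id p) ⨾ (id 1 ⊕ z))
      ≈⟨ ⊕-assoc _ _ _ ⟩⨾⟨refl ⟩
    (id 1 ⊕ (η∘ ⊕ id p)) ⨾ accumulate (act η∘ v ++ w) ∎
    where
    z = accumulate w

  intertwines-id : ∀ {n} {h : Term HAGen n n} {x y} → h ≈ id n → x ≈ᵛ y → Intertwines h x y
  intertwines-id {h = h} {x} {y} p q = begin
    accumulate x ⨾ h          ≈⟨ accumulate-cong q ⟩⨾⟨ p ⟩
    accumulate y ⨾ id _       ≈⟨ ⨾-identityʳ _ ⟩
    accumulate y              ≈⟨ ⨾-identityˡ _ ⟨
    id _ ⨾ accumulate y       ≈⟨ ≈-trans (refl⟩⊕⟨ p) (⊕-id 1 _) ⟩⨾⟨refl ⟨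
    (id 1 ⊕ h) ⨾ accumulate y ∎

  intertwines-⨾ : ∀ {n m k} {f : Term HAGen n m} {g : Term HAGen m k} {x y z} →
                  Intertwines f x y → Intertwines g y z → Intertwines (f ⨾ g) x z
  intertwines-⨾ {f = f} {g} {x} {y} {z} p q = begin
    accumulate x ⨾ (f ⨾ g)                   ≈⟨ assoc²ʳ p ⟩
    (id 1 ⊕ f) ⨾ accumulate y ⨾ g            ≈⟨ rewriteʳ q ⟩
    (id 1 ⊕ f) ⨾ (id 1 ⊕ g) ⨾ accumulate z   ≈⟨ id-⊕-⨾ ⟩⨾⟨refl ⟨
    (id 1 ⊕ (f ⨾ g)) ⨾ accumulate z          ∎

  intertwines-cong : ∀ {n m} {f g : Term HAGen n m} {x y} → f ≈ g → Intertwines f x y → Intertwines g x y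
  intertwines-cong {f = f} {g} {x} {y} p q = begin
    accumulate x ⨾ g          ≈⟨ refl⟩⨾⟨ p ⟨
    accumulate x ⨾ f          ≈⟨ q ⟩
    (id 1 ⊕ f) ⨾ accumulate y ≈⟨ (refl⟩⊕⟨ p) ⟩⨾⟨refl ⟩
    (id 1 ⊕ g) ⨾ accumulate y ∎

  intertwines-het : ∀ {n m n′ m′} {f : Term HAGen n m} {g : Term HAGen n′ m′} {x y x′ y′} →
                    f ≈ʰ g → accumulate x ≈ʰ accumulate x′ → accumulate y ≈ʰ accumulate y′ →
                    Intertwines g x′ y′ → Intertwines f x y
  intertwines-het p q r i = unhet
    (transʰ (⨾-congʰ q p)
    (transʰ (het i)
            (⨾-congʰ (⊕-congʰ (het ≈-refl) (symʰ p)) (symʰ r))))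

  -- `f ⊕ g` is f beside identities, then g beside identities: f takes the wires of g as spectators,
  -- and g works behind the already transformed coordinates of f.
  carries-⊕ : ∀ {n m n′ m′} {f : Term HAGen n m} {g : Term HAGen n′ m′} →
              Carries f → Carries g → Carries (f ⊕ g)
  carries-⊕ {n} {m} {n′} {m′} {f} {g} F G .carry {p} v w =
    intertwines-het
      (⊕-assocʰ f g (id p))
      (accumulate-++-assoc {n} v w)
      (transʰ (accumulate-++-assoc {m} (act (f ⊕ g) v) w)
              (het (accumulate-cong (++-cong
                (λ i → reflexive (lookup-++ˡ (act f (takeᵛ v)) (act g (dropᵛ {n} v)) i))
                (++-cong (λ i → reflexive (lookup-++ʳ (act f (takeᵛ v)) (act g (dropᵛ {n} v)) i))
                         (λ _ → reflᴿ))))))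
      (intertwines-cong slideˡʳ
        (intertwines-⨾
          (F .carry (takeᵛ v) (dropᵛ {n} v ++ w))
          (intertwines-id-⊕ (act f (takeᵛ v)) (G .carry (dropᵛ {n} v) w))))

  all-carry : ∀ {n m} (t : Term HAGen n m) → Carries t
  all-carry (gen Δ)     = carries-Δ
  all-carry (gen ε)     = carries-ε
  all-carry (gen μ)     = carries-μ
  all-carry (gen η)     = carries-η
  all-carry (gen (s k)) = carries-s k
  all-carry id₀ .carry v w = intertwines-id (⊕-id 0 _) (λ _ → reflᴿ)
  all-carry id₁ .carry v w = intertwines-id {x = v ++ w} {v ++ w} (≈-trans (id₁≈id ⟩⊕⟨refl) (⊕-id 1 _)) (λ _ → reflᴿ)
  all-carry σ₁₁ = carries-σ
  all-carry (f Term.⨾ g) .carry v w =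
    intertwines-cong (≈-sym ⨾-⊕-id)
      (intertwines-⨾ (all-carry f .carry v w) (all-carry g .carry (act f v) w))
  all-carry (f Term.⊕ g) = carries-⊕ (all-carry f) (all-carry g)

  accumulate-++-[] : ∀ {n} (v : Vector Carrier n) → accumulate (v ++ []) ≈ʰ accumulate v
  accumulate-++-[] {zero}  v = het ≈-refl
  accumulate-++-[] {suc n} v =
    transʰ (het (refl⟩⨾⟨ (refl⟩⊕⟨ accumulate-cong (λ i → reflexive (++-tail v [] i)))))
           (⨾-congʰ (⊕-congʰ (het ≈-refl) (id-het (+ℕ-identityʳ n)))
                    (⊕-congʰ (het ≈-refl) (accumulate-++-[] (tail v))))

  accumulate-natural : ∀ {n m} (t : Term HAGen n m) v → Intertwines t v (act t v)
  accumulate-natural t v = intertwines-het (symʰ (⊕-identityʳʰ t))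
    (symʰ (accumulate-++-[] v)) (symʰ (accumulate-++-[] (act t v))) (all-carry t .carry v [])

  zeros : ∀ m → Term HAGen 0 m
  zeros zero    = id₀
  zeros (suc m) = η∘ ⊕ zeros m

  zeros-++ : ∀ n m → zeros (n +ℕ m) ≈ zeros n ⊕ zeros m
  zeros-++ zero    m = ≈-sym (⊕-identityˡ _)
  zeros-++ (suc n) m = ≈-trans (refl⟩⊕⟨ zeros-++ n m) (≈-sym (⊕-assoc _ _ _))

  zeros-natural : ∀ {n m} (t : Term HAGen n m) → zeros n ⨾ t ≈ zeros m
  zeros-natural (gen Δ) = ≈-trans (⊕-identityʳ _ ⟩⨾⟨refl)
    (≈-trans (axiom a9) (refl⟩⊕⟨ ≈-sym (⊕-identityʳ _)))
  zeros-natural (gen ε) = ≈-trans (⊕-identityʳ _ ⟩⨾⟨refl) (axiom a10)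
  zeros-natural (gen μ) = begin
    (η∘ ⊕ (η∘ ⊕ id 0)) ⨾ μ∘      ≈⟨ (refl⟩⊕⟨ ⊕-identityʳ _) ⟩⨾⟨refl ⟩
    (η∘ ⊕ η∘) ⨾ μ∘               ≈⟨ slideʳˡ ⟩⨾⟨refl ⟨
    (id 0 ⊕ η∘) ⨾ (η∘ ⊕ id 1) ⨾ μ∘ ≈⟨ ≈-trans (assoc²ˡ μ-unitˡ) (⨾-identityʳ _) ⟩
    id 0 ⊕ η∘                    ≈⟨ ⊕-identityˡ _ ⟩
    η∘                           ≈⟨ ⊕-identityʳ _ ⟨
    η∘ ⊕ id 0                    ∎
  zeros-natural (gen η) = ≈-trans (⨾-identityˡ _) (≈-sym (⊕-identityʳ _))
  zeros-natural (gen (s k)) = ≈-trans (⊕-identityʳ _ ⟩⨾⟨refl)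
    (≈-trans (axiom (a14 k)) (≈-sym (⊕-identityʳ _)))
  zeros-natural id₀ = ⨾-identityˡ _
  zeros-natural id₁ = ≈-trans (refl⟩⨾⟨ id₁≈id) (⨾-identityʳ _)
  zeros-natural σ₁₁ = begin
    (η∘ ⊕ (η∘ ⊕ id 0)) ⨾ σ₁₁ ≈⟨ (refl⟩⊕⟨ ⊕-identityʳ _) ⟩⨾⟨ ≈-sym σ≈σ₁₁ ⟩
    (η∘ ⊕ η∘) ⨾ σ 1 1        ≈⟨ σ-natural _ _ ⟩
    id 0 ⨾ (η∘ ⊕ η∘)         ≈⟨ ⨾-identityˡ _ ⟩
    η∘ ⊕ η∘                  ≈⟨ refl⟩⊕⟨ ⊕-identityʳ _ ⟨
    η∘ ⊕ (η∘ ⊕ id 0)         ∎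
  zeros-natural (f Term.⨾ g) = ≈-trans (assoc²ʳ (zeros-natural f)) (zeros-natural g)
  zeros-natural {n} {m} (Term._⊕_ {a} {b} {a′} {b′} f g) = begin
    zeros (a +ℕ a′) ⨾ (f ⊕ g)        ≈⟨ zeros-++ a a′ ⟩⨾⟨refl ⟩
    (zeros a ⊕ zeros a′) ⨾ (f ⊕ g)   ≈⟨ merge ⟩
    (zeros a ⨾ f) ⊕ (zeros a′ ⨾ g)   ≈⟨ zeros-natural f ⟩⊕⟨ zeros-natural g ⟩
    zeros b ⊕ zeros b′               ≈⟨ zeros-++ b b′ ⟨
    zeros (b +ℕ b′)                  ∎

  canonical : ∀ {n m} → Mat n m → Term HAGen n m
  canonical {zero}  A = zeros _
  canonical {suc n} A = (id 1 ⊕ canonical (λ i j → A i (suc j))) ⨾ accumulate (λ i → A i zero)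

  canonical-cong : ∀ {n m} {A B : Mat n m} → A ≋ B → canonical A ≈ canonical B
  canonical-cong {zero}  p = ≈-refl
  canonical-cong {suc n} p =
    (refl⟩⊕⟨ canonical-cong (λ i j → p i (suc j))) ⟩⨾⟨ accumulate-cong (λ i → p i zero)

  -- By `accumulate-natural` the term slides past one column after another, acting on each, until it
  -- meets the zeros, which it preserves.
  canonical-⨾ : ∀ {n m k} (A : Mat n m) (t : Term HAGen m k) →
                canonical A ⨾ t ≈ canonical (λ i j → act t (λ l → A l j) i)
  canonical-⨾ {zero}  A t = zeros-natural t
  canonical-⨾ {suc n} A t = begin
    (id 1 ⊕ canonical A′) ⨾ accumulate (λ i → A i zero) ⨾ t
      ≈⟨ assoc²ˡ (accumulate-natural t _) ⟩
    (id 1 ⊕ canonical A′) ⨾ ((id 1 ⊕ t) ⨾ accumulate (act t (λ i → A i zero)))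
      ≈⟨ assoc²ʳ (≈-trans (≈-sym id-⊕-⨾) (refl⟩⊕⟨ canonical-⨾ A′ t)) ⟩
    canonical (λ i j → act t (λ l → A l j) i) ∎
    where A′ = λ i j → A i (suc j)

  accumulate-0 : ∀ {n} → accumulate {n} (λ _ → 0#) ≈ ε• ⊕ id n
  accumulate-0 {zero}  = ≈-sym (⊕-identityʳ _)
  accumulate-0 {suc n} = begin
    (pass 0# ⊕ id n) ⨾ (id 1 ⊕ accumulate (λ _ → 0#))
      ≈⟨ refl⟩⨾⟨ ≈-trans (refl⟩⊕⟨ accumulate-0 {n}) (≈-sym (⊕-assoc _ _ _)) ⟩
    (pass 0# ⊕ id n) ⨾ ((id 1 ⊕ ε•) ⊕ id n)
      ≈⟨ ≈-trans (≈-sym ⨾-⊕-id) (≈-trans (pass-εʳ 0#) scaleAdd-0 ⟩⊕⟨refl) ⟩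
    (ε• ⊕ id 1) ⊕ id n
      ≈⟨ ≈-trans (⊕-assoc _ _ _) ⊕-assoc-id ⟩
    ε• ⊕ id (suc n) ∎

  canonical-id : ∀ n → canonical (idᴹ n) ≈ id n
  canonical-id zero    = ≈-refl
  canonical-id (suc n) = begin
    (id 1 ⊕ canonical (λ i j → idᴹ (suc n) i (suc j))) ⨾ accumulate (λ i → idᴹ (suc n) i zero)
      -- The later columns are those of `idᴹ n` with a zero on top, that is, their images under
      -- `η∘ ⊕ id n`; this makes `canonical-⨾` and the induction hypothesis applicable.
      ≈⟨ (refl⟩⊕⟨ canonical-cong (λ { zero j → reflᴿ ; (suc i) j → symᴿ (act-id n _ i) })) ⟩⨾⟨
         accumulate-cong {v = λ i → idᴹ (suc n) i zero} {w = e₀} (λ { zero → reflᴿ ; (suc i) → reflᴿ }) ⟩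
    (id 1 ⊕ canonical (λ i j → act (η∘ ⊕ id n) (λ l → idᴹ n l j) i)) ⨾ accumulate e₀
      ≈⟨ (refl⟩⊕⟨ ≈-trans (≈-sym (canonical-⨾ (idᴹ n) (η∘ ⊕ id n)))
                          (≈-trans (canonical-id n ⟩⨾⟨refl) (⨾-identityˡ _)))
         ⟩⨾⟨ (refl⟩⨾⟨ (refl⟩⊕⟨ accumulate-0)) ⟩
    (id 1 ⊕ (η∘ ⊕ id n)) ⨾ ((pass 1# ⊕ id n) ⨾ (id 1 ⊕ (ε• ⊕ id n)))
      ≈⟨ ⊕-assoc _ _ _ ⟩⨾⟨ (refl⟩⨾⟨ ⊕-assoc _ _ _) ⟨
    ((id 1 ⊕ η∘) ⊕ id n) ⨾ ((pass 1# ⊕ id n) ⨾ ((id 1 ⊕ ε•) ⊕ id n))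
      ≈⟨ refl⟩⨾⟨ ≈-trans (≈-sym ⨾-⊕-id) (pass-εʳ 1# ⟩⊕⟨refl) ⟩
    ((id 1 ⊕ η∘) ⊕ id n) ⨾ (scaleAdd 1# ⊕ id n)
      ≈⟨ ≈-trans (≈-sym ⨾-⊕-id) (≈-trans (η-scaleAdd 1#) (axiom a11) ⟩⊕⟨refl) ⟩
    id₁ ⊕ id n ∎
    where
    e₀ : Vector Carrier (suc n)
    e₀ = λ { zero → 1# ; (suc _) → 0# }

  matrix : ∀ {n m} → Term HAGen n m → Mat n m
  matrix t i j = act t (λ l → idᴹ _ l j) i

  canonical-matrix : ∀ {n m} (t : Term HAGen n m) → canonical (matrix t) ≈ t
  canonical-matrix t = begin
    canonical (matrix t)  ≈⟨ canonical-⨾ (idᴹ _) t ⟨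
    canonical (idᴹ _) ⨾ t ≈⟨ canonical-id _ ⟩⨾⟨refl ⟩
    id _ ⨾ t              ≈⟨ ⨾-identityˡ t ⟩
    t                     ∎

  complete : ∀ {n m} {t u : Term HAGen n m} → (∀ x → act t x ≈ᵛ act u x) → t ≈ u
  complete {t = t} {u} p = begin
    t                    ≈⟨ canonical-matrix t ⟨
    canonical (matrix t) ≈⟨ canonical-cong (λ i j → p (λ l → idᴹ _ l j) i) ⟩
    canonical (matrix u) ≈⟨ canonical-matrix u ⟩
    u                    ∎

-- Matrices form a PROP

module MatrixPROP {c ℓ} (R : CommutativeRing c ℓ) where
  open CommutativeRing R
    using (Carrier; _≈_; 0#; _+_; _*_; setoid; reflexive; semiring; +-commutativeMonoid; +-cong; +-congˡ; +-congʳ; +-identityˡ; +-identityʳ; +-assoc; *-cong; *-congʳ; *-assoc; *-comm; zeroˡ; zeroʳ; *-identityˡ; *-identityʳ; distribˡ)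
    renaming (refl to ≈-refl; sym to ≈-sym; trans to ≈-trans)
  open SemiringSum semiring using (sum; sum-cong-≋; sum-replicate-zero; ∑-distrib-+; *-distribˡ-sum; *-distribʳ-sum)
  open CommutativeMonoidSum +-commutativeMonoid using (∑-comm)
  open Matrices R
  open Action R
  private module ≈-Reasoning = SetoidReasoning setoid

  vector-setoid : ℕ → Setoid c ℓ
  vector-setoid n = record
    { Carrier = Vector Carrier n ; _≈_ = _≈ᵛ_
    ; isEquivalence = record
        { refl = λ _ → ≈-refl ; sym = λ p i → ≈-sym (p i) ; trans = λ p q i → ≈-trans (p i) (q i) } }

  ≈ᵛ-refl : ∀ {n} {x : Vector Carrier n} → x ≈ᵛ x
  ≈ᵛ-refl _ = ≈-refl
  ≈ᵛ-sym : ∀ {n} {x y : Vector Carrier n} → x ≈ᵛ y → y ≈ᵛ x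
  ≈ᵛ-sym p i = ≈-sym (p i)
  ≈ᵛ-trans : ∀ {n} {x y z : Vector Carrier n} → x ≈ᵛ y → y ≈ᵛ z → x ≈ᵛ z
  ≈ᵛ-trans p q i = ≈-trans (p i) (q i)

  module ≈ᵛ-Reasoning {n} = SetoidReasoning (vector-setoid n)

  mat-setoid : ℕ → ℕ → Setoid c ℓ
  mat-setoid n m = record
    { Carrier = Mat n m ; _≈_ = _≋_
    ; isEquivalence = record
        { refl = λ _ _ → ≈-refl ; sym = λ p i j → ≈-sym (p i j)
        ; trans = λ p q i j → ≈-trans (p i j) (q i j) } }

  module ≋-Reasoning {n m} = SetoidReasoning (mat-setoid n m)

  take-++ : ∀ {n m} (x : Vector Carrier n) (y : Vector Carrier m) → takeᵛ (x ++ y) ≈ᵛ x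
  take-++ x y i = reflexive (lookup-++ˡ x y i)

  drop-++ : ∀ {n m} (x : Vector Carrier n) (y : Vector Carrier m) → dropᵛ (x ++ y) ≈ᵛ y
  drop-++ x y i = reflexive (lookup-++ʳ x y i)

  ++-congˡ : ∀ {n m} (x : Vector Carrier n) {y z : Vector Carrier m} → y ≈ᵛ z → x ++ y ≈ᵛ x ++ z
  ++-congˡ x = ++-cong {v = x} ≈ᵛ-refl

  take-++-drop : ∀ {n m} (x : Vector Carrier (n +ℕ m)) → takeᵛ {n} x ++ dropᵛ {n} x ≈ᵛ x
  take-++-drop {n} x i with splitAt n i in eq
  ... | inj₁ j = reflexive (cong x (splitAt⁻¹-↑ˡ {n} eq))
  ... | inj₂ j = reflexive (cong x (splitAt⁻¹-↑ʳ {n} eq))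

  infixr 5 _▷_
  _▷_ : ∀ {n m} → Mat n m → Vector Carrier n → Vector Carrier m
  (A ▷ x) i = sum (λ l → A i l * x l)

  ▷-cong : ∀ {n m} {A B : Mat n m} {x y} → A ≋ B → x ≈ᵛ y → A ▷ x ≈ᵛ B ▷ y
  ▷-cong p q i = sum-cong-≋ (λ l → *-cong (p i l) (q l))

  ▷-congˡ : ∀ {n m} {A : Mat n m} {x y} → x ≈ᵛ y → A ▷ x ≈ᵛ A ▷ y
  ▷-congˡ {A = A} = ▷-cong {A = A} {A} (λ _ _ → ≈-refl)

  ▷-+ : ∀ {n m} (A : Mat n m) x y → A ▷ (λ i → x i + y i) ≈ᵛ λ i → (A ▷ x) i + (A ▷ y) i
  ▷-+ A x y i = ≈-trans (sum-cong-≋ (λ l → distribˡ (A i l) (x l) (y l)))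
                        (∑-distrib-+ (λ l → A i l * x l) (λ l → A i l * y l))

  ▷-* : ∀ {n m} (A : Mat n m) k x → A ▷ (λ i → k * x i) ≈ᵛ λ i → k * (A ▷ x) i
  ▷-* A k x i = ≈-trans (sum-cong-≋ (λ l → begin
      A i l * (k * x l) ≈⟨ *-assoc _ _ _ ⟨
      (A i l * k) * x l ≈⟨ *-congʳ (*-comm _ _) ⟩
      (k * A i l) * x l ≈⟨ *-assoc _ _ _ ⟩
      k * (A i l * x l) ∎))
    (≈-sym (*-distribˡ-sum k (λ l → A i l * x l)))
    where open ≈-Reasoning

  ▷-0 : ∀ {n m} (A : Mat n m) → A ▷ (λ _ → 0#) ≈ᵛ λ _ → 0#
  ▷-0 {n} A i = ≈-trans (sum-cong-≋ (λ l → zeroʳ (A i l))) (sum-replicate-zero n)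

  sum-0* : ∀ {n} (x : Vector Carrier n) → sum (λ l → 0# * x l) ≈ 0#
  sum-0* {n} x = ≈-trans (sum-cong-≋ (λ l → zeroˡ (x l))) (sum-replicate-zero n)

  id-▷ : ∀ n x → idᴹ n ▷ x ≈ᵛ x
  id-▷ (suc n) x zero = ≈-trans (+-cong (*-identityˡ _) (sum-0* (tail x))) (+-identityʳ _)
  id-▷ (suc n) x (suc i) = ≈-trans (+-cong (zeroˡ _) (id-▷ n (tail x) i)) (+-identityˡ _)

  ▷-basis : ∀ {n m} (A : Mat n m) j → A ▷ (λ l → idᴹ n l j) ≈ᵛ λ i → A i j
  ▷-basis {suc n} A zero i = ≈-trans (+-cong (*-identityʳ _) (▷-0 (λ i l → A i (suc l)) i)) (+-identityʳ _)
  ▷-basis {suc n} A (suc j) i = ≈-trans (+-cong (zeroʳ _) (▷-basis (λ i l → A i (suc l)) j i)) (+-identityˡ _)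

  -- The basis vectors recover the entries. The PROP laws are checked on vectors by this, where
  -- composition is application and `⊕` is concatenation.
  ≋-ext : ∀ {n m} {A B : Mat n m} → (∀ x → A ▷ x ≈ᵛ B ▷ x) → A ≋ B
  ≋-ext {A = A} {B} p i j =
    ≈-trans (≈-sym (▷-basis A j i)) (≈-trans (p _ i) (▷-basis B j i))

  ⨾-▷ : ∀ {n m k} (A : Mat n m) (B : Mat m k) x → (A ⨾ᴹ B) ▷ x ≈ᵛ B ▷ A ▷ x
  ⨾-▷ {n} {m} A B x i = begin
    sum (λ j → sum (λ l → B i l * A l j) * x j)
      ≈⟨ sum-cong-≋ (λ j → *-distribʳ-sum (x j) (λ l → B i l * A l j)) ⟩
    sum (λ j → sum (λ l → B i l * A l j * x j))
      ≈⟨ ∑-comm (λ j l → B i l * A l j * x j) ⟩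
    sum (λ l → sum (λ j → B i l * A l j * x j))
      ≈⟨ sum-cong-≋ (λ l → ≈-trans (sum-cong-≋ (λ j → *-assoc (B i l) (A l j) (x j))) (≈-sym (*-distribˡ-sum (B i l) (λ j → A l j * x j)))) ⟩
    sum (λ l → B i l * sum (λ j → A l j * x j)) ∎
    where open ≈-Reasoning

  sum-++ : ∀ n {m} (x : Vector Carrier (n +ℕ m)) → sum x ≈ sum (takeᵛ {n} x) + sum (dropᵛ {n} x)
  sum-++ zero    x = ≈-sym (+-identityˡ _)
  sum-++ (suc n) x = ≈-trans (+-congˡ (sum-++ n (tail x))) (≈-sym (+-assoc _ _ _))

  sum-++-* : ∀ {n m} (a : Vector Carrier n) (b : Vector Carrier m) (x : Vector Carrier (n +ℕ m)) →
             sum (λ l → (a ++ b) l * x l) ≈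
             sum (λ l → a l * takeᵛ {n} x l) + sum (λ l → b l * dropᵛ {n} x l)
  sum-++-* {n} a b x = ≈-trans (sum-++ n (λ l → (a ++ b) l * x l))
    (+-cong (sum-cong-≋ (λ l → *-congʳ (take-++ a b l)))
            (sum-cong-≋ (λ l → *-congʳ (drop-++ a b l))))

  ⊕-▷ : ∀ {n m n′ m′} (A : Mat n m) (B : Mat n′ m′) x →
        (A ⊕ᴹ B) ▷ x ≈ᵛ (A ▷ takeᵛ {n} x) ++ (B ▷ dropᵛ {n} x)
  ⊕-▷ {n} {m} {n′} A B x i with splitAt m i
  ... | inj₁ j = ≈-trans (sum-++-* (A j) (replicate n′ 0#) x)
                         (≈-trans (+-congˡ (sum-0* (dropᵛ {n} x))) (+-identityʳ _))
  ... | inj₂ j = ≈-trans (sum-++-* (replicate n 0#) (B j) x)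
                         (≈-trans (+-congʳ (sum-0* (takeᵛ {n} x))) (+-identityˡ _))

  ⊕-▷-++ : ∀ {n m n′ m′} (A : Mat n m) (B : Mat n′ m′) x y →
           (A ⊕ᴹ B) ▷ (x ++ y) ≈ᵛ (A ▷ x) ++ (B ▷ y)
  ⊕-▷-++ A B x y = ≈ᵛ-trans (⊕-▷ A B (x ++ y))
    (++-cong (▷-congˡ {A = A} (take-++ x y)) (▷-congˡ {A = B} (drop-++ x y)))

  σ-▷ : ∀ n m x → σᴹ n m ▷ x ≈ᵛ dropᵛ {n} x ++ takeᵛ {n} x
  σ-▷ n m x i with splitAt m i
  ... | inj₁ j = ≈-trans (sum-++-* (replicate n 0#) (idᴹ m j) x)
                         (≈-trans (+-cong (sum-0* (takeᵛ {n} x)) (id-▷ m _ j)) (+-identityˡ _))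
  ... | inj₂ j = ≈-trans (sum-++-* (idᴹ n j) (replicate m 0#) x)
                         (≈-trans (+-cong (id-▷ n _ j) (sum-0* (dropᵛ {n} x))) (+-identityʳ _))

  σ-▷-++ : ∀ n m x y → σᴹ n m ▷ (x ++ y) ≈ᵛ y ++ x
  σ-▷-++ n m x y = ≈ᵛ-trans (σ-▷ n m (x ++ y)) (++-cong (drop-++ {n} {m} x y) (take-++ {n} {m} x y))

  infix 4 _≈ʰᵛ_
  data _≈ʰᵛ_ {n m} (x : Vector Carrier n) (y : Vector Carrier m) : Set (c ⊔ ℓ) where
    hetᵛ : (e : n ≡ m) → subst (Vector Carrier) e x ≈ᵛ y → x ≈ʰᵛ y

  homᵛ : ∀ {n} {x y : Vector Carrier n} → x ≈ᵛ y → x ≈ʰᵛ y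
  homᵛ = hetᵛ refl

  unhetᵛ : ∀ {n} {x y : Vector Carrier n} → x ≈ʰᵛ y → x ≈ᵛ y
  unhetᵛ (hetᵛ refl p) = p

  symʰᵛ : ∀ {n m} {x : Vector Carrier n} {y : Vector Carrier m} → x ≈ʰᵛ y → y ≈ʰᵛ x
  symʰᵛ (hetᵛ refl p) = homᵛ (≈ᵛ-sym p)

  transʰᵛ : ∀ {n m k} {x : Vector Carrier n} {y : Vector Carrier m} {z : Vector Carrier k} →
            x ≈ʰᵛ y → y ≈ʰᵛ z → x ≈ʰᵛ z
  transʰᵛ (hetᵛ refl p) (hetᵛ refl q) = homᵛ (≈ᵛ-trans p q)

  ++-congʰᵛ : ∀ {n m n′ m′} {x : Vector Carrier n} {y : Vector Carrier m}
              {x′ : Vector Carrier n′} {y′ : Vector Carrier m′} →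
              x ≈ʰᵛ y → x′ ≈ʰᵛ y′ → x ++ x′ ≈ʰᵛ y ++ y′
  ++-congʰᵛ (hetᵛ refl p) (hetᵛ refl q) = homᵛ (++-cong p q)

  suc-congʰᵛ : ∀ {n m} {x : Vector Carrier (suc n)} {y : Vector Carrier (suc m)} →
               x zero ≈ y zero → tail x ≈ʰᵛ tail y → x ≈ʰᵛ y
  suc-congʰᵛ p (hetᵛ refl q) = homᵛ λ { zero → p ; (suc i) → q i }

  tail-++ : ∀ {n m} (x : Vector Carrier (suc n)) (y : Vector Carrier m) → tail (x ++ y) ≈ᵛ tail x ++ y
  tail-++ x y i = reflexive (++-tail x y i)

  ++-assocʰᵛ : ∀ {n m k} (x : Vector Carrier n) (y : Vector Carrier m) (z : Vector Carrier k) →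
               (x ++ y) ++ z ≈ʰᵛ x ++ (y ++ z)
  ++-assocʰᵛ {zero}  x y z = homᵛ ≈ᵛ-refl
  ++-assocʰᵛ {suc n} x y z = suc-congʰᵛ ≈-refl
    (transʰᵛ (homᵛ (≈ᵛ-trans (tail-++ (x ++ y) z) (++-cong (tail-++ x y) ≈ᵛ-refl)))
    (transʰᵛ (++-assocʰᵛ (tail x) y z)
             (homᵛ (≈ᵛ-sym (tail-++ x (y ++ z))))))

  ++-[]ʰᵛ : ∀ {n} (x : Vector Carrier n) (y : Vector Carrier 0) → x ++ y ≈ʰᵛ x
  ++-[]ʰᵛ {zero}  x y = homᵛ λ ()
  ++-[]ʰᵛ {suc n} x y = suc-congʰᵛ ≈-refl (transʰᵛ (homᵛ (tail-++ x y)) (++-[]ʰᵛ (tail x) y))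

  cast-▷ : ∀ {n m n′ m′} (p : n ≡ n′) (q : m ≡ m′) {A : Mat n m} {x y} →
           x ≈ʰᵛ y → cast {Hom = Mat} p q A ▷ x ≈ʰᵛ A ▷ y
  cast-▷ refl refl {A} (hetᵛ refl p) = homᵛ (▷-congˡ {A = A} p)

  split₃ : ∀ {n m k} (x : Vector Carrier (n +ℕ (m +ℕ k))) →
           x ≈ᵛ takeᵛ {n} x ++ (takeᵛ {m} (dropᵛ {n} x) ++ dropᵛ {m} (dropᵛ {n} x))
  split₃ {n} {m} x = ≈ᵛ-sym (≈ᵛ-trans (++-congˡ (takeᵛ {n} x) (take-++-drop {m} (dropᵛ {n} x))) (take-++-drop {n} x))

  ⨾ᴹ-cong : ∀ {n m k} {A A′ : Mat n m} {B B′ : Mat m k} → A ≋ A′ → B ≋ B′ → A ⨾ᴹ B ≋ A′ ⨾ᴹ B′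
  ⨾ᴹ-cong p q i j = sum-cong-≋ (λ l → *-cong (q i l) (p l j))

  ⊕ᴹ-cong : ∀ {n m n′ m′} {A A′ : Mat n m} {B B′ : Mat n′ m′} → A ≋ A′ → B ≋ B′ → A ⊕ᴹ B ≋ A′ ⊕ᴹ B′
  ⊕ᴹ-cong {n} {A = A} {A′} {B} {B′} p q = ≋-ext λ x →
    ≈ᵛ-trans (⊕-▷ A B x) (≈ᵛ-trans (++-cong (▷-cong p ≈ᵛ-refl) (▷-cong q ≈ᵛ-refl)) (≈ᵛ-sym (⊕-▷ A′ B′ x)))

  open ≈ᵛ-Reasoning

  MatPROP-isPROP : IsPROP MatPROP
  MatPROP-isPROP = record
    { isEquivalence = Setoid.isEquivalence (mat-setoid _ _)
    ; ⨾-cong = ⨾ᴹ-cong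
    ; ⊕-cong = ⊕ᴹ-cong
    ; ⨾-assoc = λ A B C → ≋-ext λ x → begin
        ((A ⨾ᴹ B) ⨾ᴹ C) ▷ x ≈⟨ ⨾-▷ (A ⨾ᴹ B) C x ⟩
        C ▷ (A ⨾ᴹ B) ▷ x    ≈⟨ ▷-congˡ {A = C} (⨾-▷ A B x) ⟩
        C ▷ B ▷ A ▷ x       ≈⟨ ⨾-▷ B C (A ▷ x) ⟨
        (B ⨾ᴹ C) ▷ A ▷ x    ≈⟨ ⨾-▷ A (B ⨾ᴹ C) x ⟨
        (A ⨾ᴹ (B ⨾ᴹ C)) ▷ x ∎
    ; ⨾-identityˡ = λ {n} A → ≋-ext λ x → ≈ᵛ-trans (⨾-▷ (idᴹ n) A x) (▷-congˡ {A = A} (id-▷ n x))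
    ; ⨾-identityʳ = λ {n} {m} A → ≋-ext λ x → ≈ᵛ-trans (⨾-▷ A (idᴹ m) x) (id-▷ m (A ▷ x))
    ; ⊕-id = λ n m → ≋-ext λ x → begin
        (idᴹ n ⊕ᴹ idᴹ m) ▷ x
          ≈⟨ ⊕-▷ (idᴹ n) (idᴹ m) x ⟩
        (idᴹ n ▷ takeᵛ {n} x) ++ (idᴹ m ▷ dropᵛ {n} x)
          ≈⟨ ++-cong (id-▷ n _) (id-▷ m _) ⟩
        takeᵛ {n} x ++ dropᵛ {n} x
          ≈⟨ take-++-drop {n} x ⟩
        x ≈⟨ id-▷ (n +ℕ m) x ⟨
        idᴹ (n +ℕ m) ▷ x ∎
    ; interchange = λ {n} A B A′ B′ → ≋-ext λ x → begin
        ((A ⨾ᴹ B) ⊕ᴹ (A′ ⨾ᴹ B′)) ▷ x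
          ≈⟨ ⊕-▷ (A ⨾ᴹ B) (A′ ⨾ᴹ B′) x ⟩
        ((A ⨾ᴹ B) ▷ takeᵛ {n} x) ++ ((A′ ⨾ᴹ B′) ▷ dropᵛ {n} x)
          ≈⟨ ++-cong (⨾-▷ A B _) (⨾-▷ A′ B′ _) ⟩
        (B ▷ A ▷ takeᵛ {n} x) ++ (B′ ▷ A′ ▷ dropᵛ {n} x)
          ≈⟨ ⊕-▷-++ B B′ _ _ ⟨
        (B ⊕ᴹ B′) ▷ ((A ▷ takeᵛ {n} x) ++ (A′ ▷ dropᵛ {n} x))
          ≈⟨ ▷-congˡ {A = B ⊕ᴹ B′} (⊕-▷ A A′ x) ⟨
        (B ⊕ᴹ B′) ▷ (A ⊕ᴹ A′) ▷ x
          ≈⟨ ⨾-▷ (A ⊕ᴹ A′) (B ⊕ᴹ B′) x ⟨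
        ((A ⊕ᴹ A′) ⨾ᴹ (B ⊕ᴹ B′)) ▷ x ∎
    ; ⊕-assoc = λ {n} {m} {n′} {m′} {n″} {m″} A B C → ≋-ext λ x →
        let u = takeᵛ {n} x
            v = takeᵛ {n′} (dropᵛ {n} x)
            w = dropᵛ {n′} (dropᵛ {n} x)
        in unhetᵛ (transʰᵛ
             (cast-▷ (+ℕ-assoc n n′ n″) (+ℕ-assoc m m′ m″) {(A ⊕ᴹ B) ⊕ᴹ C} (transʰᵛ (homᵛ (split₃ {n} {n′} x)) (symʰᵛ (++-assocʰᵛ u v w))))
           (transʰᵛ (homᵛ (begin
               ((A ⊕ᴹ B) ⊕ᴹ C) ▷ ((u ++ v) ++ w)     ≈⟨ ⊕-▷-++ (A ⊕ᴹ B) C (u ++ v) w ⟩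
               ((A ⊕ᴹ B) ▷ (u ++ v)) ++ (C ▷ w)      ≈⟨ ++-cong (⊕-▷-++ A B u v) ≈ᵛ-refl ⟩
               ((A ▷ u) ++ (B ▷ v)) ++ (C ▷ w)       ∎))
           (transʰᵛ (++-assocʰᵛ (A ▷ u) (B ▷ v) (C ▷ w))
             (homᵛ (begin
               (A ▷ u) ++ ((B ▷ v) ++ (C ▷ w))       ≈⟨ ++-congˡ (A ▷ u) (⊕-▷ B C (dropᵛ {n} x)) ⟨
               (A ▷ u) ++ ((B ⊕ᴹ C) ▷ dropᵛ {n} x)   ≈⟨ ⊕-▷ A (B ⊕ᴹ C) x ⟨
               (A ⊕ᴹ (B ⊕ᴹ C)) ▷ x                   ∎)))))
    ; ⊕-identityˡ = λ A → ≋-ext (⊕-▷ (idᴹ 0) A)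
    ; ⊕-identityʳ = λ {n} {m} A → ≋-ext λ x → unhetᵛ (transʰᵛ
        (cast-▷ (+ℕ-identityʳ n) (+ℕ-identityʳ m) {A ⊕ᴹ idᴹ 0} (symʰᵛ (++-[]ʰᵛ x [])))
        (transʰᵛ (homᵛ (⊕-▷-++ A (idᴹ 0) x [])) (++-[]ʰᵛ (A ▷ x) _)))
    ; σ-natural = λ {n} {m} {n′} {m′} A B → ≋-ext λ x → begin
        ((A ⊕ᴹ B) ⨾ᴹ σᴹ m m′) ▷ x
          ≈⟨ ⨾-▷ (A ⊕ᴹ B) (σᴹ m m′) x ⟩
        σᴹ m m′ ▷ (A ⊕ᴹ B) ▷ x
          ≈⟨ ▷-congˡ {A = σᴹ m m′} (⊕-▷ A B x) ⟩
        σᴹ m m′ ▷ ((A ▷ takeᵛ {n} x) ++ (B ▷ dropᵛ {n} x))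
          ≈⟨ σ-▷-++ m m′ _ _ ⟩
        (B ▷ dropᵛ {n} x) ++ (A ▷ takeᵛ {n} x)
          ≈⟨ ⊕-▷-++ B A _ _ ⟨
        (B ⊕ᴹ A) ▷ (dropᵛ {n} x ++ takeᵛ {n} x)
          ≈⟨ ▷-congˡ {A = B ⊕ᴹ A} (σ-▷ n n′ x) ⟨
        (B ⊕ᴹ A) ▷ σᴹ n n′ ▷ x
          ≈⟨ ⨾-▷ (σᴹ n n′) (B ⊕ᴹ A) x ⟨
        (σᴹ n n′ ⨾ᴹ (B ⊕ᴹ A)) ▷ x ∎
    ; σ-involutive = λ n m → ≋-ext λ x → begin
        (σᴹ n m ⨾ᴹ σᴹ m n) ▷ x                   ≈⟨ ⨾-▷ (σᴹ n m) (σᴹ m n) x ⟩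
        σᴹ m n ▷ σᴹ n m ▷ x                      ≈⟨ ▷-congˡ {A = σᴹ m n} (σ-▷ n m x) ⟩
        σᴹ m n ▷ (dropᵛ {n} x ++ takeᵛ {n} x)    ≈⟨ σ-▷-++ m n _ _ ⟩
        takeᵛ {n} x ++ dropᵛ {n} x               ≈⟨ take-++-drop {n} x ⟩
        x                                        ≈⟨ id-▷ (n +ℕ m) x ⟨
        idᴹ (n +ℕ m) ▷ x                         ∎
    ; σ-hexagon = λ n m k → ≋-ext λ x →
        let u = takeᵛ {n} x
            v = takeᵛ {m} (dropᵛ {n} x)
            w = dropᵛ {m} (dropᵛ {n} x)
            C = cast {Hom = Mat} (+ℕ-assoc n k m) refl (σᴹ n k ⊕ᴹ idᴹ m)
        in unhetᵛ (transʰᵛ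
             (cast-▷ (+ℕ-assoc n m k) (sym (+ℕ-assoc k n m)) {σᴹ (n +ℕ m) k} (transʰᵛ (homᵛ (split₃ {n} {m} x)) (symʰᵛ (++-assocʰᵛ u v w))))
           (transʰᵛ (homᵛ (σ-▷-++ (n +ℕ m) k (u ++ v) w))
           (transʰᵛ (symʰᵛ (++-assocʰᵛ w u v))
           (transʰᵛ (homᵛ (begin
               (w ++ u) ++ v                         ≈⟨ ++-cong (σ-▷-++ n k u w) (id-▷ m v) ⟨
               (σᴹ n k ▷ (u ++ w)) ++ (idᴹ m ▷ v)    ≈⟨ ⊕-▷-++ (σᴹ n k) (idᴹ m) (u ++ w) v ⟨
               (σᴹ n k ⊕ᴹ idᴹ m) ▷ ((u ++ w) ++ v)   ∎))
           (transʰᵛ (symʰᵛ (cast-▷ (+ℕ-assoc n k m) refl {σᴹ n k ⊕ᴹ idᴹ m}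
                     (symʰᵛ (++-assocʰᵛ u w v))))
             (homᵛ (begin
               C ▷ (u ++ (w ++ v))                   ≈⟨ ▷-congˡ {A = C} (++-cong (id-▷ n u) (σ-▷ m k (dropᵛ {n} x))) ⟨
               C ▷ ((idᴹ n ▷ u) ++ (σᴹ m k ▷ dropᵛ {n} x)) ≈⟨ ▷-congˡ {A = C} (⊕-▷ (idᴹ n) (σᴹ m k) x) ⟨
               C ▷ (idᴹ n ⊕ᴹ σᴹ m k) ▷ x             ≈⟨ ⨾-▷ (idᴹ n ⊕ᴹ σᴹ m k) C x ⟨
               ((idᴹ n ⊕ᴹ σᴹ m k) ⨾ᴹ C) ▷ x          ∎)))))))
    }

-- Pushouts and cokernels in an abstract PROP

module PushoutTheory {a ℓ} {P : RawPROP a ℓ} (isPROP : IsPROP P) where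
  open RawPROP P
  open PROPReasoning isPROP
  open ≈-Reasoning

  record IsPushout {k n m p} (f : Hom k n) (g : Hom k m) (ι₁ : Hom n p) (ι₂ : Hom m p) :
                   Set (a ⊔ ℓ) where
    field
      commutes  : f ⨾ ι₁ ≈ g ⨾ ι₂
      universal : ∀ {q} (h₁ : Hom n q) (h₂ : Hom m q) → f ⨾ h₁ ≈ g ⨾ h₂ → Hom p q
      factor₁   : ∀ {q} {h₁ : Hom n q} {h₂ : Hom m q} (e : f ⨾ h₁ ≈ g ⨾ h₂) →
                  ι₁ ⨾ universal h₁ h₂ e ≈ h₁
      factor₂   : ∀ {q} {h₁ : Hom n q} {h₂ : Hom m q} (e : f ⨾ h₁ ≈ g ⨾ h₂) →
                  ι₂ ⨾ universal h₁ h₂ e ≈ h₂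
      unique    : ∀ {q} (u v : Hom p q) → ι₁ ⨾ u ≈ ι₁ ⨾ v → ι₂ ⨾ u ≈ ι₂ ⨾ v → u ≈ v

  record Inverses {n m} (f : Hom n m) (g : Hom m n) : Set ℓ where
    field
      invˡ : f ⨾ g ≈ id n
      invʳ : g ⨾ f ≈ id m

  -- Isomorphism of the cospans `(l , r)` and `(l′ , r′)`.
  record Iso {n m p q} (l : Hom n p) (r : Hom m p) (l′ : Hom n q) (r′ : Hom m q) : Set (a ⊔ ℓ) where
    field
      to       : Hom p q
      from     : Hom q p
      inverses : Inverses to from
      left-to  : l ⨾ to ≈ l′
      right-to : r ⨾ to ≈ r′
    open Inverses inverses public

    left-from : l′ ⨾ from ≈ l
    left-from = ≈-trans (≈-sym left-to ⟩⨾⟨refl) (cancelʳ invˡ)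

    right-from : r′ ⨾ from ≈ r
    right-from = ≈-trans (≈-sym right-to ⟩⨾⟨refl) (cancelʳ invˡ)

  id-inverses : ∀ {n} → Inverses (id n) (id n)
  id-inverses = record { invˡ = ⨾-identityˡ _ ; invʳ = ⨾-identityˡ _ }

  inverses-sym : ∀ {n m} {f : Hom n m} {g : Hom m n} → Inverses f g → Inverses g f
  inverses-sym i = record { invˡ = invʳ ; invʳ = invˡ }
    where open Inverses i

  inverses-⨾ : ∀ {n m k} {f : Hom n m} {f′ : Hom m n} {g : Hom m k} {g′ : Hom k m} →
               Inverses f f′ → Inverses g g′ → Inverses (f ⨾ g) (g′ ⨾ f′)
  inverses-⨾ i j = record
    { invˡ = ≈-trans (assoc²ʳ (cancelʳ j.invˡ)) i.invˡ
    ; invʳ = ≈-trans (assoc²ʳ (cancelʳ i.invʳ)) j.invʳ }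
    where
    module i = Inverses i
    module j = Inverses j

  inverses-⊕ : ∀ {n m n′ m′} {f : Hom n m} {f⁻ : Hom m n} {g : Hom n′ m′} {g⁻ : Hom m′ n′} →
               Inverses f f⁻ → Inverses g g⁻ → Inverses (f ⊕ g) (f⁻ ⊕ g⁻)
  inverses-⊕ i j = record
    { invˡ = ≈-trans merge (≈-trans (i.invˡ ⟩⊕⟨ j.invˡ) (⊕-id _ _))
    ; invʳ = ≈-trans merge (≈-trans (i.invʳ ⟩⊕⟨ j.invʳ) (⊕-id _ _)) }
    where
    module i = Inverses i
    module j = Inverses j

  iso-≈ : ∀ {n m p} {l l′ : Hom n p} {r r′ : Hom m p} → l ≈ l′ → r ≈ r′ → Iso l r l′ r′
  iso-≈ p q = record
    { to = id _ ; from = id _ ; inverses = id-inverses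
    ; left-to = ≈-trans (⨾-identityʳ _) p ; right-to = ≈-trans (⨾-identityʳ _) q }

  iso-refl : ∀ {n m p} {l : Hom n p} {r : Hom m p} → Iso l r l r
  iso-refl = iso-≈ ≈-refl ≈-refl

  iso-sym : ∀ {n m p q} {l : Hom n p} {r : Hom m p} {l′ : Hom n q} {r′ : Hom m q} →
            Iso l r l′ r′ → Iso l′ r′ l r
  iso-sym i = record
    { to = from ; from = to ; inverses = inverses-sym inverses
    ; left-to = left-from ; right-to = right-from }
    where open Iso i

  iso-trans : ∀ {n m p q o} {l : Hom n p} {r : Hom m p} {l′ : Hom n q} {r′ : Hom m q}
              {l″ : Hom n o} {r″ : Hom m o} → Iso l r l′ r′ → Iso l′ r′ l″ r″ → Iso l r l″ r″
  iso-trans i j = record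
    { to = i.to ⨾ j.to ; from = j.from ⨾ i.from ; inverses = inverses-⨾ i.inverses j.inverses
    ; left-to = ≈-trans (assoc²ʳ i.left-to) j.left-to
    ; right-to = ≈-trans (assoc²ʳ i.right-to) j.right-to }
    where
    module i = Iso i
    module j = Iso j

  iso-⨾ : ∀ {n m p q n′ m′} {l : Hom n p} {r : Hom m p} {l′ : Hom n q} {r′ : Hom m q}
          (f : Hom n′ n) (g : Hom m′ m) → Iso l r l′ r′ → Iso (f ⨾ l) (g ⨾ r) (f ⨾ l′) (g ⨾ r′)
  iso-⨾ f g i = record
    { to = to ; from = from ; inverses = inverses
    ; left-to = assoc²ˡ left-to ; right-to = assoc²ˡ right-to }
    where open Iso i

  pushout-unique : ∀ {k n m p q} {f : Hom k n} {g : Hom k m} {l : Hom n p} {r : Hom m p}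
                   {l′ : Hom n q} {r′ : Hom m q} →
                   IsPushout f g l r → IsPushout f g l′ r′ → Iso l r l′ r′
  pushout-unique P Q = record
    { to = P.universal _ _ Q.commutes
    ; from = Q.universal _ _ P.commutes
    ; inverses = record
        { invˡ = P.unique _ _
            (≈-trans (assoc²ʳ (P.factor₁ _)) (≈-trans (Q.factor₁ _) (≈-sym (⨾-identityʳ _))))
            (≈-trans (assoc²ʳ (P.factor₂ _)) (≈-trans (Q.factor₂ _) (≈-sym (⨾-identityʳ _))))
        ; invʳ = Q.unique _ _
            (≈-trans (assoc²ʳ (Q.factor₁ _)) (≈-trans (P.factor₁ _) (≈-sym (⨾-identityʳ _))))
            (≈-trans (assoc²ʳ (Q.factor₂ _)) (≈-trans (P.factor₂ _) (≈-sym (⨾-identityʳ _)))) }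
    ; left-to = P.factor₁ _
    ; right-to = P.factor₂ _ }
    where
    module P = IsPushout P
    module Q = IsPushout Q

  pushout-sym : ∀ {k n m p} {f : Hom k n} {g : Hom k m} {l : Hom n p} {r : Hom m p} →
                IsPushout f g l r → IsPushout g f r l
  pushout-sym P = record
    { commutes = ≈-sym commutes
    ; universal = λ h₁ h₂ e → universal h₂ h₁ (≈-sym e)
    ; factor₁ = λ e → factor₂ (≈-sym e)
    ; factor₂ = λ e → factor₁ (≈-sym e)
    ; unique = λ u v p q → unique u v q p }
    where open IsPushout P

  pushout-id : ∀ {n m} (f : Hom n m) → IsPushout f (id n) (id m) f
  pushout-id f = record
    { commutes = ≈-trans (⨾-identityʳ f) (≈-sym (⨾-identityˡ f))
    ; universal = λ h₁ h₂ e → h₁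
    ; factor₁ = λ e → ⨾-identityˡ _
    ; factor₂ = λ e → ≈-trans e (⨾-identityˡ _)
    ; unique = λ u v p q → ≈-trans (≈-sym (⨾-identityˡ u)) (≈-trans p (⨾-identityˡ v)) }

  -- The feet of the span are changed by isomorphisms; this is what makes composition of cospans
  -- independent of representatives.
  pushout-cong : ∀ {k n m p n′ m′} {f : Hom k n} {g : Hom k m} {f′ : Hom k n′} {g′ : Hom k m′}
                 {l : Hom n p} {r : Hom m p} {s : Hom n′ n} {s⁻ : Hom n n′} {t : Hom m′ m} {t⁻ : Hom m m′} →
                 Inverses s s⁻ → Inverses t t⁻ → f′ ⨾ s ≈ f → g′ ⨾ t ≈ g →
                 IsPushout f g l r → IsPushout f′ g′ (s ⨾ l) (t ⨾ r)
  pushout-cong {f = f} {g} {f′} {g′} {l} {r} {s} {s⁻} {t} {t⁻} i j p q P = record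
    { commutes = begin
        f′ ⨾ (s ⨾ l) ≈⟨ assoc²ʳ p ⟩
        f ⨾ l        ≈⟨ commutes ⟩
        g ⨾ r        ≈⟨ assoc²ʳ q ⟨
        g′ ⨾ (t ⨾ r) ∎
    ; universal = λ h₁ h₂ e → universal (s⁻ ⨾ h₁) (t⁻ ⨾ h₂) (square e)
    ; factor₁ = λ e → ≈-trans (assoc²ˡ (factor₁ (square e))) (≈-trans (assoc²ʳ i.invˡ) (⨾-identityˡ _))
    ; factor₂ = λ e → ≈-trans (assoc²ˡ (factor₂ (square e))) (≈-trans (assoc²ʳ j.invˡ) (⨾-identityˡ _))
    ; unique = λ u v e₁ e₂ → unique u v (cancel i e₁) (cancel j e₂) }
    where
    open IsPushout P
    module i = Inverses i
    module j = Inverses j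
    f-s⁻ : f ⨾ s⁻ ≈ f′
    f-s⁻ = ≈-trans (≈-sym p ⟩⨾⟨refl) (cancelʳ i.invˡ)
    g-t⁻ : g ⨾ t⁻ ≈ g′
    g-t⁻ = ≈-trans (≈-sym q ⟩⨾⟨refl) (cancelʳ j.invˡ)
    square : ∀ {q} {h₁ : Hom _ q} {h₂ : Hom _ q} → f′ ⨾ h₁ ≈ g′ ⨾ h₂ → f ⨾ (s⁻ ⨾ h₁) ≈ g ⨾ (t⁻ ⨾ h₂)
    square e = ≈-trans (assoc²ʳ f-s⁻) (≈-trans e (≈-sym (assoc²ʳ g-t⁻)))
    cancel : ∀ {n n′ p q} {s : Hom n′ n} {s⁻ : Hom n n′} {l : Hom n p} {u v : Hom p q} →
             Inverses s s⁻ → (s ⨾ l) ⨾ u ≈ (s ⨾ l) ⨾ v → l ⨾ u ≈ l ⨾ v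
    cancel {s = s} {s⁻} {l} {u} {v} i e = begin
      l ⨾ u              ≈⟨ ≈-trans (assoc²ʳ (Inverses.invʳ i)) (⨾-identityˡ _) ⟨
      s⁻ ⨾ (s ⨾ (l ⨾ u)) ≈⟨ refl⟩⨾⟨ ≈-trans (≈-sym (⨾-assoc _ _ _)) (≈-trans e (⨾-assoc _ _ _)) ⟩
      s⁻ ⨾ (s ⨾ (l ⨾ v)) ≈⟨ ≈-trans (assoc²ʳ (Inverses.invʳ i)) (⨾-identityˡ _) ⟩
      l ⨾ v              ∎

  pushout-≈ : ∀ {k n m p} {f f′ : Hom k n} {g g′ : Hom k m} {l l′ : Hom n p} {r r′ : Hom m p} →
              f ≈ f′ → g ≈ g′ → l ≈ l′ → r ≈ r′ → IsPushout f g l r → IsPushout f′ g′ l′ r′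
  pushout-≈ {f = f} {f′} {g} {g′} p q s t P = record
    { commutes = ≈-trans (≈-sym p ⟩⨾⟨ ≈-sym s) (≈-trans commutes (q ⟩⨾⟨ t))
    ; universal = λ h₁ h₂ e → universal h₁ h₂ (square e)
    ; factor₁ = λ e → ≈-trans (≈-sym s ⟩⨾⟨refl) (factor₁ (square e))
    ; factor₂ = λ e → ≈-trans (≈-sym t ⟩⨾⟨refl) (factor₂ (square e))
    ; unique = λ u v e₁ e₂ → unique u v (≈-trans (s ⟩⨾⟨refl) (≈-trans e₁ (≈-sym s ⟩⨾⟨refl)))
                                        (≈-trans (t ⟩⨾⟨refl) (≈-trans e₂ (≈-sym t ⟩⨾⟨refl))) }
    where
    open IsPushout P
    square : ∀ {q} {h₁ : Hom _ q} {h₂ : Hom _ q} → f′ ⨾ h₁ ≈ g′ ⨾ h₂ → f ⨾ h₁ ≈ g ⨾ h₂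
    square e = ≈-trans (p ⟩⨾⟨refl) (≈-trans e (≈-sym q ⟩⨾⟨refl))

  pushout-iso : ∀ {k n m} (f : Hom k n) {g : Hom k m} {g⁻ : Hom m k} →
                Inverses g g⁻ → IsPushout f g (id n) (g⁻ ⨾ f)
  pushout-iso f i = pushout-≈ ≈-refl ≈-refl (⨾-identityˡ _) ≈-refl
    (pushout-cong id-inverses (inverses-sym i) (⨾-identityʳ f) (Inverses.invˡ i) (pushout-id f))

  -- The two ways of composing three cospans both give the colimit of the
  -- diagram n ← k → m ← k′ → n′.
  pushout-paste : ∀ {k k′ n m n′ p q o} {f : Hom k n} {g : Hom k m} {f′ : Hom k′ m} {g′ : Hom k′ n′}
    {l : Hom n p} {r : Hom m p} {l′ : Hom m q} {r′ : Hom n′ q} {l″ : Hom n o} {r″ : Hom q o} →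
    (P : IsPushout f g l r) → IsPushout f′ g′ l′ r′ → (Q : IsPushout f (g ⨾ l′) l″ r″) →
    IsPushout (f′ ⨾ r) g′
      (IsPushout.universal P l″ (l′ ⨾ r″) (≈-trans (IsPushout.commutes Q) (⨾-assoc g l′ r″)))
      (r′ ⨾ r″)
  pushout-paste {f = f} {g} {f′} {g′} {l} {r} {l′} {r′} {l″} {r″} P Q S = record
    { commutes = begin
        (f′ ⨾ r) ⨾ t    ≈⟨ assoc²ˡ (P.factor₂ _) ⟩
        f′ ⨾ (l′ ⨾ r″)  ≈⟨ assoc²ʳ Q.commutes ⟩
        (g′ ⨾ r′) ⨾ r″  ≈⟨ ⨾-assoc _ _ _ ⟩
        g′ ⨾ (r′ ⨾ r″)  ∎
    ; universal = λ h₁ h₂ e → S.universal (l ⨾ h₁) (v e) (outer e)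
    ; factor₁ = λ {_} {h₁} {h₂} e → P.unique _ _
        (begin
          l ⨾ (t ⨾ _)  ≈⟨ assoc²ʳ (P.factor₁ _) ⟩
          l″ ⨾ _       ≈⟨ S.factor₁ (outer e) ⟩
          l ⨾ h₁       ∎)
        (begin
          r ⨾ (t ⨾ _)     ≈⟨ assoc²ʳ (P.factor₂ _) ⟩
          (l′ ⨾ r″) ⨾ _   ≈⟨ assoc²ˡ (S.factor₂ (outer e)) ⟩
          l′ ⨾ v e        ≈⟨ Q.factor₁ (inner e) ⟩
          r ⨾ h₁          ∎)
    ; factor₂ = λ {_} {h₁} {h₂} e → begin
        (r′ ⨾ r″) ⨾ _  ≈⟨ assoc²ˡ (S.factor₂ (outer e)) ⟩
        r′ ⨾ v e       ≈⟨ Q.factor₂ (inner e) ⟩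
        h₂             ∎
    ; unique = λ u v e₁ e₂ → S.unique u v
        (begin
          l″ ⨾ u       ≈⟨ assoc²ʳ (P.factor₁ _) ⟨
          l ⨾ (t ⨾ u)  ≈⟨ refl⟩⨾⟨ e₁ ⟩
          l ⨾ (t ⨾ v)  ≈⟨ assoc²ʳ (P.factor₁ _) ⟩
          l″ ⨾ v       ∎)
        (Q.unique _ _
          (begin
            l′ ⨾ (r″ ⨾ u)  ≈⟨ ≈-trans (assoc²ʳ (P.factor₂ _)) (⨾-assoc _ _ _) ⟨
            r ⨾ (t ⨾ u)    ≈⟨ refl⟩⨾⟨ e₁ ⟩
            r ⨾ (t ⨾ v)    ≈⟨ ≈-trans (assoc²ʳ (P.factor₂ _)) (⨾-assoc _ _ _) ⟩
            l′ ⨾ (r″ ⨾ v)  ∎)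
          (≈-trans (≈-sym (⨾-assoc _ _ _)) (≈-trans e₂ (⨾-assoc _ _ _)))) }
    where
    module P = IsPushout P
    module Q = IsPushout Q
    module S = IsPushout S
    t = P.universal l″ (l′ ⨾ r″) (≈-trans S.commutes (⨾-assoc g l′ r″))
    module _ {q} {h₁ : Hom _ q} {h₂ : Hom _ q} (e : (f′ ⨾ r) ⨾ h₁ ≈ g′ ⨾ h₂) where
      inner : f′ ⨾ (r ⨾ h₁) ≈ g′ ⨾ h₂
      inner = ≈-trans (≈-sym (⨾-assoc _ _ _)) e
      v : Hom _ q
      v = Q.universal (r ⨾ h₁) h₂ inner
      outer : f ⨾ (l ⨾ h₁) ≈ (g ⨾ l′) ⨾ v
      outer = begin
        f ⨾ (l ⨾ h₁)   ≈⟨ assoc²ʳ P.commutes ⟩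
        (g ⨾ r) ⨾ h₁   ≈⟨ ⨾-assoc _ _ _ ⟩
        g ⨾ (r ⨾ h₁)   ≈⟨ refl⟩⨾⟨ Q.factor₁ inner ⟨
        g ⨾ (l′ ⨾ v)   ≈⟨ ⨾-assoc _ _ _ ⟨
        (g ⨾ l′) ⨾ v   ∎

  record Coproducts : Set (a ⊔ ℓ) where
    field
      inl     : ∀ n m → Hom n (n +ℕ m)
      inr     : ∀ n m → Hom m (n +ℕ m)
      [_,_]   : ∀ {n m q} → Hom n q → Hom m q → Hom (n +ℕ m) q
      inl-[,] : ∀ {n m q} (h : Hom n q) (h′ : Hom m q) → inl n m ⨾ [ h , h′ ] ≈ h
      inr-[,] : ∀ {n m q} (h : Hom n q) (h′ : Hom m q) → inr n m ⨾ [ h , h′ ] ≈ h′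
      epi     : ∀ {n m q} {u v : Hom (n +ℕ m) q} →
                inl n m ⨾ u ≈ inl n m ⨾ v → inr n m ⨾ u ≈ inr n m ⨾ v → u ≈ v
      inl-⊕   : ∀ {n m n′ m′} (f : Hom n m) (g : Hom n′ m′) → inl n n′ ⨾ (f ⊕ g) ≈ f ⨾ inl m m′
      inr-⊕   : ∀ {n m n′ m′} (f : Hom n m) (g : Hom n′ m′) → inr n n′ ⨾ (f ⊕ g) ≈ g ⨾ inr m m′

  module _ (coproducts : Coproducts) where
    open Coproducts coproducts

    -- Arrows out of a direct sum are pairs of arrows, so the universal property can be checked on
    -- each summand.
    pushout-⊕ : ∀ {k n m p k′ n′ m′ p′} {f : Hom k n} {g : Hom k m} {l : Hom n p} {r : Hom m p}
      {f′ : Hom k′ n′} {g′ : Hom k′ m′} {l′ : Hom n′ p′} {r′ : Hom m′ p′} →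
      IsPushout f g l r → IsPushout f′ g′ l′ r′ → IsPushout (f ⊕ f′) (g ⊕ g′) (l ⊕ l′) (r ⊕ r′)
    pushout-⊕ {k} {n} {m} {p} {k′} {n′} {m′} {p′} {f} {g} {l} {r} {f′} {g′} {l′} {r′} P P′ = record
      { commutes = ≈-trans merge (≈-trans (P.commutes ⟩⊕⟨ P′.commutes) (interchange _ _ _ _))
      ; universal = λ h₁ h₂ e → [ P.universal (inl _ _ ⨾ h₁) (inl _ _ ⨾ h₂) (restrictˡ e)
                                , P′.universal (inr _ _ ⨾ h₁) (inr _ _ ⨾ h₂) (restrictʳ e) ]
      ; factor₁ = λ e → epi
          (≈-trans (assoc²ʳ (inl-⊕ _ _)) (≈-trans (assoc²ˡ (inl-[,] _ _)) (P.factor₁ (restrictˡ e))))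
          (≈-trans (assoc²ʳ (inr-⊕ _ _)) (≈-trans (assoc²ˡ (inr-[,] _ _)) (P′.factor₁ (restrictʳ e))))
      ; factor₂ = λ e → epi
          (≈-trans (assoc²ʳ (inl-⊕ _ _)) (≈-trans (assoc²ˡ (inl-[,] _ _)) (P.factor₂ (restrictˡ e))))
          (≈-trans (assoc²ʳ (inr-⊕ _ _)) (≈-trans (assoc²ˡ (inr-[,] _ _)) (P′.factor₂ (restrictʳ e))))
      ; unique = λ u v e₁ e₂ → epi
          (P.unique _ _ (restrictˡ e₁) (restrictˡ e₂))
          (P′.unique _ _ (restrictʳ e₁) (restrictʳ e₂)) }
      where
      module P = IsPushout P
      module P′ = IsPushout P′
      restrictˡ : ∀ {k n m k′ n′ m′ q} {f : Hom k n} {f′ : Hom k′ n′} {g : Hom k m} {g′ : Hom k′ m′}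
                  {u : Hom (n +ℕ n′) q} {v : Hom (m +ℕ m′) q} →
                  (f ⊕ f′) ⨾ u ≈ (g ⊕ g′) ⨾ v → f ⨾ (inl _ _ ⨾ u) ≈ g ⨾ (inl _ _ ⨾ v)
      restrictˡ e = ≈-trans (≈-sym (≈-trans (assoc²ʳ (inl-⊕ _ _)) (⨾-assoc _ _ _)))
        (≈-trans (refl⟩⨾⟨ e) (≈-trans (assoc²ʳ (inl-⊕ _ _)) (⨾-assoc _ _ _)))
      restrictʳ : ∀ {k n m k′ n′ m′ q} {f : Hom k n} {f′ : Hom k′ n′} {g : Hom k m} {g′ : Hom k′ m′}
                  {u : Hom (n +ℕ n′) q} {v : Hom (m +ℕ m′) q} →
                  (f ⊕ f′) ⨾ u ≈ (g ⊕ g′) ⨾ v → f′ ⨾ (inr _ _ ⨾ u) ≈ g′ ⨾ (inr _ _ ⨾ v)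
      restrictʳ e = ≈-trans (≈-sym (≈-trans (assoc²ʳ (inr-⊕ _ _)) (⨾-assoc _ _ _)))
        (≈-trans (refl⟩⨾⟨ e) (≈-trans (assoc²ʳ (inr-⊕ _ _)) (⨾-assoc _ _ _)))

    -- The pushout of f and g is the cokernel of the difference of f and g,
    -- which is given here by the arrow h.
    pushout-cokernel : ∀ {k n m p} {f : Hom k n} {g : Hom k m} {l : Hom n p} {r : Hom m p}
      {d : Hom k 0} {h : Hom k (m +ℕ n)} {z : Hom 0 p} →
      (∀ {q} (u v : Hom 0 q) → u ≈ v) →
      (∀ {q} {u : Hom 0 q} {v : Hom (m +ℕ n) q} → d ⨾ u ≈ h ⨾ v → f ⨾ (inr m n ⨾ v) ≈ g ⨾ (inl m n ⨾ v)) →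
      d ⨾ z ≈ h ⨾ [ r , l ] → IsPushout f g l r → IsPushout d h z [ r , l ]
    pushout-cokernel initial difference square P = record
      { commutes = square
      ; universal = λ u v e → universal (inr _ _ ⨾ v) (inl _ _ ⨾ v) (difference e)
      ; factor₁ = λ e → initial _ _
      ; factor₂ = λ e → epi
          (≈-trans (assoc²ʳ (inl-[,] _ _)) (factor₂ (difference e)))
          (≈-trans (assoc²ʳ (inr-[,] _ _)) (factor₁ (difference e)))
      ; unique = λ u v _ e → unique u v
          (≈-trans (≈-sym (assoc²ʳ (inr-[,] _ _))) (≈-trans (refl⟩⨾⟨ e) (assoc²ʳ (inr-[,] _ _))))
          (≈-trans (≈-sym (assoc²ʳ (inl-[,] _ _))) (≈-trans (refl⟩⨾⟨ e) (assoc²ʳ (inl-[,] _ _)))) }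
      where open IsPushout P

    -- The cokernel of [ f , g ] is computed by first passing to the cokernel of f.
    cokernel-[,] : ∀ {k k′ n p q} {f : Hom k n} {g : Hom k′ n} {d : Hom k 0} {d′ : Hom k′ 0} {e : Hom (k +ℕ k′) 0}
      {z : Hom 0 p} {l : Hom n p} {z′ : Hom 0 q} {l′ : Hom p q} →
      (∀ {q} (u v : Hom 0 q) → u ≈ v) → (∀ {q} (u v : Hom q 0) → u ≈ v) →
      IsPushout d f z l → IsPushout d′ (g ⨾ l) z′ l′ → IsPushout e [ f , g ] z′ (l ⨾ l′)
    cokernel-[,] {f = f} {g} {d} {d′} {e} {z} {l} {z′} {l′} initial terminal P Q = record
      { commutes = epi
          (begin
            inl _ _ ⨾ (e ⨾ z′)               ≈⟨ assoc²ʳ (terminal _ d) ⟩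
            d ⨾ z′                           ≈⟨ refl⟩⨾⟨ initial z′ (z ⨾ l′) ⟩
            d ⨾ (z ⨾ l′)                     ≈⟨ ≈-trans (assoc²ʳ P.commutes) (⨾-assoc _ _ _) ⟩
            f ⨾ (l ⨾ l′)                     ≈⟨ assoc²ʳ (inl-[,] f g) ⟨
            inl _ _ ⨾ ([ f , g ] ⨾ (l ⨾ l′)) ∎)
          (begin
            inr _ _ ⨾ (e ⨾ z′)               ≈⟨ assoc²ʳ (terminal _ d′) ⟩
            d′ ⨾ z′                          ≈⟨ ≈-trans Q.commutes (⨾-assoc _ _ _) ⟩
            g ⨾ (l ⨾ l′)                     ≈⟨ assoc²ʳ (inr-[,] f g) ⟨
            inr _ _ ⨾ ([ f , g ] ⨾ (l ⨾ l′)) ∎)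
      ; universal = λ u v s → Q.universal u (P.universal u v (left s)) (right s)
      ; factor₁ = λ s → initial _ _
      ; factor₂ = λ s → ≈-trans (assoc²ˡ (Q.factor₂ (right s))) (P.factor₂ (left s))
      ; unique = λ u v _ s → Q.unique u v (initial _ _)
          (P.unique _ _ (initial _ _) (≈-trans (≈-sym (⨾-assoc _ _ _)) (≈-trans s (⨾-assoc _ _ _)))) }
      where
      module P = IsPushout P
      module Q = IsPushout Q
      module _ {o} {u : Hom 0 o} {v : Hom _ o} (s : e ⨾ u ≈ [ f , g ] ⨾ v) where
        left : d ⨾ u ≈ f ⨾ v
        left = ≈-trans (terminal d _ ⟩⨾⟨refl) (≈-trans (⨾-assoc _ _ _)
          (≈-trans (refl⟩⨾⟨ s) (assoc²ʳ (inl-[,] f g))))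
        right : d′ ⨾ u ≈ (g ⨾ l) ⨾ P.universal u v left
        right = begin
          d′ ⨾ u                         ≈⟨ ≈-trans (terminal d′ _ ⟩⨾⟨refl) (⨾-assoc _ _ _) ⟩
          inr _ _ ⨾ (e ⨾ u)              ≈⟨ ≈-trans (refl⟩⨾⟨ s) (assoc²ʳ (inr-[,] f g)) ⟩
          g ⨾ v                          ≈⟨ refl⟩⨾⟨ P.factor₂ left ⟨
          g ⨾ (l ⨾ P.universal u v left) ≈⟨ ⨾-assoc _ _ _ ⟨
          (g ⨾ l) ⨾ _                    ∎

-- Cospans form a PROP

module CospanTheory {a ℓ} {P : RawPROP a ℓ} (isPROP : IsPROP P)
    (coproducts : PushoutTheory.Coproducts isPROP)
    (pushout : ∀ {k n m} (f : RawPROP.Hom P k n) (g : RawPROP.Hom P k m) →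
               Σ ℕ λ p → Σ (RawPROP.Hom P n p) λ l → Σ (RawPROP.Hom P m p) λ r →
               PushoutTheory.IsPushout isPROP f g l r) where
  open RawPROP P
  open PROPReasoning isPROP
  open PushoutTheory isPROP

  record Cospan (n m : ℕ) : Set a where
    constructor cospan
    field
      {apex} : ℕ
      left   : Hom n apex
      right  : Hom m apex

  open Cospan

  infix 4 _≅_
  _≅_ : ∀ {n m} → Cospan n m → Cospan n m → Set (a ⊔ ℓ)
  C ≅ D = Iso (left C) (right C) (left D) (right D)

  ≅-refl : ∀ {n m} (C : Cospan n m) → C ≅ C
  ≅-refl C = iso-refl

  ≅-sym : ∀ {n m} (C D : Cospan n m) → C ≅ D → D ≅ C
  ≅-sym C D = iso-sym

  ≅-trans : ∀ {n m} (C D E : Cospan n m) → C ≅ D → D ≅ E → C ≅ E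
  ≅-trans C D E = iso-trans

  module _ {k n m} (f : Hom k n) (g : Hom k m) where
    ι₁ : Hom n (proj₁ (pushout f g))
    ι₁ = proj₁ (proj₂ (pushout f g))
    ι₂ : Hom m (proj₁ (pushout f g))
    ι₂ = proj₁ (proj₂ (proj₂ (pushout f g)))
    pushout-square : IsPushout f g ι₁ ι₂
    pushout-square = proj₂ (proj₂ (proj₂ (pushout f g)))

  idᶜ : ∀ n → Cospan n n
  idᶜ n = cospan (id n) (id n)

  _⨾ᶜ_ : ∀ {n m k} → Cospan n m → Cospan m k → Cospan n k
  C ⨾ᶜ D = cospan (left C ⨾ ι₁ (right C) (left D)) (right D ⨾ ι₂ (right C) (left D))

  _⊕ᶜ_ : ∀ {n m n′ m′} → Cospan n m → Cospan n′ m′ → Cospan (n +ℕ n′) (m +ℕ m′)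
  C ⊕ᶜ D = cospan (left C ⊕ left D) (right C ⊕ right D)

  σᶜ : ∀ n m → Cospan (n +ℕ m) (m +ℕ n)
  σᶜ n m = cospan (σ n m) (id (m +ℕ n))

  CospanPROP : RawPROP a (a ⊔ ℓ)
  CospanPROP = record
    { Hom = Cospan ; _≈_ = _≅_ ; id = idᶜ ; _⨾_ = _⨾ᶜ_ ; _⊕_ = _⊕ᶜ_ ; σ = σᶜ }

  -- Any pushout may replace the chosen one; the laws below each supply a convenient square.
  composite : ∀ {n m k a} {C : Cospan n m} {D : Cospan m k} {l : Hom (apex C) a} {r : Hom (apex D) a} →
              IsPushout (right C) (left D) l r → C ⨾ᶜ D ≅ cospan (left C ⨾ l) (right D ⨾ r)
  composite {C = C} {D} {l} {r} P = (iso-⨾ (left C) (right D) (pushout-unique (pushout-square (right C) (left D)) P))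

  graph : ∀ {n m} → Hom n m → Cospan n m
  graph {m = m} A = cospan A (id m)

  graph-⨾ : ∀ {n m k} (A : Hom n m) (C : Cospan m k) → graph A ⨾ᶜ C ≅ cospan (A ⨾ left C) (right C)
  graph-⨾ A C = iso-trans (composite {C = graph A} {C} (pushout-sym (pushout-id (left C))))
    (iso-≈ ≈-refl (⨾-identityʳ (right C)))

  ⨾-graph : ∀ {n m k} (C : Cospan n m) {A : Hom m k} {A⁻ : Hom k m} → Inverses A A⁻ →
            C ⨾ᶜ graph A ≅ cospan (left C) (A⁻ ⨾ right C)
  ⨾-graph C {A} {A⁻} i = iso-trans (composite {C = C} {graph A} (pushout-iso (right C) i))
    (iso-≈ (⨾-identityʳ (left C)) (⨾-identityˡ (A⁻ ⨾ right C)))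

  graph-⨾-graph : ∀ {n m k} (A : Hom n m) (B : Hom m k) → graph A ⨾ᶜ graph B ≅ graph (A ⨾ B)
  graph-⨾-graph A B = graph-⨾ A (graph B)

  graph-⊕ : ∀ {n m n′ m′} (A : Hom n m) (B : Hom n′ m′) → graph A ⊕ᶜ graph B ≅ graph (A ⊕ B)
  graph-⊕ {m = m} {m′ = m′} A B = iso-≈ ≈-refl (⊕-id m m′)

  cast-≅ : ∀ {n m n′ m′ a b} (p : n ≡ n′) (q : m ≡ m′) (r : a ≡ b)
           {A : Hom n a} {B : Hom m a} {A′ : Hom n′ b} {B′ : Hom m′ b} →
           cast {Hom = Hom} p r A ≈ A′ → cast {Hom = Hom} q r B ≈ B′ →
           cast {Hom = Cospan} p q (cospan A B) ≅ cospan A′ B′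
  cast-≅ refl refl refl = iso-≈

  cast-graph : ∀ {n m n′ m′} (p : n ≡ n′) (q : m ≡ m′) (A : Hom n m) →
               cast {Hom = Cospan} p q (graph A) ≅ graph (cast {Hom = Hom} p q A)
  cast-graph refl refl A = iso-refl

  ⨾ᶜ-cong : ∀ {n m k} {C C′ : Cospan n m} {D D′ : Cospan m k} → C ≅ C′ → D ≅ D′ → C ⨾ᶜ D ≅ C′ ⨾ᶜ D′
  ⨾ᶜ-cong {C = C} {C′} {D} {D′} i j = iso-trans
    (composite {C = C} {D} (pushout-cong i.inverses j.inverses i.right-to j.left-to
                             (pushout-square (right C′) (left D′))))
    (iso-≈ (assoc²ʳ i.left-to) (assoc²ʳ j.right-to))
    where
    module i = Iso i
    module j = Iso j

  ⊕ᶜ-cong : ∀ {n m n′ m′} {C C′ : Cospan n m} {D D′ : Cospan n′ m′} → C ≅ C′ → D ≅ D′ → C ⊕ᶜ D ≅ C′ ⊕ᶜ D′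
  ⊕ᶜ-cong {C = C} {C′} {D} {D′} i j = record
    { to = i.to ⊕ j.to ; from = i.from ⊕ j.from ; inverses = inverses-⊕ i.inverses j.inverses
    ; left-to = ≈-trans merge (i.left-to ⟩⊕⟨ j.left-to)
    ; right-to = ≈-trans merge (i.right-to ⟩⊕⟨ j.right-to) }
    where
    module i = Iso i
    module j = Iso j

  ⨾ᶜ-assoc : ∀ {n m k l} (C : Cospan n m) (D : Cospan m k) (E : Cospan k l) →
             (C ⨾ᶜ D) ⨾ᶜ E ≅ C ⨾ᶜ (D ⨾ᶜ E)
  ⨾ᶜ-assoc C D E = iso-trans
    (composite {C = C ⨾ᶜ D} {E} (pushout-paste CD DE CDE))
    (iso-≈ (assoc²ˡ (IsPushout.factor₁ CD _)) (≈-sym (⨾-assoc _ _ _)))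
    where
    CD = pushout-square (right C) (left D)
    DE = pushout-square (right D) (left E)
    CDE = pushout-square (right C) (left (D ⨾ᶜ E))

  ⨾ᶜ-interchange : ∀ {n m k n′ m′ k′} (C : Cospan n m) (D : Cospan m k) (C′ : Cospan n′ m′) (D′ : Cospan m′ k′) →
                   (C ⨾ᶜ D) ⊕ᶜ (C′ ⨾ᶜ D′) ≅ (C ⊕ᶜ C′) ⨾ᶜ (D ⊕ᶜ D′)
  ⨾ᶜ-interchange C D C′ D′ = iso-sym (iso-trans
    (composite {C = C ⊕ᶜ C′} {D ⊕ᶜ D′}
      (pushout-⊕ coproducts (pushout-square (right C) (left D)) (pushout-square (right C′) (left D′))))
    (iso-≈ merge merge))

  σ-inverses : ∀ n m → Inverses (σ n m) (σ m n)
  σ-inverses n m = record { invˡ = σ-involutive n m ; invʳ = σ-involutive m n }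

  -- Crossing the legs only exchanges the two apexes, so the symmetry of the apexes is the required
  -- isomorphism.
  σᶜ-natural : ∀ {n m n′ m′} (C : Cospan n m) (D : Cospan n′ m′) →
               (C ⊕ᶜ D) ⨾ᶜ σᶜ m m′ ≅ σᶜ n n′ ⨾ᶜ (D ⊕ᶜ C)
  σᶜ-natural {n} {m} {n′} {m′} C D =
    iso-trans (⨾-graph (C ⊕ᶜ D) (σ-inverses m m′))
    (iso-trans (record
      { to = σ (apex C) (apex D) ; from = σ (apex D) (apex C) ; inverses = σ-inverses (apex C) (apex D)
      ; left-to = σ-natural (left C) (left D)
      ; right-to = ≈-trans (assoc²ˡ (σ-natural (right C) (right D)))
                     (≈-trans (assoc²ʳ (σ-involutive m′ m)) (⨾-identityˡ _)) })
    (iso-sym (graph-⨾ (σ n n′) (D ⊕ᶜ C))))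

  CospanPROP-isPROP : IsPROP CospanPROP
  CospanPROP-isPROP = record
    { isEquivalence = record { refl = iso-refl ; sym = iso-sym ; trans = iso-trans }
    ; ⨾-cong = ⨾ᶜ-cong
    ; ⊕-cong = ⊕ᶜ-cong
    ; ⨾-assoc = ⨾ᶜ-assoc
    ; ⨾-identityˡ = λ {n} C → iso-trans (graph-⨾ (id n) C) (iso-≈ (⨾-identityˡ (left C)) ≈-refl)
    ; ⨾-identityʳ = λ C → iso-trans (⨾-graph C id-inverses) (iso-≈ ≈-refl (⨾-identityˡ (right C)))
    ; ⊕-id = λ n m → iso-≈ (⊕-id n m) (⊕-id n m)
    ; interchange = ⨾ᶜ-interchange
    ; ⊕-assoc = λ {n} {m} {n′} {m′} {n″} {m″} C D E →
        cast-≅ (+ℕ-assoc n n′ n″) (+ℕ-assoc m m′ m″) (+ℕ-assoc (apex C) (apex D) (apex E))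
          (⊕-assoc (left C) (left D) (left E)) (⊕-assoc (right C) (right D) (right E))
    ; ⊕-identityˡ = λ C → iso-≈ (⊕-identityˡ (left C)) (⊕-identityˡ (right C))
    ; ⊕-identityʳ = λ {n} {m} C →
        cast-≅ (+ℕ-identityʳ n) (+ℕ-identityʳ m) (+ℕ-identityʳ (apex C))
          (⊕-identityʳ (left C)) (⊕-identityʳ (right C))
    ; σ-natural = σᶜ-natural
    ; σ-involutive = λ n m → iso-trans (graph-⨾-graph (σ n m) (σ m n)) (iso-≈ (σ-involutive n m) ≈-refl)
    ; σ-hexagon = λ n m k →
        let A = id n ⊕ σ m k
            B = σ n k ⊕ id m
            q = +ℕ-assoc n k m
        in iso-trans (cast-graph (+ℕ-assoc n m k) (sym (+ℕ-assoc k n m)) (σ (n +ℕ m) k))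
          (iso-trans (iso-≈ (σ-hexagon n m k) ≈-refl)
          (iso-trans (iso-sym (graph-⨾-graph A (cast {Hom = Hom} q refl B)))
                   (⨾ᶜ-cong (iso-sym (graph-⊕ (id n) (σ m k)))
                            (iso-trans (iso-sym (cast-graph q refl B))
                                     (cast-cong q (iso-sym (graph-⊕ (σ n k) (id m))))))))
    }
    where
    cast-cong : ∀ {n n′ m} (p : n ≡ n′) {C D : Cospan n m} → C ≅ D →
                cast {Hom = Cospan} p refl C ≅ cast {Hom = Cospan} p refl D
    cast-cong refl i = i

-- Direct sums of matrices as coproducts

module MatrixCoproducts {c ℓ} (R : CommutativeRing c ℓ) where
  open CommutativeRing R
    using (Carrier; 0#; _+_; +-cong; +-congˡ; +-congʳ; +-identityˡ; +-identityʳ)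
    renaming (refl to reflᴿ; trans to transᴿ)
  open Matrices R
  open Action R
  open MatrixPROP R
  open PushoutTheory MatPROP-isPROP using (Coproducts)
  open ≈ᵛ-Reasoning

  inlᴹ : ∀ n m → Mat n (n +ℕ m)
  inlᴹ n m = idᴹ n ++ replicate m (replicate n 0#)

  inrᴹ : ∀ n m → Mat m (n +ℕ m)
  inrᴹ n m = replicate n (replicate m 0#) ++ idᴹ m

  [_,_]ᴹ : ∀ {n m q} → Mat n q → Mat m q → Mat (n +ℕ m) q
  [ A , B ]ᴹ i = A i ++ B i

  infixl 6 _+ᵛ_
  _+ᵛ_ : ∀ {n} → Vector Carrier n → Vector Carrier n → Vector Carrier n
  (x +ᵛ y) i = x i + y i

  0ᵛ : ∀ {n} → Vector Carrier n
  0ᵛ _ = 0#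

  +ᵛ-cong : ∀ {n} {x x′ y y′ : Vector Carrier n} → x ≈ᵛ x′ → y ≈ᵛ y′ → x +ᵛ y ≈ᵛ x′ +ᵛ y′
  +ᵛ-cong p q i = +-cong (p i) (q i)

  inl-▷ : ∀ n m x → inlᴹ n m ▷ x ≈ᵛ x ++ 0ᵛ
  inl-▷ n m x i with splitAt n i
  ... | inj₁ j = id-▷ n x j
  ... | inj₂ j = sum-0* x

  inr-▷ : ∀ n m x → inrᴹ n m ▷ x ≈ᵛ 0ᵛ ++ x
  inr-▷ n m x i with splitAt n i
  ... | inj₁ j = sum-0* x
  ... | inj₂ j = id-▷ m x j

  [,]-▷ : ∀ {n m q} (A : Mat n q) (B : Mat m q) x →
          [ A , B ]ᴹ ▷ x ≈ᵛ (A ▷ takeᵛ {n} x) +ᵛ (B ▷ dropᵛ {n} x)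
  [,]-▷ A B x i = sum-++-* (A i) (B i) x

  [,]-▷-++ : ∀ {n m q} (A : Mat n q) (B : Mat m q) x y → [ A , B ]ᴹ ▷ (x ++ y) ≈ᵛ (A ▷ x) +ᵛ (B ▷ y)
  [,]-▷-++ A B x y = ≈ᵛ-trans ([,]-▷ A B (x ++ y))
    (+ᵛ-cong (▷-congˡ {A = A} (take-++ x y)) (▷-congˡ {A = B} (drop-++ x y)))

  ++-+ᵛ : ∀ {n m} (x x′ : Vector Carrier n) (y y′ : Vector Carrier m) →
          (x ++ y) +ᵛ (x′ ++ y′) ≈ᵛ (x +ᵛ x′) ++ (y +ᵛ y′)
  ++-+ᵛ {n} x x′ y y′ i with splitAt n i
  ... | inj₁ j = reflᴿ
  ... | inj₂ j = reflᴿ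

  split-+ᵛ : ∀ {n m} (x : Vector Carrier (n +ℕ m)) →
             (takeᵛ {n} x ++ 0ᵛ) +ᵛ (0ᵛ ++ dropᵛ {n} x) ≈ᵛ x
  split-+ᵛ {n} x = ≈ᵛ-trans (++-+ᵛ (takeᵛ {n} x) 0ᵛ 0ᵛ (dropᵛ {n} x))
    (≈ᵛ-trans (++-cong {v = takeᵛ {n} x +ᵛ 0ᵛ} {w = 0ᵛ +ᵛ dropᵛ {n} x} (λ _ → +-identityʳ _) (λ _ → +-identityˡ _)) (take-++-drop {n} x))

  matrix-coproducts : Coproducts
  matrix-coproducts = record
    { inl = inlᴹ ; inr = inrᴹ ; [_,_] = [_,_]ᴹ
    ; inl-[,] = λ {n} {m} A B → ≋-ext λ x → begin
        (inlᴹ n m ⨾ᴹ [ A , B ]ᴹ) ▷ x  ≈⟨ ⨾-▷ (inlᴹ n m) [ A , B ]ᴹ x ⟩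
        [ A , B ]ᴹ ▷ inlᴹ n m ▷ x     ≈⟨ ▷-congˡ {A = [ A , B ]ᴹ} (inl-▷ n m x) ⟩
        [ A , B ]ᴹ ▷ (x ++ 0ᵛ)        ≈⟨ [,]-▷-++ A B x 0ᵛ ⟩
        (A ▷ x) +ᵛ (B ▷ 0ᵛ)           ≈⟨ (λ i → transᴿ (+-congˡ (▷-0 B i)) (+-identityʳ _)) ⟩
        A ▷ x                         ∎
    ; inr-[,] = λ {n} {m} A B → ≋-ext λ x → begin
        (inrᴹ n m ⨾ᴹ [ A , B ]ᴹ) ▷ x  ≈⟨ ⨾-▷ (inrᴹ n m) [ A , B ]ᴹ x ⟩
        [ A , B ]ᴹ ▷ inrᴹ n m ▷ x     ≈⟨ ▷-congˡ {A = [ A , B ]ᴹ} (inr-▷ n m x) ⟩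
        [ A , B ]ᴹ ▷ (0ᵛ ++ x)        ≈⟨ [,]-▷-++ A B 0ᵛ x ⟩
        (A ▷ 0ᵛ) +ᵛ (B ▷ x)           ≈⟨ (λ i → transᴿ (+-congʳ (▷-0 A i)) (+-identityˡ _)) ⟩
        B ▷ x                         ∎
    ; epi = λ {n} {m} {_} {A} {B} p q → ≋-ext λ x → begin
        A ▷ x
          ≈⟨ ▷-congˡ {A = A} (split {n} {m} x) ⟨
        A ▷ ((inlᴹ n m ▷ takeᵛ {n} x) +ᵛ (inrᴹ n m ▷ dropᵛ {n} x))
          ≈⟨ ▷-+ A _ _ ⟩
        (A ▷ inlᴹ n m ▷ takeᵛ {n} x) +ᵛ (A ▷ inrᴹ n m ▷ dropᵛ {n} x)
          ≈⟨ +ᵛ-cong (swap (inlᴹ n m) A B p (takeᵛ {n} x)) (swap (inrᴹ n m) A B q (dropᵛ {n} x)) ⟩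
        (B ▷ inlᴹ n m ▷ takeᵛ {n} x) +ᵛ (B ▷ inrᴹ n m ▷ dropᵛ {n} x)
          ≈⟨ ▷-+ B _ _ ⟨
        B ▷ ((inlᴹ n m ▷ takeᵛ {n} x) +ᵛ (inrᴹ n m ▷ dropᵛ {n} x))
          ≈⟨ ▷-congˡ {A = B} (split {n} {m} x) ⟩
        B ▷ x ∎
    ; inl-⊕ = λ {n} {m} {n′} {m′} A B → ≋-ext λ x → begin
        (inlᴹ n n′ ⨾ᴹ (A ⊕ᴹ B)) ▷ x   ≈⟨ ⨾-▷ (inlᴹ n n′) (A ⊕ᴹ B) x ⟩
        (A ⊕ᴹ B) ▷ inlᴹ n n′ ▷ x      ≈⟨ ▷-congˡ {A = A ⊕ᴹ B} (inl-▷ n n′ x) ⟩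
        (A ⊕ᴹ B) ▷ (x ++ 0ᵛ)          ≈⟨ ⊕-▷-++ A B x 0ᵛ ⟩
        (A ▷ x) ++ (B ▷ 0ᵛ)           ≈⟨ ++-congˡ (A ▷ x) (▷-0 B) ⟩
        (A ▷ x) ++ 0ᵛ                 ≈⟨ inl-▷ m m′ (A ▷ x) ⟨
        inlᴹ m m′ ▷ A ▷ x             ≈⟨ ⨾-▷ A (inlᴹ m m′) x ⟨
        (A ⨾ᴹ inlᴹ m m′) ▷ x          ∎
    ; inr-⊕ = λ {n} {m} {n′} {m′} A B → ≋-ext λ x → begin
        (inrᴹ n n′ ⨾ᴹ (A ⊕ᴹ B)) ▷ x   ≈⟨ ⨾-▷ (inrᴹ n n′) (A ⊕ᴹ B) x ⟩
        (A ⊕ᴹ B) ▷ inrᴹ n n′ ▷ x      ≈⟨ ▷-congˡ {A = A ⊕ᴹ B} (inr-▷ n n′ x) ⟩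
        (A ⊕ᴹ B) ▷ (0ᵛ ++ x)          ≈⟨ ⊕-▷-++ A B 0ᵛ x ⟩
        (A ▷ 0ᵛ) ++ (B ▷ x)           ≈⟨ ++-cong (▷-0 A) ≈ᵛ-refl ⟩
        0ᵛ ++ (B ▷ x)                 ≈⟨ inr-▷ m m′ (B ▷ x) ⟨
        inrᴹ m m′ ▷ B ▷ x             ≈⟨ ⨾-▷ B (inrᴹ m m′) x ⟨
        (B ⨾ᴹ inrᴹ m m′) ▷ x          ∎
    }
    where
    split : ∀ {n m} (x : Vector Carrier (n +ℕ m)) →
            (inlᴹ n m ▷ takeᵛ {n} x) +ᵛ (inrᴹ n m ▷ dropᵛ {n} x) ≈ᵛ x
    split {n} {m} x = ≈ᵛ-trans (+ᵛ-cong (inl-▷ n m _) (inr-▷ n m _)) (split-+ᵛ {n} x)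
    swap : ∀ {n m q} (J : Mat n m) (A B : Mat m q) → J ⨾ᴹ A ≋ J ⨾ᴹ B → ∀ x → A ▷ J ▷ x ≈ᵛ B ▷ J ▷ x
    swap J A B p x = ≈ᵛ-trans (≈ᵛ-sym (⨾-▷ J A x)) (≈ᵛ-trans (▷-cong p ≈ᵛ-refl) (⨾-▷ J B x))

-- The PROP laws for cospans of matrices

module CospanMatrices {c ℓ} (R : PrincipalIdealDomain c ℓ) where
  open PrincipalIdealDomain R using (commutativeRing)
  open Matrices commutativeRing
  open MatrixPROP commutativeRing using (MatPROP-isPROP)
  open MatrixCoproducts commutativeRing using (matrix-coproducts)
  open PushoutTheory MatPROP-isPROP using (IsPushout; Iso; iso-refl; iso-sym; iso-trans; iso-⨾; pushout-unique)
  open Cospans R using (Cospan; CospanMat; _≅_)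

  isPushout : ∀ {k n m} {f : Mat k n} {g : Mat k m} (P : Pushout f g) →
              IsPushout f g (Pushout.ι₁ P) (Pushout.ι₂ P)
  isPushout P = record
    { commutes = commutes ; universal = universal ; factor₁ = factor₁ ; factor₂ = factor₂ ; unique = unique }
    where open Pushout P

  -- Opaque, since unfolding the pushouts of nested composites is infeasible.
  opaque
    chosenPushout : ∀ {k n m} (f : Mat k n) (g : Mat k m) →
      Σ ℕ λ p → Σ (Mat n p) λ l → Σ (Mat m p) λ r → IsPushout f g l r
    chosenPushout f g = _ , _ , _ , isPushout (PIDPushouts.pushout R f g)

  module Theory = CospanTheory MatPROP-isPROP matrix-coproducts chosenPushout
  open Theory using (≅-refl; ≅-sym; ≅-trans) renaming (_≅_ to _≅ᵀ_; _⨾ᶜ_ to _⨾ᵀ_)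
  private
    module C = RawPROP CospanMat
    module L = IsPROP Theory.CospanPROP-isPROP

  -- Legs are unchanged; only composition differs, between the computed pushout on one side and the
  -- opaque one on the other. `⨾-abstract` compares the two, and every law is transported along it.
  abstractᶜ : ∀ {n m} → Cospan n m → Theory.Cospan n m
  abstractᶜ C = Theory.cospan (Cospan.left C) (Cospan.right C)

  fromIso : ∀ {n m} (C D : Cospan n m) → abstractᶜ C ≅ᵀ abstractᶜ D → C ≅ D
  fromIso C D i = record
    { to = to ; from = from ; to-from = invˡ ; from-to = invʳ ; left-to = left-to ; right-to = right-to }
    where open Iso i

  toIso : ∀ {n m} (C D : Cospan n m) → C ≅ D → abstractᶜ C ≅ᵀ abstractᶜ D
  toIso C D i = record
    { to = to ; from = from ; inverses = record { invˡ = to-from ; invʳ = from-to }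
    ; left-to = left-to ; right-to = right-to }
    where open _≅_ i

  cast-abstract : ∀ {n m n′ m′} (p : n ≡ n′) (q : m ≡ m′) (C : Cospan n m) →
    abstractᶜ (cast {Hom = Cospan} p q C) ≡ cast {Hom = Theory.Cospan} p q (abstractᶜ C)
  cast-abstract refl refl C = refl

  ⨾-abstract : ∀ {n m k} (C : Cospan n m) (D : Cospan m k) →
               abstractᶜ (C C.⨾ D) ≅ᵀ (abstractᶜ C ⨾ᵀ abstractᶜ D)
  ⨾-abstract C D = iso-⨾ (Cospan.left C) (Cospan.right D)
    (pushout-unique (isPushout (PIDPushouts.pushout R (Cospan.right C) (Cospan.left D)))
                    (Theory.pushout-square (Cospan.right C) (Cospan.left D)))

  ⨾-cong : ∀ {n m k} {C C′ : Theory.Cospan n m} {D D′ : Theory.Cospan m k} →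
           C ≅ᵀ C′ → D ≅ᵀ D′ → (C ⨾ᵀ D) ≅ᵀ (C′ ⨾ᵀ D′)
  ⨾-cong {C = C} {C′} {D} {D′} = L.⨾-cong {f = C} {C′} {D} {D′}

  ⨾-conjugate : ∀ {n m k k′} (C : Cospan n m) (D : Cospan m k) (E : Cospan n k′) (F : Cospan k′ k) →
    (abstractᶜ C ⨾ᵀ abstractᶜ D) ≅ᵀ (abstractᶜ E ⨾ᵀ abstractᶜ F) → (C C.⨾ D) ≅ (E C.⨾ F)
  ⨾-conjugate C D E F i = fromIso (C C.⨾ D) (E C.⨾ F)
    (iso-trans (⨾-abstract C D) (iso-trans i (iso-sym (⨾-abstract E F))))

  CospanMat-isPROP : IsPROP CospanMat
  CospanMat-isPROP = record
    { isEquivalence = λ {n} {m} → record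
        { refl = λ {C} → fromIso C C (≅-refl (abstractᶜ C))
        ; sym = λ {C} {D} i → fromIso D C (≅-sym (abstractᶜ C) (abstractᶜ D) (toIso C D i))
        ; trans = λ {C} {D} {E} i j →
            fromIso C E (≅-trans (abstractᶜ C) (abstractᶜ D) (abstractᶜ E) (toIso C D i) (toIso D E j)) }
    ; ⨾-cong = λ {_} {_} {_} {C} {C′} {D} {D′} i j →
        ⨾-conjugate C D C′ D′ (L.⨾-cong {f = abstractᶜ C} {abstractᶜ C′} {abstractᶜ D} {abstractᶜ D′} (toIso C C′ i) (toIso D D′ j))
    ; ⊕-cong = λ {_} {_} {_} {_} {C} {C′} {D} {D′} i j →
        fromIso (C C.⊕ D) (C′ C.⊕ D′) (L.⊕-cong {f = abstractᶜ C} {abstractᶜ C′} {abstractᶜ D} {abstractᶜ D′} (toIso C C′ i) (toIso D D′ j))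
    ; ⨾-assoc = λ C D E → ⨾-conjugate (C C.⨾ D) E C (D C.⨾ E)
        (iso-trans (⨾-cong {D = abstractᶜ E} (⨾-abstract C D) iso-refl)
        (iso-trans (L.⨾-assoc (abstractᶜ C) (abstractᶜ D) (abstractᶜ E))
                   (⨾-cong {C = abstractᶜ C} iso-refl (iso-sym (⨾-abstract D E)))))
    ; ⨾-identityˡ = λ C → fromIso (C.id _ C.⨾ C) C (iso-trans (⨾-abstract (C.id _) C) (L.⨾-identityˡ (abstractᶜ C)))
    ; ⨾-identityʳ = λ C → fromIso (C C.⨾ C.id _) C (iso-trans (⨾-abstract C (C.id _)) (L.⨾-identityʳ (abstractᶜ C)))
    ; ⊕-id = λ n m → fromIso (C.id n C.⊕ C.id m) (C.id (n +ℕ m)) (L.⊕-id n m)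
    ; interchange = λ C D C′ D′ →
        fromIso ((C C.⨾ D) C.⊕ (C′ C.⨾ D′)) ((C C.⊕ C′) C.⨾ (D C.⊕ D′))
          (iso-trans (L.⊕-cong {f = abstractᶜ (C C.⨾ D)} {abstractᶜ C ⨾ᵀ abstractᶜ D}
                               {abstractᶜ (C′ C.⨾ D′)} {abstractᶜ C′ ⨾ᵀ abstractᶜ D′}
                        (⨾-abstract C D) (⨾-abstract C′ D′))
          (iso-trans (L.interchange (abstractᶜ C) (abstractᶜ D) (abstractᶜ C′) (abstractᶜ D′))
                     (iso-sym (⨾-abstract (C C.⊕ C′) (D C.⊕ D′)))))
    ; ⊕-assoc = λ {n} {m} {n′} {m′} {n″} {m″} C D E →
        let p = +ℕ-assoc n n′ n″
            q = +ℕ-assoc m m′ m″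
            F = (C C.⊕ D) C.⊕ E
        in fromIso (cast {Hom = Cospan} p q F) (C C.⊕ (D C.⊕ E))
             (subst (_≅ᵀ abstractᶜ (C C.⊕ (D C.⊕ E))) (sym (cast-abstract p q F))
               (L.⊕-assoc (abstractᶜ C) (abstractᶜ D) (abstractᶜ E)))
    ; ⊕-identityˡ = λ C → fromIso (C.id 0 C.⊕ C) C (L.⊕-identityˡ (abstractᶜ C))
    ; ⊕-identityʳ = λ {n} {m} C →
        let p = +ℕ-identityʳ n
            q = +ℕ-identityʳ m
            F = C C.⊕ C.id 0
        in fromIso (cast {Hom = Cospan} p q F) C
             (subst (_≅ᵀ abstractᶜ C) (sym (cast-abstract p q F)) (L.⊕-identityʳ (abstractᶜ C)))
    ; σ-natural = λ {n} {m} {n′} {m′} C D →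
        ⨾-conjugate (C C.⊕ D) (C.σ m m′) (C.σ n n′) (D C.⊕ C)
          (L.σ-natural (abstractᶜ C) (abstractᶜ D))
    ; σ-involutive = λ n m → fromIso (C.σ n m C.⨾ C.σ m n) (C.id (n +ℕ m))
        (iso-trans (⨾-abstract (C.σ n m) (C.σ m n)) (L.σ-involutive n m))
    ; σ-hexagon = λ n m k →
        let p = +ℕ-assoc n m k
            p′ = sym (+ℕ-assoc k n m)
            q = +ℕ-assoc n k m
            F = C.σ (n +ℕ m) k
            G = C.σ n k C.⊕ C.id m
            H = C.id n C.⊕ C.σ m k
        in fromIso (cast {Hom = Cospan} p p′ F) (H C.⨾ cast {Hom = Cospan} q refl G)
             (iso-trans (subst₂ (λ X Y → X ≅ᵀ (abstractᶜ H ⨾ᵀ Y))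
               (sym (cast-abstract p p′ F)) (sym (cast-abstract q refl G)) (L.σ-hexagon n m k))
               (iso-sym (⨾-abstract H (cast {Hom = Cospan} q refl G))))
    }

-- The second hexagon, symmetry with the unit, and the opposite PROP

module Symmetry {a ℓ} {P : RawPROP a ℓ} (isPROP : IsPROP P) where
  open RawPROP P
  open PROPReasoning isPROP
  open ≈-Reasoning

  inverse-unique : ∀ {n m} {f : Hom n m} {g h : Hom m n} → f ⨾ g ≈ id n → h ⨾ f ≈ id m → h ≈ g
  inverse-unique {f = f} {g} {h} p q = begin
    h           ≈⟨ ⨾-identityʳ h ⟨
    h ⨾ id _    ≈⟨ refl⟩⨾⟨ p ⟨
    h ⨾ (f ⨾ g) ≈⟨ assoc²ʳ q ⟩
    id _ ⨾ g    ≈⟨ ⨾-identityˡ g ⟩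
    g           ∎

  cast-inverse : ∀ {n m n′ m′} (p : n ≡ n′) (q : m ≡ m′) {f : Hom n m} {g : Hom m n} →
                 f ⨾ g ≈ id n → cast {Hom = Hom} p q f ⨾ cast {Hom = Hom} q p g ≈ id n′
  cast-inverse refl refl e = e

  -- Both sides are inverse to the same arrow, the left by involutivity and the right by the given
  -- hexagon.
  σ-hexagon′ : ∀ n m k →
    cast {Hom = Hom} (sym (+ℕ-assoc k n m)) (+ℕ-assoc n m k) (σ k (n +ℕ m))
      ≈ cast {Hom = Hom} refl (+ℕ-assoc n k m) (σ k n ⊕ id m) ⨾ (id n ⊕ σ k m)
  σ-hexagon′ n m k = inverse-unique
    (begin
      cast {Hom = Hom} p q (σ (n +ℕ m) k) ⨾ (X ⨾ (id n ⊕ σ k m))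
        ≈⟨ σ-hexagon n m k ⟩⨾⟨refl ⟩
      ((id n ⊕ σ m k) ⨾ Y) ⨾ (X ⨾ (id n ⊕ σ k m))
        ≈⟨ ≈-trans (assoc²ʳ (cancelʳ Y-X)) merge ⟩
      (id n ⨾ id n) ⊕ (σ m k ⨾ σ k m)
        ≈⟨ ⨾-identityˡ _ ⟩⊕⟨ σ-involutive m k ⟩
      id n ⊕ id (m +ℕ k)
        ≈⟨ ⊕-id n (m +ℕ k) ⟩
      id (n +ℕ (m +ℕ k)) ∎)
    (cast-inverse q p (σ-involutive k (n +ℕ m)))
    where
    p = +ℕ-assoc n m k
    q = sym (+ℕ-assoc k n m)
    X = cast {Hom = Hom} refl (+ℕ-assoc n k m) (σ k n ⊕ id m)
    Y = cast {Hom = Hom} (+ℕ-assoc n k m) refl (σ n k ⊕ id m)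
    Y-X : Y ⨾ X ≈ id _
    Y-X = cast-inverse (+ℕ-assoc n k m) refl
      (≈-trans merge (≈-trans (σ-involutive n k ⟩⊕⟨ ⨾-identityˡ _) (⊕-id _ _)))

  -- The hexagon with two empty blocks makes this symmetry, once cast to `k`, idempotent; being
  -- invertible as well, it is the identity.
  σ-zeroˡ : ∀ k → σ 0 k ≈ʰ id k
  σ-zeroˡ k = transʰ (symʰ τ≈σ) (het (begin
      τ            ≈⟨ ⨾-identityʳ τ ⟨
      τ ⨾ id k     ≈⟨ refl⟩⨾⟨ inv ⟨
      τ ⨾ (τ ⨾ τ⁻) ≈⟨ assoc²ʳ idem ⟩
      τ ⨾ τ⁻       ≈⟨ inv ⟩
      id k         ∎))
    where
    e = +ℕ-identityʳ k
    τ = cast {Hom = Hom} refl e (σ 0 k)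
    τ⁻ = cast {Hom = Hom} e refl (σ k 0)
    τ≈σ : τ ≈ʰ σ 0 k
    τ≈σ = cast-het refl e
    inv : τ ⨾ τ⁻ ≈ id k
    inv = cast-inverse refl e (σ-involutive 0 k)
    idem : τ ⨾ τ ≈ τ
    idem = unhet (transʰ
      (⨾-congʰ (transʰ τ≈σ (het (≈-sym (⊕-identityˡ (σ 0 k)))))
               (transʰ τ≈σ (transʰ (symʰ (⊕-identityʳʰ (σ 0 k))) (symʰ (cast-het (+ℕ-assoc 0 k 0) refl)))))
      (transʰ (het (≈-sym (σ-hexagon 0 0 k)))
      (transʰ (cast-het (+ℕ-assoc 0 0 k) (sym (+ℕ-assoc k 0 0))) (symʰ τ≈σ))))

  σ-zeroʳ : σ 1 0 ≈ id 1
  σ-zeroʳ = inverse-unique (≈-trans (unhet (σ-zeroˡ 1) ⟩⨾⟨refl) (⨾-identityˡ _)) (σ-involutive 1 0)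

  -- Target of the converse `_†`, which thereby counts as an ordinary PROP morphism and is covered
  -- by the general induction on terms.
  opposite : RawPROP a ℓ
  opposite = record
    { Hom = λ n m → Hom m n ; _≈_ = _≈_ ; id = id ; _⨾_ = λ f g → g ⨾ f ; _⊕_ = _⊕_ ; σ = λ n m → σ m n }

  cast-opposite : ∀ {n m n′ m′} (p : n ≡ n′) (q : m ≡ m′) (f : Hom m n) →
    cast {Hom = λ n m → Hom m n} p q f ≡ cast {Hom = Hom} q p f
  cast-opposite refl refl f = refl

  opposite-isPROP : IsPROP opposite
  opposite-isPROP = record
    { isEquivalence = isEquivalence
    ; ⨾-cong = λ p q → ⨾-cong q p
    ; ⊕-cong = ⊕-cong
    ; ⨾-assoc = λ f g h → ≈-sym (⨾-assoc h g f)
    ; ⨾-identityˡ = ⨾-identityʳ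
    ; ⨾-identityʳ = ⨾-identityˡ
    ; ⊕-id = ⊕-id
    ; interchange = λ f g f′ g′ → interchange g f g′ f′
    ; ⊕-assoc = λ {n} {m} {n′} {m′} {n″} {m″} f g h →
        ≈-trans (reflexive (cast-opposite (+ℕ-assoc n n′ n″) (+ℕ-assoc m m′ m″) ((f ⊕ g) ⊕ h))) (⊕-assoc f g h)
    ; ⊕-identityˡ = ⊕-identityˡ
    ; ⊕-identityʳ = λ {n} {m} f →
        ≈-trans (reflexive (cast-opposite (+ℕ-identityʳ n) (+ℕ-identityʳ m) (f ⊕ id 0))) (⊕-identityʳ f)
    ; σ-natural = λ {n} {m} {n′} {m′} f g → ≈-sym (σ-natural g f)
    ; σ-involutive = λ n m → σ-involutive n m
    ; σ-hexagon = λ n m k → ≈-trans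
        (reflexive (cast-opposite (+ℕ-assoc n m k) (sym (+ℕ-assoc k n m)) (σ k (n +ℕ m))))
        (≈-trans (σ-hexagon′ n m k)
        (reflexive (cong (_⨾ (id n ⊕ σ k m)) (sym (cast-opposite (+ℕ-assoc n k m) refl (σ k n ⊕ id m))))))
    }
    where
    reflexive : ∀ {n m} {f g : Hom n m} → f ≡ g → f ≈ g
    reflexive = IsEquivalence.reflexive isEquivalence

-- Maps of terms that preserve the PROP structure

module StructurePreservation {a a′ ℓ′} {Gen : Signature a}
    {P : RawPROP a′ ℓ′} (isPROP : IsPROP P)
    (F : ∀ {n m} → Term Gen n m → RawPROP.Hom P n m)
    (F-id₀ : RawPROP._≈_ P (F id₀) (RawPROP.id P 0))
    (F-id₁ : RawPROP._≈_ P (F id₁) (RawPROP.id P 1))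
    (F-σ₁₁ : RawPROP._≈_ P (F σ₁₁) (RawPROP.σ P 1 1))
    (F-⨾ : ∀ {n m k} (f : Term Gen n m) (g : Term Gen m k) →
           RawPROP._≈_ P (F (f Term.⨾ g)) (RawPROP._⨾_ P (F f) (F g)))
    (F-⊕ : ∀ {n m n′ m′} (f : Term Gen n m) (g : Term Gen n′ m′) →
           RawPROP._≈_ P (F (f Term.⊕ g)) (RawPROP._⊕_ P (F f) (F g))) where
  open RawPROP P
  open PROPReasoning isPROP
  open Symmetry isPROP

  F-id : ∀ n → F (idᵗ n) ≈ id n
  F-id zero    = F-id₀
  F-id (suc n) = ≈-trans (F-⊕ id₁ (idᵗ n)) (≈-trans (F-id₁ ⟩⊕⟨ F-id n) (⊕-id 1 n))

  F-cast : ∀ {n m n′ m′} (p : n ≡ n′) (q : m ≡ m′) {f : Term Gen n m} →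
           F (cast {Hom = Term Gen} p q f) ≈ʰ F f
  F-cast refl refl = het ≈-refl

  -- The recursion defining `σ₁ᵗ` is the hexagon splitting the second argument, and that of `σᵗ` is
  -- the one splitting the first.
  F-σ₁ : ∀ m → F (σ₁ᵗ m) ≈ σ 1 m
  F-σ₁ zero    = ≈-trans F-id₁ (≈-sym σ-zeroʳ)
  F-σ₁ (suc m) = ≈-trans (F-⨾ _ _)
    (≈-trans (≈-trans (F-⊕ _ _) (F-σ₁₁ ⟩⊕⟨ F-id m) ⟩⨾⟨ ≈-trans (F-⊕ _ _) (F-id₁ ⟩⊕⟨ F-σ₁ m))
             (≈-sym (σ-hexagon′ 1 m 1)))

  F-σ : ∀ n m → F (σᵗ n m) ≈ σ n m
  F-σ zero    m = unhet (transʰ (F-cast refl (sym (+ℕ-identityʳ m))) (transʰ (het (F-id m)) (symʰ (σ-zeroˡ m))))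
  F-σ (suc n) m = unhet (transʰ (het (F-⨾ _ _))
    (transʰ (⨾-congʰ (het (≈-trans (F-⊕ _ _) (F-id₁ ⟩⊕⟨ F-σ n m)))
                     (transʰ (F-cast refl (+ℕ-assoc m 1 n)) (het (≈-trans (F-⊕ _ _) (F-σ₁ m ⟩⊕⟨ F-id n)))))
    (transʰ (het (≈-sym (σ-hexagon 1 n m))) (cast-het refl (sym (+ℕ-assoc m 1 n))))))

  F-shuffle : ∀ a b c d {a′ b′} (p : _ ≡ a′) (q : _ ≡ b′) →
              F (cast {Hom = Term Gen} p q (idᵗ a Term.⊕ (σᵗ b c Term.⊕ idᵗ d))) ≈
              cast {Hom = Hom} p q (id a ⊕ (σ b c ⊕ id d))
  F-shuffle a b c d p q = unhet (transʰ (F-cast p q)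
    (transʰ (het (≈-trans (F-⊕ _ _) (F-id a ⟩⊕⟨ ≈-trans (F-⊕ _ _) (F-σ b c ⟩⊕⟨ F-id d))))
            (symʰ (cast-het p q))))

  module Congruence {e} (E : Equations Gen e)
      (F-axiom : ∀ {n m} {f g : Term Gen n m} → E f g → F f ≈ F g) where

    F-cong : ∀ {n m} {f g : Term Gen n m} → _≃_ E f g → F f ≈ F g
    F-cong (axiom p)        = F-axiom p
    F-cong Defs.≃-refl           = ≈-refl
    F-cong (Defs.≃-sym p)        = ≈-sym (F-cong p)
    F-cong (Defs.≃-trans p q)    = ≈-trans (F-cong p) (F-cong q)
    F-cong (Defs.⨾-cong p q)     = ≈-trans (F-⨾ _ _) (≈-trans (F-cong p ⟩⨾⟨ F-cong q) (≈-sym (F-⨾ _ _)))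
    F-cong (Defs.⊕-cong p q)     = ≈-trans (F-⊕ _ _) (≈-trans (F-cong p ⟩⊕⟨ F-cong q) (≈-sym (F-⊕ _ _)))
    F-cong (Defs.⨾-assoc f g h)  =
      ≈-trans (≈-trans (F-⨾ _ _) (F-⨾ f g ⟩⨾⟨refl))
      (≈-trans (⨾-assoc _ _ _) (≈-sym (≈-trans (F-⨾ _ _) (refl⟩⨾⟨ F-⨾ g h))))
    F-cong (Defs.⨾-identityˡ f)  = ≈-trans (F-⨾ _ _) (≈-trans (F-id _ ⟩⨾⟨refl) (⨾-identityˡ _))
    F-cong (Defs.⨾-identityʳ f)  = ≈-trans (F-⨾ _ _) (≈-trans (refl⟩⨾⟨ F-id _) (⨾-identityʳ _))
    F-cong (Defs.⊕-id n m)       =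
      ≈-trans (F-⊕ _ _) (≈-trans (F-id n ⟩⊕⟨ F-id m) (≈-trans (⊕-id n m) (≈-sym (F-id (n +ℕ m)))))
    F-cong (Defs.interchange f g f′ g′) =
      ≈-trans (F-⊕ _ _) (≈-trans (F-⨾ f g ⟩⊕⟨ F-⨾ f′ g′) (≈-trans (interchange _ _ _ _)
        (≈-sym (≈-trans (F-⨾ _ _) (F-⊕ f f′ ⟩⨾⟨ F-⊕ g g′)))))
    F-cong (Defs.⊕-assoc {n} {m} {n′} {m′} {n″} {m″} f g h) =
      unhet (transʰ (F-cast (+ℕ-assoc n n′ n″) (+ℕ-assoc m m′ m″))
      (transʰ (het (≈-trans (F-⊕ _ _) (F-⊕ f g ⟩⊕⟨refl)))
      (transʰ (⊕-assocʰ (F f) (F g) (F h)) (het (≈-sym (≈-trans (F-⊕ _ _) (refl⟩⊕⟨ F-⊕ g h)))))))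
    F-cong (Defs.⊕-identityˡ f)  = ≈-trans (F-⊕ _ _) (≈-trans (F-id₀ ⟩⊕⟨refl) (⊕-identityˡ _))
    F-cong (Defs.⊕-identityʳ {n} {m} f) =
      unhet (transʰ (F-cast (+ℕ-identityʳ n) (+ℕ-identityʳ m))
      (transʰ (het (≈-trans (F-⊕ _ _) (refl⟩⊕⟨ F-id₀))) (⊕-identityʳʰ (F f))))
    F-cong (Defs.σ-natural {n} {m} {n′} {m′} f g) =
      ≈-trans (≈-trans (F-⨾ _ _) (F-⊕ f g ⟩⨾⟨ F-σ m m′)) (≈-trans (σ-natural _ _)
        (≈-sym (≈-trans (F-⨾ _ _) (F-σ n n′ ⟩⨾⟨ F-⊕ g f))))
    F-cong (Defs.σ-involutive n m) =
      ≈-trans (F-⨾ _ _) (≈-trans (F-σ n m ⟩⨾⟨ F-σ m n) (≈-trans (σ-involutive n m) (≈-sym (F-id (n +ℕ m)))))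
    F-cong (Defs.σ-hexagon n m k) =
      unhet (transʰ (F-cast (+ℕ-assoc n m k) (sym (+ℕ-assoc k n m)))
      (transʰ (het (F-σ (n +ℕ m) k))
      (transʰ (symʰ (cast-het (+ℕ-assoc n m k) (sym (+ℕ-assoc k n m))))
      (transʰ (het (σ-hexagon n m k))
      (transʰ (⨾-congʰ (het (≈-sym (≈-trans (F-⊕ _ _) (F-id n ⟩⊕⟨ F-σ m k))))
                       (transʰ (cast-het (+ℕ-assoc n k m) refl)
                       (transʰ (het (≈-sym (≈-trans (F-⊕ _ _) (F-σ n k ⟩⊕⟨ F-id m))))
                               (symʰ (F-cast (+ℕ-assoc n k m) refl)))))
              (het (≈-sym (F-⨾ _ _))))))))

-- Matrices of terms of HA

module Evaluation {c ℓ} (R : PrincipalIdealDomain c ℓ) where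
  open PrincipalIdealDomain R using (commutativeRing)
  open CommutativeRing commutativeRing
    using (Carrier; 0#; 1#; _+_; _*_; +-cong; +-congˡ; +-identityʳ; *-identityˡ)
    renaming (_≈_ to _≈ᴿ_; refl to reflᴿ; sym to symᴿ; trans to transᴿ)
  open HopfAlgebras commutativeRing using (HAGen; Δ; ε; μ; η; s; HAEq; HA)
  open Matrices commutativeRing
  open MatrixPROP commutativeRing
  open Action commutativeRing
  open HopfCompleteness commutativeRing using (canonical; accumulate; zeros; complete)
  open Interpretation R using (𝓜)

  eval : ∀ {n m} → Term HAGen n m → Mat n m
  eval (gen g)      = 𝓜 g
  eval id₀          = idᴹ 0
  eval id₁          = idᴹ 1
  eval σ₁₁          = σᴹ 1 1
  eval (f Term.⨾ g) = eval f ⨾ᴹ eval g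
  eval (f Term.⊕ g) = eval f ⊕ᴹ eval g

  eval-▷ : ∀ {n m} (t : Term HAGen n m) x → eval t ▷ x ≈ᵛ act t x
  eval-▷ (gen Δ)     x i = transᴿ (+-identityʳ _) (*-identityˡ _)
  eval-▷ (gen ε)     x ()
  eval-▷ (gen μ)     x i = +-cong (*-identityˡ _) (transᴿ (+-identityʳ _) (*-identityˡ _))
  eval-▷ (gen η)     x i = reflᴿ
  eval-▷ (gen (s k)) x i = +-identityʳ _
  eval-▷ id₀ x = id-▷ 0 x
  eval-▷ id₁ x = id-▷ 1 x
  eval-▷ σ₁₁ x = ≈ᵛ-trans (σ-▷ 1 1 x) λ { zero → reflᴿ ; (suc zero) → reflᴿ }
  eval-▷ (f Term.⨾ g) x =
    ≈ᵛ-trans (⨾-▷ (eval f) (eval g) x) (≈ᵛ-trans (▷-congˡ {A = eval g} (eval-▷ f x)) (eval-▷ g (act f x)))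
  eval-▷ (Term._⊕_ {n} f g) x =
    ≈ᵛ-trans (⊕-▷ (eval f) (eval g) x) (++-cong (eval-▷ f (takeᵛ {n} x)) (eval-▷ g (dropᵛ {n} x)))

  act-accumulate : ∀ {m} (v : Vector Carrier m) x i → act (accumulate v) x i ≈ᴿ v i * x zero + x (suc i)
  act-accumulate {suc m} v x zero = reflᴿ
  act-accumulate {suc m} v x (suc i) =
    transᴿ (act-accumulate (tail v) _ i) (+-congˡ (act-id m (λ j → x (suc (suc j))) i))

  act-zeros : ∀ m x → act (zeros m) x ≈ᵛ λ _ → 0#
  act-zeros (suc m) x zero    = reflᴿ
  act-zeros (suc m) x (suc i) = act-zeros m _ i

  act-canonical : ∀ {n m} (A : Mat n m) x → act (canonical A) x ≈ᵛ A ▷ x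
  act-canonical {zero}  A x i = act-zeros _ x i
  act-canonical {suc n} A x i = transᴿ (act-accumulate (λ i → A i zero) _ i)
    (+-congˡ (act-canonical (λ i j → A i (suc j)) (tail x) i))

  eval-canonical : ∀ {n m} (A : Mat n m) → eval (canonical A) ≋ A
  eval-canonical A = ≋-ext λ x → ≈ᵛ-trans (eval-▷ (canonical A) x) (act-canonical A x)

  eval-complete : ∀ {n m} {t u : Term HAGen n m} → eval t ≋ eval u → RawPROP._≈_ HA t u
  eval-complete {t = t} {u} p = complete λ x →
    ≈ᵛ-trans (≈ᵛ-sym (eval-▷ t x)) (≈ᵛ-trans (▷-cong p ≈ᵛ-refl) (eval-▷ u x))

-- The images F and G of matrices, and the converse of a term

module Functors {c ℓ} (R : PrincipalIdealDomain c ℓ) where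
  open PrincipalIdealDomain R using (commutativeRing; isPID)
  open CommutativeRing commutativeRing
    using (Carrier; 0#; 1#; -_; _+_; _*_; ring; *-identityˡ; -‿cong)
    renaming (_≈_ to _≈ᴿ_; refl to reflᴿ; sym to symᴿ; trans to transᴿ)
  open import Algebra.Properties.Ring ring using (-1*x≈-x; -‿involutive; -0#≈0#)
  open HopfAlgebras commutativeRing using (HAGen; Δ; ε; μ; η; s; HAEq; HA; s-cong; a11; a12)
  open InteractingHopfAlgebras commutativeRing
  open Matrices commutativeRing
  open MatrixPROP commutativeRing
  open HopfCompleteness commutativeRing using (canonical; complete; canonical-cong)
  open Action commutativeRing
  open Evaluation R
  open RawPROP IHᶜᵖ using (_≈_; id; _⨾_; _⊕_; σ)
  IH-isPROP : IsPROP IHᶜᵖ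
  IH-isPROP = presented-isPROP IHEq
  open PROPReasoning IH-isPROP
  open PresentedStructure IHEq
  open Symmetry IH-isPROP using (opposite-isPROP)
  open ≈-Reasoning

  private module ⟦⟧ = StructurePreservation IH-isPROP ⟦_⟧ ≈-refl id₁≈id (≈-sym σ≈σ₁₁)
                        (λ _ _ → ≈-refl) (λ _ _ → ≈-refl)
  open ⟦⟧.Congruence HAEq (λ p → axiom (ha p)) renaming (F-cong to ⟦⟧-cong) public
  open ⟦⟧ using () renaming (F-id to ⟦⟧-id; F-σ to ⟦⟧-σ) public

  infix 9 _†
  _† : ∀ {n m} → Term IHGen n m → Term IHGen m n
  gen (fwd g) †    = gen (bwd g)
  gen (bwd g) †    = gen (fwd g)
  id₀ †            = id₀
  id₁ †            = id₁
  σ₁₁ †            = σ₁₁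
  (f Term.⨾ g) †   = g † ⨾ f †
  (f Term.⊕ g) †   = f † ⊕ g †

  ⟦⟧† : ∀ {n m} (t : Term HAGen n m) → ⟦ t ⟧ † ≡ ⟦ t ⟧ᵒᵖ
  ⟦⟧† (gen g)      = refl
  ⟦⟧† id₀          = refl
  ⟦⟧† id₁          = refl
  ⟦⟧† σ₁₁          = refl
  ⟦⟧† (f Term.⨾ g) = cong₂ _⨾_ (⟦⟧† g) (⟦⟧† f)
  ⟦⟧† (f Term.⊕ g) = cong₂ _⊕_ (⟦⟧† f) (⟦⟧† g)

  ⟦⟧ᵒᵖ† : ∀ {n m} (t : Term HAGen n m) → ⟦ t ⟧ᵒᵖ † ≡ ⟦ t ⟧
  ⟦⟧ᵒᵖ† (gen g)      = refl
  ⟦⟧ᵒᵖ† id₀          = refl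
  ⟦⟧ᵒᵖ† id₁          = refl
  ⟦⟧ᵒᵖ† σ₁₁          = refl
  ⟦⟧ᵒᵖ† (f Term.⨾ g) = cong₂ _⨾_ (⟦⟧ᵒᵖ† f) (⟦⟧ᵒᵖ† g)
  ⟦⟧ᵒᵖ† (f Term.⊕ g) = cong₂ _⊕_ (⟦⟧ᵒᵖ† f) (⟦⟧ᵒᵖ† g)

  -1≉0 : ¬ (- 1# ≈ᴿ 0#)
  -1≉0 p = IsPID.1≉0 isPID (transᴿ (symᴿ (-‿involutive 1#)) (transᴿ (-‿cong p) -0#≈0#))

  s₋₁² : s⟨ - 1# ⟩ ⨾ s⟨ - 1# ⟩ ≈ id₁
  s₋₁² = ≈-trans (axiom (ha (a12 (- 1#) (- 1#))))
    (≈-trans (axiom (ha (s-cong (transᴿ (-1*x≈-x (- 1#)) (-‿involutive 1#))))) (axiom (ha a11)))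

  -- `s⟨ - 1# ⟩` is its own inverse, and (B1) makes `s̄⟨ - 1# ⟩` another left inverse of it, as -1
  -- is non-zero. Reversing (B5) or (B6) produces the latter where the partner axiom has the former.
  s̄₋₁≈s₋₁ : s̄⟨ - 1# ⟩ ≈ s⟨ - 1# ⟩
  s̄₋₁≈s₋₁ = begin
    s̄⟨ - 1# ⟩                               ≈⟨ ⨾-identityʳ _ ⟨
    s̄⟨ - 1# ⟩ ⨾ id 1                        ≈⟨ refl⟩⨾⟨ ≈-trans s₋₁² id₁≈id ⟨
    s̄⟨ - 1# ⟩ ⨾ (s⟨ - 1# ⟩ ⨾ s⟨ - 1# ⟩)     ≈⟨ assoc²ʳ (≈-trans (axiom (b1 _ -1≉0)) id₁≈id) ⟩
    id 1 ⨾ s⟨ - 1# ⟩                        ≈⟨ ⨾-identityˡ _ ⟩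
    s⟨ - 1# ⟩                               ∎

  -- The axioms are closed under reversal: the two halves of (B3), and those of (B4), trade places,
  -- as do (B5) with (B6) and (B7) with (B8), while (B1) and (B2) are fixed.
  †-axiom : ∀ {n m} {f g : Term IHGen n m} → IHEq f g → f † ≈ g †
  †-axiom (ha {f = f} {g} p)   = subst₂ _≈_ (sym (⟦⟧† f)) (sym (⟦⟧† g)) (axiom (haᵒᵖ p))
  †-axiom (haᵒᵖ {f = f} {g} p) = subst₂ _≈_ (sym (⟦⟧ᵒᵖ† f)) (sym (⟦⟧ᵒᵖ† g)) (axiom (ha p))
  †-axiom (b1 l l≉0) = axiom (b1 l l≉0)
  †-axiom b2         = axiom b2
  †-axiom b3ˡ        = ≈-sym (axiom b3ʳ)
  †-axiom b3ʳ        = ≈-sym (axiom b3ˡ)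
  †-axiom b4ˡ        = ≈-sym (axiom b4ʳ)
  †-axiom b4ʳ        = ≈-sym (axiom b4ˡ)
  †-axiom b5         = ≈-trans (axiom b6) (≈-trans (⨾-assoc _ _ _) ((refl⟩⊕⟨ ≈-sym s̄₋₁≈s₋₁) ⟩⨾⟨refl))
  †-axiom b6         = ≈-trans (axiom b5) (≈-trans (refl⟩⨾⟨ (refl⟩⊕⟨ ≈-sym s̄₋₁≈s₋₁)) (⨾-assoc _ _ _))
  †-axiom (b7 k)     = ≈-trans (axiom (b8 k)) (⨾-assoc _ _ _)
  †-axiom (b8 k)     = ≈-trans (axiom (b7 k)) (⨾-assoc _ _ _)

  private module † = StructurePreservation opposite-isPROP _† ≈-refl id₁≈id (≈-sym σ≈σ₁₁)
                       (λ _ _ → ≈-refl) (λ _ _ → ≈-refl)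
  open †.Congruence IHEq †-axiom renaming (F-cong to †-cong) public
  open † using () renaming (F-id to †-id) public

  private module E = StructurePreservation MatPROP-isPROP eval (λ _ _ → reflᴿ) (λ _ _ → reflᴿ) (λ _ _ → reflᴿ)
                       (λ _ _ _ _ → reflᴿ) (λ _ _ _ _ → reflᴿ)

  opaque
    F : ∀ {n m} → Mat n m → Term IHGen n m
    F A = ⟦ canonical A ⟧

    G : ∀ {n m} → Mat n m → Term IHGen m n
    G A = F A †

    -- Completeness of HA in the form used from here on: a diagram is recognised as the image of a
    -- matrix by evaluating it.
    F-interp : ∀ {n m} (t : Term HAGen n m) {A : Mat n m} → eval t ≋ A → ⟦ t ⟧ ≈ F A
    F-interp t {A} p = ⟦⟧-cong (eval-complete {t = t} {canonical A} λ i j → transᴿ (p i j) (symᴿ (eval-canonical A i j)))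

    G-interp : ∀ {n m} (t : Term HAGen n m) {A : Mat n m} → eval t ≋ A → ⟦ t ⟧ † ≈ G A
    G-interp t p = †-cong (F-interp t p)

    F-† : ∀ {n m} (A : Mat n m) → F A † ≈ G A
    F-† A = ≈-refl

    ⟦⟧-complete : ∀ {n m} {t u : Term HAGen n m} → (∀ x → act t x ≈ᵛ act u x) → ⟦ t ⟧ ≈ ⟦ u ⟧
    ⟦⟧-complete p = ⟦⟧-cong (complete p)

    F-⨾ : ∀ {n m k} {A : Mat n m} {B : Mat m k} {C : Mat n k} → A ⨾ᴹ B ≋ C → F A ⨾ F B ≈ F C
    F-⨾ {A = A} {B} p = F-interp (canonical A Term.⨾ canonical B)
      λ i j → transᴿ (⨾ᴹ-cong (eval-canonical A) (eval-canonical B) i j) (p i j)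

    F-⊕ : ∀ {n m n′ m′} {A : Mat n m} {B : Mat n′ m′} {C : Mat (n +ℕ n′) (m +ℕ m′)} →
          A ⊕ᴹ B ≋ C → F A ⊕ F B ≈ F C
    F-⊕ {A = A} {B} p = F-interp (canonical A Term.⊕ canonical B)
      λ i j → transᴿ (⊕ᴹ-cong (eval-canonical A) (eval-canonical B) i j) (p i j)

    F-cong : ∀ {n m} {A B : Mat n m} → A ≋ B → F A ≈ F B
    F-cong p = ⟦⟧-cong (canonical-cong p)

    G-cong : ∀ {n m} {A B : Mat n m} → A ≋ B → G A ≈ G B
    G-cong p = †-cong (F-cong p)

    G-⨾ : ∀ {n m k} {A : Mat n m} {B : Mat m k} {C : Mat n k} → A ⨾ᴹ B ≋ C → G B ⨾ G A ≈ G C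
    G-⨾ {A = A} {B} p = †-cong (F-⨾ {A = A} {B} p)

    G-⊕ : ∀ {n m n′ m′} {A : Mat n m} {B : Mat n′ m′} {C : Mat (n +ℕ n′) (m +ℕ m′)} →
          A ⊕ᴹ B ≋ C → G A ⊕ G B ≈ G C
    G-⊕ {A = A} {B} p = †-cong (F-⊕ {A = A} {B} p)

    F-id : ∀ {n} {A : Mat n n} → idᴹ n ≋ A → id n ≈ F A
    F-id {n} p = ≈-trans (≈-sym (⟦⟧-id n)) (F-interp (idᵗ n) λ i j → transᴿ (E.F-id n i j) (p i j))

    G-id : ∀ {n} {A : Mat n n} → idᴹ n ≋ A → id n ≈ G A
    G-id {n} p = ≈-trans (≈-sym (†-id n)) (†-cong (F-id p))

    F-σ : ∀ n m → σ n m ≈ F (σᴹ n m)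
    F-σ n m = ≈-trans (≈-sym (⟦⟧-σ n m)) (F-interp (σᵗ n m) (E.F-σ n m))

  F-shuffle : ∀ a b c d → shuffle a b c d ≈ F (Shuffle.shuffle MatPROP a b c d)
  F-shuffle a b c d = ≈-trans
    (≈-sym (⟦⟧.F-shuffle a b c d (regroup a b c d) (regroup a c b d)))
    (F-interp (Shuffle.shuffle HA a b c d) (E.F-shuffle a b c d (regroup a b c d) (regroup a c b d)))

-- Addition of vectors as a matrix

module RingIdentities {c ℓ} (R : CommutativeRing c ℓ) where
  open CommutativeRing R hiding (refl; sym; zero) renaming (trans to transᴿ)
  open import Algebra.Properties.Ring ring using (-1*x≈-x)
  open SetoidReasoning setoid

  -- Adding z to both terms leaves a difference unchanged; this is the coordinate that decides
  -- `absorbs-Δ`.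
  cancel-shear : ∀ x y z → (x + z) + - 1# * (y + z) ≈ x + - 1# * y
  cancel-shear x y z = begin
    (x + z) + - 1# * (y + z)          ≈⟨ +-congˡ (distribˡ _ _ _) ⟩
    (x + z) + (- 1# * y + - 1# * z)   ≈⟨ +-congˡ (+-comm _ _) ⟩
    (x + z) + (- 1# * z + - 1# * y)   ≈⟨ +-assoc _ _ _ ⟩
    x + (z + (- 1# * z + - 1# * y))   ≈⟨ +-congˡ (+-assoc _ _ _) ⟨
    x + ((z + - 1# * z) + - 1# * y)   ≈⟨ +-congˡ (+-congʳ (transᴿ (+-congˡ (-1*x≈-x z)) (-‿inverseʳ z))) ⟩
    x + (0# + - 1# * y)               ≈⟨ +-congˡ (+-identityˡ _) ⟩
    x + - 1# * y                      ∎

module AdditionMatrix {c ℓ} (R : CommutativeRing c ℓ) where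
  open CommutativeRing R using (Carrier; _+_; 0#)
  open Matrices R
  open MatrixPROP R
  open MatrixCoproducts R
  open Action R
  open Shuffle MatPROP
  open ≈ᵛ-Reasoning

  addᴹ : ∀ n → Mat (n +ℕ n) n
  addᴹ n = [ idᴹ n , idᴹ n ]ᴹ

  add-▷ : ∀ n x → addᴹ n ▷ x ≈ᵛ takeᵛ {n} x +ᵛ dropᵛ {n} x
  add-▷ n x = ≈ᵛ-trans ([,]-▷ (idᴹ n) (idᴹ n) x) (+ᵛ-cong (id-▷ n _) (id-▷ n _))

  add-▷-++ : ∀ n x y → addᴹ n ▷ (x ++ y) ≈ᵛ x +ᵛ y
  add-▷-++ n x y = ≈ᵛ-trans ([,]-▷-++ (idᴹ n) (idᴹ n) x y) (+ᵛ-cong (id-▷ n x) (id-▷ n y))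

  ++-regroup : ∀ {a b c d} (u : Vector Carrier a) (v : Vector Carrier b) (w : Vector Carrier c) (z : Vector Carrier d) →
               (u ++ v) ++ (w ++ z) ≈ʰᵛ u ++ ((v ++ w) ++ z)
  ++-regroup u v w z = transʰᵛ (++-assocʰᵛ u v (w ++ z)) (++-congʰᵛ {x = u} {u} (homᵛ ≈ᵛ-refl) (symʰᵛ (++-assocʰᵛ v w z)))

  shuffle-▷ : ∀ {a b c d} (u : Vector Carrier a) (v : Vector Carrier b) (w : Vector Carrier c) (z : Vector Carrier d) →
              shuffle a b c d ▷ ((u ++ v) ++ (w ++ z)) ≈ᵛ (u ++ w) ++ (v ++ z)
  shuffle-▷ {a} {b} {c} {d} u v w z = unhetᵛ (transʰᵛ
    (cast-▷ (regroup a b c d) (regroup a c b d) {idᴹ a ⊕ᴹ (σᴹ b c ⊕ᴹ idᴹ d)} (++-regroup u v w z))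
    (transʰᵛ (homᵛ (begin
        (idᴹ a ⊕ᴹ (σᴹ b c ⊕ᴹ idᴹ d)) ▷ (u ++ ((v ++ w) ++ z))
          ≈⟨ ⊕-▷-++ (idᴹ a) (σᴹ b c ⊕ᴹ idᴹ d) u ((v ++ w) ++ z) ⟩
        (idᴹ a ▷ u) ++ ((σᴹ b c ⊕ᴹ idᴹ d) ▷ ((v ++ w) ++ z))
          ≈⟨ ++-cong (id-▷ a u) (⊕-▷-++ (σᴹ b c) (idᴹ d) (v ++ w) z) ⟩
        u ++ ((σᴹ b c ▷ (v ++ w)) ++ (idᴹ d ▷ z))
          ≈⟨ ++-congˡ u (++-cong (σ-▷-++ b c v w) (id-▷ d z)) ⟩
        u ++ ((w ++ v) ++ z) ∎))
    (symʰᵛ (++-regroup u w v z))))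

  -- Lets absorption for `f ⊕ g` be checked on the two blocks separately.
  shuffle-add : ∀ n m → shuffle n m n m ⨾ᴹ (addᴹ n ⊕ᴹ addᴹ m) ≋ addᴹ (n +ℕ m)
  shuffle-add n m = ≋-ext λ x →
    let u = takeᵛ {n} (takeᵛ {n +ℕ m} x)
        v = dropᵛ {n} (takeᵛ {n +ℕ m} x)
        w = takeᵛ {n} (dropᵛ {n +ℕ m} x)
        z = dropᵛ {n} (dropᵛ {n +ℕ m} x)
        x≈ = ≈ᵛ-trans (≈ᵛ-sym (take-++-drop {n +ℕ m} x))
               (≈ᵛ-sym (++-cong (take-++-drop {n} (takeᵛ {n +ℕ m} x)) (take-++-drop {n} (dropᵛ {n +ℕ m} x))))
    in begin
      (shuffle n m n m ⨾ᴹ (addᴹ n ⊕ᴹ addᴹ m)) ▷ x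
        ≈⟨ ⨾-▷ (shuffle n m n m) (addᴹ n ⊕ᴹ addᴹ m) x ⟩
      (addᴹ n ⊕ᴹ addᴹ m) ▷ shuffle n m n m ▷ x
        ≈⟨ ▷-congˡ {A = addᴹ n ⊕ᴹ addᴹ m} (≈ᵛ-trans (▷-congˡ {A = shuffle n m n m} x≈) (shuffle-▷ u v w z)) ⟩
      (addᴹ n ⊕ᴹ addᴹ m) ▷ ((u ++ w) ++ (v ++ z))
        ≈⟨ ⊕-▷-++ (addᴹ n) (addᴹ m) (u ++ w) (v ++ z) ⟩
      (addᴹ n ▷ (u ++ w)) ++ (addᴹ m ▷ (v ++ z))
        ≈⟨ ++-cong (add-▷-++ n u w) (add-▷-++ m v z) ⟩
      (u +ᵛ w) ++ (v +ᵛ z)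
        ≈⟨ ++-+ᵛ u w v z ⟨
      (u ++ v) +ᵛ (w ++ z)
        ≈⟨ add-▷-++ (n +ℕ m) (u ++ v) (w ++ z) ⟨
      addᴹ (n +ℕ m) ▷ ((u ++ v) ++ (w ++ z))
        ≈⟨ ▷-congˡ {A = addᴹ (n +ℕ m)} x≈ ⟨
      addᴹ (n +ℕ m) ▷ x ∎

-- The absorption law

module Absorption {c ℓ} (R : PrincipalIdealDomain c ℓ) where
  open PrincipalIdealDomain R using (commutativeRing)
  open CommutativeRing commutativeRing
    using (Carrier; 0#; 1#; -_; _+_; _*_; ring; +-identityˡ; +-identityʳ; +-assoc; +-comm; +-congˡ; +-congʳ; -‿inverseʳ; distribˡ)
    renaming (refl to reflᴿ; sym to symᴿ)
  open HopfAlgebras commutativeRing using (HAGen; Δ; ε; μ; η; s; a1; a2; a3; a4; a16; a17)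
  open InteractingHopfAlgebras commutativeRing
  open Matrices commutativeRing
  open MatrixPROP commutativeRing
  open MatrixCoproducts commutativeRing
  open AdditionMatrix commutativeRing
  open Action commutativeRing
  open Evaluation R
  open Functors R
  open RawPROP IHᶜᵖ using (_≈_; id; _⨾_; _⊕_)
  open PROPReasoning IH-isPROP
  open PresentedStructure IHEq
  open ≈-Reasoning
  open RingIdentities commutativeRing

  add : ∀ n → Term IHGen (n +ℕ n) n
  add n = F (addᴹ n)

  ⟦⟧-add : ∀ {n} (t : Term HAGen (n +ℕ n) n) → (∀ x → act t x ≈ᵛ takeᵛ {n} x +ᵛ dropᵛ {n} x) → ⟦ t ⟧ ≈ add n
  ⟦⟧-add {n} t p = F-interp t (≋-ext λ x → ≈ᵛ-trans (eval-▷ t x) (≈ᵛ-trans (p x) (≈ᵛ-sym (add-▷ n x))))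

  μ≈add : μ∘ ≈ add 1
  μ≈add = ⟦⟧-add (gen μ) λ { x zero → reflᴿ }

  add-shuffle : ∀ n m → add (n +ℕ m) ≈ shuffle n m n m ⨾ (add n ⊕ add m)
  add-shuffle n m = ≈-sym (≈-trans
    (F-shuffle n m n m ⟩⨾⟨ F-⊕ {C = addᴹ n ⊕ᴹ addᴹ m} (λ _ _ → reflᴿ)) (F-⨾ (shuffle-add n m)))

  -- (B7) is the case of a scalar. Relationally, with inputs x, y and output w, both sides state
  -- `f (w - y) = x`: the left solves `f z = x` and `z + y = w`, the right compares `x + f y` with
  -- `f w`.
  record Absorbs {n m} (f : Term IHGen n m) : Set (c ⊔ ℓ) where
    constructor absorbs
    field absorb : (f † ⊕ id n) ⨾ add n ≈ (id m ⊕ f) ⨾ add m ⨾ f †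
  open Absorbs public

  absorbs-⨾ : ∀ {n m k} {f : Term IHGen n m} {g : Term IHGen m k} →
              Absorbs f → Absorbs g → Absorbs (f ⨾ g)
  absorbs-⨾ {n} {m} {k} {f} {g} p q .absorb = begin
    ((g † ⨾ f †) ⊕ id n) ⨾ add n                      ≈⟨ ⨾-⊕-id ⟩⨾⟨refl ⟩
    (g † ⊕ id n) ⨾ (f † ⊕ id n) ⨾ add n               ≈⟨ assoc²ˡ (≈-trans (p .absorb) (⨾-assoc _ _ _)) ⟩
    (g † ⊕ id n) ⨾ ((id m ⊕ f) ⨾ (add m ⨾ f †))       ≈⟨ assoc²ʳ exchange ⟩
    (id k ⊕ f) ⨾ (g † ⊕ id m) ⨾ (add m ⨾ f †)         ≈⟨ ≈-trans (assoc²ˡ (≈-trans (≈-sym (⨾-assoc _ _ _)) (q .absorb ⟩⨾⟨refl)))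
                                                                 (≈-trans (refl⟩⨾⟨ ≈-trans (⨾-assoc _ _ _) (⨾-assoc _ _ _)) (≈-sym (⨾-assoc _ _ _))) ⟩
    (id k ⊕ f) ⨾ (id k ⊕ g) ⨾ (add k ⨾ (g † ⨾ f †))   ≈⟨ id-⊕-⨾ ⟩⨾⟨refl ⟨
    (id k ⊕ (f ⨾ g)) ⨾ (add k ⨾ (g † ⨾ f †))          ≈⟨ ⨾-assoc _ _ _ ⟨
    (id k ⊕ (f ⨾ g)) ⨾ add k ⨾ (g † ⨾ f †)            ∎

  absorbs-⊕ : ∀ {n m n′ m′} {f : Term IHGen n m} {g : Term IHGen n′ m′} →
              Absorbs f → Absorbs g → Absorbs (f ⊕ g)
  absorbs-⊕ {n} {m} {n′} {m′} {f} {g} p q .absorb = begin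
    ((f † ⊕ g †) ⊕ id (n +ℕ n′)) ⨾ add (n +ℕ n′)
      ≈⟨ (refl⟩⊕⟨ ≈-sym (⊕-id n n′)) ⟩⨾⟨ add-shuffle n n′ ⟩
    ((f † ⊕ g †) ⊕ (id n ⊕ id n′)) ⨾ (shuffle n n′ n n′ ⨾ (add n ⊕ add n′))
      ≈⟨ assoc²ʳ (shuffle-natural _ _ _ _) ⟩
    shuffle m m′ n n′ ⨾ ((f † ⊕ id n) ⊕ (g † ⊕ id n′)) ⨾ (add n ⊕ add n′)
      ≈⟨ assoc²ˡ (≈-trans merge (≈-trans (p .absorb ⟩⊕⟨ q .absorb)
           (≈-trans (interchange _ _ _ _) (≈-trans (interchange _ _ _ _ ⟩⨾⟨refl) (⨾-assoc _ _ _))))) ⟩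
    shuffle m m′ n n′ ⨾ (((id m ⊕ f) ⊕ (id m′ ⊕ g)) ⨾ ((add m ⊕ add m′) ⨾ (f † ⊕ g †)))
      ≈⟨ assoc²ʳ (≈-sym (shuffle-natural _ _ _ _)) ⟩
    ((id m ⊕ id m′) ⊕ (f ⊕ g)) ⨾ shuffle m m′ m m′ ⨾ ((add m ⊕ add m′) ⨾ (f † ⊕ g †))
      ≈⟨ ≈-trans (≈-sym (⨾-assoc _ _ _)) (⨾-assoc _ _ _ ⟩⨾⟨refl) ⟩
    ((id m ⊕ id m′) ⊕ (f ⊕ g)) ⨾ (shuffle m m′ m m′ ⨾ (add m ⊕ add m′)) ⨾ (f † ⊕ g †)
      ≈⟨ (⊕-id m m′ ⟩⊕⟨refl) ⟩⨾⟨ ≈-sym (add-shuffle m m′) ⟩⨾⟨refl ⟩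
    (id (m +ℕ m′) ⊕ (f ⊕ g)) ⨾ add (m +ℕ m′) ⨾ (f † ⊕ g †) ∎

  absorbs-s : ∀ k → Absorbs s⟨ k ⟩
  absorbs-s k .absorb = begin
    (s̄⟨ k ⟩ ⊕ id 1) ⨾ add 1             ≈⟨ (refl⟩⊕⟨ id₁≈id) ⟩⨾⟨ μ≈add ⟨
    (s̄⟨ k ⟩ ⊕ id₁) ⨾ μ∘                 ≈⟨ axiom (b7 k) ⟩
    (id₁ ⊕ s⟨ k ⟩) ⨾ μ∘ ⨾ s̄⟨ k ⟩        ≈⟨ (id₁≈id ⟩⊕⟨refl) ⟩⨾⟨ μ≈add ⟩⨾⟨refl ⟩
    (id 1 ⊕ s⟨ k ⟩) ⨾ add 1 ⨾ s̄⟨ k ⟩    ∎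

  Δ∘-σ : Δ∘ ⨾ σ₁₁ ≈ Δ∘
  Δ∘-σ = axiom (haᵒᵖ a2)

  id₁-⨾-id₁ : id₁ ⨾ id₁ ≈ id₁
  id₁-⨾-id₁ = ≈-trans (refl⟩⨾⟨ id₁≈id) (⨾-identityʳ id₁)

  ⨾-⊕-id₁ : ∀ {n m k} {f : Term IHGen n m} {g : Term IHGen m k} →
            (f ⨾ g) ⊕ id₁ ≈ (f ⊕ id₁) ⨾ (g ⊕ id₁)
  ⨾-⊕-id₁ = ≈-trans (refl⟩⊕⟨ ≈-sym id₁-⨾-id₁) (interchange _ _ _ _)

  id₁-⊕-⨾ : ∀ {n m k} {f : Term IHGen n m} {g : Term IHGen m k} →
            id₁ ⊕ (f ⨾ g) ≈ (id₁ ⊕ f) ⨾ (id₁ ⊕ g)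
  id₁-⊕-⨾ = ≈-trans (≈-sym id₁-⨾-id₁ ⟩⊕⟨refl) (interchange _ _ _ _)

  id₂≈id : id₁ ⊕ id₁ ≈ id 2
  id₂≈id = refl⟩⊕⟨ id₁≈id

  -- (B4) with the outputs of `Δ∘` exchanged, which its cocommutativity allows on both sides.
  frobenius-swapped : (Δ∘ ⊕ id₁) ⨾ ((id₁ ⊕ σ₁₁) ⨾ (μ∘ ⊕ id₁)) ≈ μ∘ ⨾ Δ∘
  frobenius-swapped = begin
    (Δ∘ ⊕ id₁) ⨾ ((id₁ ⊕ σ₁₁) ⨾ (μ∘ ⊕ id₁))
      ≈⟨ (≈-trans (≈-sym Δ∘-σ ⟩⊕⟨refl) ⨾-⊕-id₁) ⟩⨾⟨refl ⟩
    (Δ∘ ⊕ id₁) ⨾ (σ₁₁ ⊕ id₁) ⨾ ((id₁ ⊕ σ₁₁) ⨾ (μ∘ ⊕ id₁))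
      ≈⟨ assoc²ˡ (⟦⟧-complete
           {t = (σ₁₁ Term.⊕ id₁) Term.⨾ ((id₁ Term.⊕ σ₁₁) Term.⨾ (gen μ Term.⊕ id₁))}
           {(id₁ Term.⊕ gen μ) Term.⨾ σ₁₁}
           λ { x zero → reflᴿ ; x (suc zero) → reflᴿ }) ⟩
    (Δ∘ ⊕ id₁) ⨾ ((id₁ ⊕ μ∘) ⨾ σ₁₁)
      ≈⟨ assoc²ʳ (axiom b4ˡ) ⟩
    μ∘ ⨾ Δ∘ ⨾ σ₁₁
      ≈⟨ assoc²ˡ Δ∘-σ ⟩
    μ∘ ⨾ Δ∘ ∎

  -- Two Frobenius steps: `Δ∘` splits x into two summands, and the additions of y₁ to the first and
  -- of y₂ to the second are moved, in this order, in front of the splitting.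
  absorbs-μ : Absorbs μ∘
  absorbs-μ .absorb = begin
    (Δ∘ ⊕ id 2) ⨾ add 2
      ≈⟨ ≈-trans (refl⟩⊕⟨ ≈-sym id₂≈id) (≈-sym (⊕-assoc Δ∘ id₁ id₁)) ⟩⨾⟨ add₂ ⟩
    ((Δ∘ ⊕ id₁) ⊕ id₁) ⨾ ((((id₁ ⊕ σ₁₁) ⨾ (μ∘ ⊕ id₁)) ⊕ id₁) ⨾ (id₁ ⊕ μ∘))
      ≈⟨ assoc²ʳ (≈-trans (≈-sym ⨾-⊕-id₁) (≈-trans (frobenius-swapped ⟩⊕⟨refl) ⨾-⊕-id₁)) ⟩
    (μ∘ ⊕ id₁) ⨾ (Δ∘ ⊕ id₁) ⨾ (id₁ ⊕ μ∘)
      ≈⟨ assoc²ˡ (axiom b4ˡ) ⟩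
    (μ∘ ⊕ id₁) ⨾ (μ∘ ⨾ Δ∘)
      ≈⟨ assoc²ʳ (axiom (ha a3)) ⟩
    (id₁ ⊕ μ∘) ⨾ μ∘ ⨾ Δ∘
      ≈⟨ (id₁≈id ⟩⊕⟨refl) ⟩⨾⟨ μ≈add ⟩⨾⟨refl ⟩
    (id 1 ⊕ μ∘) ⨾ add 1 ⨾ Δ∘ ∎
    where
    add₂ : add 2 ≈ (((id₁ ⊕ σ₁₁) ⨾ (μ∘ ⊕ id₁)) ⊕ id₁) ⨾ (id₁ ⊕ μ∘)
    add₂ = ≈-sym (⟦⟧-add
      ((((id₁ Term.⊕ σ₁₁) Term.⨾ (gen μ Term.⊕ id₁)) Term.⊕ id₁) Term.⨾ (id₁ Term.⊕ gen μ))
      λ { x zero → reflᴿ ; x (suc zero) → reflᴿ })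

  add₀ : add 0 ≈ id 0
  add₀ = ≈-sym (F-id {A = addᴹ 0} (λ ()))

  absorbs-η : Absorbs η∘
  absorbs-η .absorb = begin
    (ε∘ ⊕ id 0) ⨾ add 0             ≈⟨ ⊕-identityʳ ε∘ ⟩⨾⟨ add₀ ⟩
    ε∘ ⨾ id 0                       ≈⟨ ⨾-identityʳ ε∘ ⟩
    ε∘                              ≈⟨ ⨾-identityˡ ε∘ ⟨
    id 1 ⨾ ε∘                       ≈⟨ id₁≈id ⟩⨾⟨refl ⟨
    id₁ ⨾ ε∘                        ≈⟨ ⟦⟧-complete {t = (id₁ Term.⊕ gen η) Term.⨾ gen μ} {id₁}
                                         (λ { x zero → +-identityʳ _ }) ⟩⨾⟨refl ⟨
    (id₁ ⊕ η∘) ⨾ μ∘ ⨾ ε∘            ≈⟨ (id₁≈id ⟩⊕⟨refl) ⟩⨾⟨ μ≈add ⟩⨾⟨refl ⟩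
    (id 1 ⊕ η∘) ⨾ add 1 ⨾ ε∘        ∎

  Δ∘-counitʳ : Δ∘ ⨾ (id₁ ⊕ ε∘) ≈ id₁
  Δ∘-counitʳ = †-cong {f = (id₁ ⊕ η∘) ⨾ μ∘} {id₁} (⟦⟧-complete
    {t = (id₁ Term.⊕ gen η) Term.⨾ gen μ} {id₁} λ { x zero → +-identityʳ _ })

  -- By (A16) a scalar zero can be put before `ε•`; (B8) at zero then places `s̄⟨ 0# ⟩` on the other
  -- wire, and its form `ε∘ ⨾ η•` cuts that wire.
  Δ∘-discard : Δ∘ ⨾ (ε• ⊕ id₁) ≈ ε• ⨾ η•
  Δ∘-discard = begin
    Δ∘ ⨾ (ε• ⊕ id₁)
      ≈⟨ refl⟩⨾⟨ ≈-trans (≈-sym (axiom (ha (a16 0#))) ⟩⊕⟨refl) ⨾-⊕-id₁ ⟩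
    Δ∘ ⨾ ((s⟨ 0# ⟩ ⊕ id₁) ⨾ (ε• ⊕ id₁))
      ≈⟨ assoc²ʳ (axiom (b8 0#)) ⟩
    s⟨ 0# ⟩ ⨾ Δ∘ ⨾ (id₁ ⊕ s̄⟨ 0# ⟩) ⨾ (ε• ⊕ id₁)
      ≈⟨ rewriteʳ (begin
           (id₁ ⊕ s̄⟨ 0# ⟩) ⨾ (ε• ⊕ id₁)
             ≈⟨ (id₁≈id ⟩⊕⟨ axiom (haᵒᵖ a17)) ⟩⨾⟨ (refl⟩⊕⟨ id₁≈id) ⟩
           (id 1 ⊕ (ε∘ ⨾ η•)) ⨾ (ε• ⊕ id 1)
             ≈⟨ ≈-trans slideʳˡ (≈-trans (≈-sym (⨾-identityˡ ε•) ⟩⊕⟨refl) (interchange _ _ _ _)) ⟩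
           (id 1 ⊕ ε∘) ⨾ (ε• ⊕ η•)
             ≈⟨ (≈-sym id₁≈id ⟩⊕⟨refl) ⟩⨾⟨ ≈-trans (≈-sym slideˡʳ) (⊕-identityʳ ε• ⟩⨾⟨ ⊕-identityˡ η•) ⟩
           (id₁ ⊕ ε∘) ⨾ (ε• ⨾ η•) ∎) ⟩
    s⟨ 0# ⟩ ⨾ Δ∘ ⨾ (id₁ ⊕ ε∘) ⨾ (ε• ⨾ η•)
      ≈⟨ ≈-trans (assoc²ˡ Δ∘-counitʳ) (≈-trans (refl⟩⨾⟨ id₁≈id) (⨾-identityʳ _)) ⟩⨾⟨refl ⟩
    s⟨ 0# ⟩ ⨾ (ε• ⨾ η•)
      ≈⟨ assoc²ʳ (axiom (ha (a16 0#))) ⟩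
    ε• ⨾ η• ∎

  -- A copy of the unconstrained wire is made and discarded; (B5) turns the copied pair into a white
  -- cup, and the sign vanishes into `ε•`.
  η•≈cup : η• ≈ η∘ ⨾ Δ∘ ⨾ (id₁ ⊕ ε•)
  η•≈cup = begin
    η•
      ≈⟨ ≈-trans (refl⟩⨾⟨ id₁≈id) (⨾-identityʳ η•) ⟨
    η• ⨾ id₁
      ≈⟨ refl⟩⨾⟨ ⟦⟧-complete {t = gen Δ Term.⨾ (id₁ Term.⊕ gen ε)} {id₁} (λ { x zero → reflᴿ }) ⟨
    η• ⨾ (Δ• ⨾ (id₁ ⊕ ε•))
      ≈⟨ assoc²ʳ (axiom b5) ⟩
    η∘ ⨾ Δ∘ ⨾ (id₁ ⊕ s⟨ - 1# ⟩) ⨾ (id₁ ⊕ ε•)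
      ≈⟨ assoc²ˡ (≈-trans (≈-sym id₁-⊕-⨾) (refl⟩⊕⟨ axiom (ha (a16 (- 1#))))) ⟩
    η∘ ⨾ Δ∘ ⨾ (id₁ ⊕ ε•) ∎

  -- An unconstrained summand makes the sum unconstrained and forgets y. Written as a cup with one
  -- end discarded, it lets Frobenius carry the addition around the bend.
  η•-absorbs : (η• ⊕ id₁) ⨾ μ∘ ≈ ε• ⨾ η•
  η•-absorbs = begin
    (η• ⊕ id₁) ⨾ μ∘
      ≈⟨ ≈-trans (η•≈cup ⟩⊕⟨refl) (≈-trans ⨾-⊕-id₁ (⨾-⊕-id₁ ⟩⨾⟨refl)) ⟩⨾⟨refl ⟩
    (η∘ ⊕ id₁) ⨾ (Δ∘ ⊕ id₁) ⨾ ((id₁ ⊕ ε•) ⊕ id₁) ⨾ μ∘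
      ≈⟨ assoc²ˡ (⟦⟧-complete
           {t = ((id₁ Term.⊕ gen ε) Term.⊕ id₁) Term.⨾ gen μ}
           {((id₁ Term.⊕ σ₁₁) Term.⨾ (gen μ Term.⊕ id₁)) Term.⨾ (id₁ Term.⊕ gen ε)}
           λ { x zero → reflᴿ }) ⟩
    (η∘ ⊕ id₁) ⨾ (Δ∘ ⊕ id₁) ⨾ (((id₁ ⊕ σ₁₁) ⨾ (μ∘ ⊕ id₁)) ⨾ (id₁ ⊕ ε•))
      ≈⟨ ≈-trans (≈-sym (⨾-assoc _ _ _)) (assoc²ˡ frobenius-swapped ⟩⨾⟨refl) ⟩
    (η∘ ⊕ id₁) ⨾ (μ∘ ⨾ Δ∘) ⨾ (id₁ ⊕ ε•)
      ≈⟨ assoc²ʳ (axiom (ha a1)) ⟩⨾⟨refl ⟩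
    id₁ ⨾ Δ∘ ⨾ (id₁ ⊕ ε•)
      ≈⟨ ≈-trans (id₁≈id ⟩⨾⟨refl) (⨾-identityˡ Δ∘) ⟩⨾⟨refl ⟩
    Δ∘ ⨾ (id₁ ⊕ ε•)
      ≈⟨ ≈-trans (≈-sym Δ∘-σ ⟩⨾⟨refl) (assoc²ˡ (⟦⟧-complete
           {t = σ₁₁ Term.⨾ (id₁ Term.⊕ gen ε)} {gen ε Term.⊕ id₁} λ { x zero → reflᴿ })) ⟩
    Δ∘ ⨾ (ε• ⊕ id₁)
      ≈⟨ Δ∘-discard ⟩
    ε• ⨾ η• ∎

  absorbs-ε : Absorbs ε•
  absorbs-ε .absorb = begin
    (η• ⊕ id 1) ⨾ add 1           ≈⟨ (refl⟩⊕⟨ id₁≈id) ⟩⨾⟨ μ≈add ⟨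
    (η• ⊕ id₁) ⨾ μ∘               ≈⟨ η•-absorbs ⟩
    ε• ⨾ η•                       ≈⟨ ≈-trans (⊕-identityˡ ε• ⟩⨾⟨ add₀) (⨾-identityʳ ε•) ⟩⨾⟨refl ⟨
    (id 0 ⊕ ε•) ⨾ add 0 ⨾ η•      ∎

  -- (x , y) ↦ (x + a y , y)
  shear : Carrier → Term HAGen 2 2
  shear a = (id₁ Term.⊕ gen Δ) Term.⨾ (((id₁ Term.⊕ gen (s a)) Term.⨾ gen μ) Term.⊕ id₁)

  -- `μ•` imposes equality of its inputs. A copy of the output is opened by (A4); (B3) and (B6) then
  -- express the equality as `x - y = 0` with y kept.
  μ•≈shear : μ• ≈ ⟦ shear (- 1#) ⟧ ⨾ (ε∘ ⊕ id₁)
  μ•≈shear = begin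
    μ•
      ≈⟨ ≈-trans (refl⟩⨾⟨ ≈-trans (axiom (ha a4)) id₁≈id) (⨾-identityʳ μ•) ⟨
    μ• ⨾ (Δ• ⨾ (ε• ⊕ id₁))
      ≈⟨ assoc²ʳ (axiom b3ʳ) ⟩
    (id₁ ⊕ Δ•) ⨾ (μ• ⊕ id₁) ⨾ (ε• ⊕ id₁)
      ≈⟨ assoc²ˡ (≈-trans (≈-sym ⨾-⊕-id₁) (≈-trans (axiom b6 ⟩⊕⟨refl) ⨾-⊕-id₁)) ⟩
    (id₁ ⊕ Δ•) ⨾ ((((id₁ ⊕ s⟨ - 1# ⟩) ⨾ μ∘) ⊕ id₁) ⨾ (ε∘ ⊕ id₁))
      ≈⟨ ⨾-assoc _ _ _ ⟨
    ⟦ shear (- 1#) ⟧ ⨾ (ε∘ ⊕ id₁) ∎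

  -- Written with shear, both sides are the same linear map followed by ε∘ ⊕ id.
  absorbs-Δ : Absorbs Δ•
  absorbs-Δ .absorb = begin
    (μ• ⊕ id 1) ⨾ add 1
      ≈⟨ (μ•≈shear ⟩⊕⟨ ≈-sym id₁≈id) ⟩⨾⟨ ≈-sym μ≈add ⟩
    ((⟦ shear (- 1#) ⟧ ⨾ (ε∘ ⊕ id₁)) ⊕ id₁) ⨾ μ∘
      ≈⟨ ≈-trans ⨾-⊕-id₁ (refl⟩⨾⟨ ≈-trans (⊕-assoc ε∘ id₁ id₁) (refl⟩⊕⟨ id₂≈id)) ⟩⨾⟨ ≈-sym (⊕-identityˡ μ∘) ⟩
    (⟦ shear (- 1#) ⟧ ⊕ id₁) ⨾ (ε∘ ⊕ id 2) ⨾ (id 0 ⊕ μ∘)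
      ≈⟨ ≈-trans (rewriteʳ exchange) ((refl⟩⨾⟨ (≈-sym id₁≈id ⟩⊕⟨refl)) ⟩⨾⟨ (refl⟩⊕⟨ ≈-sym id₁≈id)) ⟩
    (⟦ shear (- 1#) ⟧ ⊕ id₁) ⨾ (id₁ ⊕ μ∘) ⨾ (ε∘ ⊕ id₁)
      ≈⟨ ⟦⟧-complete
           {t = (shear (- 1#) Term.⊕ id₁) Term.⨾ (id₁ Term.⊕ gen μ)}
           {((id₁ Term.⊕ id₁) Term.⊕ gen Δ) Term.⨾ add₂ Term.⨾ shear (- 1#)}
           (λ { x zero → symᴿ (cancel-shear _ _ _) ; x (suc zero) → reflᴿ }) ⟩⨾⟨refl ⟩
    ((id₁ ⊕ id₁) ⊕ Δ•) ⨾ ⟦ add₂ ⟧ ⨾ ⟦ shear (- 1#) ⟧ ⨾ (ε∘ ⊕ id₁)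
      ≈⟨ ≈-trans (assoc²ˡ (≈-sym μ•≈shear))
           ((id₂≈id ⟩⊕⟨refl) ⟩⨾⟨ ⟦⟧-add add₂ (λ { x zero → reflᴿ ; x (suc zero) → reflᴿ }) ⟩⨾⟨refl) ⟩
    (id 2 ⊕ Δ•) ⨾ add 2 ⨾ μ• ∎
    where
    add₂ : Term HAGen 4 2
    add₂ = (id₁ Term.⊕ (σ₁₁ Term.⊕ id₁)) Term.⨾ (gen μ Term.⊕ gen μ)

  absorbs-id : ∀ {n} {f : Term IHGen n n} → f ≈ id n → f † ≈ id n → Absorbs f
  absorbs-id {n} {f} p q .absorb = begin
    (f † ⊕ id n) ⨾ add n        ≈⟨ (q ⟩⊕⟨ ≈-sym p) ⟩⨾⟨refl ⟩
    (id n ⊕ f) ⨾ add n          ≈⟨ ⨾-identityʳ _ ⟨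
    (id n ⊕ f) ⨾ add n ⨾ id n   ≈⟨ refl⟩⨾⟨ q ⟨
    (id n ⊕ f) ⨾ add n ⨾ f †    ∎

  absorbs-σ : Absorbs σ₁₁
  absorbs-σ .absorb = begin
    (σ₁₁ ⊕ id 2) ⨾ add 2
      ≈⟨ refl⟩⨾⟨ ⟦⟧-add add₂ (λ { x zero → reflᴿ ; x (suc zero) → reflᴿ }) ⟨
    (σ₁₁ ⊕ id 2) ⨾ ⟦ add₂ ⟧
      ≈⟨ ⟦⟧-complete {t = (σ₁₁ Term.⊕ idᵗ 2) Term.⨾ add₂} {(idᵗ 2 Term.⊕ σ₁₁) Term.⨾ add₂ Term.⨾ σ₁₁}
           (λ { x zero → reflᴿ ; x (suc zero) → reflᴿ }) ⟩
    (id 2 ⊕ σ₁₁) ⨾ ⟦ add₂ ⟧ ⨾ σ₁₁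
      ≈⟨ (refl⟩⨾⟨ ⟦⟧-add add₂ (λ { x zero → reflᴿ ; x (suc zero) → reflᴿ })) ⟩⨾⟨refl ⟩
    (id 2 ⊕ σ₁₁) ⨾ add 2 ⨾ σ₁₁ ∎
    where
    add₂ : Term HAGen 4 2
    add₂ = (id₁ Term.⊕ (σ₁₁ Term.⊕ id₁)) Term.⨾ (gen μ Term.⊕ gen μ)

  all-absorb : ∀ {n m} (t : Term HAGen n m) → Absorbs ⟦ t ⟧
  all-absorb (gen Δ)      = absorbs-Δ
  all-absorb (gen ε)      = absorbs-ε
  all-absorb (gen μ)      = absorbs-μ
  all-absorb (gen η)      = absorbs-η
  all-absorb (gen (s k))  = absorbs-s k
  all-absorb id₀          = absorbs-id ≈-refl ≈-refl
  all-absorb id₁          = absorbs-id id₁≈id id₁≈id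
  all-absorb σ₁₁          = absorbs-σ
  all-absorb (f Term.⨾ g) = absorbs-⨾ (all-absorb f) (all-absorb g)
  all-absorb (f Term.⊕ g) = absorbs-⊕ (all-absorb f) (all-absorb g)

-- Converses of shears

module Shears {c ℓ} (R : PrincipalIdealDomain c ℓ) where
  open PrincipalIdealDomain R using (commutativeRing)
  open CommutativeRing commutativeRing
    using (Carrier; 0#; 1#; -_; _+_; _*_; ring; +-identityˡ; +-identityʳ; +-assoc; +-comm; +-congˡ; +-congʳ; +-cong; -‿inverseʳ; -‿inverseˡ; *-identityˡ; zeroˡ; distribʳ; *-congʳ)
    renaming (_≈_ to _≈ᴿ_; refl to reflᴿ; sym to symᴿ; trans to transᴿ; setoid to setoidᴿ)
  open HopfAlgebras commutativeRing using (HAGen; Δ; ε; μ; η; s; a9; a14)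
  open InteractingHopfAlgebras commutativeRing
  open Matrices commutativeRing
  open MatrixPROP commutativeRing
  open AdditionMatrix commutativeRing
  open Action commutativeRing
  open HopfCompleteness commutativeRing using (accumulate; canonical)
  open Evaluation R
  open Functors R
  open Absorption R
  open RawPROP IHᶜᵖ using (_≈_; id; _⨾_; _⊕_)
  open PROPReasoning IH-isPROP
  open PresentedStructure IHEq
  open ≈-Reasoning

  absorb-G : ∀ {n m} (A : Mat n m) → (G A ⊕ id n) ⨾ add n ≈ (id m ⊕ F A) ⨾ add m ⨾ G A
  absorb-G {n} {m} A = begin
    (G A ⊕ id n) ⨾ add n                        ≈⟨ (G≈ ⟩⊕⟨refl) ⟩⨾⟨refl ⟨
    (⟦ canonical A ⟧ † ⊕ id n) ⨾ add n          ≈⟨ all-absorb (canonical A) .absorb ⟩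
    (id m ⊕ ⟦ canonical A ⟧) ⨾ add m ⨾ ⟦ canonical A ⟧ †
      ≈⟨ (refl⟩⊕⟨ F-interp (canonical A) (eval-canonical A)) ⟩⨾⟨refl ⟩⨾⟨ G≈ ⟩
    (id m ⊕ F A) ⨾ add m ⨾ G A                  ∎
    where
    G≈ : ⟦ canonical A ⟧ † ≈ G A
    G≈ = G-interp (canonical A) (eval-canonical A)

  zeroᴹ : ∀ n → Mat 0 n
  zeroᴹ n _ ()

  discardᴹ : ∀ n → Mat n 0
  discardᴹ n ()

  zero-addˡ : ∀ {n m} (f : Term IHGen m n) → (F (zeroᴹ n) ⊕ f) ⨾ add n ≈ f
  zero-addˡ {n} f = begin
    (F (zeroᴹ n) ⊕ f) ⨾ add n
      ≈⟨ ≈-sym slideʳˡ ⟩⨾⟨refl ⟩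
    (id 0 ⊕ f) ⨾ (F (zeroᴹ n) ⊕ id n) ⨾ add n
      ≈⟨ assoc²ˡ (≈-trans ((refl⟩⊕⟨ F-id (λ _ _ → reflᴿ)) ⟩⨾⟨refl)
           (≈-trans (F-⊕ {C = zeroᴹ n ⊕ᴹ idᴹ n} (λ _ _ → reflᴿ) ⟩⨾⟨refl)
           (≈-trans (F-⨾ (≋-ext unit)) (≈-sym (F-id {A = idᴹ n} (λ _ _ → reflᴿ)))))) ⟩
    (id 0 ⊕ f) ⨾ id n
      ≈⟨ ≈-trans (⨾-identityʳ _) (⊕-identityˡ f) ⟩
    f ∎
    where
    unit : ∀ x → ((zeroᴹ n ⊕ᴹ idᴹ n) ⨾ᴹ addᴹ n) ▷ x ≈ᵛ idᴹ n ▷ x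
    unit x = ≈ᵛ-trans (⨾-▷ (zeroᴹ n ⊕ᴹ idᴹ n) (addᴹ n) x)
      (≈ᵛ-trans (▷-congˡ {A = addᴹ n} (⊕-▷ (zeroᴹ n) (idᴹ n) x))
      (≈ᵛ-trans (add-▷-++ n (λ _ → 0#) (idᴹ n ▷ x)) (λ i → +-identityˡ _)))

  -- Absorption with first argument zero. The hypothesis `F (zeroᴹ m) ⨾ f † ≈ F (zeroᴹ n)` is
  -- triviality of the kernel: only zero is sent to zero.
  ⨾-† : ∀ {n m} {f : Term IHGen n m} → Absorbs f → F (zeroᴹ m) ⨾ f † ≈ F (zeroᴹ n) → f ⨾ f † ≈ id n
  ⨾-† {n} {m} {f} p q = begin
    f ⨾ f †
      ≈⟨ zero-addˡ f ⟩⨾⟨refl ⟨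
    (F (zeroᴹ m) ⊕ f) ⨾ add m ⨾ f †
      ≈⟨ slideˡʳ ⟩⨾⟨refl ⟩⨾⟨refl ⟨
    (F (zeroᴹ m) ⊕ id n) ⨾ (id m ⊕ f) ⨾ add m ⨾ f †
      ≈⟨ ≈-trans (⨾-assoc _ _ _ ⟩⨾⟨refl) (assoc²ˡ (≈-sym (p .absorb))) ⟩
    (F (zeroᴹ m) ⊕ id n) ⨾ ((f † ⊕ id n) ⨾ add n)
      ≈⟨ assoc²ʳ (≈-trans (≈-sym ⨾-⊕-id) (q ⟩⊕⟨refl)) ⟩
    (F (zeroᴹ n) ⊕ id n) ⨾ add n
      ≈⟨ zero-addˡ (id n) ⟩
    id n ∎

  shear-shear : ∀ a b → a + b ≈ᴿ 0# → ⟦ shear a ⟧ ⨾ ⟦ shear b ⟧ ≈ id 2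
  shear-shear a b p = ⟦⟧-complete {t = shear a Term.⨾ shear b} {idᵗ 2} λ
    { x zero → transᴿ (+-assoc _ _ _) (transᴿ (+-congˡ
        (transᴿ (symᴿ (distribʳ _ a b)) (transᴿ (*-congʳ p) (zeroˡ _)))) (+-identityʳ _))
    ; x (suc zero) → reflᴿ }

  ε∘² : Term IHGen 2 0
  ε∘² = ε∘ ⊕ ε∘

  -- The reversed (A9), read through `μ•≈shear`. Coefficient -1 is the one that the axioms deliver
  -- directly.
  shear-1-ε∘² : ⟦ shear (- 1#) ⟧ ⨾ ε∘² ≈ ε∘²
  shear-1-ε∘² = begin
    ⟦ shear (- 1#) ⟧ ⨾ (ε∘ ⊕ ε∘)
      ≈⟨ refl⟩⨾⟨ ≈-trans (≈-sym slideˡʳ) ((refl⟩⊕⟨ ≈-sym id₁≈id) ⟩⨾⟨ ⊕-identityˡ ε∘) ⟩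
    ⟦ shear (- 1#) ⟧ ⨾ ((ε∘ ⊕ id₁) ⨾ ε∘)
      ≈⟨ assoc²ʳ (≈-sym μ•≈shear) ⟩
    μ• ⨾ ε∘
      ≈⟨ axiom (haᵒᵖ a9) ⟩
    ε∘ ⊕ ε∘ ∎

  shear₁-ε∘² : ⟦ shear 1# ⟧ ⨾ ε∘² ≈ ε∘²
  shear₁-ε∘² = begin
    ⟦ shear 1# ⟧ ⨾ ε∘²                        ≈⟨ refl⟩⨾⟨ shear-1-ε∘² ⟨
    ⟦ shear 1# ⟧ ⨾ (⟦ shear (- 1#) ⟧ ⨾ ε∘²)   ≈⟨ assoc²ʳ (shear-shear 1# (- 1#) (-‿inverseʳ 1#)) ⟩
    id 2 ⨾ ε∘²                                ≈⟨ ⨾-identityˡ _ ⟩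
    ε∘²                                       ∎

  -- Under `x + a y = 0`, (B7) and the reversed (A14) trade `s⟨ a ⟩` on y for `s̄⟨ a ⟩` on x. A
  -- shear with coefficient 1 remains, and `ε∘` finally absorbs `s̄⟨ a ⟩`.
  shear-ε∘² : ∀ a → ⟦ shear a ⟧ ⨾ ε∘² ≈ ε∘²
  shear-ε∘² a = begin
    (id₁ ⊕ Δ•) ⨾ (((id₁ ⊕ s⟨ a ⟩) ⨾ μ∘) ⊕ id₁) ⨾ (ε∘ ⊕ ε∘)
      ≈⟨ assoc²ˡ (≈-trans merge (slide ⟩⊕⟨ ≈-trans (id₁≈id ⟩⨾⟨refl) (⨾-identityˡ ε∘))) ⟩
    (id₁ ⊕ Δ•) ⨾ (((s̄⟨ a ⟩ ⊕ id₁) ⨾ (μ∘ ⨾ ε∘)) ⊕ ε∘)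
      ≈⟨ refl⟩⨾⟨ ≈-trans (refl⟩⊕⟨ ≈-trans (≈-sym (⨾-identityˡ ε∘)) (≈-sym id₁≈id ⟩⨾⟨refl)) (interchange _ _ _ _) ⟩
    (id₁ ⊕ Δ•) ⨾ (((s̄⟨ a ⟩ ⊕ id₁) ⊕ id₁) ⨾ ((μ∘ ⨾ ε∘) ⊕ ε∘))
      ≈⟨ assoc²ʳ (begin
           (id₁ ⊕ Δ•) ⨾ ((s̄⟨ a ⟩ ⊕ id₁) ⊕ id₁)
             ≈⟨ (id₁≈id ⟩⊕⟨refl) ⟩⨾⟨ ≈-trans (⊕-assoc _ _ _) (refl⟩⊕⟨ id₂≈id) ⟩
           (id 1 ⊕ Δ•) ⨾ (s̄⟨ a ⟩ ⊕ id 2)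
             ≈⟨ exchange ⟨
           (s̄⟨ a ⟩ ⊕ id 1) ⨾ (id 1 ⊕ Δ•)
             ≈⟨ (refl⟩⊕⟨ id₁≈id) ⟩⨾⟨ (id₁≈id ⟩⊕⟨refl) ⟨
           (s̄⟨ a ⟩ ⊕ id₁) ⨾ (id₁ ⊕ Δ•) ∎) ⟩
    (s̄⟨ a ⟩ ⊕ id₁) ⨾ (id₁ ⊕ Δ•) ⨾ ((μ∘ ⨾ ε∘) ⊕ ε∘)
      ≈⟨ refl⟩⨾⟨ ≈-trans (refl⟩⊕⟨ ≈-trans (≈-sym (⨾-identityˡ ε∘)) (≈-sym id₁≈id ⟩⨾⟨refl)) (interchange _ _ _ _) ⟩
    (s̄⟨ a ⟩ ⊕ id₁) ⨾ (id₁ ⊕ Δ•) ⨾ ((μ∘ ⊕ id₁) ⨾ (ε∘ ⊕ ε∘))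
      ≈⟨ ≈-trans (≈-sym (⨾-assoc _ _ _)) (assoc²ˡ (⟦⟧-complete
           {t = (id₁ Term.⊕ gen Δ) Term.⨾ (gen μ Term.⊕ id₁)} {shear 1#}
           λ { x zero → +-congˡ (symᴿ (*-identityˡ _)) ; x (suc zero) → reflᴿ }) ⟩⨾⟨refl) ⟩
    (s̄⟨ a ⟩ ⊕ id₁) ⨾ ⟦ shear 1# ⟧ ⨾ ε∘²
      ≈⟨ assoc²ˡ shear₁-ε∘² ⟩
    (s̄⟨ a ⟩ ⊕ id₁) ⨾ (ε∘ ⊕ ε∘)
      ≈⟨ ≈-trans merge (axiom (haᵒᵖ (a14 a)) ⟩⊕⟨ ≈-trans (id₁≈id ⟩⨾⟨refl) (⨾-identityˡ ε∘)) ⟩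
    ε∘² ∎
    where
    slide : (id₁ ⊕ s⟨ a ⟩) ⨾ μ∘ ⨾ ε∘ ≈ (s̄⟨ a ⟩ ⊕ id₁) ⨾ (μ∘ ⨾ ε∘)
    slide = begin
      (id₁ ⊕ s⟨ a ⟩) ⨾ μ∘ ⨾ ε∘             ≈⟨ refl⟩⨾⟨ axiom (haᵒᵖ (a14 a)) ⟨
      (id₁ ⊕ s⟨ a ⟩) ⨾ μ∘ ⨾ (s̄⟨ a ⟩ ⨾ ε∘)  ≈⟨ assoc²ʳ (≈-sym (axiom (b7 a))) ⟩
      (s̄⟨ a ⟩ ⊕ id₁) ⨾ μ∘ ⨾ ε∘             ≈⟨ ⨾-assoc _ _ _ ⟩
      (s̄⟨ a ⟩ ⊕ id₁) ⨾ (μ∘ ⨾ ε∘)           ∎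

  zero₂ : F (zeroᴹ 2) ≈ η∘ ⊕ η∘
  zero₂ = ≈-sym (F-interp (gen η Term.⊕ gen η) (≋-ext λ x → λ { zero → reflᴿ ; (suc zero) → reflᴿ }))

  -- The kernel is trivial by `shear-ε∘²`, so the converse is a right inverse by `⨾-†`, hence equal
  -- to the two-sided inverse known in HA.
  shear-† : ∀ a → ⟦ shear a ⟧ † ≈ ⟦ shear (- a) ⟧
  shear-† a = begin
    ⟦ shear a ⟧ †
      ≈⟨ ≈-trans (shear-shear (- a) a (-‿inverseˡ a) ⟩⨾⟨refl) (⨾-identityˡ _) ⟨
    ⟦ shear (- a) ⟧ ⨾ ⟦ shear a ⟧ ⨾ ⟦ shear a ⟧ †
      ≈⟨ assoc²ˡ (⨾-† (all-absorb (shear a)) stable) ⟩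
    ⟦ shear (- a) ⟧ ⨾ id 2
      ≈⟨ ⨾-identityʳ _ ⟩
    ⟦ shear (- a) ⟧ ∎
    where
    stable : F (zeroᴹ 2) ⨾ ⟦ shear a ⟧ † ≈ F (zeroᴹ 2)
    stable = ≈-trans (zero₂ ⟩⨾⟨refl) (≈-trans (†-cong {f = ⟦ shear a ⟧ ⨾ ε∘²} {ε∘²} (shear-ε∘² a)) (≈-sym zero₂))

-- One-sided inverses by fraction-free elimination

module Elimination {c ℓ} (R : PrincipalIdealDomain c ℓ) where
  open PrincipalIdealDomain R using (commutativeRing; isPID)
  open CommutativeRing commutativeRing
    using (Carrier; 0#; 1#; -_; _+_; _*_; ring; semiring; +-identityˡ; +-identityʳ; +-assoc; +-comm; +-congˡ; +-congʳ; +-cong; -‿inverseʳ; -‿inverseˡ; -‿cong; *-identityˡ; *-assoc; *-comm; *-congˡ; *-congʳ; zeroˡ; distribʳ; distribˡ)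
    renaming (_≈_ to _≈ᴿ_; refl to reflᴿ; sym to symᴿ; trans to transᴿ; setoid to setoidᴿ)
  open import Algebra.Properties.Ring ring using (-‿distribˡ-*)
  open SemiringSum semiring using (sum; sum-cong-≋; ∑-distrib-+; *-distribˡ-sum; *-distribʳ-sum)
  open PIDPushouts R using (≈0?)
  open HopfAlgebras commutativeRing using (HAGen; Δ; ε; μ; η; s)
  open InteractingHopfAlgebras commutativeRing
  open Matrices commutativeRing
  open MatrixPROP commutativeRing
  open MatrixCoproducts commutativeRing
  open Action commutativeRing
  open HopfLocal commutativeRing using (pass)
  open HopfCompleteness commutativeRing using (accumulate; canonical)
  open Evaluation R
  open Functors R
  open Absorption R
  open Shears R
  open RawPROP IHᶜᵖ using (_≈_; id; _⨾_; _⊕_)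
  open PROPReasoning IH-isPROP
  open PresentedStructure IHEq
  open ≈-Reasoning
  private module ᴿ = SetoidReasoning setoidᴿ

  -- For `f = F U` its cospan meaning is that the pushout of U with itself is trivial, i.e. that U
  -- is an epimorphism. Non-zero scalars have this property by (B1) even when they are not units.
  record CoIsometry {n m} (f : Term IHGen n m) : Set (c ⊔ ℓ) where
    constructor coIsometry
    field †-⨾ : f † ⨾ f ≈ id m
  open CoIsometry public

  coIsometry-cong : ∀ {n m} {f g : Term IHGen n m} → f ≈ g → CoIsometry f → CoIsometry g
  coIsometry-cong p q .†-⨾ = ≈-trans (†-cong (≈-sym p) ⟩⨾⟨ ≈-sym p) (q .†-⨾)

  coIsometry-⨾ : ∀ {n m k} {f : Term IHGen n m} {g : Term IHGen m k} →
                 CoIsometry f → CoIsometry g → CoIsometry (f ⨾ g)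
  coIsometry-⨾ p q .†-⨾ = ≈-trans (assoc²ˡ (≈-trans (assoc²ʳ (p .†-⨾)) (⨾-identityˡ _))) (q .†-⨾)

  coIsometry-⊕ : ∀ {n m n′ m′} {f : Term IHGen n m} {g : Term IHGen n′ m′} →
                 CoIsometry f → CoIsometry g → CoIsometry (f ⊕ g)
  coIsometry-⊕ p q .†-⨾ = ≈-trans merge (≈-trans (p .†-⨾ ⟩⊕⟨ q .†-⨾) (⊕-id _ _))

  -- Inserting `f † ⨾ f` in the middle of `g † ⨾ g` exposes the composite. Thus elimination may
  -- precompose with column operations that are not invertible.
  coIsometry-cancel : ∀ {n m k} {f : Term IHGen n m} {g : Term IHGen m k} →
                      CoIsometry f → CoIsometry (f ⨾ g) → CoIsometry g
  coIsometry-cancel {f = f} {g} p q .†-⨾ = begin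
    g † ⨾ g               ≈⟨ refl⟩⨾⟨ ≈-trans (p .†-⨾ ⟩⨾⟨refl) (⨾-identityˡ g) ⟨
    g † ⨾ (f † ⨾ f ⨾ g)   ≈⟨ ≈-trans (refl⟩⨾⟨ ⨾-assoc _ _ _) (≈-sym (⨾-assoc _ _ _)) ⟩
    (g † ⨾ f †) ⨾ (f ⨾ g) ≈⟨ q .†-⨾ ⟩
    id _                  ∎

  coIsometry-id : ∀ n → CoIsometry (id n)
  coIsometry-id n .†-⨾ = ≈-trans (†-id n ⟩⨾⟨refl) (⨾-identityˡ _)

  coIsometry-id₁ : CoIsometry id₁
  coIsometry-id₁ .†-⨾ = ≈-trans id₁-⨾-id₁ id₁≈id

  coIsometry-σ : CoIsometry σ₁₁
  coIsometry-σ .†-⨾ = ⟦⟧-complete {t = σ₁₁ Term.⨾ σ₁₁} {idᵗ 2} λ { x zero → reflᴿ ; x (suc zero) → reflᴿ }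

  coIsometry-s : ∀ {a} → ¬ a ≈ᴿ 0# → CoIsometry s⟨ a ⟩
  coIsometry-s a≉0 .†-⨾ = ≈-trans (axiom (b1 _ a≉0)) id₁≈id

  coIsometry-ε : CoIsometry ε•
  coIsometry-ε .†-⨾ = axiom b2

  coIsometry-shear : ∀ a → CoIsometry ⟦ shear a ⟧
  coIsometry-shear a .†-⨾ = ≈-trans (shear-† a ⟩⨾⟨refl) (shear-shear (- a) a (-‿inverseˡ a))

  -- `(x , y) ↦ (x , y + a x)`
  shear′ : Carrier → Term HAGen 2 2
  shear′ a = σ₁₁ Term.⨾ (shear a Term.⨾ σ₁₁)

  coIsometry-shear′ : ∀ a → CoIsometry ⟦ shear′ a ⟧
  coIsometry-shear′ a = coIsometry-⨾ coIsometry-σ (coIsometry-⨾ (coIsometry-shear a) coIsometry-σ)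

  -- Apply b (v i) to the wires 0 and 1 + i, for every i in turn.
  spread : (Carrier → Term HAGen 2 2) → ∀ {k} → Vector Carrier k → Term HAGen (1 +ℕ k) (1 +ℕ k)
  spread b {zero}  v = id₁
  spread b {suc k} v = (b (v zero) Term.⊕ idᵗ k) Term.⨾
    ((σ₁₁ Term.⊕ idᵗ k) Term.⨾ ((id₁ Term.⊕ spread b (tail v)) Term.⨾ (σ₁₁ Term.⊕ idᵗ k)))

  coIsometry-⊕-id : ∀ {n m k} {f : Term IHGen n m} → CoIsometry f → CoIsometry (f ⊕ ⟦ idᵗ k ⟧)
  coIsometry-⊕-id {k = k} p = coIsometry-⊕ p (coIsometry-cong (≈-sym (⟦⟧-id k)) (coIsometry-id k))

  coIsometry-spread : ∀ b {k} (v : Vector Carrier k) → (∀ a → CoIsometry ⟦ b a ⟧) → CoIsometry ⟦ spread b v ⟧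
  coIsometry-spread b {zero}  v p = coIsometry-id₁
  coIsometry-spread b {suc k} v p = coIsometry-⨾ (coIsometry-⊕-id (p (v zero)))
    (coIsometry-⨾ (coIsometry-⊕-id coIsometry-σ)
    (coIsometry-⨾ (coIsometry-⊕ coIsometry-id₁ (coIsometry-spread b (tail v) p)) (coIsometry-⊕-id coIsometry-σ)))

  act-spread-shear : ∀ {k} (v : Vector Carrier k) x →
    act (spread shear v) x ≈ᵛ (x zero + sum (λ i → v i * x (suc i))) ∷ tail x
  act-spread-shear {zero}  v x zero = symᴿ (+-identityʳ _)
  act-spread-shear {suc k} v x zero =
    transᴿ (act-spread-shear (tail v) _ zero)
      (transᴿ (+-congˡ (sum-cong-≋ (λ i → *-congˡ (transᴿ (act-id k _ i) (act-id k _ i))))) (+-assoc _ _ _))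
  act-spread-shear {suc k} v x (suc zero) = reflᴿ
  act-spread-shear {suc k} v x (suc (suc i)) =
    transᴿ (act-id k _ i) (transᴿ (act-spread-shear (tail v) _ (suc i)) (transᴿ (act-id k _ i) (act-id k _ i)))

  act-spread-shear′ : ∀ {k} (v : Vector Carrier k) x →
    act (spread shear′ v) x ≈ᵛ x zero ∷ (λ i → x (suc i) + v i * x zero)
  act-spread-shear′ {zero}  v x zero = reflᴿ
  act-spread-shear′ {suc k} v x zero = act-spread-shear′ (tail v) _ zero
  act-spread-shear′ {suc k} v x (suc zero) = reflᴿ
  act-spread-shear′ {suc k} v x (suc (suc i)) =
    transᴿ (act-id k _ i) (transᴿ (act-spread-shear′ (tail v) _ (suc i))
      (+-congʳ (transᴿ (act-id k _ i) (act-id k _ i))))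

  scale : Carrier → ∀ k → Term HAGen k k
  scale a zero    = id₀
  scale a (suc k) = gen (s a) Term.⊕ scale a k

  act-scale : ∀ a {k} x → act (scale a k) x ≈ᵛ λ i → a * x i
  act-scale a {suc k} x zero    = reflᴿ
  act-scale a {suc k} x (suc i) = act-scale a (tail x) i

  coIsometry-scale : ∀ {a} → ¬ a ≈ᴿ 0# → ∀ k → CoIsometry ⟦ scale a k ⟧
  coIsometry-scale a≉0 zero    = coIsometry-id 0
  coIsometry-scale a≉0 (suc k) = coIsometry-⊕ (coIsometry-s a≉0) (coIsometry-scale a≉0 k)

  coIsometry-pass : ∀ a → CoIsometry ⟦ pass a ⟧
  coIsometry-pass a = coIsometry-cong
    (⟦⟧-complete {t = shear′ a Term.⨾ σ₁₁} {pass a}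
      λ { x zero → +-comm _ _ ; x (suc zero) → reflᴿ })
    (coIsometry-⨾ (coIsometry-shear′ a) coIsometry-σ)

  coIsometry-accumulate : ∀ {k} (v : Vector Carrier k) → CoIsometry ⟦ accumulate v ⟧
  coIsometry-accumulate {zero}  v = coIsometry-ε
  coIsometry-accumulate {suc k} v = coIsometry-⨾ (coIsometry-⊕-id (coIsometry-pass (v zero)))
    (coIsometry-⊕ (coIsometry-cong (≈-sym (⟦⟧-id 1)) (coIsometry-id 1)) (coIsometry-accumulate (tail v)))

  coIsometry-! : ∀ {k} (A : Mat k 0) → CoIsometry (F A)
  coIsometry-! {zero}  A = coIsometry-cong (F-id (λ ())) (coIsometry-id 0)
  coIsometry-! {suc k} A = coIsometry-cong
    (≈-trans (F-interp (gen ε) {discardᴹ 1} (λ ()) ⟩⊕⟨refl) (F-⊕ {A = discardᴹ 1} {discardᴹ k} (λ ())))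
    (coIsometry-⊕ coIsometry-ε (coIsometry-! (discardᴹ k)))

  -- Linear independence of the rows; `X` is a row of coefficients.
  RowInjective : ∀ {k m} → Mat k m → Set (c ⊔ ℓ)
  RowInjective {k} {m} U = (X : Mat m 1) → (∀ i j → (U ⨾ᴹ X) i j ≈ᴿ 0#) → ∀ i j → X i j ≈ᴿ 0#

  -- If the first row vanished, the unit row `e₀` would be a non-trivial relation. Decidability of
  -- zero turns this refutation into an actual index.
  pivot : ∀ {k m} (U : Mat k (suc m)) → RowInjective U → ∃ λ j → ¬ U zero j ≈ᴿ 0#
  pivot {k} {m} U inj = ¬∀⟶∃¬ k (λ j → U zero j ≈ᴿ 0#) (λ j → ≈0? (U zero j)) λ U₀≈0 →
    IsPID.1≉0 isPID (inj e₀ (λ i j → ᴿ.begin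
      1# * U zero j + sum (λ l → 0# * U (suc l) j) ᴿ.≈⟨ +-cong (*-identityˡ _) (sum-0* (λ l → U (suc l) j)) ⟩
      U zero j + 0#                                ᴿ.≈⟨ +-identityʳ _ ⟩
      U zero j                                     ᴿ.≈⟨ U₀≈0 j ⟩
      0#                                           ᴿ.∎) zero zero)
    where
    e₀ : Mat (suc m) 1
    e₀ _ zero    = 1#
    e₀ _ (suc _) = 0#

  sum-neg : ∀ {n} (u x : Vector Carrier n) → sum (λ l → - u l * x l) + sum (λ l → u l * x l) ≈ᴿ 0#
  sum-neg {n} u x = ᴿ.begin
    sum (λ l → - u l * x l) + sum (λ l → u l * x l)
      ᴿ.≈⟨ ∑-distrib-+ (λ l → - u l * x l) (λ l → u l * x l) ⟨
    sum (λ l → - u l * x l + u l * x l)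
      ᴿ.≈⟨ sum-cong-≋ (λ l → transᴿ (symᴿ (distribʳ (x l) (- u l) (u l))) (*-congʳ (-‿inverseˡ (u l)))) ⟩
    sum (λ l → 0# * x l)
      ᴿ.≈⟨ sum-0* x ⟩
    0# ᴿ.∎

  factor : ∀ a x u r w → (a * x) * u + r * (x * w) ≈ᴿ x * (a * u + r * w)
  factor a x u r w = transᴿ
    (+-cong (transᴿ (*-congʳ (*-comm a x)) (*-assoc x a u))
            (transᴿ (symᴿ (*-assoc r x w)) (transᴿ (*-congʳ (*-comm r x)) (*-assoc x r w))))
    (symᴿ (distribˡ x (a * u) (r * w)))

  expand : ∀ a u r w x → (a * u + r * w) * x ≈ᴿ a * (u * x) + (r * x) * w
  expand a u r w x = transᴿ (distribʳ x (a * u) (r * w))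
    (+-cong (*-assoc a u x)
            (transᴿ (*-assoc r w x) (transᴿ (*-congˡ (*-comm w x)) (symᴿ (*-assoc r x w)))))

  -- One step of fraction-free Gaussian elimination: for a pivot a = U zero j,
  -- composing U with the co-isometry `columns` clears the first row except
  -- for a, and `blocks` factors the result through the smaller matrix `rest`.
  module Step {k m} (U : Mat k (suc m)) (j : Fin k) where
    a : Carrier
    a = U zero j

    r : Vector Carrier k
    r l = - U zero l

    w : Vector Carrier m
    w i = U (suc i) j

    -- The 2 × 2 minors of U through the pivot, so nothing is divided. Column j becomes zero but is
    -- retained, which spares any reindexing.
    rest : Mat k m
    rest i l = a * U (suc i) l + r l * w i

    -- `(x₀ , x) ↦ (x₀ + r · x) e_j + a x`. The extra input x₀ feeds the pivot column, and the first
    -- row of U sends the result to `a x₀`.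
    columns : Term HAGen (1 +ℕ k) k
    columns = spread shear r Term.⨾ ((id₁ Term.⊕ scale a k) Term.⨾ accumulate (λ i → idᴹ k i j))

    blocks : Term HAGen (1 +ℕ k) (1 +ℕ m)
    blocks = (id₁ Term.⊕ canonical rest) Term.⨾ (spread shear′ w Term.⨾ (gen (s a) Term.⊕ idᵗ m))

    module _ (x : Vector Carrier (1 +ℕ k)) where
      n : Carrier
      n = sum (λ l → r l * x (suc l))

      act-columns : act columns x ≈ᵛ λ i → (x zero + n) * idᴹ k i j + a * x (suc i)
      act-columns i = transᴿ (act-accumulate (λ i → idᴹ k i j) _ i)
        (+-cong (transᴿ (*-comm _ _) (*-congʳ (act-spread-shear r x zero)))
                (transᴿ (act-scale a _ i) (*-congˡ (act-spread-shear r x (suc i)))))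

      act-columns-U : ∀ i → act (columns Term.⨾ canonical U) x i ≈ᴿ (x zero + n) * U i j + a * (U ▷ tail x) i
      act-columns-U i = ᴿ.begin
        act (canonical U) (act columns x) i
          ᴿ.≈⟨ act-canonical U _ i ⟩
        (U ▷ act columns x) i
          ᴿ.≈⟨ ▷-congˡ {A = U} act-columns i ⟩
        (U ▷ ((λ l → (x zero + n) * idᴹ k l j) +ᵛ (λ l → a * x (suc l)))) i
          ᴿ.≈⟨ ▷-+ U _ _ i ⟩
        (U ▷ (λ l → (x zero + n) * idᴹ k l j)) i + (U ▷ (λ l → a * x (suc l))) i
          ᴿ.≈⟨ +-cong (transᴿ (▷-* U _ _ i) (*-congˡ (▷-basis U j i))) (▷-* U a (tail x) i) ⟩
        (x zero + n) * U i j + a * (U ▷ tail x) i ᴿ.∎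

      rest-▷ : ∀ i → (rest ▷ tail x) i ≈ᴿ a * (U ▷ tail x) (suc i) + n * w i
      rest-▷ i = ᴿ.begin
        sum (λ l → (a * U (suc i) l + r l * w i) * x (suc l))
          ᴿ.≈⟨ sum-cong-≋ (λ l → expand a (U (suc i) l) (r l) (w i) (x (suc l))) ⟩
        sum (λ l → a * (U (suc i) l * x (suc l)) + (r l * x (suc l)) * w i)
          ᴿ.≈⟨ ∑-distrib-+ (λ l → a * (U (suc i) l * x (suc l))) (λ l → (r l * x (suc l)) * w i) ⟩
        sum (λ l → a * (U (suc i) l * x (suc l))) + sum (λ l → (r l * x (suc l)) * w i)
          ᴿ.≈⟨ +-cong (*-distribˡ-sum a (λ l → U (suc i) l * x (suc l))) (*-distribʳ-sum (w i) (λ l → r l * x (suc l))) ⟨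
        a * (U ▷ tail x) (suc i) + n * w i ᴿ.∎

      act-blocks-zero : act blocks x zero ≈ᴿ a * x zero
      act-blocks-zero = *-congˡ (act-spread-shear′ w _ zero)

      act-blocks-suc : ∀ i → act blocks x (suc i) ≈ᴿ (rest ▷ tail x) i + w i * x zero
      act-blocks-suc i = transᴿ (act-id m _ i)
        (transᴿ (act-spread-shear′ w _ (suc i)) (+-congʳ (act-canonical rest (tail x) i)))

      columns-U≈blocks : act (columns Term.⨾ canonical U) x ≈ᵛ act blocks x
      columns-U≈blocks zero = ᴿ.begin
        act (columns Term.⨾ canonical U) x zero    ᴿ.≈⟨ act-columns-U zero ⟩
        (x zero + n) * a + a * (U ▷ tail x) zero   ᴿ.≈⟨ +-congʳ (*-comm _ _) ⟩
        a * (x zero + n) + a * (U ▷ tail x) zero   ᴿ.≈⟨ distribˡ _ _ _ ⟨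
        a * ((x zero + n) + (U ▷ tail x) zero)     ᴿ.≈⟨ *-congˡ (transᴿ (+-assoc _ _ _)
                                                          (transᴿ (+-congˡ (sum-neg (U zero) (tail x))) (+-identityʳ _))) ⟩
        a * x zero                                 ᴿ.≈⟨ act-blocks-zero ⟨
        act blocks x zero                          ᴿ.∎
      columns-U≈blocks (suc i) = ᴿ.begin
        act (columns Term.⨾ canonical U) x (suc i)                 ᴿ.≈⟨ act-columns-U (suc i) ⟩
        (x zero + n) * w i + a * (U ▷ tail x) (suc i)              ᴿ.≈⟨ +-congʳ (distribʳ _ _ _) ⟩
        (x zero * w i + n * w i) + a * (U ▷ tail x) (suc i)        ᴿ.≈⟨ +-assoc _ _ _ ⟩
        x zero * w i + (n * w i + a * (U ▷ tail x) (suc i))        ᴿ.≈⟨ +-comm _ _ ⟩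
        (n * w i + a * (U ▷ tail x) (suc i)) + x zero * w i        ᴿ.≈⟨ +-cong (transᴿ (+-comm _ _) (symᴿ (rest-▷ i))) (*-comm _ _) ⟩
        (rest ▷ tail x) i + w i * x zero                           ᴿ.≈⟨ act-blocks-suc i ⟨
        act blocks x (suc i)                                       ᴿ.∎

    -- A relation X between the rows of `rest` lifts to the relation `(- X · w , a X)` between those
    -- of U: expanding the minors gives the same row of sums. The pivot is then cancelled.
    rest-rowInjective : ¬ a ≈ᴿ 0# → RowInjective U → RowInjective rest
    rest-rowInjective a≉0 inj X X-rest≈0 zero i =
      cancel (inj Y Y-U≈0 zero (suc i))
      where
      t : Carrier
      t = sum (λ i → X zero i * w i)
      Y : Mat (suc m) 1
      Y _ = - t ∷ (λ i → a * X zero i)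
      cancel : a * X zero i ≈ᴿ 0# → X zero i ≈ᴿ 0#
      cancel p with IsPID.noZeroDivisors isPID p
      ... | inj₁ a≈0 = contradiction a≈0 a≉0
      ... | inj₂ x≈0 = x≈0
      Y-U≈0 : ∀ i l → (U ⨾ᴹ Y) i l ≈ᴿ 0#
      Y-U≈0 zero l = ᴿ.begin
        - t * U zero l + sum (λ i → (a * X zero i) * U (suc i) l)
          ᴿ.≈⟨ +-congʳ (transᴿ (transᴿ (symᴿ (-‿distribˡ-* _ _)) (-‿cong (*-comm _ _))) (-‿distribˡ-* _ _)) ⟩
        r l * t + sum (λ i → (a * X zero i) * U (suc i) l)
          ᴿ.≈⟨ +-comm _ _ ⟩
        sum (λ i → (a * X zero i) * U (suc i) l) + r l * t
          ᴿ.≈⟨ +-congˡ (*-distribˡ-sum (r l) (λ i → X zero i * w i)) ⟩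
        sum (λ i → (a * X zero i) * U (suc i) l) + sum (λ i → r l * (X zero i * w i))
          ᴿ.≈⟨ ∑-distrib-+ (λ i → (a * X zero i) * U (suc i) l) (λ i → r l * (X zero i * w i)) ⟨
        sum (λ i → (a * X zero i) * U (suc i) l + r l * (X zero i * w i))
          ᴿ.≈⟨ sum-cong-≋ (λ i → factor a (X zero i) (U (suc i) l) (r l) (w i)) ⟩
        sum (λ i → X zero i * rest i l)
          ᴿ.≈⟨ X-rest≈0 zero l ⟩
        0# ᴿ.∎

    coIsometry-step : ¬ a ≈ᴿ 0# → CoIsometry (F rest) → CoIsometry (F U)
    coIsometry-step a≉0 p = coIsometry-cong (F-interp (canonical U) (eval-canonical U))
      (coIsometry-cancel coIsometry-columns
        (coIsometry-cong (⟦⟧-complete {t = blocks} {columns Term.⨾ canonical U} (λ x → ≈ᵛ-sym (columns-U≈blocks x)))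
          coIsometry-blocks))
      where
      coIsometry-columns : CoIsometry ⟦ columns ⟧
      coIsometry-columns = coIsometry-⨾ (coIsometry-spread shear r coIsometry-shear)
        (coIsometry-⨾ (coIsometry-⊕ coIsometry-id₁ (coIsometry-scale a≉0 k)) (coIsometry-accumulate _))
      coIsometry-blocks : CoIsometry ⟦ blocks ⟧
      coIsometry-blocks = coIsometry-⨾
        (coIsometry-⊕ coIsometry-id₁ (coIsometry-cong (≈-sym (F-interp (canonical rest) (eval-canonical rest))) p))
        (coIsometry-⨾ (coIsometry-spread shear′ w coIsometry-shear′) (coIsometry-⊕-id (coIsometry-s a≉0)))

  coIsometry-F : ∀ {k m} (U : Mat k m) → RowInjective U → CoIsometry (F U)
  coIsometry-F {m = zero}  U inj = coIsometry-! U
  coIsometry-F {m = suc m} U inj with pivot U inj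
  ... | j , a≉0 = coIsometry-step a≉0 (coIsometry-F rest (rest-rowInjective a≉0 inj))
    where open Step U j

-- Exchange for cokernels

module Kernels {c ℓ} (R : PrincipalIdealDomain c ℓ) where
  open PrincipalIdealDomain R using (commutativeRing; isPID)
  open CommutativeRing commutativeRing
    using (Carrier; 0#; 1#; -_; _+_; _*_; semiring; +-identityˡ; +-identityʳ; +-assoc; +-comm; +-congˡ; +-congʳ; +-cong; *-identityˡ; *-identityʳ; *-assoc; *-comm; *-congˡ; *-congʳ; zeroˡ; zeroʳ; distribʳ)
    renaming (_≈_ to _≈ᴿ_; refl to reflᴿ; sym to symᴿ; trans to transᴿ; setoid to setoidᴿ)
  open HopfAlgebras commutativeRing using (ε; s; a16)
  open InteractingHopfAlgebras commutativeRing
  open Matrices commutativeRing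
  open MatrixPROP commutativeRing
  open MatrixCoproducts commutativeRing
  open AdditionMatrix commutativeRing
  open Action commutativeRing
  open Functors R
  open Absorption R
  open Shears R
  open Elimination R
  open CospanMatrices R using (isPushout)
  open PushoutTheory MatPROP-isPROP using (IsPushout; Iso; pushout-unique; pushout-sym; pushout-id; pushout-≈; cokernel-[,])
  open RawPROP IHᶜᵖ using (_≈_; id; _⨾_; _⊕_)
  open PROPReasoning IH-isPROP
  open PresentedStructure IHEq
  private
    module M = PROPReasoning MatPROP-isPROP
    module ≈ᵛ = ≈ᵛ-Reasoning

  ⨾ᴹ-0 : ∀ {n m k} (A : Mat n m) {B : Mat m k} → (∀ i j → B i j ≈ᴿ 0#) → ∀ i j → (A ⨾ᴹ B) i j ≈ᴿ 0#
  ⨾ᴹ-0 A {B} p i j = transᴿ (⨾ᴹ-cong {A = A} {A} {B} {λ _ _ → 0#} (λ _ _ → reflᴿ) p i j) (sum-0* (λ l → A l j))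

  inverses-rowInjective : ∀ {n m} {U : Mat n m} {W : Mat m n} → W ⨾ᴹ U ≋ idᴹ m → RowInjective U
  inverses-rowInjective {n} {m} {U} {W} p X q i j = transᴿ (symᴿ (X≋ i j)) (⨾ᴹ-0 W {U ⨾ᴹ X} q i j)
    where
    X≋ : W ⨾ᴹ (U ⨾ᴹ X) ≋ X
    X≋ = M.≈-trans {f = W ⨾ᴹ (U ⨾ᴹ X)} {(W ⨾ᴹ U) ⨾ᴹ X} {X} (M.≈-sym {f = (W ⨾ᴹ U) ⨾ᴹ X} {W ⨾ᴹ (U ⨾ᴹ X)} (M.⨾-assoc W U X))
      (M.≈-trans {f = (W ⨾ᴹ U) ⨾ᴹ X} {idᴹ m ⨾ᴹ X} {X} (⨾ᴹ-cong p (λ _ _ → reflᴿ)) (M.⨾-identityˡ X))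

  G-† : ∀ {n m} (A : Mat n m) → CoIsometry (F A) → G A ⨾ F A ≈ id m
  G-† A p = ≈-trans (≈-sym (F-† A) ⟩⨾⟨refl) (p .†-⨾)

  -- The one-sided law `G U ⨾ F U ≈ id` is upgraded by the genuine inverse W of U.
  G≈F⁻¹ : ∀ {n m} {U : Mat n m} {W : Mat m n} → U ⨾ᴹ W ≋ idᴹ n → W ⨾ᴹ U ≋ idᴹ m → G U ≈ F W
  G≈F⁻¹ {n} {m} {U} {W} p q = begin
    G U                ≈⟨ ⨾-identityʳ _ ⟨
    G U ⨾ id n         ≈⟨ refl⟩⨾⟨ ≈-trans (F-⨾ p) (≈-sym (F-id (λ _ _ → reflᴿ))) ⟨
    G U ⨾ (F U ⨾ F W)  ≈⟨ assoc²ʳ (G-† U (coIsometry-F U (inverses-rowInjective {U = U} {W} q))) ⟩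
    id m ⨾ F W         ≈⟨ ⨾-identityˡ _ ⟩
    F W                ∎
    where open ≈-Reasoning

  open ≈-Reasoning

  Exchanges : ∀ {k n m p} → Mat k n → Mat k m → Mat n p → Mat m p → Set (c ⊔ ℓ)
  Exchanges f g l r = G f ⨾ F g ≈ F l ⨾ G r

  -- An invertible `to` satisfies `F to ⨾ G to ≈ id`, which can be inserted at the apex. This makes
  -- the inverse of 𝓢 well defined on isomorphism classes, and the exchange law independent of the
  -- chosen pushout.
  span-iso : ∀ {n m p q} {l : Mat n p} {r : Mat m p} {l′ : Mat n q} {r′ : Mat m q} →
             Iso l r l′ r′ → F l ⨾ G r ≈ F l′ ⨾ G r′
  span-iso {l = l} {r} {l′} {r′} i = begin
    F l ⨾ G r                      ≈⟨ refl⟩⨾⟨ ⨾-identityˡ _ ⟨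
    F l ⨾ (id _ ⨾ G r)             ≈⟨ refl⟩⨾⟨ (≈-trans (refl⟩⨾⟨ G≈F⁻¹ invˡ invʳ)
                                        (≈-trans (F-⨾ invˡ) (≈-sym (F-id (λ _ _ → reflᴿ)))) ⟩⨾⟨refl) ⟨
    F l ⨾ (F to ⨾ G to ⨾ G r)      ≈⟨ ≈-trans (refl⟩⨾⟨ ⨾-assoc _ _ _) (≈-sym (⨾-assoc _ _ _)) ⟩
    (F l ⨾ F to) ⨾ (G to ⨾ G r)    ≈⟨ F-⨾ left-to ⟩⨾⟨ G-⨾ right-to ⟩
    F l′ ⨾ G r′                    ∎
    where open Iso i

  exchanges-iso : ∀ {k n m p q} {f : Mat k n} {g : Mat k m} {l : Mat n p} {r : Mat m p} {l′ : Mat n q} {r′ : Mat m q} →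
    IsPushout f g l r → IsPushout f g l′ r′ → Exchanges f g l r → Exchanges f g l′ r′
  exchanges-iso P Q e = ≈-trans e (span-iso (pushout-unique P Q))

  0-initial : ∀ {q} (u v : Mat 0 q) → u ≋ v
  0-initial u v i ()

  0-terminal : ∀ {q} (u v : Mat q 0) → u ≋ v
  0-terminal u v ()

  F-[,] : ∀ {n m q} (A : Mat n q) (B : Mat m q) → F [ A , B ]ᴹ ≈ (F A ⊕ F B) ⨾ add q
  F-[,] {n} {m} {q} A B = ≈-sym (≈-trans (F-⊕ {C = A ⊕ᴹ B} (λ _ _ → reflᴿ) ⟩⨾⟨refl) (F-⨾ (≋-ext λ x → ≈ᵛ.begin
    ((A ⊕ᴹ B) ⨾ᴹ addᴹ q) ▷ x                       ≈ᵛ.≈⟨ ⨾-▷ (A ⊕ᴹ B) (addᴹ q) x ⟩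
    addᴹ q ▷ (A ⊕ᴹ B) ▷ x                          ≈ᵛ.≈⟨ ▷-congˡ {A = addᴹ q} (⊕-▷ A B x) ⟩
    addᴹ q ▷ ((A ▷ takeᵛ {n} x) ++ (B ▷ dropᵛ {n} x)) ≈ᵛ.≈⟨ add-▷-++ q _ _ ⟩
    (A ▷ takeᵛ {n} x) +ᵛ (B ▷ dropᵛ {n} x)         ≈ᵛ.≈⟨ [,]-▷ A B x ⟨
    [ A , B ]ᴹ ▷ x                                 ≈ᵛ.∎)))

  -- `F (zeroᴹ q) ⨾ G C` is an arbitrary element of the kernel of C; adding one to the value of f
  -- leaves only its image under C determined.
  absorb-zero : ∀ {n p q} (C : Mat p q) (f : Term IHGen n p) →
                ((F (zeroᴹ q) ⨾ G C) ⊕ f) ⨾ add p ≈ f ⨾ F C ⨾ G C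
  absorb-zero {n} {p} {q} C f = begin
    ((F (zeroᴹ q) ⨾ G C) ⊕ f) ⨾ add p
      ≈⟨ ≈-trans (refl⟩⊕⟨ ≈-sym (⨾-identityʳ f)) (interchange _ _ _ _) ⟩⨾⟨refl ⟩
    (F (zeroᴹ q) ⊕ f) ⨾ (G C ⊕ id p) ⨾ add p
      ≈⟨ assoc²ˡ (≈-trans (absorb-G C) (⨾-assoc _ _ _)) ⟩
    (F (zeroᴹ q) ⊕ f) ⨾ ((id q ⊕ F C) ⨾ (add q ⨾ G C))
      ≈⟨ assoc²ʳ (≈-trans merge (⨾-identityʳ _ ⟩⊕⟨refl)) ⟩
    (F (zeroᴹ q) ⊕ (f ⨾ F C)) ⨾ (add q ⨾ G C)
      ≈⟨ assoc²ʳ (zero-addˡ _) ⟩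
    f ⨾ F C ⨾ G C ∎

  -- The image of `[ f , g ]ᴹ` is the sum of two images. The first is the kernel of l; adding it to
  -- a value of g amounts to passing through l and back, so the second hypothesis takes over for
  -- `g ⨾ᴹ l`.
  exchanges-[,] : ∀ {k k′ n p q} {f : Mat k n} {g : Mat k′ n} {l : Mat n p} {l′ : Mat p q} →
    Exchanges (discardᴹ k) f (zeroᴹ p) l → Exchanges (discardᴹ k′) (g ⨾ᴹ l) (zeroᴹ q) l′ →
    Exchanges (discardᴹ (k +ℕ k′)) [ f , g ]ᴹ (zeroᴹ q) (l ⨾ᴹ l′)
  exchanges-[,] {k} {k′} {n} {p} {q} {f} {g} {l} {l′} e e′ = begin
    G (discardᴹ (k +ℕ k′)) ⨾ F [ f , g ]ᴹ
      ≈⟨ G-⊕ {A = discardᴹ k} {discardᴹ k′} (λ ()) ⟩⨾⟨ ≈-sym (F-[,] f g) ⟨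
    (G (discardᴹ k) ⊕ G (discardᴹ k′)) ⨾ ((F f ⊕ F g) ⨾ add n)
      ≈⟨ assoc²ʳ merge ⟩
    ((G (discardᴹ k) ⨾ F f) ⊕ (G (discardᴹ k′) ⨾ F g)) ⨾ add n
      ≈⟨ (e ⟩⊕⟨refl) ⟩⨾⟨refl ⟩
    ((F (zeroᴹ p) ⨾ G l) ⊕ (G (discardᴹ k′) ⨾ F g)) ⨾ add n
      ≈⟨ absorb-zero l _ ⟩
    G (discardᴹ k′) ⨾ F g ⨾ F l ⨾ G l
      ≈⟨ ≈-trans (assoc²ˡ (F-⨾ (λ _ _ → reflᴿ))) e′ ⟩⨾⟨refl ⟩
    F (zeroᴹ q) ⨾ G l′ ⨾ G l
      ≈⟨ assoc²ˡ (G-⨾ (λ _ _ → reflᴿ)) ⟩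
    F (zeroᴹ q) ⨾ G (l ⨾ᴹ l′) ∎

  -- Exchange for a single non-zero column v = d q, where d = u · v generates
  -- the ideal of its entries: u together with the cokernel of v is a change
  -- of basis taking q to the first basis vector.
  module Column {p} (v : Mat 1 p) (v≉0 : ¬ (∀ i → v i zero ≈ᴿ 0#)) where
    open SemiringSum semiring using (sum; sum-cong-≋; ∑-distrib-+; *-distribˡ-sum; *-distribʳ-sum)
    open SemiringDivisibility semiring using (_∣_; _,_)
    open PIDPushouts R using (pushout; cancelʳ-nonZero)
    private module ᴿ = SetoidReasoning setoidᴿ

    -- The ideal generated by the entries of v. Membership keeps the combination u, so that the
    -- generator d comes with Bézout coefficients.
    I : Carrier → Set (c ⊔ ℓ)
    I x = Σ (Vector Carrier p) λ u → sum (λ l → u l * v l zero) ≈ᴿ x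

    I-isIdeal : IsIdeal commutativeRing I
    I-isIdeal = record
      { resp     = λ x≈y (u , e) → u , transᴿ e x≈y
      ; 0#-mem   = (λ _ → 0#) , sum-0* (λ l → v l zero)
      ; +-closed = λ { {x} {y} (u , e) (u′ , e′) → (λ l → u l + u′ l) , (ᴿ.begin
          sum (λ l → (u l + u′ l) * v l zero)
            ᴿ.≈⟨ sum-cong-≋ (λ l → distribʳ (v l zero) (u l) (u′ l)) ⟩
          sum (λ l → u l * v l zero + u′ l * v l zero)
            ᴿ.≈⟨ ∑-distrib-+ (λ l → u l * v l zero) (λ l → u′ l * v l zero) ⟩
          sum (λ l → u l * v l zero) + sum (λ l → u′ l * v l zero)
            ᴿ.≈⟨ +-cong e e′ ⟩
          x + y ᴿ.∎) }
      ; *-closed = λ { k {x} (u , e) → (λ l → k * u l) , (ᴿ.begin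
          sum (λ l → (k * u l) * v l zero)
            ᴿ.≈⟨ sum-cong-≋ (λ l → *-assoc k (u l) (v l zero)) ⟩
          sum (λ l → k * (u l * v l zero))
            ᴿ.≈⟨ *-distribˡ-sum k (λ l → u l * v l zero) ⟨
          k * sum (λ l → u l * v l zero)
            ᴿ.≈⟨ *-congˡ e ⟩
          k * x ᴿ.∎) }
      }

    private
      generator = IsPID.principal isPID I I-isIdeal

    d : Carrier
    d = proj₁ generator

    d-mem : I d
    d-mem = Equivalence.from (proj₂ generator d) (1# , *-identityˡ d)

    d∣v : ∀ i → d ∣ v i zero
    d∣v i = Equivalence.to (proj₂ generator (v i zero)) (idᴹ p i , id-▷ p (λ l → v l zero) i)

    u : Mat p 1
    u _ = proj₁ d-mem

    q : Mat 1 p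
    q i _ = let k , _ = d∣v i in k

    q*d : ∀ i → q i zero * d ≈ᴿ v i zero
    q*d i = let _ , e = d∣v i in e

    d≉0 : ¬ d ≈ᴿ 0#
    d≉0 d≈0 = v≉0 λ i → transᴿ (symᴿ (q*d i)) (transᴿ (*-congˡ d≈0) (zeroʳ _))

    -- The Bézout identity `u · v = d`, divided by d.
    uq≈1 : sum (λ l → u zero l * q l zero) ≈ᴿ 1#
    uq≈1 = cancelʳ-nonZero d≉0 (ᴿ.begin
      sum (λ l → u zero l * q l zero) * d    ᴿ.≈⟨ *-distribʳ-sum d (λ l → u zero l * q l zero) ⟩
      sum (λ l → (u zero l * q l zero) * d)  ᴿ.≈⟨ sum-cong-≋ (λ l → transᴿ (*-assoc (u zero l) (q l zero) d) (*-congˡ (q*d l))) ⟩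
      sum (λ l → u zero l * v l zero)        ᴿ.≈⟨ proj₂ d-mem ⟩
      d                                      ᴿ.≈⟨ *-identityˡ d ⟨
      1# * d                                 ᴿ.∎)

    open Pushout (pushout (discardᴹ 1) v) using (apex) renaming (ι₁ to Z; ι₂ to C)
    private module P = Pushout (pushout (discardᴹ 1) v)

    -- The projection x ↦ x - (u · x) q.
    E : Mat p p
    E i j = idᴹ p i j + (- u zero j) * q i zero

    module _ (x : Vector Carrier p) where
      t n : Carrier
      t = sum (λ l → u zero l * x l)
      n = sum (λ l → - u zero l * x l)

      n+t≈0 : n + t ≈ᴿ 0#
      n+t≈0 = sum-neg (u zero) x

      E-▷ : E ▷ x ≈ᵛ x +ᵛ (λ i → n * q i zero)
      E-▷ i = ᴿ.begin
        sum (λ l → (idᴹ p i l + (- u zero l) * q i zero) * x l)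
          ᴿ.≈⟨ sum-cong-≋ (λ l → swap (idᴹ p i l) (- u zero l) (q i zero) (x l)) ⟩
        sum (λ l → idᴹ p i l * x l + ((- u zero l) * x l) * q i zero)
          ᴿ.≈⟨ ∑-distrib-+ (λ l → idᴹ p i l * x l) (λ l → ((- u zero l) * x l) * q i zero) ⟩
        (idᴹ p ▷ x) i + sum (λ l → ((- u zero l) * x l) * q i zero)
          ᴿ.≈⟨ +-cong (id-▷ p x i) (symᴿ (*-distribʳ-sum (q i zero) (λ l → (- u zero l) * x l))) ⟩
        x i + n * q i zero ᴿ.∎
        where
        swap : ∀ a b c d → (a + b * c) * d ≈ᴿ a * d + (b * d) * c
        swap a b c d = transᴿ (distribʳ d a (b * c)) (+-congˡ
          (transᴿ (*-assoc b c d) (transᴿ (*-congˡ (*-comm c d)) (symᴿ (*-assoc b d c)))))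

      u-E : (u ▷ E ▷ x) zero ≈ᴿ 0#
      u-E = ᴿ.begin
        (u ▷ E ▷ x) zero                               ᴿ.≈⟨ ▷-congˡ {A = u} E-▷ zero ⟩
        (u ▷ (x +ᵛ (λ i → n * q i zero))) zero         ᴿ.≈⟨ ▷-+ u x (λ i → n * q i zero) zero ⟩
        t + (u ▷ (λ i → n * q i zero)) zero            ᴿ.≈⟨ +-congˡ (transᴿ (▷-* u n (λ i → q i zero) zero)
                                                             (transᴿ (*-congˡ uq≈1) (*-identityʳ n))) ⟩
        t + n                                          ᴿ.≈⟨ transᴿ (+-comm t n) n+t≈0 ⟩
        0#                                             ᴿ.∎

    v-E : ∀ i → (E ▷ (λ l → v l zero)) i ≈ᴿ 0#
    v-E i = ᴿ.begin
      (E ▷ (λ l → v l zero)) i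
        ᴿ.≈⟨ E-▷ (λ l → v l zero) i ⟩
      v i zero + n _ * q i zero
        ᴿ.≈⟨ +-congʳ (transᴿ (symᴿ (q*d i)) (transᴿ (*-congˡ (symᴿ (proj₂ d-mem))) (*-comm _ _))) ⟩
      t _ * q i zero + n _ * q i zero
        ᴿ.≈⟨ distribʳ (q i zero) _ _ ⟨
      (t _ + n _) * q i zero
        ᴿ.≈⟨ *-congʳ (transᴿ (+-comm _ _) (n+t≈0 (λ l → v l zero))) ⟩
      0# * q i zero
        ᴿ.≈⟨ zeroˡ _ ⟩
      0# ᴿ.∎

    square : discardᴹ 1 ⨾ᴹ zeroᴹ p ≋ v ⨾ᴹ E
    square i zero = symᴿ (v-E i)

    -- A section of the cokernel C: the projection E kills v and therefore factors through C.
    S : Mat apex p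
    S = P.universal (zeroᴹ p) E square

    S-▷ : ∀ x → S ▷ C ▷ x ≈ᵛ E ▷ x
    S-▷ x = ≈ᵛ-trans (≈ᵛ-sym (⨾-▷ C S x)) (▷-cong (P.factor₂ {h₁ = zeroᴹ p} {E} square) ≈ᵛ-refl)

    -- `d (C q) = C v = 0`, and d can be cancelled: the cokernel among free modules kills q along
    -- with its multiple v.
    C-q : ∀ i → (C ▷ (λ l → q l zero)) i ≈ᴿ 0#
    C-q i with IsPID.noZeroDivisors isPID {(C ▷ (λ l → q l zero)) i} {d} (ᴿ.begin
        (C ▷ (λ l → q l zero)) i * d           ᴿ.≈⟨ *-distribʳ-sum d (λ l → C i l * q l zero) ⟩
        sum (λ l → (C i l * q l zero) * d)     ᴿ.≈⟨ sum-cong-≋ (λ l → transᴿ (*-assoc (C i l) (q l zero) d) (*-congˡ (q*d l))) ⟩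
        sum (λ l → C i l * v l zero)           ᴿ.≈⟨ P.commutes i zero ⟨
        0#                                     ᴿ.∎)
    ... | inj₁ e = e
    ... | inj₂ d≈0 = contradiction d≈0 d≉0

    C-E : ∀ x → C ▷ E ▷ x ≈ᵛ C ▷ x
    C-E x i = ᴿ.begin
      (C ▷ E ▷ x) i                                       ᴿ.≈⟨ ▷-congˡ {A = C} (E-▷ x) i ⟩
      (C ▷ (x +ᵛ (λ l → n x * q l zero))) i               ᴿ.≈⟨ ▷-+ C x (λ l → n x * q l zero) i ⟩
      (C ▷ x) i + (C ▷ (λ l → n x * q l zero)) i          ᴿ.≈⟨ +-congˡ (transᴿ (▷-* C (n x) (λ l → q l zero) i)
                                                                (transᴿ (*-congˡ (C-q i)) (zeroʳ (n x)))) ⟩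
      (C ▷ x) i + 0#                                      ᴿ.≈⟨ +-identityʳ _ ⟩
      (C ▷ x) i                                           ᴿ.∎

    S-u : ∀ x → u ▷ S ▷ x ≈ᵛ 0ᵛ
    S-u x = ≈ᵛ-trans (≈ᵛ-sym (⨾-▷ S u x)) (≈ᵛ-trans (▷-cong S-u≋0 ≈ᵛ-refl) (λ { zero → sum-0* x }))
      where
      S-u≋0 : S ⨾ᴹ u ≋ λ _ _ → 0#
      S-u≋0 = P.unique (S ⨾ᴹ u) (λ _ _ → 0#) (λ _ ()) (≋-ext λ x → ≈ᵛ.begin
        (C ⨾ᴹ (S ⨾ᴹ u)) ▷ x           ≈ᵛ.≈⟨ ≈ᵛ-trans (⨾-▷ C (S ⨾ᴹ u) x) (⨾-▷ S u (C ▷ x)) ⟩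
        u ▷ S ▷ C ▷ x                 ≈ᵛ.≈⟨ ▷-congˡ {A = u} (S-▷ x) ⟩
        u ▷ E ▷ x                     ≈ᵛ.≈⟨ (λ { zero → u-E x }) ⟩
        0ᵛ                            ≈ᵛ.≈⟨ (λ { zero → sum-0* (C ▷ x) }) ⟨
        (λ _ _ → 0#) ▷ C ▷ x          ≈ᵛ.≈⟨ ⨾-▷ C (λ _ _ → 0#) x ⟨
        (C ⨾ᴹ (λ _ _ → 0#)) ▷ x       ≈ᵛ.∎)

    S-C : ∀ x → C ▷ S ▷ x ≈ᵛ x
    S-C x = ≈ᵛ-trans (≈ᵛ-sym (⨾-▷ S C x)) (≈ᵛ-trans (▷-cong S-C≋id ≈ᵛ-refl) (id-▷ apex x))
      where
      S-C≋id : S ⨾ᴹ C ≋ idᴹ apex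
      S-C≋id = P.unique (S ⨾ᴹ C) (idᴹ apex) (λ _ ()) (≋-ext λ x → ≈ᵛ.begin
        (C ⨾ᴹ (S ⨾ᴹ C)) ▷ x           ≈ᵛ.≈⟨ ≈ᵛ-trans (⨾-▷ C (S ⨾ᴹ C) x) (⨾-▷ S C (C ▷ x)) ⟩
        C ▷ S ▷ C ▷ x                 ≈ᵛ.≈⟨ ▷-congˡ {A = C} (S-▷ x) ⟩
        C ▷ E ▷ x                     ≈ᵛ.≈⟨ C-E x ⟩
        C ▷ x                         ≈ᵛ.≈⟨ id-▷ apex (C ▷ x) ⟨
        idᴹ apex ▷ C ▷ x              ≈ᵛ.≈⟨ ⨾-▷ C (idᴹ apex) x ⟨
        (C ⨾ᴹ idᴹ apex) ▷ x           ≈ᵛ.∎)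

    -- New coordinates: u reads the coefficient of q, and C the class modulo q. The inverse W
    -- recombines them with q and the section S.
    U : Mat p (1 +ℕ apex)
    U = u ++ C

    W : Mat (1 +ℕ apex) p
    W = [ q , S ]ᴹ

    U-▷ : ∀ x → U ▷ x ≈ᵛ (u ▷ x) ++ (C ▷ x)
    U-▷ x zero    = reflᴿ
    U-▷ x (suc i) = reflᴿ

    q-▷ : ∀ y i → (q ▷ y) i ≈ᴿ y zero * q i zero
    q-▷ y i = transᴿ (+-identityʳ _) (*-comm _ _)

    U-W : U ⨾ᴹ W ≋ idᴹ p
    U-W = ≋-ext λ x → ≈ᵛ.begin
      (U ⨾ᴹ W) ▷ x                         ≈ᵛ.≈⟨ ⨾-▷ U W x ⟩
      W ▷ U ▷ x                            ≈ᵛ.≈⟨ ▷-congˡ {A = W} (U-▷ x) ⟩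
      W ▷ ((u ▷ x) ++ (C ▷ x))             ≈ᵛ.≈⟨ [,]-▷-++ q S (u ▷ x) (C ▷ x) ⟩
      (q ▷ u ▷ x) +ᵛ (S ▷ C ▷ x)           ≈ᵛ.≈⟨ (λ i → ᴿ.begin
          (q ▷ u ▷ x) i + (S ▷ C ▷ x) i            ᴿ.≈⟨ +-cong (q-▷ (u ▷ x) i) (transᴿ (S-▷ x i) (E-▷ x i)) ⟩
          t x * q i zero + (x i + n x * q i zero)  ᴿ.≈⟨ +-congˡ (+-comm _ _) ⟩
          t x * q i zero + (n x * q i zero + x i)  ᴿ.≈⟨ +-assoc _ _ _ ⟨
          (t x * q i zero + n x * q i zero) + x i  ᴿ.≈⟨ +-congʳ (transᴿ (symᴿ (distribʳ (q i zero) _ _))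
                                                         (transᴿ (*-congʳ (transᴿ (+-comm _ _) (n+t≈0 x))) (zeroˡ _))) ⟩
          0# + x i                                 ᴿ.≈⟨ +-identityˡ _ ⟩
          x i                                      ᴿ.∎) ⟩
      x                                    ≈ᵛ.≈⟨ id-▷ p x ⟨
      idᴹ p ▷ x                            ≈ᵛ.∎

    W-U : W ⨾ᴹ U ≋ idᴹ (1 +ℕ apex)
    W-U = ≋-ext λ x → let y = takeᵛ {1} x ; z = dropᵛ {1} x in ≈ᵛ.begin
      (W ⨾ᴹ U) ▷ x                                     ≈ᵛ.≈⟨ ⨾-▷ W U x ⟩
      U ▷ W ▷ x                                        ≈ᵛ.≈⟨ ▷-congˡ {A = U} ([,]-▷ q S x) ⟩
      U ▷ ((q ▷ y) +ᵛ (S ▷ z))                         ≈ᵛ.≈⟨ U-▷ _ ⟩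
      (u ▷ ((q ▷ y) +ᵛ (S ▷ z))) ++ (C ▷ ((q ▷ y) +ᵛ (S ▷ z)))
        ≈ᵛ.≈⟨ ++-cong
                (λ { zero → ᴿ.begin
                  (u ▷ ((q ▷ y) +ᵛ (S ▷ z))) zero          ᴿ.≈⟨ ▷-+ u (q ▷ y) (S ▷ z) zero ⟩
                  (u ▷ q ▷ y) zero + (u ▷ S ▷ z) zero      ᴿ.≈⟨ +-cong (▷-congˡ {A = u} (q-▷ y) zero) (S-u z zero) ⟩
                  (u ▷ (λ i → y zero * q i zero)) zero + 0# ᴿ.≈⟨ +-identityʳ _ ⟩
                  (u ▷ (λ i → y zero * q i zero)) zero     ᴿ.≈⟨ ▷-* u (y zero) (λ i → q i zero) zero ⟩
                  y zero * (u ▷ (λ i → q i zero)) zero     ᴿ.≈⟨ *-congˡ uq≈1 ⟩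
                  y zero * 1#                              ᴿ.≈⟨ *-identityʳ _ ⟩
                  y zero                                   ᴿ.∎ })
                (λ i → ᴿ.begin
                  (C ▷ ((q ▷ y) +ᵛ (S ▷ z))) i             ᴿ.≈⟨ ▷-+ C (q ▷ y) (S ▷ z) i ⟩
                  (C ▷ q ▷ y) i + (C ▷ S ▷ z) i            ᴿ.≈⟨ +-cong (▷-congˡ {A = C} (q-▷ y) i) (S-C z i) ⟩
                  (C ▷ (λ l → y zero * q l zero)) i + z i  ᴿ.≈⟨ +-congʳ (transᴿ (▷-* C (y zero) (λ l → q l zero) i)
                                                                 (transᴿ (*-congˡ (C-q i)) (zeroʳ _))) ⟩
                  0# + z i                                 ᴿ.≈⟨ +-identityˡ _ ⟩
                  z i                                      ᴿ.∎) ⟩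
      y ++ z                                           ≈ᵛ.≈⟨ take-++-drop {1} x ⟩
      x                                                ≈ᵛ.≈⟨ id-▷ (1 +ℕ apex) x ⟨
      idᴹ (1 +ℕ apex) ▷ x                              ≈ᵛ.∎

    -- `η•` can emit `s̄⟨ d ⟩` by the reversed (A16), and (B1) cancels it against `s⟨ d ⟩`. This is
    -- why v may be replaced by q.
    η•-s : η• ⨾ s⟨ d ⟩ ≈ η•
    η•-s = begin
      η• ⨾ s⟨ d ⟩                ≈⟨ axiom (haᵒᵖ (a16 d)) ⟩⨾⟨refl ⟨
      η• ⨾ s̄⟨ d ⟩ ⨾ s⟨ d ⟩       ≈⟨ assoc²ˡ (≈-trans (axiom (b1 d d≉0)) id₁≈id) ⟩
      η• ⨾ id 1                  ≈⟨ ⨾-identityʳ η• ⟩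
      η•                         ∎

    J : Mat 1 (1 +ℕ apex)
    J = idᴹ 1 ⊕ᴹ zeroᴹ apex

    J-W : J ⨾ᴹ W ≋ q
    J-W = ≋-ext λ x → ≈ᵛ.begin
      (J ⨾ᴹ W) ▷ x                            ≈ᵛ.≈⟨ ⨾-▷ J W x ⟩
      W ▷ J ▷ x                               ≈ᵛ.≈⟨ ▷-congˡ {A = W} (⊕-▷ (idᴹ 1) (zeroᴹ apex) x) ⟩
      W ▷ ((idᴹ 1 ▷ takeᵛ {1} x) ++ 0ᵛ)       ≈ᵛ.≈⟨ [,]-▷-++ q S (idᴹ 1 ▷ takeᵛ {1} x) 0ᵛ ⟩
      (q ▷ idᴹ 1 ▷ takeᵛ {1} x) +ᵛ (S ▷ 0ᵛ)   ≈ᵛ.≈⟨ +ᵛ-cong (▷-congˡ {A = q} {idᴹ 1 ▷ takeᵛ {1} x} {x} (λ { zero → id-▷ 1 x zero })) (▷-0 S) ⟩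
      (q ▷ x) +ᵛ 0ᵛ                           ≈ᵛ.≈⟨ (λ i → +-identityʳ _) ⟩
      q ▷ x                                   ≈ᵛ.∎

    U-π : U ⨾ᴹ (discardᴹ 1 ⊕ᴹ idᴹ apex) ≋ C
    U-π = ≋-ext λ x → ≈ᵛ-trans (⨾-▷ U (discardᴹ 1 ⊕ᴹ idᴹ apex) x)
      (≈ᵛ-trans (⊕-▷ (discardᴹ 1) (idᴹ apex) (U ▷ x)) (id-▷ apex (C ▷ x)))

    -- Once d has disappeared into `η•`, q is the first coordinate inclusion J followed by W, that
    -- is by `G U`. An unconstrained first coordinate beside zeros is exactly the kernel of the
    -- projection that forgets this coordinate, and that projection after U is C.
    exchange-column : Exchanges (discardᴹ 1) v Z C
    exchange-column = begin
      G (discardᴹ 1) ⨾ F v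
        ≈⟨ G-interp (gen ε) {discardᴹ 1} (λ ()) ⟩⨾⟨ F-⨾ {A = λ _ _ → d} {q} (λ { i zero → transᴿ (+-identityʳ _) (q*d i) }) ⟨
      η• ⨾ (F (λ _ _ → d) ⨾ F q)
        ≈⟨ assoc²ʳ (≈-trans (refl⟩⨾⟨ ≈-sym (F-interp (gen (s d)) (λ _ _ → reflᴿ))) η•-s) ⟩
      η• ⨾ F q
        ≈⟨ refl⟩⨾⟨ ≈-trans (F-⊕ {A = idᴹ 1} {zeroᴹ apex} {J} (λ _ _ → reflᴿ) ⟩⨾⟨ G≈F⁻¹ U-W W-U) (F-⨾ J-W) ⟨
      η• ⨾ ((F (idᴹ 1) ⊕ F (zeroᴹ apex)) ⨾ G U)
        ≈⟨ assoc²ʳ (begin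
             η• ⨾ (F (idᴹ 1) ⊕ F (zeroᴹ apex))
               ≈⟨ ≈-sym (⊕-identityʳ η•) ⟩⨾⟨ (≈-sym (F-id (λ _ _ → reflᴿ)) ⟩⊕⟨refl) ⟩
             (η• ⊕ id 0) ⨾ (id 1 ⊕ F (zeroᴹ apex))
               ≈⟨ exchange ⟩
             (id 0 ⊕ F (zeroᴹ apex)) ⨾ (η• ⊕ id apex)
               ≈⟨ ⊕-identityˡ _ ⟩⨾⟨ (G-interp (gen ε) {discardᴹ 1} (λ ()) ⟩⊕⟨ G-id (λ _ _ → reflᴿ)) ⟩
             F (zeroᴹ apex) ⨾ (G (discardᴹ 1) ⊕ G (idᴹ apex))
               ≈⟨ refl⟩⨾⟨ G-⊕ (λ _ _ → reflᴿ) ⟩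
             F (zeroᴹ apex) ⨾ G (discardᴹ 1 ⊕ᴹ idᴹ apex) ∎) ⟩
      F (zeroᴹ apex) ⨾ G (discardᴹ 1 ⊕ᴹ idᴹ apex) ⨾ G U
        ≈⟨ assoc²ˡ (G-⨾ U-π) ⟩
      F (zeroᴹ apex) ⨾ G C
        ≈⟨ F-cong (λ _ ()) ⟩⨾⟨refl ⟩
      F Z ⨾ G C ∎

  -- It suffices to exhibit one cokernel for which exchange holds; `exchanges-iso` transfers the law
  -- to all others.
  record ExchangedCokernel {k p} (M : Mat k p) : Set (c ⊔ ℓ) where
    field
      {rank}    : ℕ
      cokernel  : Mat p rank
      square    : IsPushout (discardᴹ k) M (zeroᴹ rank) cokernel
      exchanged : Exchanges (discardᴹ k) M (zeroᴹ rank) cokernel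

  cokernel-empty : ∀ {p} (M : Mat 0 p) → ExchangedCokernel M
  cokernel-empty {p} M = record
    { cokernel  = idᴹ p
    ; square    = pushout-≈ {f = idᴹ 0} {discardᴹ 0} {M} {M} {M} {zeroᴹ p} {idᴹ p} {idᴹ p} (λ ()) (λ _ _ → reflᴿ)
                    (λ _ ()) (λ _ _ → reflᴿ) (pushout-sym (pushout-id M))
    ; exchanged = begin
        G (discardᴹ 0) ⨾ F M        ≈⟨ ≈-sym (G-id {A = discardᴹ 0} (λ ())) ⟩⨾⟨ F-cong (λ _ ()) ⟩
        id 0 ⨾ F (zeroᴹ p)          ≈⟨ ⨾-identityˡ _ ⟩
        F (zeroᴹ p)                 ≈⟨ ⨾-identityʳ _ ⟨
        F (zeroᴹ p) ⨾ id p          ≈⟨ refl⟩⨾⟨ G-id (λ _ _ → reflᴿ) ⟩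
        F (zeroᴹ p) ⨾ G (idᴹ p)     ∎
    }

  -- A zero column factors through the object 0, and the unconstrained input is then discarded by
  -- (B2).
  cokernel-zero : ∀ {p} (v : Mat 1 p) → (∀ i → v i zero ≈ᴿ 0#) → ExchangedCokernel v
  cokernel-zero {p} v v≈0 = record
    { cokernel  = idᴹ p
    ; square    = record
        { commutes  = M.≈-sym {f = v ⨾ᴹ idᴹ p} {discardᴹ 1 ⨾ᴹ zeroᴹ p}
                        (M.≈-trans {f = v ⨾ᴹ idᴹ p} {v} {discardᴹ 1 ⨾ᴹ zeroᴹ p} (M.⨾-identityʳ v) v≋0)
        ; universal = λ h₁ h₂ e → h₂
        ; factor₁   = λ e _ ()
        ; factor₂   = λ {_} {_} {h₂} e → M.⨾-identityˡ h₂
        ; unique    = λ u w _ e → M.≈-trans {f = u} {idᴹ p ⨾ᴹ u} {w} (M.≈-sym {f = idᴹ p ⨾ᴹ u} {u} (M.⨾-identityˡ u))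
                        (M.≈-trans {f = idᴹ p ⨾ᴹ u} {idᴹ p ⨾ᴹ w} {w} e (M.⨾-identityˡ w))
        }
    ; exchanged = begin
        G (discardᴹ 1) ⨾ F v
          ≈⟨ refl⟩⨾⟨ F-⨾ {A = discardᴹ 1} {zeroᴹ p} (λ i j → symᴿ (v≋0 i j)) ⟨
        G (discardᴹ 1) ⨾ (F (discardᴹ 1) ⨾ F (zeroᴹ p))
          ≈⟨ assoc²ʳ (G-† (discardᴹ 1) (coIsometry-! (discardᴹ 1))) ⟩
        id 0 ⨾ F (zeroᴹ p)
          ≈⟨ ⨾-identityˡ _ ⟩
        F (zeroᴹ p)
          ≈⟨ ≈-trans (refl⟩⨾⟨ ≈-sym (G-id (λ _ _ → reflᴿ))) (⨾-identityʳ _) ⟨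
        F (zeroᴹ p) ⨾ G (idᴹ p) ∎
    }
    where
    v≋0 : v ≋ discardᴹ 1 ⨾ᴹ zeroᴹ p
    v≋0 i zero = v≈0 i

  cokernel-column : ∀ {p} (v : Mat 1 p) → ExchangedCokernel v
  -- Only a non-zero generator d can be cancelled by (B1), so the zero column is decided and treated
  -- apart.
  cokernel-column v with all? (λ i → PIDPushouts.≈0? R (v i zero))
  ... | yes v≈0 = cokernel-zero v v≈0
  ... | no v≉0 = record
    { cokernel  = Pushout.ι₂ P
    ; square    = pushout-≈ {f = discardᴹ 1} {discardᴹ 1} {v} {v} {Pushout.ι₁ P} {zeroᴹ _} {Pushout.ι₂ P} {Pushout.ι₂ P}
                    (λ ()) (λ _ _ → reflᴿ) (λ _ ()) (λ _ _ → reflᴿ) (isPushout P)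
    ; exchanged = ≈-trans (Column.exchange-column v v≉0) (F-cong (λ _ ()) ⟩⨾⟨refl)
    }
    where
    P = PIDPushouts.pushout R (discardᴹ 1) v

  exchanged-cokernel : ∀ {k p} (M : Mat k p) → ExchangedCokernel M
  exchanged-cokernel {zero}  M = cokernel-empty M
  exchanged-cokernel {suc k} {p} M = record
    { cokernel  = C ⨾ᴹ C′
    ; square    = pushout-≈ {f = discardᴹ (suc k)} {discardᴹ (suc k)} {[ v , M′ ]ᴹ} {M} {zeroᴹ _} {zeroᴹ _} {C ⨾ᴹ C′} {C ⨾ᴹ C′}
                    (λ ()) (λ i j → symᴿ (M≋ i j)) (λ _ ()) (λ _ _ → reflᴿ)
                    (cokernel-[,] matrix-coproducts {f = v} {M′} {discardᴹ 1} {discardᴹ k} {discardᴹ (suc k)} {zeroᴹ _} {C} {zeroᴹ _} {C′}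
                      0-initial 0-terminal (ExchangedCokernel.square first) (ExchangedCokernel.square second))
    ; exchanged = ≈-trans (refl⟩⨾⟨ F-cong M≋)
                    (exchanges-[,] (ExchangedCokernel.exchanged first) (ExchangedCokernel.exchanged second))
    }
    where
    v : Mat 1 p
    v i _ = M i zero
    M′ : Mat k p
    M′ i j = M i (suc j)
    M≋ : M ≋ [ v , M′ ]ᴹ
    M≋ i zero    = reflᴿ
    M≋ i (suc j) = reflᴿ
    first = cokernel-column v
    C = ExchangedCokernel.cokernel first
    second = exchanged-cokernel (M′ ⨾ᴹ C)
    C′ = ExchangedCokernel.cokernel second

  exchange-discard : ∀ {k p q} {M : Mat k p} {C : Mat p q} →
                     IsPushout (discardᴹ k) M (zeroᴹ q) C → Exchanges (discardᴹ k) M (zeroᴹ q) C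
  exchange-discard {k} {M = M} {C} P =
    exchanges-iso {f = discardᴹ k} {M} {zeroᴹ _} {cokernel} {zeroᴹ _} {C} square P exchanged
    where open ExchangedCokernel (exchanged-cokernel M)

-- Exchange for arbitrary pushouts

module PushoutExchange {c ℓ} (R : PrincipalIdealDomain c ℓ) where
  open PrincipalIdealDomain R using (commutativeRing)
  open CommutativeRing commutativeRing
    using (Carrier; 0#; -_; _+_; ring; semiring; +-identityˡ; +-identityʳ; +-assoc; +-comm; +-congˡ; +-congʳ; -‿inverseˡ)
    renaming (refl to reflᴿ; sym to symᴿ; trans to transᴿ; setoid to setoidᴿ)
  open SemiringSum semiring using (sum-cong-≋)
  open import Algebra.Properties.Ring ring using (-‿distribˡ-*; -‿distribʳ-*; -‿involutive; +-cancelʳ)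
  open InteractingHopfAlgebras commutativeRing
  open Matrices commutativeRing
  open MatrixPROP commutativeRing
  open MatrixCoproducts commutativeRing
  open AdditionMatrix commutativeRing
  open Action commutativeRing
  open Functors R
  open Absorption R
  open Shears R
  open Elimination R using (sum-neg)
  open Kernels R
  open PushoutTheory MatPROP-isPROP using (IsPushout; pushout-cokernel)
  open RawPROP IHᶜᵖ using (_≈_; id; _⨾_; _⊕_; σ)
  open PROPReasoning IH-isPROP
  open ≈-Reasoning
  private
    module ᴿ = SetoidReasoning setoidᴿ
    module ≈ᵛ = ≈ᵛ-Reasoning

  add-comm : ∀ n → σ n n ⨾ add n ≈ add n
  add-comm n = ≈-trans (F-σ n n ⟩⨾⟨refl) (F-⨾ (≋-ext λ x → ≈ᵛ.begin
    (σᴹ n n ⨾ᴹ addᴹ n) ▷ x                   ≈ᵛ.≈⟨ ⨾-▷ (σᴹ n n) (addᴹ n) x ⟩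
    addᴹ n ▷ σᴹ n n ▷ x                      ≈ᵛ.≈⟨ ▷-congˡ {A = addᴹ n} (σ-▷ n n x) ⟩
    addᴹ n ▷ (dropᵛ {n} x ++ takeᵛ {n} x)    ≈ᵛ.≈⟨ add-▷-++ n _ _ ⟩
    dropᵛ {n} x +ᵛ takeᵛ {n} x               ≈ᵛ.≈⟨ (λ i → +-comm _ _) ⟩
    takeᵛ {n} x +ᵛ dropᵛ {n} x               ≈ᵛ.≈⟨ add-▷ n x ⟨
    addᴹ n ▷ x                               ≈ᵛ.∎))

  absorb-Gʳ : ∀ {n m} (A : Mat n m) → (id n ⊕ G A) ⨾ add n ≈ (F A ⊕ id m) ⨾ add m ⨾ G A
  absorb-Gʳ {n} {m} A = begin
    (id n ⊕ G A) ⨾ add n                      ≈⟨ refl⟩⨾⟨ add-comm n ⟨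
    (id n ⊕ G A) ⨾ (σ n n ⨾ add n)            ≈⟨ assoc²ʳ (σ-natural _ _) ⟩
    σ n m ⨾ (G A ⊕ id n) ⨾ add n              ≈⟨ assoc²ˡ (≈-trans (absorb-G A) (⨾-assoc _ _ _)) ⟩
    σ n m ⨾ ((id m ⊕ F A) ⨾ (add m ⨾ G A))    ≈⟨ assoc²ʳ (≈-sym (σ-natural _ _)) ⟩
    (F A ⊕ id m) ⨾ σ m m ⨾ (add m ⨾ G A)      ≈⟨ assoc²ˡ (assoc²ʳ (add-comm m)) ⟩
    (F A ⊕ id m) ⨾ (add m ⨾ G A)              ≈⟨ ⨾-assoc _ _ _ ⟨
    (F A ⊕ id m) ⨾ add m ⨾ G A                ∎

  G-cast : ∀ {n m n′ m′} (p : n ≡ n′) (q : m ≡ m′) (A : Mat n m) → G (cast {Hom = Mat} p q A) ≈ʰ G A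
  G-cast refl refl A = het ≈-refl

  -- `idᴹ m ⊕ᴹ zeroᴹ k` has domain `m + 0`, which is `m` only up to propositional equality.
  inl-cast : ∀ m k → cast {Hom = Mat} (+ℕ-identityʳ m) refl (idᴹ m ⊕ᴹ zeroᴹ k) ≋ inlᴹ m k
  inl-cast m k = ≋-ext λ x → unhetᵛ (transʰᵛ
    (cast-▷ (+ℕ-identityʳ m) refl {idᴹ m ⊕ᴹ zeroᴹ k} (symʰᵛ (++-[]ʰᵛ x [])))
    (homᵛ (≈ᵛ.begin
      (idᴹ m ⊕ᴹ zeroᴹ k) ▷ (x ++ [])          ≈ᵛ.≈⟨ ⊕-▷-++ (idᴹ m) (zeroᴹ k) x [] ⟩
      (idᴹ m ▷ x) ++ 0ᵛ                       ≈ᵛ.≈⟨ ++-cong (id-▷ m x) ≈ᵛ-refl ⟩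
      x ++ 0ᵛ                                 ≈ᵛ.≈⟨ inl-▷ m k x ⟨
      inlᴹ m k ▷ x                            ≈ᵛ.∎)))

  G-inl : ∀ m k → G (inlᴹ m k) ≈ʰ id m ⊕ G (zeroᴹ k)
  G-inl m k = transʰ (het (≈-sym (G-cong (inl-cast m k))))
    (transʰ (G-cast (+ℕ-identityʳ m) refl (idᴹ m ⊕ᴹ zeroᴹ k))
            (het (≈-trans (≈-sym (G-⊕ (λ _ _ → reflᴿ))) (≈-sym (G-id (λ _ _ → reflᴿ)) ⟩⊕⟨refl))))

  -- `G (inlᴹ m k)` forces the last k wires to be zero and reads the others, so it does not interact
  -- with an f acting on the latter.
  inl-natural : ∀ {n m} k (f : Term IHGen n m) → (f ⊕ id k) ⨾ G (inlᴹ m k) ≈ G (inlᴹ n k) ⨾ f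
  inl-natural {n} {m} k f = unhet
    (transʰ (⨾-congʰ (het ≈-refl) (G-inl m k))
    (transʰ (het exchange)
            (⨾-congʰ (symʰ (G-inl n k)) (⊕-identityʳʰ f))))

  negᴹ : ∀ {n m} → Mat n m → Mat n m
  negᴹ A i j = - A i j

  neg-▷ : ∀ {n m} (A : Mat n m) x → (negᴹ A ▷ x) +ᵛ (A ▷ x) ≈ᵛ 0ᵛ
  neg-▷ A x i = sum-neg (A i) x

  -- z ↦ (- g z , f z)
  difference : ∀ {k n m} → Mat k n → Mat k m → Mat k (m +ℕ n)
  difference f g = negᴹ g ++ f

  ++-▷ : ∀ {k n m} (A : Mat k n) (B : Mat k m) x → (A ++ B) ▷ x ≈ᵛ (A ▷ x) ++ (B ▷ x)
  ++-▷ {n = n} A B x i with splitAt n i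
  ... | inj₁ j = reflᴿ
  ... | inj₂ j = reflᴿ

  module _ {k n m q} (f : Mat k n) (g : Mat k m) (v : Mat (m +ℕ n) q) where
    difference-▷ : ∀ x → v ▷ difference f g ▷ x ≈ᵛ
      (v ▷ inlᴹ m n ▷ negᴹ g ▷ x) +ᵛ (v ▷ inrᴹ m n ▷ f ▷ x)
    difference-▷ x = ≈ᵛ.begin
      v ▷ difference f g ▷ x
        ≈ᵛ.≈⟨ ▷-congˡ {A = v} (++-▷ (negᴹ g) f x) ⟩
      v ▷ ((negᴹ g ▷ x) ++ (f ▷ x))
        ≈ᵛ.≈⟨ ▷-congˡ {A = v} (≈ᵛ-trans (+ᵛ-cong (inl-▷ m n (negᴹ g ▷ x)) (inr-▷ m n (f ▷ x)))
               (≈ᵛ-trans (++-+ᵛ (negᴹ g ▷ x) 0ᵛ 0ᵛ (f ▷ x))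
                 (++-cong {v = (negᴹ g ▷ x) +ᵛ 0ᵛ} {w = 0ᵛ +ᵛ (f ▷ x)} (λ _ → +-identityʳ _) (λ _ → +-identityˡ _)))) ⟨
      v ▷ ((inlᴹ m n ▷ negᴹ g ▷ x) +ᵛ (inrᴹ m n ▷ f ▷ x))
        ≈ᵛ.≈⟨ ▷-+ v _ _ ⟩
      (v ▷ inlᴹ m n ▷ negᴹ g ▷ x) +ᵛ (v ▷ inrᴹ m n ▷ f ▷ x) ≈ᵛ.∎

    cancel-neg : ∀ x → (v ▷ inlᴹ m n ▷ negᴹ g ▷ x) +ᵛ (v ▷ inlᴹ m n ▷ g ▷ x) ≈ᵛ 0ᵛ
    cancel-neg x = ≈ᵛ.begin
      (v ▷ inlᴹ m n ▷ negᴹ g ▷ x) +ᵛ (v ▷ inlᴹ m n ▷ g ▷ x)   ≈ᵛ.≈⟨ ▷-+ v _ _ ⟨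
      v ▷ ((inlᴹ m n ▷ negᴹ g ▷ x) +ᵛ (inlᴹ m n ▷ g ▷ x))     ≈ᵛ.≈⟨ ▷-congˡ {A = v} (▷-+ (inlᴹ m n) _ _) ⟨
      v ▷ inlᴹ m n ▷ ((negᴹ g ▷ x) +ᵛ (g ▷ x))                ≈ᵛ.≈⟨ ▷-congˡ {A = v} (▷-congˡ {A = inlᴹ m n} (neg-▷ g x)) ⟩
      v ▷ inlᴹ m n ▷ 0ᵛ                                       ≈ᵛ.≈⟨ ▷-congˡ {A = v} (▷-0 (inlᴹ m n)) ⟩
      v ▷ 0ᵛ                                                  ≈ᵛ.≈⟨ ▷-0 v ⟩
      0ᵛ                                                      ≈ᵛ.∎

    ⨾-⨾-▷ : ∀ {p o} (A : Mat p o) (B : Mat o (m +ℕ n)) x → (A ⨾ᴹ (B ⨾ᴹ v)) ▷ x ≈ᵛ v ▷ B ▷ A ▷ x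
    ⨾-⨾-▷ A B x = ≈ᵛ-trans (⨾-▷ A (B ⨾ᴹ v) x) (⨾-▷ B v (A ▷ x))

    discard-▷ : ∀ (u : Mat 0 q) x → (discardᴹ k ⨾ᴹ u) ▷ x ≈ᵛ 0ᵛ
    discard-▷ u x = ≈ᵛ-trans (⨾-▷ (discardᴹ k) u x) ≈ᵛ-refl

    difference⇒ : ∀ {u : Mat 0 q} → discardᴹ k ⨾ᴹ u ≋ difference f g ⨾ᴹ v →
                  f ⨾ᴹ (inrᴹ m n ⨾ᴹ v) ≋ g ⨾ᴹ (inlᴹ m n ⨾ᴹ v)
    difference⇒ {u} e = ≋-ext λ x i →
      transᴿ (⨾-⨾-▷ f (inrᴹ m n) x i) (transᴿ
        (+-cancelʳ ((v ▷ inlᴹ m n ▷ negᴹ g ▷ x) i) _ _ (ᴿ.begin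
          (v ▷ inrᴹ m n ▷ f ▷ x) i + (v ▷ inlᴹ m n ▷ negᴹ g ▷ x) i  ᴿ.≈⟨ +-comm _ _ ⟩
          (v ▷ inlᴹ m n ▷ negᴹ g ▷ x) i + (v ▷ inrᴹ m n ▷ f ▷ x) i  ᴿ.≈⟨ difference-▷ x i ⟨
          (v ▷ difference f g ▷ x) i                                ᴿ.≈⟨ ⨾-▷ (difference f g) v x i ⟨
          ((difference f g ⨾ᴹ v) ▷ x) i                             ᴿ.≈⟨ ▷-cong e (≈ᵛ-refl {x = x}) i ⟨
          ((discardᴹ k ⨾ᴹ u) ▷ x) i                                 ᴿ.≈⟨ discard-▷ u x i ⟩
          0#                                                        ᴿ.≈⟨ cancel-neg x i ⟨
          (v ▷ inlᴹ m n ▷ negᴹ g ▷ x) i + (v ▷ inlᴹ m n ▷ g ▷ x) i  ᴿ.≈⟨ +-comm _ _ ⟩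
          (v ▷ inlᴹ m n ▷ g ▷ x) i + (v ▷ inlᴹ m n ▷ negᴹ g ▷ x) i  ᴿ.∎))
        (symᴿ (⨾-⨾-▷ g (inlᴹ m n) x i)))

    difference⇐ : ∀ {u : Mat 0 q} → f ⨾ᴹ (inrᴹ m n ⨾ᴹ v) ≋ g ⨾ᴹ (inlᴹ m n ⨾ᴹ v) →
                  discardᴹ k ⨾ᴹ u ≋ difference f g ⨾ᴹ v
    difference⇐ {u} e = ≋-ext λ x i → ᴿ.begin
      ((discardᴹ k ⨾ᴹ u) ▷ x) i                                 ᴿ.≈⟨ discard-▷ u x i ⟩
      0#                                                        ᴿ.≈⟨ cancel-neg x i ⟨
      (v ▷ inlᴹ m n ▷ negᴹ g ▷ x) i + (v ▷ inlᴹ m n ▷ g ▷ x) i  ᴿ.≈⟨ +-congˡ (transᴿ (symᴿ (⨾-⨾-▷ f (inrᴹ m n) x i))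
                                                                     (transᴿ (▷-cong e (≈ᵛ-refl {x = x}) i) (⨾-⨾-▷ g (inlᴹ m n) x i))) ⟨
      (v ▷ inlᴹ m n ▷ negᴹ g ▷ x) i + (v ▷ inrᴹ m n ▷ f ▷ x) i  ᴿ.≈⟨ difference-▷ x i ⟨
      (v ▷ difference f g ▷ x) i                                ᴿ.≈⟨ ⨾-▷ (difference f g) v x i ⟨
      ((difference f g ⨾ᴹ v) ▷ x) i                             ᴿ.∎

  difference-cokernel : ∀ {k n m p} {f : Mat k n} {g : Mat k m} {l : Mat n p} {r : Mat m p} →
    IsPushout f g l r → IsPushout (discardᴹ k) (difference f g) (zeroᴹ p) [ r , l ]ᴹ
  difference-cokernel {k} {n} {m} {p} {f} {g} {l} {r} P =
    pushout-cokernel matrix-coproducts {f = f} {g} {l} {r} {discardᴹ k} {difference f g} {zeroᴹ p}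
      0-initial (λ {_} {u} {v} → difference⇒ f g v {u})
      (difference⇐ f g [ r , l ]ᴹ {zeroᴹ p} (≋-ext λ x → ≈ᵛ.begin
        (f ⨾ᴹ (inrᴹ m n ⨾ᴹ [ r , l ]ᴹ)) ▷ x   ≈ᵛ.≈⟨ ▷-cong (⨾ᴹ-cong {A = f} {f} (λ _ _ → reflᴿ) (M.inr-[,] r l)) (≈ᵛ-refl {x = x}) ⟩
        (f ⨾ᴹ l) ▷ x                          ≈ᵛ.≈⟨ ▷-cong (IsPushout.commutes P) (≈ᵛ-refl {x = x}) ⟩
        (g ⨾ᴹ r) ▷ x                          ≈ᵛ.≈⟨ ▷-cong (⨾ᴹ-cong {A = g} {g} (λ _ _ → reflᴿ) (M.inl-[,] r l)) (≈ᵛ-refl {x = x}) ⟨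
        (g ⨾ᴹ (inlᴹ m n ⨾ᴹ [ r , l ]ᴹ)) ▷ x   ≈ᵛ.∎))
      P
    where module M = PushoutTheory.Coproducts matrix-coproducts

  -- The kernel of a pushout (l , r), read from its second half to its first:
  -- the wires inr are fed into it and the wires inl are read off.
  readˡ : ∀ {n m p} (l : Mat n p) (r : Mat m p) →
    ((F (zeroᴹ p) ⨾ G [ r , l ]ᴹ) ⊕ F (inrᴹ m n)) ⨾ add (m +ℕ n) ⨾ G (inlᴹ m n) ≈ F l ⨾ G r
  readˡ {n} {m} {p} l r = begin
    ((F (zeroᴹ p) ⨾ G [ r , l ]ᴹ) ⊕ F (inrᴹ m n)) ⨾ add (m +ℕ n) ⨾ G (inlᴹ m n)
      ≈⟨ absorb-zero [ r , l ]ᴹ (F (inrᴹ m n)) ⟩⨾⟨refl ⟩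
    F (inrᴹ m n) ⨾ F [ r , l ]ᴹ ⨾ G [ r , l ]ᴹ ⨾ G (inlᴹ m n)
      ≈⟨ assoc²ˡ (G-⨾ (M.inl-[,] r l)) ⟩
    F (inrᴹ m n) ⨾ F [ r , l ]ᴹ ⨾ G r
      ≈⟨ F-⨾ (M.inr-[,] r l) ⟩⨾⟨refl ⟩
    F l ⨾ G r ∎
    where module M = PushoutTheory.Coproducts matrix-coproducts

  -- `(x , y) ↦ (- x , x + y)`
  reflection : ∀ k → Mat (k +ℕ k) (k +ℕ k)
  reflection k = [ difference (idᴹ k) (idᴹ k) , inrᴹ k k ]ᴹ

  -ᵛ_ : ∀ {n} → Vector Carrier n → Vector Carrier n
  (-ᵛ x) i = - x i

  neg-▷′ : ∀ {n m} (A : Mat n m) x → negᴹ A ▷ x ≈ᵛ A ▷ (-ᵛ x)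
  neg-▷′ A x i = sum-cong-≋ (λ l → transᴿ (symᴿ (-‿distribˡ-* (A i l) (x l))) (-‿distribʳ-* (A i l) (x l)))

  difference-inr-▷ : ∀ {k m} (g : Mat k m) x y →
    [ difference (idᴹ k) g , inrᴹ m k ]ᴹ ▷ (x ++ y) ≈ᵛ (g ▷ (-ᵛ x)) ++ (x +ᵛ y)
  difference-inr-▷ {k} {m} g x y = ≈ᵛ.begin
    [ difference (idᴹ k) g , inrᴹ m k ]ᴹ ▷ (x ++ y)
      ≈ᵛ.≈⟨ [,]-▷-++ (difference (idᴹ k) g) (inrᴹ m k) x y ⟩
    (difference (idᴹ k) g ▷ x) +ᵛ (inrᴹ m k ▷ y)
      ≈ᵛ.≈⟨ +ᵛ-cong (≈ᵛ-trans (++-▷ (negᴹ g) (idᴹ k) x) (++-cong (neg-▷′ g x) (id-▷ k x))) (inr-▷ m k y) ⟩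
    ((g ▷ (-ᵛ x)) ++ x) +ᵛ (0ᵛ ++ y)
      ≈ᵛ.≈⟨ ++-+ᵛ (g ▷ (-ᵛ x)) 0ᵛ x y ⟩
    ((g ▷ (-ᵛ x)) +ᵛ 0ᵛ) ++ (x +ᵛ y)
      ≈ᵛ.≈⟨ ++-cong {v = (g ▷ (-ᵛ x)) +ᵛ 0ᵛ} (λ _ → +-identityʳ _) ≈ᵛ-refl ⟩
    (g ▷ (-ᵛ x)) ++ (x +ᵛ y) ≈ᵛ.∎

  reflection-▷ : ∀ k x y → reflection k ▷ (x ++ y) ≈ᵛ (-ᵛ x) ++ (x +ᵛ y)
  reflection-▷ k x y = ≈ᵛ-trans (difference-inr-▷ (idᴹ k) x y) (++-cong (id-▷ k (-ᵛ x)) ≈ᵛ-refl)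

  reflection-involutive : ∀ k → reflection k ⨾ᴹ reflection k ≋ idᴹ (k +ℕ k)
  reflection-involutive k = ≋-ext λ z → let x = takeᵛ {k} z ; y = dropᵛ {k} z in ≈ᵛ.begin
    (reflection k ⨾ᴹ reflection k) ▷ z
      ≈ᵛ.≈⟨ ⨾-▷ (reflection k) (reflection k) z ⟩
    reflection k ▷ reflection k ▷ z
      ≈ᵛ.≈⟨ ▷-congˡ {A = reflection k} (≈ᵛ-trans (▷-congˡ {A = reflection k} (≈ᵛ-sym (take-++-drop {k} z))) (reflection-▷ k x y)) ⟩
    reflection k ▷ ((-ᵛ x) ++ (x +ᵛ y))
      ≈ᵛ.≈⟨ reflection-▷ k (-ᵛ x) (x +ᵛ y) ⟩
    (-ᵛ (-ᵛ x)) ++ ((-ᵛ x) +ᵛ (x +ᵛ y))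
      ≈ᵛ.≈⟨ ++-cong {v = -ᵛ (-ᵛ x)} {w = (-ᵛ x) +ᵛ (x +ᵛ y)} (λ i → -‿involutive (x i))
              (λ i → transᴿ (symᴿ (+-assoc _ _ _)) (transᴿ (+-congʳ (-‿inverseˡ (x i))) (+-identityˡ _))) ⟩
    x ++ y
      ≈ᵛ.≈⟨ take-++-drop {k} z ⟩
    z ≈ᵛ.≈⟨ id-▷ (k +ℕ k) z ⟨
    idᴹ (k +ℕ k) ▷ z ≈ᵛ.∎

  difference-inr : ∀ {k m} (g : Mat k m) →
    reflection k ⨾ᴹ (g ⊕ᴹ idᴹ k) ≋ [ difference (idᴹ k) g , inrᴹ m k ]ᴹ
  difference-inr {k} {m} g = ≋-ext λ z → let x = takeᵛ {k} z ; y = dropᵛ {k} z in ≈ᵛ.begin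
    (reflection k ⨾ᴹ (g ⊕ᴹ idᴹ k)) ▷ z
      ≈ᵛ.≈⟨ ⨾-▷ (reflection k) (g ⊕ᴹ idᴹ k) z ⟩
    (g ⊕ᴹ idᴹ k) ▷ reflection k ▷ z
      ≈ᵛ.≈⟨ ▷-congˡ {A = g ⊕ᴹ idᴹ k} (≈ᵛ-trans (▷-congˡ {A = reflection k} (≈ᵛ-sym (take-++-drop {k} z))) (reflection-▷ k x y)) ⟩
    (g ⊕ᴹ idᴹ k) ▷ ((-ᵛ x) ++ (x +ᵛ y))
      ≈ᵛ.≈⟨ ⊕-▷-++ g (idᴹ k) (-ᵛ x) (x +ᵛ y) ⟩
    (g ▷ (-ᵛ x)) ++ (idᴹ k ▷ (x +ᵛ y))
      ≈ᵛ.≈⟨ ++-congˡ (g ▷ (-ᵛ x)) (id-▷ k (x +ᵛ y)) ⟩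
    (g ▷ (-ᵛ x)) ++ (x +ᵛ y)
      ≈ᵛ.≈⟨ difference-inr-▷ g x y ⟨
    [ difference (idᴹ k) g , inrᴹ m k ]ᴹ ▷ (x ++ y)
      ≈ᵛ.≈⟨ ▷-congˡ {A = [ difference (idᴹ k) g , inrᴹ m k ]ᴹ} (take-++-drop {k} z) ⟩
    [ difference (idᴹ k) g , inrᴹ m k ]ᴹ ▷ z ≈ᵛ.∎

  project-reflection : ∀ k → (inlᴹ k k ⨾ᴹ reflection k) ⨾ᴹ (discardᴹ k ⊕ᴹ idᴹ k) ≋ idᴹ k
  project-reflection k = ≋-ext λ x → ≈ᵛ.begin
    ((inlᴹ k k ⨾ᴹ reflection k) ⨾ᴹ (discardᴹ k ⊕ᴹ idᴹ k)) ▷ x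
      ≈ᵛ.≈⟨ ≈ᵛ-trans (⨾-▷ (inlᴹ k k ⨾ᴹ reflection k) (discardᴹ k ⊕ᴹ idᴹ k) x)
              (▷-congˡ {A = discardᴹ k ⊕ᴹ idᴹ k} (⨾-▷ (inlᴹ k k) (reflection k) x)) ⟩
    (discardᴹ k ⊕ᴹ idᴹ k) ▷ reflection k ▷ inlᴹ k k ▷ x
      ≈ᵛ.≈⟨ ▷-congˡ {A = discardᴹ k ⊕ᴹ idᴹ k} (≈ᵛ-trans (▷-congˡ {A = reflection k} (inl-▷ k k x)) (reflection-▷ k x 0ᵛ)) ⟩
    (discardᴹ k ⊕ᴹ idᴹ k) ▷ ((-ᵛ x) ++ (x +ᵛ 0ᵛ))
      ≈ᵛ.≈⟨ ⊕-▷-++ (discardᴹ k) (idᴹ k) (-ᵛ x) (x +ᵛ 0ᵛ) ⟩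
    (discardᴹ k ▷ (-ᵛ x)) ++ (idᴹ k ▷ (x +ᵛ 0ᵛ))
      ≈ᵛ.≈⟨ (λ i → transᴿ (id-▷ k (x +ᵛ 0ᵛ) i) (+-identityʳ (x i))) ⟩
    x ≈ᵛ.≈⟨ id-▷ k x ⟨
    idᴹ k ▷ x ≈ᵛ.∎

  -- `(- g z , z) + (0 , x) = (y , 0)` forces `z = - x` and hence `y = g x`. The substitution is the
  -- involution `reflection`, which solves for z on the diagram.
  readʳ-id : ∀ {k m} (g : Mat k m) →
    ((G (discardᴹ k) ⨾ F (difference (idᴹ k) g)) ⊕ F (inrᴹ m k)) ⨾ add (m +ℕ k) ⨾ G (inlᴹ m k) ≈ F g
  readʳ-id {k} {m} g = begin
    ((G (discardᴹ k) ⨾ F (difference (idᴹ k) g)) ⊕ F (inrᴹ m k)) ⨾ add (m +ℕ k) ⨾ G (inlᴹ m k)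
      ≈⟨ ≈-trans (refl⟩⊕⟨ ≈-sym (⨾-identityˡ _)) (interchange _ _ _ _) ⟩⨾⟨refl ⟩⨾⟨refl ⟩
    (G (discardᴹ k) ⊕ id k) ⨾ (F (difference (idᴹ k) g) ⊕ F (inrᴹ m k)) ⨾ add (m +ℕ k) ⨾ G (inlᴹ m k)
      ≈⟨ assoc²ˡ (≈-trans (≈-sym (F-[,] _ _)) (≈-sym (F-⨾ (difference-inr g)))) ⟩⨾⟨refl ⟩
    (G (discardᴹ k) ⊕ id k) ⨾ (F (reflection k) ⨾ F (g ⊕ᴹ idᴹ k)) ⨾ G (inlᴹ m k)
      ≈⟨ ≈-trans (≈-sym (⨾-assoc _ _ _) ⟩⨾⟨refl) (rewriteʳ (≈-trans
           (≈-trans (≈-sym (F-⊕ (λ _ _ → reflᴿ))) (refl⟩⊕⟨ ≈-sym (F-id (λ _ _ → reflᴿ))) ⟩⨾⟨refl) (inl-natural k (F g)))) ⟩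
    (G (discardᴹ k) ⊕ id k) ⨾ F (reflection k) ⨾ G (inlᴹ k k) ⨾ F g
      -- `reflection` is its own inverse, so its image may be read backwards; all factors before
      -- `F g` then belong to G and compose to the converse of a single matrix, the identity.
      ≈⟨ ((≈-trans (refl⟩⊕⟨ G-id (λ _ _ → reflᴿ)) (G-⊕ (λ _ _ → reflᴿ))) ⟩⨾⟨
          ≈-sym (G≈F⁻¹ (reflection-involutive k) (reflection-involutive k))) ⟩⨾⟨refl ⟩⨾⟨refl ⟩
    G (discardᴹ k ⊕ᴹ idᴹ k) ⨾ G (reflection k) ⨾ G (inlᴹ k k) ⨾ F g
      ≈⟨ ≈-trans (assoc²ˡ (G-⨾ (λ _ _ → reflᴿ))) (≈-trans (G-⨾ (project-reflection k)) (≈-sym (G-id (λ _ _ → reflᴿ)))) ⟩⨾⟨refl ⟩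
    id k ⨾ F g
      ≈⟨ ⨾-identityˡ _ ⟩
    F g ∎

  module _ {k n m} (f : Mat k n) (g : Mat k m) where
    private
      h : Mat (m +ℕ k) (m +ℕ n)
      h = idᴹ m ⊕ᴹ f

    difference-⊕ : difference (idᴹ k) g ⨾ᴹ h ≋ difference f g
    difference-⊕ = ≋-ext λ x → ≈ᵛ.begin
      (difference (idᴹ k) g ⨾ᴹ h) ▷ x         ≈ᵛ.≈⟨ ⨾-▷ (difference (idᴹ k) g) h x ⟩
      h ▷ difference (idᴹ k) g ▷ x            ≈ᵛ.≈⟨ ▷-congˡ {A = h} (≈ᵛ-trans (++-▷ (negᴹ g) (idᴹ k) x) (++-congˡ (negᴹ g ▷ x) (id-▷ k x))) ⟩
      h ▷ ((negᴹ g ▷ x) ++ x)                 ≈ᵛ.≈⟨ ⊕-▷-++ (idᴹ m) f (negᴹ g ▷ x) x ⟩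
      (idᴹ m ▷ negᴹ g ▷ x) ++ (f ▷ x)         ≈ᵛ.≈⟨ ++-cong (id-▷ m (negᴹ g ▷ x)) ≈ᵛ-refl ⟩
      (negᴹ g ▷ x) ++ (f ▷ x)                 ≈ᵛ.≈⟨ ++-▷ (negᴹ g) f x ⟨
      difference f g ▷ x                      ≈ᵛ.∎

    inl-h : inlᴹ m k ⨾ᴹ h ≋ inlᴹ m n
    inl-h = ≋-ext λ x → ≈ᵛ.begin
      (inlᴹ m k ⨾ᴹ h) ▷ x                     ≈ᵛ.≈⟨ ⨾-▷ (inlᴹ m k) h x ⟩
      h ▷ inlᴹ m k ▷ x                        ≈ᵛ.≈⟨ ▷-congˡ {A = h} (inl-▷ m k x) ⟩
      h ▷ (x ++ 0ᵛ)                           ≈ᵛ.≈⟨ ⊕-▷-++ (idᴹ m) f x 0ᵛ ⟩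
      (idᴹ m ▷ x) ++ (f ▷ 0ᵛ)                 ≈ᵛ.≈⟨ ++-cong (id-▷ m x) (▷-0 f) ⟩
      x ++ 0ᵛ                                 ≈ᵛ.≈⟨ inl-▷ m n x ⟨
      inlᴹ m n ▷ x                            ≈ᵛ.∎

    F-inr : ∀ o → F (inrᴹ m o) ≈ F (zeroᴹ m) ⊕ id o
    F-inr o = ≈-sym (≈-trans (refl⟩⊕⟨ F-id (λ _ _ → reflᴿ)) (F-⊕ (≋-ext λ x → ≈ᵛ.begin
      (zeroᴹ m ⊕ᴹ idᴹ o) ▷ x                  ≈ᵛ.≈⟨ ⊕-▷ (zeroᴹ m) (idᴹ o) x ⟩
      (zeroᴹ m ▷ takeᵛ {0} x) ++ (idᴹ o ▷ x)  ≈ᵛ.≈⟨ ++-cong {v = zeroᴹ m ▷ takeᵛ {0} x} {0ᵛ} (λ _ → reflᴿ) (id-▷ o x) ⟩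
      0ᵛ ++ x                                 ≈ᵛ.≈⟨ inr-▷ m o x ⟨
      inrᴹ m o ▷ x                            ≈ᵛ.∎)))

    inr-G : F (inrᴹ m n) ⨾ G h ≈ G f ⨾ F (inrᴹ m k)
    inr-G = begin
      F (inrᴹ m n) ⨾ G h
        ≈⟨ F-inr n ⟩⨾⟨ ≈-trans (≈-sym (G-⊕ (λ _ _ → reflᴿ))) (≈-sym (G-id (λ _ _ → reflᴿ)) ⟩⊕⟨refl) ⟩
      (F (zeroᴹ m) ⊕ id n) ⨾ (id m ⊕ G f)
        ≈⟨ exchange ⟩
      (id 0 ⊕ G f) ⨾ (F (zeroᴹ m) ⊕ id k)
        ≈⟨ ⊕-identityˡ _ ⟩⨾⟨ ≈-sym (F-inr k) ⟩
      G f ⨾ F (inrᴹ m k) ∎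

    -- Reading the span of f and g in the same way slides f through the
    -- addition, which leaves the case f = id.
    readʳ : ((G (discardᴹ k) ⨾ F (difference f g)) ⊕ F (inrᴹ m n)) ⨾ add (m +ℕ n) ⨾ G (inlᴹ m n) ≈ G f ⨾ F g
    readʳ = begin
      ((G (discardᴹ k) ⨾ F (difference f g)) ⊕ F (inrᴹ m n)) ⨾ add (m +ℕ n) ⨾ G (inlᴹ m n)
        ≈⟨ ((≈-trans (refl⟩⨾⟨ ≈-sym (F-⨾ difference-⊕)) (≈-sym (⨾-assoc _ _ _)) ⟩⊕⟨ ≈-sym (⨾-identityʳ _)) ⟩⨾⟨refl)
           ⟩⨾⟨ ≈-sym (G-⨾ inl-h) ⟩
      ((D ⨾ F h) ⊕ (F (inrᴹ m n) ⨾ id (m +ℕ n))) ⨾ add (m +ℕ n) ⨾ (G h ⨾ G (inlᴹ m k))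
        ≈⟨ interchange _ _ _ _ ⟩⨾⟨refl ⟩⨾⟨refl ⟩
      (D ⊕ F (inrᴹ m n)) ⨾ (F h ⊕ id (m +ℕ n)) ⨾ add (m +ℕ n) ⨾ (G h ⨾ G (inlᴹ m k))
        ≈⟨ ≈-trans (≈-sym (⨾-assoc _ _ _)) (≈-trans (⨾-assoc _ _ _ ⟩⨾⟨refl) (assoc²ˡ (≈-sym (absorb-Gʳ h)))  ⟩⨾⟨refl) ⟩
      (D ⊕ F (inrᴹ m n)) ⨾ ((id (m +ℕ k) ⊕ G h) ⨾ add (m +ℕ k)) ⨾ G (inlᴹ m k)
        ≈⟨ assoc²ʳ (≈-trans merge (⨾-identityʳ _ ⟩⊕⟨ inr-G)) ⟩⨾⟨refl ⟩
      (D ⊕ (G f ⨾ F (inrᴹ m k))) ⨾ add (m +ℕ k) ⨾ G (inlᴹ m k)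
        ≈⟨ ≈-trans (≈-sym (⨾-identityˡ D) ⟩⊕⟨refl) (≈-trans (interchange _ _ _ _) (⊕-identityˡ (G f) ⟩⨾⟨refl)) ⟩⨾⟨refl ⟩⨾⟨refl ⟩
      G f ⨾ (D ⊕ F (inrᴹ m k)) ⨾ add (m +ℕ k) ⨾ G (inlᴹ m k)
        ≈⟨ ≈-trans (⨾-assoc _ _ _ ⟩⨾⟨refl) (assoc²ˡ (readʳ-id g)) ⟩
      G f ⨾ F g ∎
      where
      D : Term IHGen 0 (m +ℕ k)
      D = G (discardᴹ k) ⨾ F (difference (idᴹ k) g)

  -- Exchange for the cokernel of the difference is read on both of its sides: `readʳ` recovers the
  -- span from one, `readˡ` the cospan from the other.
  exchange-pushout : ∀ {k n m p} {f : Mat k n} {g : Mat k m} {l : Mat n p} {r : Mat m p} →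
                     IsPushout f g l r → G f ⨾ F g ≈ F l ⨾ G r
  exchange-pushout {f = f} {g} {l} {r} P = ≈-trans (≈-sym (readʳ f g))
    (≈-trans ((exchange-discard {C = [ r , l ]ᴹ} (difference-cokernel P) ⟩⊕⟨refl) ⟩⨾⟨refl ⟩⨾⟨refl) (readˡ l r))

-- Soundness of the axioms in cospans

module Soundness {c ℓ} (R : PrincipalIdealDomain c ℓ) where
  open PrincipalIdealDomain R using (commutativeRing)
  open CommutativeRing commutativeRing
    using (Carrier; 0#; 1#; -_; _+_; _*_; ring; semiring; +-identityˡ; +-identityʳ; +-assoc; +-comm; +-congˡ; +-congʳ; +-cong; -‿inverseˡ; *-comm; *-assoc; *-congʳ; *-identityˡ; zeroˡ; zeroʳ; distribˡ; distribʳ)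
    renaming (_≈_ to _≈ᴿ_; refl to reflᴿ; sym to symᴿ; trans to transᴿ)
  open import Algebra.Properties.Ring ring using (-1*x≈-x; -‿involutive)
  open SemiringSum semiring using (sum-cong-≋; ∑-distrib-+)
  open HopfAlgebras commutativeRing
  open InteractingHopfAlgebras commutativeRing
    using (IHGen; ⟦_⟧; ⟦_⟧ᵒᵖ; IHEq; ha; haᵒᵖ; b1; b2; b3ˡ; b3ʳ; b4ˡ; b4ʳ; b5; b6; b7; b8)
  open Matrices commutativeRing
  open MatrixPROP commutativeRing
  open MatrixCoproducts commutativeRing using (_+ᵛ_; +ᵛ-cong)
  open Action commutativeRing
  open Evaluation R
  open CospanMatrices R using (fromIso; isPushout; CospanMat-isPROP)
  open PushoutTheory MatPROP-isPROP using (IsPushout; iso-≈; iso-⨾; pushout-unique; pushout-sym; pushout-id)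
  open Cospans R using (Cospan; cospan; _⨾ᶜ_; _≅_)
  open Interpretation R using (𝓢)
  open PROPReasoning CospanMat-isPROP
  private
    module M = PROPReasoning MatPROP-isPROP
    module ≈ᵛ = ≈ᵛ-Reasoning

  ≅-≈ : ∀ {n m a} {A A′ : Mat n a} {B B′ : Mat m a} → A ≋ A′ → B ≋ B′ → cospan A B ≅ cospan A′ B′
  ≅-≈ {A = A} {A′} {B} {B′} p q = fromIso (cospan A B) (cospan A′ B′) (iso-≈ {l = A} {A′} {B} {B′} p q)

  compose : ∀ {n m k a b o} {A : Mat n a} {B : Mat m a} {A′ : Mat m b} {B′ : Mat k b} {l : Mat a o} {r : Mat b o} →
            IsPushout B A′ l r → cospan A B ⨾ᶜ cospan A′ B′ ≅ cospan (A ⨾ᴹ l) (B′ ⨾ᴹ r)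
  compose {A = A} {B} {A′} {B′} {l} {r} P =
    fromIso (cospan A B ⨾ᶜ cospan A′ B′) (cospan (A ⨾ᴹ l) (B′ ⨾ᴹ r))
      (iso-⨾ A B′ (pushout-unique (isPushout (PIDPushouts.pushout R B A′)) P))

  eval-≋ : ∀ {n m} {t u : Term HAGen n m} → (∀ x → act t x ≈ᵛ act u x) → eval t ≋ eval u
  eval-≋ {t = t} {u} p = ≋-ext λ x → ≈ᵛ-trans (eval-▷ t x) (≈ᵛ-trans (p x) (≈ᵛ-sym (eval-▷ u x)))

  𝓢-fwd : ∀ {n m} (t : Term HAGen n m) → 𝓢 ⟦ t ⟧ ≅ cospan (eval t) (idᴹ m)
  𝓢-fwd (gen g) = ≈-refl
  𝓢-fwd id₀ = ≈-refl
  𝓢-fwd id₁ = ≈-refl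
  𝓢-fwd σ₁₁ = ≈-refl
  𝓢-fwd (f Term.⨾ g) = ≈-trans (𝓢-fwd f ⟩⨾⟨ 𝓢-fwd g)
    (≈-trans (compose (pushout-sym (pushout-id (eval g)))) (≅-≈ (λ _ _ → reflᴿ) (M.⨾-identityˡ (idᴹ _))))
  𝓢-fwd (Term._⊕_ {m = m} {m′ = m′} f g) = ≈-trans (𝓢-fwd f ⟩⊕⟨ 𝓢-fwd g) (≅-≈ (λ _ _ → reflᴿ) (M.⊕-id m m′))

  𝓢-bwd : ∀ {n m} (t : Term HAGen n m) → 𝓢 ⟦ t ⟧ᵒᵖ ≅ cospan (idᴹ m) (eval t)
  𝓢-bwd (gen g) = ≈-refl
  𝓢-bwd id₀ = ≈-refl
  𝓢-bwd id₁ = ≈-refl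
  -- The reversed crossing still has `σᴹ 1 1` as its left leg; the swap of the apex, being an
  -- involution, moves it to the right leg.
  𝓢-bwd σ₁₁ = fromIso (cospan (σᴹ 1 1) (idᴹ 2)) (cospan (idᴹ 2) (σᴹ 1 1)) record
    { to = σᴹ 1 1 ; from = σᴹ 1 1
    ; inverses = record { invˡ = M.σ-involutive 1 1 ; invʳ = M.σ-involutive 1 1 }
    ; left-to = M.σ-involutive 1 1 ; right-to = M.⨾-identityˡ (σᴹ 1 1) }
  𝓢-bwd (f Term.⨾ g) = ≈-trans (𝓢-bwd g ⟩⨾⟨ 𝓢-bwd f)
    (≈-trans (compose (pushout-id (eval g))) (≅-≈ (M.⨾-identityˡ (idᴹ _)) (λ _ _ → reflᴿ)))
  𝓢-bwd (Term._⊕_ {m = m} {m′ = m′} f g) = ≈-trans (𝓢-bwd f ⟩⊕⟨ 𝓢-bwd g) (≅-≈ (M.⊕-id m m′) (λ _ _ → reflᴿ))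

  𝓢-cospan : ∀ {n m k} (f : Term HAGen n m) (g : Term HAGen k m) →
             𝓢 (⟦ f ⟧ Term.⨾ ⟦ g ⟧ᵒᵖ) ≅ cospan (eval f) (eval g)
  𝓢-cospan {m = m} f g = ≈-trans (𝓢-fwd f ⟩⨾⟨ 𝓢-bwd g)
    (≈-trans (compose (pushout-id (idᴹ m))) (≅-≈ (M.⨾-identityʳ (eval f)) (M.⨾-identityʳ (eval g))))

  𝓢-span : ∀ {k n m p} (f : Term HAGen k n) (g : Term HAGen k m) {l : Mat n p} {r : Mat m p} →
           IsPushout (eval f) (eval g) l r → 𝓢 (⟦ f ⟧ᵒᵖ Term.⨾ ⟦ g ⟧) ≅ cospan l r
  𝓢-span f g {l} {r} P = ≈-trans (𝓢-bwd f ⟩⨾⟨ 𝓢-fwd g)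
    (≈-trans (compose P) (≅-≈ (M.⨾-identityˡ l) (M.⨾-identityˡ r)))

  𝓢-⨾ : ∀ {n m k} (t : Term IHGen n m) (u : Term IHGen m k) {C D} → 𝓢 t ≅ C → 𝓢 u ≅ D → 𝓢 (t Term.⨾ u) ≅ C ⨾ᶜ D
  𝓢-⨾ t u {C} {D} = ⨾-cong {f = 𝓢 t} {C} {𝓢 u} {D}

  𝓢-assoc : ∀ {n m k l} (t : Term IHGen n m) (u : Term IHGen m k) (v : Term IHGen k l) →
            𝓢 ((t Term.⨾ u) Term.⨾ v) ≅ 𝓢 (t Term.⨾ (u Term.⨾ v))
  𝓢-assoc t u v = ⨾-assoc (𝓢 t) (𝓢 u) (𝓢 v)

  act-axiom : ∀ {n m} {t u : Term HAGen n m} → HAEq t u → ∀ x → act t x ≈ᵛ act u x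
  act-axiom (s-cong p)  x zero       = *-congʳ p
  act-axiom a1          x zero       = +-identityˡ _
  act-axiom a2          x zero       = +-comm _ _
  act-axiom a3          x zero       = +-assoc _ _ _
  act-axiom a4          x zero       = reflᴿ
  act-axiom a5          x zero       = reflᴿ
  act-axiom a5          x (suc zero) = reflᴿ
  act-axiom a6          x zero       = reflᴿ
  act-axiom a6          x (suc zero) = reflᴿ
  act-axiom a6          x (suc (suc zero)) = reflᴿ
  act-axiom a7          x ()
  act-axiom a8          x zero       = reflᴿ
  act-axiom a8          x (suc zero) = reflᴿ
  act-axiom a9          x zero       = reflᴿ
  act-axiom a9          x (suc zero) = reflᴿ
  act-axiom a10         x ()
  act-axiom a11         x zero       = *-identityˡ _
  act-axiom (a12 k₁ k₂) x zero       = transᴿ (symᴿ (*-assoc _ _ _)) (*-congʳ (*-comm _ _))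
  act-axiom (a13 k)     x zero       = distribˡ _ _ _
  act-axiom (a14 k)     x zero       = zeroʳ _
  act-axiom (a15 k)     x zero       = reflᴿ
  act-axiom (a15 k)     x (suc zero) = reflᴿ
  act-axiom (a16 k)     x ()
  act-axiom a17         x zero       = zeroˡ _
  act-axiom (a18 k₁ k₂) x zero       = symᴿ (distribʳ _ _ _)

  -- a, b, w and w′ form a contracting homotopy of the complex k → n ⊕ m → p.
  split-pushout : ∀ {k n m p} (f : Term HAGen k n) (g : Term HAGen k m) (l : Term HAGen n p) (r : Term HAGen m p)
    (a : Term HAGen p n) (b : Term HAGen p m) (w : Term HAGen n k) (w′ : Term HAGen m k) →
    (∀ x → act l (act f x) ≈ᵛ act r (act g x)) →
    (∀ x → act a (act l x) +ᵛ act f (act w x) ≈ᵛ x) →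
    (∀ x → act b (act l x) ≈ᵛ act g (act w x)) →
    (∀ y → act b (act r y) +ᵛ act g (act w′ y) ≈ᵛ y) →
    (∀ y → act a (act r y) ≈ᵛ act f (act w′ y)) →
    (∀ z → act l (act a z) +ᵛ act r (act b z) ≈ᵛ z) →
    IsPushout (eval f) (eval g) (eval l) (eval r)
  split-pushout {k} {n} {m} {p} f g l r a b w w′ comm a-l b-l b-r a-r l-a-r-b = record
    { commutes = eval-≋ {t = f Term.⨾ l} {g Term.⨾ r} comm
    ; universal = universal
    ; factor₁ = λ {_} {h₁} {h₂} e → ≋-ext λ x → ≈ᵛ.begin
        (eval l ⨾ᴹ universal h₁ h₂ e) ▷ x
          ≈ᵛ.≈⟨ universal-▷ l h₁ h₂ e x ⟩
        (h₁ ▷ act a (act l x)) +ᵛ (h₂ ▷ act b (act l x))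
          ≈ᵛ.≈⟨ +ᵛ-cong ≈ᵛ-refl (≈ᵛ-trans (▷-congˡ {A = h₂} (b-l x)) (≈ᵛ-sym (square h₁ h₂ e (act w x)))) ⟩
        (h₁ ▷ act a (act l x)) +ᵛ (h₁ ▷ act f (act w x))
          ≈ᵛ.≈⟨ ▷-+ h₁ _ _ ⟨
        h₁ ▷ (act a (act l x) +ᵛ act f (act w x))
          ≈ᵛ.≈⟨ ▷-congˡ {A = h₁} (a-l x) ⟩
        h₁ ▷ x ≈ᵛ.∎
    ; factor₂ = λ {_} {h₁} {h₂} e → ≋-ext λ y → ≈ᵛ.begin
        (eval r ⨾ᴹ universal h₁ h₂ e) ▷ y
          ≈ᵛ.≈⟨ universal-▷ r h₁ h₂ e y ⟩
        (h₁ ▷ act a (act r y)) +ᵛ (h₂ ▷ act b (act r y))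
          ≈ᵛ.≈⟨ +ᵛ-cong (≈ᵛ-trans (▷-congˡ {A = h₁} (a-r y)) (square h₁ h₂ e (act w′ y))) ≈ᵛ-refl ⟩
        (h₂ ▷ act g (act w′ y)) +ᵛ (h₂ ▷ act b (act r y))
          ≈ᵛ.≈⟨ (λ i → +-comm _ _) ⟩
        (h₂ ▷ act b (act r y)) +ᵛ (h₂ ▷ act g (act w′ y))
          ≈ᵛ.≈⟨ ▷-+ h₂ _ _ ⟨
        h₂ ▷ (act b (act r y) +ᵛ act g (act w′ y))
          ≈ᵛ.≈⟨ ▷-congˡ {A = h₂} (b-r y) ⟩
        h₂ ▷ y ≈ᵛ.∎
    ; unique = λ u v e₁ e₂ → ≋-ext λ z → ≈ᵛ.begin
        u ▷ z                                                ≈ᵛ.≈⟨ decompose u z ⟩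
        ((eval l ⨾ᴹ u) ▷ act a z) +ᵛ ((eval r ⨾ᴹ u) ▷ act b z) ≈ᵛ.≈⟨ +ᵛ-cong (▷-cong e₁ (≈ᵛ-refl {x = act a z})) (▷-cong e₂ (≈ᵛ-refl {x = act b z})) ⟩
        ((eval l ⨾ᴹ v) ▷ act a z) +ᵛ ((eval r ⨾ᴹ v) ▷ act b z) ≈ᵛ.≈⟨ decompose v z ⟨
        v ▷ z                                                ≈ᵛ.∎
    }
    where
    universal : ∀ {q} (h₁ : Mat n q) (h₂ : Mat m q) → eval f ⨾ᴹ h₁ ≋ eval g ⨾ᴹ h₂ → Mat p q
    universal h₁ h₂ e i j = (eval a ⨾ᴹ h₁) i j + (eval b ⨾ᴹ h₂) i j

    ⨾-▷-act : ∀ {n m q} (t : Term HAGen n m) (h : Mat m q) x → (eval t ⨾ᴹ h) ▷ x ≈ᵛ h ▷ act t x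
    ⨾-▷-act t h x = ≈ᵛ-trans (⨾-▷ (eval t) h x) (▷-congˡ {A = h} (eval-▷ t x))

    +ᴹ-▷ : ∀ {n m} (A B : Mat n m) x → (λ i j → A i j + B i j) ▷ x ≈ᵛ (A ▷ x) +ᵛ (B ▷ x)
    +ᴹ-▷ A B x i = transᴿ (sum-cong-≋ (λ j → distribʳ (x j) (A i j) (B i j)))
                          (∑-distrib-+ (λ j → A i j * x j) (λ j → B i j * x j))

    universal-▷ : ∀ {q o} (t : Term HAGen o p) (h₁ : Mat n q) (h₂ : Mat m q) e x →
      (eval t ⨾ᴹ universal h₁ h₂ e) ▷ x ≈ᵛ (h₁ ▷ act a (act t x)) +ᵛ (h₂ ▷ act b (act t x))
    universal-▷ t h₁ h₂ e x = ≈ᵛ-trans (⨾-▷-act t (universal h₁ h₂ e) x)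
      (≈ᵛ-trans (+ᴹ-▷ (eval a ⨾ᴹ h₁) (eval b ⨾ᴹ h₂) (act t x))
                (+ᵛ-cong (⨾-▷-act a h₁ (act t x)) (⨾-▷-act b h₂ (act t x))))

    square : ∀ {q} (h₁ : Mat n q) (h₂ : Mat m q) → eval f ⨾ᴹ h₁ ≋ eval g ⨾ᴹ h₂ →
             ∀ x → h₁ ▷ act f x ≈ᵛ h₂ ▷ act g x
    square h₁ h₂ e x = ≈ᵛ-trans (≈ᵛ-sym (⨾-▷-act f h₁ x)) (≈ᵛ-trans (▷-cong e (≈ᵛ-refl {x = x})) (⨾-▷-act g h₂ x))

    decompose : ∀ {q} (u : Mat p q) z → u ▷ z ≈ᵛ ((eval l ⨾ᴹ u) ▷ act a z) +ᵛ ((eval r ⨾ᴹ u) ▷ act b z)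
    decompose u z = ≈ᵛ.begin
      u ▷ z                                            ≈ᵛ.≈⟨ ▷-congˡ {A = u} (l-a-r-b z) ⟨
      u ▷ (act l (act a z) +ᵛ act r (act b z))         ≈ᵛ.≈⟨ ▷-+ u _ _ ⟩
      (u ▷ act l (act a z)) +ᵛ (u ▷ act r (act b z))   ≈ᵛ.≈⟨ +ᵛ-cong (⨾-▷-act l u (act a z)) (⨾-▷-act r u (act b z)) ⟨
      ((eval l ⨾ᴹ u) ▷ act a z) +ᵛ ((eval r ⨾ᴹ u) ▷ act b z) ≈ᵛ.∎

  -x+x : ∀ x → - 1# * x + x ≈ᴿ 0#
  -x+x x = transᴿ (+-congʳ (-1*x≈-x x)) (-‿inverseˡ x)

  x+-x : ∀ x → x + - 1# * x ≈ᴿ 0#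
  x+-x x = transᴿ (+-comm _ _) (-x+x x)

  x-y+y : ∀ x y → (x + - 1# * y) + y ≈ᴿ x
  x-y+y x y = transᴿ (+-assoc _ _ _) (transᴿ (+-congˡ (-x+x y)) (+-identityʳ x))

  x+y-y : ∀ x y → (x + y) + - 1# * y ≈ᴿ x
  x+y-y x y = transᴿ (+-assoc _ _ _) (transᴿ (+-congˡ (x+-x y)) (+-identityʳ x))

  -x+y+x : ∀ x y → (- 1# * x + y) + x ≈ᴿ y
  -x+y+x x y = transᴿ (+-congʳ (+-comm _ _)) (x-y+y y x)

  neg² : ∀ x → - 1# * (- 1# * x) ≈ᴿ x
  neg² x = transᴿ (symᴿ (*-assoc _ _ _)) (transᴿ (*-congʳ (transᴿ (-1*x≈-x (- 1#)) (-‿involutive 1#))) (*-identityˡ x))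

  k*-x : ∀ k x → k * (- 1# * x) ≈ᴿ - 1# * (k * x)
  k*-x k x = transᴿ (symᴿ (*-assoc _ _ _)) (transᴿ (*-congʳ (*-comm _ _)) (*-assoc _ _ _))

  subtract : Term HAGen 2 1
  subtract = (id₁ Term.⊕ gen (s (- 1#))) Term.⨾ gen μ

  scaledSum : Carrier → Term HAGen 2 1
  scaledSum k = (id₁ Term.⊕ gen (s k)) Term.⨾ gen μ

  -- y ↦ (- y , y)
  antidiagonal : Term HAGen 1 2
  antidiagonal = gen Δ Term.⨾ (gen (s (- 1#)) Term.⊕ id₁)

  first : Term HAGen 1 2
  first = id₁ Term.⊕ gen η

  zero₂ : Term HAGen 1 2
  zero₂ = gen ε Term.⨾ (gen η Term.⊕ gen η)

  pushout-εε : IsPushout (eval (gen ε)) (eval (gen ε)) (idᴹ 0) (idᴹ 0)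
  pushout-εε = split-pushout (gen ε) (gen ε) id₀ id₀ id₀ id₀ (gen η) (gen η)
    (λ _ ()) (λ _ ()) (λ _ ()) (λ _ ()) (λ _ ()) (λ _ ())

  -- The splitting is `z = l (0 , z₂ - z₁) + r (z₀ , z₁)`.
  pushout-ΔΔ : IsPushout (eval (gen Δ)) (eval (gen Δ)) (eval (gen Δ Term.⊕ id₁)) (eval (id₁ Term.⊕ gen Δ))
  pushout-ΔΔ = split-pushout (gen Δ) (gen Δ) (gen Δ Term.⊕ id₁) (id₁ Term.⊕ gen Δ)
    (gen η Term.⊕ (gen ε Term.⊕ ((gen (s (- 1#)) Term.⊕ id₁) Term.⨾ gen μ))) (id₁ Term.⊕ (id₁ Term.⊕ gen ε))
    (id₁ Term.⊕ gen ε) ((gen ε Term.⊕ gen ε) Term.⨾ gen η)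
    (λ { x zero → reflᴿ ; x (suc zero) → reflᴿ ; x (suc (suc zero)) → reflᴿ })
    (λ { x zero → +-identityˡ _ ; x (suc zero) → -x+y+x _ _ })
    (λ { x zero → reflᴿ ; x (suc zero) → reflᴿ })
    (λ { x zero → +-identityʳ _ ; x (suc zero) → +-identityʳ _ })
    (λ { x zero → reflᴿ ; x (suc zero) → -x+x _ })
    (λ { x zero → +-identityˡ _ ; x (suc zero) → +-identityˡ _ ; x (suc (suc zero)) → -x+y+x _ _ })

  -- `first` is a section of `l`, so the component `b` can be zero; the same choice serves in
  -- `pushout-sμ`.
  pushout-μμ : IsPushout (eval (gen μ Term.⊕ id₁)) (eval (id₁ Term.⊕ gen μ)) (eval (gen μ)) (eval (gen μ))
  pushout-μμ = split-pushout (gen μ Term.⊕ id₁) (id₁ Term.⊕ gen μ) (gen μ) (gen μ)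
    first zero₂ (gen η Term.⊕ (gen ε Term.⊕ antidiagonal)) (id₁ Term.⊕ first)
    (λ { x zero → +-assoc _ _ _ })
    (λ { x zero → transᴿ (+-congˡ (+-identityˡ _)) (x+y-y _ _) ; x (suc zero) → +-identityˡ _ })
    (λ { x zero → reflᴿ ; x (suc zero) → symᴿ (-x+x _) })
    (λ { x zero → +-identityˡ _ ; x (suc zero) → transᴿ (+-identityˡ _) (+-identityʳ _) })
    (λ { x zero → reflᴿ ; x (suc zero) → reflᴿ })
    (λ { x zero → transᴿ (+-congˡ (+-identityˡ _)) (transᴿ (+-identityʳ _) (+-identityʳ _)) })

  -- Subtraction is the cokernel of the diagonal; this is the origin of the sign in (B5) and (B6).
  pushout-εΔ : IsPushout (eval (gen ε)) (eval (gen Δ)) (eval (gen η)) (eval subtract)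
  pushout-εΔ = split-pushout (gen ε) (gen Δ) (gen η) subtract (gen ε) first (gen η) (gen ε Term.⊕ id₁)
    (λ { x zero → symᴿ (x+-x _) })
    (λ _ ())
    (λ { x zero → reflᴿ ; x (suc zero) → reflᴿ })
    (λ { x zero → x-y+y _ _ ; x (suc zero) → +-identityˡ _ })
    (λ _ ())
    (λ { x zero → transᴿ (+-identityˡ _) (transᴿ (+-congˡ (zeroʳ _)) (+-identityʳ _)) })

  -- The second leg is its own inverse, so the other side of the square is obtained by composing
  -- with it.
  pushout-μs : IsPushout (eval (gen μ)) (eval (id₁ Term.⊕ gen (s (- 1#)))) (idᴹ 1) (eval subtract)
  pushout-μs = split-pushout (gen μ) (id₁ Term.⊕ gen (s (- 1#))) id₁ subtract
    id₁ zero₂ zero₂ (id₁ Term.⊕ gen (s (- 1#)))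
    (λ { x zero → +-congˡ (symᴿ (neg² _)) })
    (λ { x zero → transᴿ (+-congˡ (+-identityʳ _)) (+-identityʳ _) })
    (λ { x zero → reflᴿ ; x (suc zero) → symᴿ (zeroʳ _) })
    (λ { x zero → +-identityˡ _ ; x (suc zero) → transᴿ (+-identityˡ _) (neg² _) })
    (λ { x zero → reflᴿ })
    (λ { x zero → transᴿ (+-congˡ (transᴿ (+-identityˡ _) (zeroʳ _))) (+-identityʳ _) })

  pushout-sμ : ∀ k → IsPushout (eval (gen (s k) Term.⊕ id₁)) (eval (gen μ)) (eval (scaledSum k)) (eval (gen (s k)))
  pushout-sμ k = split-pushout (gen (s k) Term.⊕ id₁) (gen μ) (scaledSum k) (gen (s k))
    first (gen ε Term.⨾ gen η) (gen ε Term.⊕ antidiagonal) first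
    (λ { x zero → symᴿ (distribˡ _ _ _) })
    (λ { x zero → transᴿ (+-congˡ (k*-x k _)) (x+y-y _ _) ; x (suc zero) → +-identityˡ _ })
    (λ { x zero → symᴿ (-x+x _) })
    (λ { x zero → transᴿ (+-identityˡ _) (+-identityʳ _) })
    (λ { x zero → reflᴿ ; x (suc zero) → reflᴿ })
    (λ { x zero → transᴿ (+-cong (transᴿ (+-congˡ (zeroʳ _)) (+-identityʳ _)) (zeroʳ _)) (+-identityʳ _) })

  -- For a non-unit d the legs have no inverse, so the argument is cancellation instead of a
  -- homotopy: in the absence of zero divisors a non-zero scalar is an epimorphism.
  pushout-ss : ∀ {d} → ¬ d ≈ᴿ 0# → IsPushout (eval (gen (s d))) (eval (gen (s d))) (idᴹ 1) (idᴹ 1)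
  pushout-ss {d} d≉0 = record
    { commutes = λ _ _ → reflᴿ
    ; universal = λ h₁ h₂ e → h₁
    ; factor₁ = λ {_} {h₁} e → M.⨾-identityˡ h₁
    ; factor₂ = λ {_} {h₁} {h₂} e → λ { i zero → transᴿ (M.⨾-identityˡ h₁ i zero)
        (PIDPushouts.cancelʳ-nonZero R d≉0 (transᴿ (symᴿ (+-identityʳ _)) (transᴿ (e i zero) (+-identityʳ _)))) }
    ; unique = λ u v p _ → λ i j → transᴿ (symᴿ (M.⨾-identityˡ u i j)) (transᴿ (p i j) (M.⨾-identityˡ v i j)) }

  -- The two sides of an axiom are compared as terms only: unfolding 𝓢 would
  -- start the computation of the pushouts in them.
  opaque
    𝓢′ : ∀ {n m} → Term IHGen n m → Cospan n m
    𝓢′ t = 𝓢 t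

    fwd′ : ∀ {n m} (t : Term HAGen n m) → 𝓢′ ⟦ t ⟧ ≅ cospan (eval t) (idᴹ m)
    fwd′ = 𝓢-fwd

    bwd′ : ∀ {n m} (t : Term HAGen n m) → 𝓢′ ⟦ t ⟧ᵒᵖ ≅ cospan (idᴹ m) (eval t)
    bwd′ = 𝓢-bwd

    cospan′ : ∀ {n m k} (f : Term HAGen n m) (g : Term HAGen k m) →
              𝓢′ (⟦ f ⟧ Term.⨾ ⟦ g ⟧ᵒᵖ) ≅ cospan (eval f) (eval g)
    cospan′ = 𝓢-cospan

    span′ : ∀ {k n m p} (f : Term HAGen k n) (g : Term HAGen k m) {l : Mat n p} {r : Mat m p} →
            IsPushout (eval f) (eval g) l r → 𝓢′ (⟦ f ⟧ᵒᵖ Term.⨾ ⟦ g ⟧) ≅ cospan l r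
    span′ = 𝓢-span

    ⨾′ : ∀ {n m k} (t : Term IHGen n m) (u : Term IHGen m k) {C D} → 𝓢′ t ≅ C → 𝓢′ u ≅ D → 𝓢′ (t Term.⨾ u) ≅ C ⨾ᶜ D
    ⨾′ = 𝓢-⨾

    assoc′ : ∀ {n m k l} (t : Term IHGen n m) (u : Term IHGen m k) (v : Term IHGen k l) →
             𝓢′ ((t Term.⨾ u) Term.⨾ v) ≅ 𝓢′ (t Term.⨾ (u Term.⨾ v))
    assoc′ = 𝓢-assoc

  cospan-fwd′ : ∀ {n m k q p} (f : Term HAGen n m) (g : Term HAGen k m) (h : Term HAGen k q)
                {l : Mat m p} {r : Mat q p} → IsPushout (eval g) (eval h) l r →
                𝓢′ ((⟦ f ⟧ Term.⨾ ⟦ g ⟧ᵒᵖ) Term.⨾ ⟦ h ⟧) ≅ cospan (eval f ⨾ᴹ l) r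
  cospan-fwd′ f g h {l} {r} P = ≈-trans (⨾′ (⟦ f ⟧ Term.⨾ ⟦ g ⟧ᵒᵖ) ⟦ h ⟧ (cospan′ f g) (fwd′ h))
    (≈-trans (compose P) (≅-≈ (λ _ _ → reflᴿ) (M.⨾-identityˡ r)))

  cospan-bwd′ : ∀ {n m k q} (f : Term HAGen n m) (g : Term HAGen k m) (h : Term HAGen q k) →
                𝓢′ ((⟦ f ⟧ Term.⨾ ⟦ g ⟧ᵒᵖ) Term.⨾ ⟦ h ⟧ᵒᵖ) ≅ cospan (eval f) (eval (h Term.⨾ g))
  cospan-bwd′ f g h = ≈-trans (assoc′ ⟦ f ⟧ ⟦ g ⟧ᵒᵖ ⟦ h ⟧ᵒᵖ) (cospan′ f (h Term.⨾ g))

  -- Equations of HA and its opposite compare matrices. In each (B) equation one side is, up to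
  -- bracketing, a span, and the other side denotes the cospan which is its pushout; in (B5) a
  -- further pushout along an invertible leg evaluates the right side.
  axiom′ : ∀ {n m} {f g : Term IHGen n m} → IHEq f g → 𝓢′ f ≅ 𝓢′ g
  axiom′ (ha {f = f} {g} p) =
    ≈-trans (fwd′ f) (≈-trans (≅-≈ (eval-≋ {t = f} {g} (act-axiom p)) (λ _ _ → reflᴿ)) (≈-sym (fwd′ g)))
  axiom′ (haᵒᵖ {f = f} {g} p) =
    ≈-trans (bwd′ f) (≈-trans (≅-≈ (λ _ _ → reflᴿ) (eval-≋ {t = f} {g} (act-axiom p))) (≈-sym (bwd′ g)))
  axiom′ (b1 d d≉0) = ≈-trans (span′ (gen (s d)) (gen (s d)) (pushout-ss d≉0)) (≈-sym (fwd′ id₁))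
  axiom′ b2 = ≈-trans (span′ (gen ε) (gen ε) pushout-εε) (≈-sym (fwd′ id₀))
  axiom′ b3ˡ = ≈-trans (cospan′ (gen Δ Term.⊕ id₁) (id₁ Term.⊕ gen Δ)) (≈-sym (span′ (gen Δ) (gen Δ) pushout-ΔΔ))
  axiom′ b3ʳ = ≈-trans (span′ (gen Δ) (gen Δ) (pushout-sym pushout-ΔΔ))
    (≈-sym (cospan′ (id₁ Term.⊕ gen Δ) (gen Δ Term.⊕ id₁)))
  axiom′ b4ˡ = ≈-trans (span′ (gen μ Term.⊕ id₁) (id₁ Term.⊕ gen μ) pushout-μμ) (≈-sym (cospan′ (gen μ) (gen μ)))
  axiom′ b4ʳ = ≈-trans (cospan′ (gen μ) (gen μ))
    (≈-sym (span′ (id₁ Term.⊕ gen μ) (gen μ Term.⊕ id₁) (pushout-sym pushout-μμ)))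
  axiom′ b5 = ≈-trans (span′ (gen ε) (gen Δ) pushout-εΔ) (≈-sym
    (≈-trans (cospan-fwd′ (gen η) (gen μ) (id₁ Term.⊕ gen (s (- 1#))) pushout-μs)
             (≅-≈ (M.⨾-identityʳ (eval (gen η))) (λ _ _ → reflᴿ))))
  axiom′ b6 = ≈-trans (span′ (gen Δ) (gen ε) (pushout-sym pushout-εΔ)) (≈-sym (cospan′ subtract (gen η)))
  axiom′ (b7 k) = ≈-trans (span′ (gen (s k) Term.⊕ id₁) (gen μ) (pushout-sμ k))
    (≈-sym (cospan′ (scaledSum k) (gen (s k))))
  axiom′ (b8 k) = ≈-trans (span′ (gen μ) (gen (s k) Term.⊕ id₁) (pushout-sym (pushout-sμ k)))
    (≈-sym (cospan-bwd′ (gen (s k)) (gen μ) (id₁ Term.⊕ gen (s k))))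

  opaque
    unfolding 𝓢′

    𝓢-axiom : ∀ {n m} {f g : Term IHGen n m} → IHEq f g → 𝓢 f ≅ 𝓢 g
    𝓢-axiom p = axiom′ p

  private module 𝓢 = StructurePreservation CospanMat-isPROP 𝓢 ≈-refl ≈-refl ≈-refl (λ _ _ → ≈-refl) (λ _ _ → ≈-refl)
  open 𝓢 using () renaming (F-id to 𝓢-id; F-σ to 𝓢-σ) public
  open 𝓢.Congruence IHEq 𝓢-axiom renaming (F-cong to 𝓢-cong) public

-- The inverse of 𝓢

module Inverse {c ℓ} (R : PrincipalIdealDomain c ℓ) where
  open PrincipalIdealDomain R using (commutativeRing)
  open CommutativeRing commutativeRing using () renaming (refl to reflᴿ)
  open Interpretation R
  open InteractingHopfAlgebras commutativeRing using (IHEq; ⟦_⟧ᵒᵖ)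
  open Matrices commutativeRing
  open HopfCompleteness commutativeRing using (canonical)
  open Evaluation R using (eval-canonical)
  open Functors R
  open Kernels R using (span-iso)
  open PushoutExchange R using (exchange-pushout)
  open Soundness R
  open CospanMatrices R using (toIso; isPushout; CospanMat-isPROP)
  open RawPROP IHᶜᵖ using (_≈_) renaming (id to idᴵ; _⨾_ to _⨾ᴵ_; _⊕_ to _⊕ᴵ_; σ to σᴵ)
  open RawPROP CospanMat using () renaming (_≈_ to _≅_)
  open Cospans.Cospan
  open PROPReasoning IH-isPROP
  open PresentedStructure IHEq
  private
    module C = PROPReasoning CospanMat-isPROP

  inverse : ∀ {n m} → Cospan n m → Term IHGen n m
  inverse C = F (left C) ⨾ᴵ G (right C)

  inverse-id : ∀ n → inverse (idᶜ n) ≈ idᴵ n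
  inverse-id n = ≈-trans (≈-sym (F-id (λ _ _ → reflᴿ)) ⟩⨾⟨ ≈-sym (G-id (λ _ _ → reflᴿ))) (⨾-identityˡ _)

  inverse-σ : ∀ n m → inverse (σᶜ n m) ≈ σᴵ n m
  inverse-σ n m = ≈-trans (≈-sym (F-σ n m) ⟩⨾⟨ ≈-sym (G-id (λ _ _ → reflᴿ))) (⨾-identityʳ _)

  inverse-⨾ : ∀ {n m k} (C : Cospan n m) (D : Cospan m k) → inverse (C ⨾ᶜ D) ≈ inverse C ⨾ᴵ inverse D
  inverse-⨾ C D = begin
    F (left C ⨾ᴹ P.ι₁) ⨾ᴵ G (right D ⨾ᴹ P.ι₂)
      ≈⟨ F-⨾ {A = left C} {P.ι₁} (λ _ _ → reflᴿ) ⟩⨾⟨ G-⨾ {A = right D} {P.ι₂} (λ _ _ → reflᴿ) ⟨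
    (F (left C) ⨾ᴵ F P.ι₁) ⨾ᴵ (G P.ι₂ ⨾ᴵ G (right D))
      ≈⟨ ≈-trans (⨾-assoc _ _ _) (refl⟩⨾⟨ ≈-sym (⨾-assoc _ _ _)) ⟩
    F (left C) ⨾ᴵ ((F P.ι₁ ⨾ᴵ G P.ι₂) ⨾ᴵ G (right D))
      ≈⟨ refl⟩⨾⟨ (exchange-pushout (isPushout (PIDPushouts.pushout R (right C) (left D))) ⟩⨾⟨refl) ⟨
    F (left C) ⨾ᴵ ((G (right C) ⨾ᴵ F (left D)) ⨾ᴵ G (right D))
      ≈⟨ ≈-trans (refl⟩⨾⟨ ⨾-assoc _ _ _) (≈-sym (⨾-assoc _ _ _)) ⟩
    (F (left C) ⨾ᴵ G (right C)) ⨾ᴵ (F (left D) ⨾ᴵ G (right D)) ∎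
    where
    open ≈-Reasoning
    module P = Pushout (PIDPushouts.pushout R (right C) (left D))

  inverse-⊕ : ∀ {n m n′ m′} (C : Cospan n m) (D : Cospan n′ m′) → inverse (C ⊕ᶜ D) ≈ inverse C ⊕ᴵ inverse D
  inverse-⊕ C D = ≈-trans
    (≈-sym (F-⊕ {A = left C} {left D} (λ _ _ → reflᴿ)) ⟩⨾⟨ ≈-sym (G-⊕ {A = right C} {right D} (λ _ _ → reflᴿ)))
    (≈-sym (interchange _ _ _ _))

  inverse-isMorphism : IsPROPMorphism CospanMat IHᶜᵖ inverse
  inverse-isMorphism = record
    { cong    = λ {_} {_} {C} {D} i → span-iso (toIso C D i)
    ; id-homo = inverse-id
    ; ⨾-homo  = inverse-⨾
    ; ⊕-homo  = inverse-⊕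
    ; σ-homo  = inverse-σ }

  inverse-𝓢 : ∀ {n m} (t : Term IHGen n m) → inverse (𝓢 t) ≈ t
  inverse-𝓢 (gen (fwd g)) = ≈-trans
    (≈-sym (F-interp (gen g) (λ _ _ → reflᴿ)) ⟩⨾⟨ ≈-sym (G-id (λ _ _ → reflᴿ))) (⨾-identityʳ _)
  inverse-𝓢 (gen (bwd g)) = ≈-trans
    (≈-sym (F-id (λ _ _ → reflᴿ)) ⟩⨾⟨ ≈-sym (G-interp (gen g) (λ _ _ → reflᴿ))) (⨾-identityˡ _)
  inverse-𝓢 id₀ = inverse-id 0
  inverse-𝓢 id₁ = ≈-trans (inverse-id 1) (≈-sym id₁≈id)
  inverse-𝓢 σ₁₁ = ≈-trans (inverse-σ 1 1) σ≈σ₁₁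
  inverse-𝓢 (t Term.⨾ u) = ≈-trans (inverse-⨾ (𝓢 t) (𝓢 u)) (inverse-𝓢 t ⟩⨾⟨ inverse-𝓢 u)
  inverse-𝓢 (t Term.⊕ u) = ≈-trans (inverse-⊕ (𝓢 t) (𝓢 u)) (inverse-𝓢 t ⟩⊕⟨ inverse-𝓢 u)

  -- Replacing `F` and `G` by canonical terms lets `𝓢-cospan` apply; the composition there is along
  -- identities, so its pushout is trivial.
  𝓢-inverse : ∀ {n m} (C : Cospan n m) → 𝓢 (inverse C) ≅ C
  𝓢-inverse C = C.≈-trans (𝓢-cong (≈-sym (F-interp f (eval-canonical (left C))) ⟩⨾⟨ ≈-sym G≈))
    (C.≈-trans (𝓢-cospan f g) (≅-≈ (eval-canonical (left C)) (eval-canonical (right C))))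
    where
    f = canonical (left C)
    g = canonical (right C)
    G≈ : ⟦ g ⟧ᵒᵖ ≈ G (right C)
    G≈ = subst (_≈ G (right C)) (⟦⟧† g) (G-interp g (eval-canonical (right C)))

proposition6p18 : ∀ {c ℓ} (R : PrincipalIdealDomain c ℓ) →
    let open Interpretation R in IsPROPIsomorphism IHᶜᵖ CospanMat 𝓢
proposition6p18 R = record
  { source-isPROP      = Functors.IH-isPROP R
  ; target-isPROP      = CospanMatrices.CospanMat-isPROP R
  ; isMorphism         = record
      { cong    = 𝓢-cong
      ; id-homo = 𝓢-id
      ; ⨾-homo  = λ f g → C.≈-refl
      ; ⊕-homo  = λ f g → C.≈-refl
      ; σ-homo  = 𝓢-σ }
  ; inverse            = inverse
  ; inverse-isMorphism = inverse-isMorphism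
  ; inverseˡ           = inverse-𝓢
  ; inverseʳ           = 𝓢-inverse
  }
  where
  open Inverse R
  open Soundness R using (𝓢-cong; 𝓢-id; 𝓢-σ)
  module C = PROPReasoning (CospanMatrices.CospanMat-isPROP R)
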